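{- For every $\beta\in(0,1)$ there exists $c'>0$ such that the following holds. Let $p$ be a prime and let $A,B$ be nonempty subsets of $\mathbb{Z}_p$ with $|A|=|B|=n\le\frac{1-\beta}{2}p$ and $|A+B|=\kappa n$. Then for every $c\in(0,\sqrt n]$ there exist subsets $A_{(s)}\subseteq A$ and $B_{(s)}\subseteq B$, each of size at most $(c'+c)\sqrt n$, such that \[ |A_{(s)}+B_{(s)}|\ge 2n-1+c\min\Big(\tfrac14 n,\ \big(\kappa^{1/3}/2-2\big)\sqrt n\Big). \]
   Context: $\mathbb{Z}_p$ is the cyclic group of integers mod $p$; $X+Y=\{x+y:x\in X,y\in Y\}$.
   Formalization: β and c range over the rationals instead of the reals (c′ is also rational, and κ = |A+B|/n is automatically rational); the bounds involving √n and κ^{1/3} are expressed exactly by rational comparisons. -}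

module Defs where

open import Data.Nat as ℕ using (ℕ)
open import Data.Integer using (+_)
open import Data.Rational using (ℚ; _/_; _+_; _-_; _*_; _≤_; _<_; 0ℚ)
open import Data.Fin using (Fin; toℕ)
open import Data.Fin.Subset using (Subset; _∈_)
open import Data.Fin.Subset.Properties using (_∈?_)
open import Data.Fin.Properties using (any?)
open import Data.Vec using (tabulate)
open import Data.Product using (Σ; _×_; _,_; ∃)
open import Data.Sum using (_⊎_)
open import Relation.Binary.PropositionalEquality using (_≡_)
open import Relation.Nullary using (does)
open import Relation.Nullary.Decidable using (_×-dec_; _⊎-dec_)

⟦_⟧ : ℕ → ℚ
⟦ m ⟧ = + m / 1

-- addition in ℤ_p on representatives 0..p-1 : a + b ≡ x (mod p)
-- (since a, b < p we have a + b ∈ {x, x + p})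
AddsTo : {p : ℕ} → Fin p → Fin p → Fin p → Set
AddsTo {p} a b x = (toℕ a ℕ.+ toℕ b ≡ toℕ x) ⊎ (toℕ a ℕ.+ toℕ b ≡ toℕ x ℕ.+ p)

_⊕_ : {p : ℕ} → Subset p → Subset p → Subset p
_⊕_ {p} X Y = tabulate λ z →
  does (any? λ x → any? λ y →
          (x ∈? X) ×-dec (y ∈? Y) ×-dec
          ((toℕ x ℕ.+ toℕ y ℕ.≟ toℕ z) ⊎-dec (toℕ x ℕ.+ toℕ y ℕ.≟ toℕ z ℕ.+ p)))

-- q ≤ k · √m   (for k ≥ 0): either q ≤ 0 or q² ≤ k² m
_≤[_]√_ : ℚ → ℚ → ℕ → Set
q ≤[ k ]√ m = (q ≤ 0ℚ) ⊎ (q * q ≤ k * k * ⟦ m ⟧)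

-- r < (κ^{1/3}/2 − 2)·√n , encoded by a rational a strictly in between:
-- r + 2√n < a < κ^{1/3}√n/2.
--   r + 2√n < a   ⟺ 0 < a − r  and  4n < (a − r)²
--   a < κ^{1/3}√n/2 (κ > 0) ⟺ a < 0  or  (2a)⁶ < κ² n³
BelowSecond : ℚ → ℕ → ℚ → Set
BelowSecond κ n r = ∃ λ a →
    (0ℚ < a - r) × (⟦ 4 ⟧ * ⟦ n ⟧ < (a - r) * (a - r))
  × ((a < 0ℚ) ⊎ (sixth (⟦ 2 ⟧ * a) < κ * κ * ⟦ n ⟧ * ⟦ n ⟧ * ⟦ n ⟧))
  where
  sixth : ℚ → ℚ
  sixth t = t * t * t * t * t * t

BelowMin : ℚ → ℕ → ℚ → Set
BelowMin κ n r = (r < ⟦ n ⟧ * (+ 1 / 4)) × BelowSecond κ n r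

-- s ≥ 2n − 1 + c · min (n/4 , (κ^{1/3}/2 − 2)√n), for c > 0,
-- stated via rational lower cut: every rational r below the min has
-- 2n − 1 + c·r ≤ s.
SumBound : ℕ → ℚ → ℚ → ℕ → Set
SumBound n κ c s = ∀ r → BelowMin κ n r →
  ⟦ 2 ℕ.* n ⟧ - ⟦ 1 ⟧ + c * r ≤ ⟦ s ⟧

module Submission where

-- Write s = ⌊√n⌋. Greedily chosen subsets of size O(s) have 2 n sums, or their sums X miss few pairs
-- of A × B and |X| < 2 n. Then the translations almost preserving A form a norm whose balls grow like
-- intervals; it is nearly additive far from 0, some x generates its balls, and A and B are, up to a
-- tiny proportion of n, arcs in steps of x. Inside maximally dense arcs, blocks of one set and residue
-- classes of the other, at scales 4^j, cover all sums but fewer than the holes of the arcs; elements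
-- next to the ends or far away are compensated by sums outside. This gives 2 n - 1 sums.
-- For κ, add greedily O(s) elements of A or B bringing n / 4 new sums with the other set, until
-- these lines cover at least κ^{1/3} n / 2 sums, then keep the c √n best elements of A and B.

-- The loss allowed is exactly one sum, while an averaging argument loses a proportion of what it is
-- applied to. It may therefore be applied only to the deviations from an extremal configuration,
-- whose shape must be known first. As only small subsets of `A` and `B` are used, the inverse
-- theorem has to tolerate missing pairs: it rests on Pollard's theorem, where ignoring `e * e`
-- pairs costs `O(e)` sums. Its errors are constant fractions of `n`, with `e` far below `D` (growth
-- of balls) and `D` far below `q` (arcs); sets too small for `e` to be positive are taken whole.
-- For arcs of lengths `L` and `L'` the balance is `2 n = L + L' - holes + outside`, against the
-- `L + L' - 1` sums of full arcs: a hole may destroy at most one sum, an outside element must bring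
-- one. The density threshold 399/400 lets a hole cost at most 34/100, and the ends yield 1001/1000
-- of the elements lying there, which also pays for a few far ones. Sizes stay `O(√n)` because the
-- scales `2^j` form a geometric series.

module Counting where

 open import Data.Bool using (Bool; true; false; T; _∧_; _∨_; not; if_then_else_) public
 open import Data.Bool.Properties using (T-∧; ∧-comm; T?; ∨-zeroʳ; ∧-zeroʳ) public
 open import Data.Empty using (⊥; ⊥-elim) public
 open import Data.Fin as Fin using (Fin; zero; suc; toℕ; fromℕ<)
 import Data.Fin.Properties as Finₚ
 open import Data.List using (List; []; _∷_) public
 open import Data.Nat as ℕ using (ℕ; zero; suc; _≥_; z≤n; s≤s; NonZero; _≤ᵇ_; _≡ᵇ_; _∸_; _/_; _%_; _⊓_; ∣_-_∣) renaming (_+_ to infixl 6 _+_; _*_ to infixl 7 _*_; _≤_ to infix 4 _≤_; _<_ to infix 4 _<_)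
 open import Data.Nat.Properties hiding (_≟_; _≤?_; _<?_) renaming (≤-reflexive to ≡⇒≤; +-identityʳ to +0; *-identityʳ to *1; *-zeroʳ to *0) public
 open import Data.Product using (_×_; ∃; _,_; proj₁; proj₂) public
 open import Data.Sum using (_⊎_; inj₁; inj₂) public
 open import Data.Unit using (⊤; tt) public
 open import Function using (_∘_; id; case_of_) public
 open import Relation.Binary.PropositionalEquality hiding (J; [_]) public
 open import Relation.Nullary using (¬_; Dec; yes; no; does) public
 import Algebra.Properties.CommutativeMonoid.Sum as CommutativeMonoidSum
 import Data.Fin.Permutation as Permutation
 open import Data.Nat.Primality using (Prime; prime⇒nonZero) public
 open import Data.Nat.Coprimality using (prime⇒coprime; coprime-Bézout) public
 open import Data.Nat.DivMod using (_mod_; m%n<n; m%n%n≡m%n; %-distribˡ-+; %-distribˡ-*; m<n⇒m%n≡m; n%n≡0; [m+n]%n≡m%n; [m+kn]%n≡m%n; m*n%n≡0; m≡m%n+[m/n]*n) public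
 import Data.Nat.GCD as GCD
 open GCD.Bézout using (+-; -+)
 open import Relation.Nullary.Decidable using (_×-dec_; _⊎-dec_; ¬?) public

 -- Linear (and monomial-wise) arithmetic over ℕ by certificates: an inequality follows from a
 -- combination of hypotheses when its difference has only non-negative coefficients.

 infixl 6 _:+_
 infix 6 1+_
 infixl 7 _:*_
 infix 8 &_

 data Expr : Set where
  $ &_ : ℕ → Expr
  _:+_ _:*_ : Expr → Expr → Expr

 k0 k1 k2 k3 k4 k5 k6 k7 k8 k9 v0 v1 v2 v3 v4 v5 v6 v7 v8 v9 v10 v11 v12 v13 v14 v15 v16 v17 v18 v19 v20 : Expr
 k0 = & 0
 k1 = & 1
 k2 = & 2
 k3 = & 3
 k4 = & 4
 k5 = & 5
 k6 = & 6
 k7 = & 7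
 k8 = & 8
 k9 = & 9
 v0 = $ 0
 v1 = $ 1
 v2 = $ 2
 v3 = $ 3
 v4 = $ 4
 v5 = $ 5
 v6 = $ 6
 v7 = $ 7
 v8 = $ 8
 v9 = $ 9
 v10 = $ 10
 v11 = $ 11
 v12 = $ 12
 v13 = $ 13
 v14 = $ 14
 v15 = $ 15
 v16 = $ 16
 v17 = $ 17
 v18 = $ 18
 v19 = $ 19
 v20 = $ 20

 1+_ : Expr → Expr
 1+ e = & 1 :+ e

 _‼_ : List ℕ → ℕ → ℕ
 [] ‼ _ = 0
 (x ∷ ρ) ‼ zero = x
 (x ∷ ρ) ‼ suc i = ρ ‼ i

 eval : List ℕ → Expr → ℕ
 eval ρ ($ i) = ρ ‼ i
 eval ρ (& c) = c
 eval ρ (a :+ b) = eval ρ a + eval ρ b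
 eval ρ (a :* b) = eval ρ a * eval ρ b

 Monomial Polynomial : Set
 Monomial = List ℕ
 Polynomial = List (ℕ × Monomial)

 evalᵐ : List ℕ → Monomial → ℕ
 evalᵐ ρ [] = 1
 evalᵐ ρ (i ∷ m) = (ρ ‼ i) * evalᵐ ρ m

 evalᵖ : List ℕ → Polynomial → ℕ
 evalᵖ ρ [] = 0
 evalᵖ ρ ((c , m) ∷ p) = c * evalᵐ ρ m + evalᵖ ρ p

 insertᵐ : ℕ → Monomial → Monomial
 insertᵐ i [] = i ∷ []
 insertᵐ i (j ∷ m) = if i ≤ᵇ j then i ∷ j ∷ m else j ∷ insertᵐ i m

 _·ᵐ_ : Monomial → Monomial → Monomial
 [] ·ᵐ n = n
 (i ∷ m) ·ᵐ n = insertᵐ i (m ·ᵐ n)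

 _+ᵖ_ : Polynomial → Polynomial → Polynomial
 [] +ᵖ q = q
 (t ∷ p) +ᵖ q = t ∷ (p +ᵖ q)

 scaleᵖ : ℕ → Monomial → Polynomial → Polynomial
 scaleᵖ c m [] = []
 scaleᵖ c m ((d , n) ∷ p) = (c * d , m ·ᵐ n) ∷ scaleᵖ c m p

 _·ᵖ_ : Polynomial → Polynomial → Polynomial
 [] ·ᵖ q = []
 ((c , m) ∷ p) ·ᵖ q = scaleᵖ c m q +ᵖ (p ·ᵖ q)

 normal : Expr → Polynomial
 normal ($ i) = (1 , i ∷ []) ∷ []
 normal (& c) = (c , []) ∷ []
 normal (a :+ b) = normal a +ᵖ normal b
 normal (a :* b) = normal a ·ᵖ normal b

 _==ᵐ_ : Monomial → Monomial → Bool
 [] ==ᵐ [] = true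
 (i ∷ m) ==ᵐ (j ∷ n) = (i ≡ᵇ j) ∧ (m ==ᵐ n)
 _ ==ᵐ _ = false

 -- Decides coefficientwise domination without collecting like terms: each monomial on the left is
 -- paid for by occurrences consumed on the right. In `extract`, `acc` keeps the terms already
 -- passed over.
 below? : Polynomial → Polynomial → Bool
 extract : Polynomial → Polynomial → ℕ → Monomial → Polynomial → Bool

 below? [] q = true
 below? ((c , m) ∷ p) q = extract p [] c m q

 extract p acc zero m q = below? p (acc +ᵖ q)
 extract p acc (suc c) m [] = false
 extract p acc c@(suc _) m ((d , n) ∷ q) =
  if m ==ᵐ n
  then (if c ≤ᵇ d then below? p (acc +ᵖ ((d ∸ c , n) ∷ q)) else extract p acc (c ∸ d) m q)
  else extract p ((d , n) ∷ acc) c m q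

 insertᵐ-correct : ∀ ρ i m → evalᵐ ρ (insertᵐ i m) ≡ (ρ ‼ i) * evalᵐ ρ m
 insertᵐ-correct ρ i [] = refl
 insertᵐ-correct ρ i (j ∷ m) with i ≤ᵇ j
 ... | true = refl
 ... | false = begin
  (ρ ‼ j) * evalᵐ ρ (insertᵐ i m) ≡⟨ cong ((ρ ‼ j) *_) (insertᵐ-correct ρ i m) ⟩
  (ρ ‼ j) * ((ρ ‼ i) * evalᵐ ρ m) ≡⟨ *-assoc (ρ ‼ j) (ρ ‼ i) _ ⟨
  (ρ ‼ j) * (ρ ‼ i) * evalᵐ ρ m ≡⟨ cong (_* evalᵐ ρ m) (*-comm (ρ ‼ j) (ρ ‼ i)) ⟩
  (ρ ‼ i) * (ρ ‼ j) * evalᵐ ρ m ≡⟨ *-assoc (ρ ‼ i) (ρ ‼ j) _ ⟩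
  (ρ ‼ i) * ((ρ ‼ j) * evalᵐ ρ m) ∎
  where open ≡-Reasoning

 ·ᵐ-correct : ∀ ρ m n → evalᵐ ρ (m ·ᵐ n) ≡ evalᵐ ρ m * evalᵐ ρ n
 ·ᵐ-correct ρ [] n = sym (+0 _)
 ·ᵐ-correct ρ (i ∷ m) n = trans (insertᵐ-correct ρ i (m ·ᵐ n))
  (trans (cong ((ρ ‼ i) *_) (·ᵐ-correct ρ m n)) (sym (*-assoc (ρ ‼ i) _ _)))

 +ᵖ-correct : ∀ ρ p q → evalᵖ ρ (p +ᵖ q) ≡ evalᵖ ρ p + evalᵖ ρ q
 +ᵖ-correct ρ [] q = refl
 +ᵖ-correct ρ ((c , m) ∷ p) q =
  trans (cong (c * evalᵐ ρ m +_) (+ᵖ-correct ρ p q)) (sym (+-assoc (c * evalᵐ ρ m) _ _))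

 scaleᵖ-correct : ∀ ρ c m q → evalᵖ ρ (scaleᵖ c m q) ≡ c * evalᵐ ρ m * evalᵖ ρ q
 scaleᵖ-correct ρ c m [] = sym (*0 (c * evalᵐ ρ m))
 scaleᵖ-correct ρ c m ((d , n) ∷ q) = begin
  c * d * evalᵐ ρ (m ·ᵐ n) + evalᵖ ρ (scaleᵖ c m q)
   ≡⟨ cong₂ _+_ (cong (c * d *_) (·ᵐ-correct ρ m n)) (scaleᵖ-correct ρ c m q) ⟩
  c * d * (evalᵐ ρ m * evalᵐ ρ n) + c * evalᵐ ρ m * evalᵖ ρ q
   ≡⟨ cong (_+ c * evalᵐ ρ m * evalᵖ ρ q) ([m*n]*[o*p]≡[m*o]*[n*p] c d (evalᵐ ρ m) (evalᵐ ρ n)) ⟩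
  c * evalᵐ ρ m * (d * evalᵐ ρ n) + c * evalᵐ ρ m * evalᵖ ρ q
   ≡⟨ *-distribˡ-+ (c * evalᵐ ρ m) _ _ ⟨
  c * evalᵐ ρ m * (d * evalᵐ ρ n + evalᵖ ρ q) ∎
  where open ≡-Reasoning

 ·ᵖ-correct : ∀ ρ p q → evalᵖ ρ (p ·ᵖ q) ≡ evalᵖ ρ p * evalᵖ ρ q
 ·ᵖ-correct ρ [] q = refl
 ·ᵖ-correct ρ ((c , m) ∷ p) q = trans (+ᵖ-correct ρ (scaleᵖ c m q) (p ·ᵖ q))
  (trans (cong₂ _+_ (scaleᵖ-correct ρ c m q) (·ᵖ-correct ρ p q))
   (sym (*-distribʳ-+ (evalᵖ ρ q) (c * evalᵐ ρ m) (evalᵖ ρ p))))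

 normal-correct : ∀ ρ e → evalᵖ ρ (normal e) ≡ eval ρ e
 normal-correct ρ ($ i) = trans (+0 _) (trans (+0 _) (*1 _))
 normal-correct ρ (& c) = trans (+0 _) (*1 _)
 normal-correct ρ (a :+ b) =
  trans (+ᵖ-correct ρ (normal a) (normal b)) (cong₂ _+_ (normal-correct ρ a) (normal-correct ρ b))
 normal-correct ρ (a :* b) =
  trans (·ᵖ-correct ρ (normal a) (normal b)) (cong₂ _*_ (normal-correct ρ a) (normal-correct ρ b))

 ==ᵐ-sound : ∀ ρ m n → T (m ==ᵐ n) → evalᵐ ρ m ≡ evalᵐ ρ n
 ==ᵐ-sound ρ [] [] _ = refl
 ==ᵐ-sound ρ (i ∷ m) (j ∷ n) eq with Function.Equivalence.to (T-∧ {i ≡ᵇ j}) eq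
  where import Function
 ... | i=j , m=n = cong₂ _*_ (cong (ρ ‼_) (≡ᵇ⇒≡ i j i=j)) (==ᵐ-sound ρ m n m=n)

 below?-sound : ∀ ρ p q → T (below? p q) → evalᵖ ρ p ≤ evalᵖ ρ q
 extract-sound : ∀ ρ p acc c m q → T (extract p acc c m q) →
         c * evalᵐ ρ m + evalᵖ ρ p ≤ evalᵖ ρ acc + evalᵖ ρ q

 below?-sound ρ [] q _ = z≤n
 below?-sound ρ ((c , m) ∷ p) q = extract-sound ρ p [] c m q

 extract-sound ρ p acc zero m q ok =
  ≤-trans (below?-sound ρ p (acc +ᵖ q) ok) (≡⇒≤ (+ᵖ-correct ρ acc q))
 extract-sound ρ p acc c@(suc _) m ((d , n) ∷ q) ok with m ==ᵐ n in m=n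
 ... | false = ≤-trans (extract-sound ρ p ((d , n) ∷ acc) c m q ok) (≡⇒≤
  (trans (cong (_+ evalᵖ ρ q) (+-comm (d * evalᵐ ρ n) (evalᵖ ρ acc))) (+-assoc (evalᵖ ρ acc) _ _)))
 ... | true with c ≤ᵇ d in c≤d
 ... | true = begin
  c * evalᵐ ρ m + evalᵖ ρ p
   ≤⟨ +-monoʳ-≤ (c * evalᵐ ρ m) (below?-sound ρ p _ ok) ⟩
  c * evalᵐ ρ m + evalᵖ ρ (acc +ᵖ ((d ∸ c , n) ∷ q))
   ≡⟨ cong₂ _+_ (cong (c *_) (==ᵐ-sound ρ m n (subst T (sym m=n) tt))) (+ᵖ-correct ρ acc _) ⟩
  c * evalᵐ ρ n + (evalᵖ ρ acc + ((d ∸ c) * evalᵐ ρ n + evalᵖ ρ q))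
   ≡⟨ shuffle (c * evalᵐ ρ n) (evalᵖ ρ acc) ((d ∸ c) * evalᵐ ρ n) (evalᵖ ρ q) ⟩
  evalᵖ ρ acc + (c * evalᵐ ρ n + (d ∸ c) * evalᵐ ρ n + evalᵖ ρ q)
   ≡⟨ cong (λ t → evalᵖ ρ acc + (t + evalᵖ ρ q)) (*-distribʳ-+ (evalᵐ ρ n) c (d ∸ c)) ⟨
  evalᵖ ρ acc + ((c + (d ∸ c)) * evalᵐ ρ n + evalᵖ ρ q)
   ≡⟨ cong (λ t → evalᵖ ρ acc + (t * evalᵐ ρ n + evalᵖ ρ q))
      (m+[n∸m]≡n (≤ᵇ⇒≤ c d (subst T (sym c≤d) tt))) ⟩
  evalᵖ ρ acc + (d * evalᵐ ρ n + evalᵖ ρ q) ∎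
  where
  open ≤-Reasoning
  shuffle : ∀ a b c d → a + (b + (c + d)) ≡ b + (a + c + d)
  shuffle a b c d = trans (sym (+-assoc a b _)) (trans (cong (_+ (c + d)) (+-comm a b))
   (trans (+-assoc b a _) (cong (b +_) (sym (+-assoc a c d)))))
 ... | false = begin
  c * evalᵐ ρ m + evalᵖ ρ p
   ≡⟨ cong (λ t → t * evalᵐ ρ m + evalᵖ ρ p) (m+[n∸m]≡n d≤c) ⟨
  (d + (c ∸ d)) * evalᵐ ρ m + evalᵖ ρ p
   ≡⟨ trans (cong (_+ evalᵖ ρ p) (*-distribʳ-+ (evalᵐ ρ m) d (c ∸ d))) (+-assoc (d * evalᵐ ρ m) _ _) ⟩
  d * evalᵐ ρ m + ((c ∸ d) * evalᵐ ρ m + evalᵖ ρ p)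
   ≤⟨ +-monoʳ-≤ (d * evalᵐ ρ m) (extract-sound ρ p acc (c ∸ d) m q ok) ⟩
  d * evalᵐ ρ m + (evalᵖ ρ acc + evalᵖ ρ q)
   ≡⟨ cong (λ t → d * t + (evalᵖ ρ acc + evalᵖ ρ q)) (==ᵐ-sound ρ m n (subst T (sym m=n) tt)) ⟩
  d * evalᵐ ρ n + (evalᵖ ρ acc + evalᵖ ρ q)
   ≡⟨ trans (sym (+-assoc (d * evalᵐ ρ n) _ _)) (trans (cong (_+ evalᵖ ρ q) (+-comm (d * evalᵐ ρ n) _))
      (+-assoc (evalᵖ ρ acc) _ _)) ⟩
  evalᵖ ρ acc + (d * evalᵐ ρ n + evalᵖ ρ q) ∎
  where
  open ≤-Reasoning
  d≤c : d ≤ c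
  d≤c with ≤-total c d
  ... | inj₂ le = le
  ... | inj₁ le = ⊥-elim (subst T c≤d (≤⇒≤ᵇ le))

 data Hyps (ρ : List ℕ) : Set where
  [] : Hyps ρ
  hyp* : ℕ → (l r : Expr) → eval ρ l ≤ eval ρ r → Hyps ρ → Hyps ρ

 eqn* eqn⁻* : ∀ {ρ} → ℕ → (l r : Expr) → eval ρ l ≡ eval ρ r → Hyps ρ → Hyps ρ
 eqn* c l r l≡r = hyp* c l r (≡⇒≤ l≡r)
 eqn⁻* c l r l≡r = hyp* c r l (≡⇒≤ (sym l≡r))

 mul* : ∀ {ρ} → ℕ → (e l r : Expr) → eval ρ l ≤ eval ρ r → Hyps ρ → Hyps ρ
 mul* {ρ} c e l r l≤r = hyp* c (e :* l) (e :* r) (*-monoʳ-≤ (eval ρ e) l≤r)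

 hyp : ∀ {ρ} (l r : Expr) → eval ρ l ≤ eval ρ r → Hyps ρ → Hyps ρ
 hyp = hyp* 1

 eqn eqn⁻ : ∀ {ρ} (l r : Expr) → eval ρ l ≡ eval ρ r → Hyps ρ → Hyps ρ
 eqn = eqn* 1
 eqn⁻ = eqn⁻* 1

 mul : ∀ {ρ} (e l r : Expr) → eval ρ l ≤ eval ρ r → Hyps ρ → Hyps ρ
 mul = mul* 1

 lefts rights : ∀ {ρ} → Hyps ρ → Polynomial
 lefts [] = []
 lefts (hyp* c l r _ hs) = scaleᵖ c [] (normal l) +ᵖ lefts hs
 rights [] = []
 rights (hyp* c l r _ hs) = scaleᵖ c [] (normal r) +ᵖ rights hs

 scaled : ∀ ρ c e → evalᵖ ρ (scaleᵖ c [] (normal e)) ≡ c * eval ρ e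
 scaled ρ c e = trans (scaleᵖ-correct ρ c [] (normal e))
  (cong₂ _*_ (*1 c) (normal-correct ρ e))

 lefts≤rights : ∀ {ρ} (hs : Hyps ρ) → evalᵖ ρ (lefts hs) ≤ evalᵖ ρ (rights hs)
 lefts≤rights [] = z≤n
 lefts≤rights {ρ} (hyp* c l r l≤r hs) = begin
  evalᵖ ρ (scaleᵖ c [] (normal l) +ᵖ lefts hs)
   ≡⟨ trans (+ᵖ-correct ρ (scaleᵖ c [] (normal l)) (lefts hs)) (cong (_+ evalᵖ ρ (lefts hs)) (scaled ρ c l)) ⟩
  c * eval ρ l + evalᵖ ρ (lefts hs)
   ≤⟨ +-mono-≤ (*-monoʳ-≤ c l≤r) (lefts≤rights hs) ⟩
  c * eval ρ r + evalᵖ ρ (rights hs)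
   ≡⟨ trans (+ᵖ-correct ρ (scaleᵖ c [] (normal r)) (rights hs)) (cong (_+ evalᵖ ρ (rights hs)) (scaled ρ c r)) ⟨
  evalᵖ ρ (scaleᵖ c [] (normal r) +ᵖ rights hs) ∎
  where open ≤-Reasoning

 ForAll : {X : Set} → ℕ → (List X → Set) → Set
 ForAll zero P = P []
 ForAll (suc n) P = ∀ x → ForAll n λ ρ → P (x ∷ ρ)

 forAll : ∀ {X : Set} n {P : List X → Set} → (∀ ρ → P ρ) → ForAll n P
 forAll zero f = f []
 forAll (suc n) f x = forAll n λ ρ → f (x ∷ ρ)

 abstract
  certified : ∀ ρ m (a b : Expr) (hs : Hyps ρ) →
     {T (below? (scaleᵖ (suc m) [] (normal a) +ᵖ rights hs) (scaleᵖ (suc m) [] (normal b) +ᵖ lefts hs))} →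
     eval ρ a ≤ eval ρ b
  certified ρ m a b hs {ok} = *-cancelˡ-≤ (suc m) (+-cancelʳ-≤ (evalᵖ ρ (rights hs)) _ _ (begin
   suc m * eval ρ a + evalᵖ ρ (rights hs)
    ≡⟨ trans (+ᵖ-correct ρ (scaleᵖ (suc m) [] (normal a)) (rights hs)) (cong (_+ evalᵖ ρ (rights hs)) (scaled ρ (suc m) a)) ⟨
   evalᵖ ρ (scaleᵖ (suc m) [] (normal a) +ᵖ rights hs)
    ≤⟨ below?-sound ρ (scaleᵖ (suc m) [] (normal a) +ᵖ rights hs)
       (scaleᵖ (suc m) [] (normal b) +ᵖ lefts hs) ok ⟩
   evalᵖ ρ (scaleᵖ (suc m) [] (normal b) +ᵖ lefts hs)
    ≡⟨ trans (+ᵖ-correct ρ (scaleᵖ (suc m) [] (normal b)) (lefts hs)) (cong (_+ evalᵖ ρ (lefts hs)) (scaled ρ (suc m) b)) ⟩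
   suc m * eval ρ b + evalᵖ ρ (lefts hs)
    ≤⟨ +-monoʳ-≤ (suc m * eval ρ b) (lefts≤rights hs) ⟩
   suc m * eval ρ b + evalᵖ ρ (rights hs) ∎))
   where open ≤-Reasoning

 -- A call lists `n` atoms, denoted by `v0`, `v1`, ..., then `m`, the two sides and the weighted
 -- hypotheses. The goal enters multiplied by `suc m`, which clears the denominators of rational
 -- weights; `mul` multiplies a hypothesis by a polynomial, for products of atoms.
 lin : ∀ n → ForAll n λ ρ → ∀ m (a b : Expr) (hs : Hyps ρ) →
    {T (below? (scaleᵖ (suc m) [] (normal a) +ᵖ rights hs) (scaleᵖ (suc m) [] (normal b) +ᵖ lefts hs))} →
    eval ρ a ≤ eval ρ b
 lin n = forAll n certified

 linEq : ∀ n → ForAll n λ ρ → ∀ (a b : Expr) m (hs : Hyps ρ) m' (hs' : Hyps ρ) →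
     {T (below? (scaleᵖ (suc m) [] (normal a) +ᵖ rights hs) (scaleᵖ (suc m) [] (normal b) +ᵖ lefts hs))} →
     {T (below? (scaleᵖ (suc m') [] (normal b) +ᵖ rights hs') (scaleᵖ (suc m') [] (normal a) +ᵖ lefts hs'))} →
     eval ρ a ≡ eval ρ b
 linEq n = forAll n λ ρ a b m hs m' hs' {ok} {ok'} → ≤-antisym (certified ρ m a b hs {ok}) (certified ρ m' b a hs' {ok'})

 -- Contradictory hypotheses yield a certificate of `1 ≤ 0`, so `lin` also serves for refutations.
 absurd : ∀ {ℓ} {A : Set ℓ} → 1 ≤ 0 → A
 absurd ()

 -- Finite sums and counting, over `Fin` and over initial segments of ℕ.

 open CommutativeMonoidSum +-0-commutativeMonoid using (sum; ∑-distrib-+; ∑-comm; sum-permute)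

 +∸ : ∀ {m n} → m ≤ n → m + (n ∸ m) ≡ n
 +∸ = m+[n∸m]≡n

 cancelˡ : ∀ k {m n} → 1 ≤ k → k * m ≤ k * n → m ≤ n
 cancelˡ k 1≤k = *-cancelˡ-≤ k {{ℕ.>-nonZero 1≤k}}

 [_] : Bool → ℕ
 [ true ] = 1
 [ false ] = 0

 ≤-dec : ∀ {m n} → {T (m ≤ᵇ n)} → m ≤ n
 ≤-dec {m} {n} {ok} = ≤ᵇ⇒≤ m n ok

 T! : ∀ {b} → b ≡ true → T b
 T! refl = tt

 T-∧ˡ : ∀ {a b} → T (a ∧ b) → T a
 T-∧ˡ {true} _ = tt

 T-∧ʳ : ∀ {a b} → T (a ∧ b) → T b
 T-∧ʳ {true} t = t

 T-∨ˡ : ∀ {a b} → T a → T (a ∨ b)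
 T-∨ˡ {true} _ = tt

 T-∨ʳ : ∀ {a b} → T b → T (a ∨ b)
 T-∨ʳ {true} _ = tt
 T-∨ʳ {false} t = t

 T-pair : ∀ {a b} → T a → T b → T (a ∧ b)
 T-pair {true} {true} _ _ = tt

 -- Inequalities between indicator expressions are settled by a truth table during type checking;
 -- summed over the group they replace inclusion-exclusion arguments.
 bool¹ : (f g : Bool → ℕ) → {T ((f true ≤ᵇ g true) ∧ (f false ≤ᵇ g false))} → ∀ a → f a ≤ g a
 bool¹ f g {ok} true = ≤ᵇ⇒≤ _ _ (T-∧ˡ ok)
 bool¹ f g {ok} false = ≤ᵇ⇒≤ _ _ (T-∧ʳ {f true ≤ᵇ g true} ok)

 both : (Bool → Bool) → Bool
 both h = h true ∧ h false

 both-elim : ∀ h → T (both h) → ∀ a → T (h a)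
 both-elim h ok true = T-∧ˡ ok
 both-elim h ok false = T-∧ʳ {h true} ok

 bool² : (f g : Bool → Bool → ℕ) → {T (both λ a → both λ b → f a b ≤ᵇ g a b)} →
     ∀ a b → f a b ≤ g a b
 bool² f g {ok} a b =
  ≤ᵇ⇒≤ _ _ (both-elim (λ b → f a b ≤ᵇ g a b) (both-elim (λ a → both λ b → f a b ≤ᵇ g a b) ok a) b)

 bool³ : (f g : Bool → Bool → Bool → ℕ) → {T (both λ a → both λ b → both λ c → f a b c ≤ᵇ g a b c)} →
     ∀ a b c → f a b c ≤ g a b c
 bool³ f g {ok} a =
  bool² (f a) (g a) {both-elim (λ a → both λ b → both λ c → f a b c ≤ᵇ g a b c) ok a}

 bool⁴ : (f g : Bool → Bool → Bool → Bool → ℕ) →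
     {T (both λ a → both λ b → both λ c → both λ d → f a b c d ≤ᵇ g a b c d)} →
     ∀ a b c d → f a b c d ≤ g a b c d
 bool⁴ f g {ok} a =
  bool³ (f a) (g a) {both-elim (λ a → both λ b → both λ c → both λ d → f a b c d ≤ᵇ g a b c d) ok a}

 ⟨⟩≤1 : ∀ b → [ b ] ≤ 1
 ⟨⟩≤1 = bool¹ [_] (λ _ → 1)

 ⟨⟩-∧ : ∀ a b → [ a ∧ b ] ≡ [ a ] * [ b ]
 ⟨⟩-∧ true b = sym (+0 _)
 ⟨⟩-∧ false b = refl

 ⟨⟩-not : ∀ a → [ a ] + [ not a ] ≡ 1
 ⟨⟩-not true = refl
 ⟨⟩-not false = refl

 T⇒⟨⟩ : ∀ {b} → T b → [ b ] ≡ 1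
 T⇒⟨⟩ {true} _ = refl

 ⟨⟩⇒T : ∀ {b} → 1 ≤ [ b ] → T b
 ⟨⟩⇒T {true} _ = tt

 ¬T⇒⟨⟩ : ∀ {b} → ¬ T b → [ b ] ≡ 0
 ¬T⇒⟨⟩ {true} n = ⊥-elim (n tt)
 ¬T⇒⟨⟩ {false} _ = refl

 ⟨⟩-mono : ∀ {a b} → (T a → T b) → [ a ] ≤ [ b ]
 ⟨⟩-mono {false} f = z≤n
 ⟨⟩-mono {true} {true} f = ≤-refl
 ⟨⟩-mono {true} {false} f = ⊥-elim (f tt)

 T-not : ∀ {b} → ¬ T b → T (not b)
 T-not {true} n = n tt
 T-not {false} _ = tt

 T-not⁻ : ∀ {b} → T (not b) → ¬ T b
 T-not⁻ {true} ()

 abstract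
  -- Abstract, so that normalisation never unfolds a sum over all residues.
  Σ : ∀ {n} → (Fin n → ℕ) → ℕ
  Σ {zero} f = 0
  Σ {suc n} f = f zero + Σ (f ∘ suc)

  Σ-suc : ∀ {n} (f : Fin (suc n) → ℕ) → Σ f ≡ f zero + Σ (f ∘ suc)
  Σ-suc f = refl

  Σ-empty : ∀ (f : Fin 0 → ℕ) → Σ f ≡ 0
  Σ-empty f = refl

  Σ-mono : ∀ {n} {f g : Fin n → ℕ} → (∀ x → f x ≤ g x) → Σ f ≤ Σ g
  Σ-mono {zero} f≤g = z≤n
  Σ-mono {suc n} f≤g = +-mono-≤ (f≤g zero) (Σ-mono (f≤g ∘ suc))

  Σ-cong : ∀ {n} {f g : Fin n → ℕ} → (∀ x → f x ≡ g x) → Σ f ≡ Σ g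
  Σ-cong {zero} f≡g = refl
  Σ-cong {suc n} f≡g = cong₂ _+_ (f≡g zero) (Σ-cong (f≡g ∘ suc))

  Σ≡sum : ∀ {n} (f : Fin n → ℕ) → Σ f ≡ sum f
  Σ≡sum {zero} f = refl
  Σ≡sum {suc n} f = cong (f zero +_) (Σ≡sum (f ∘ suc))

  Σ-+ : ∀ {n} (f g : Fin n → ℕ) → Σ (λ x → f x + g x) ≡ Σ f + Σ g
  Σ-+ f g = trans (Σ≡sum (λ x → f x + g x)) (trans (∑-distrib-+ f g) (cong₂ _+_ (sym (Σ≡sum f)) (sym (Σ≡sum g))))

  Σ-swap : ∀ {m n} (f : Fin m → Fin n → ℕ) → Σ (λ x → Σ (f x)) ≡ Σ λ y → Σ λ x → f x y
  Σ-swap f = trans (double f) (trans (∑-comm f) (sym (double λ y x → f x y)))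
   where
   double : ∀ {m n} (f : Fin m → Fin n → ℕ) → Σ (λ x → Σ (f x)) ≡ sum λ x → sum (f x)
   double f = trans (Σ-cong λ x → Σ≡sum (f x)) (Σ≡sum λ x → sum (f x))

  Σ-* : ∀ {n} c (f : Fin n → ℕ) → Σ (λ x → c * f x) ≡ c * Σ f
  Σ-* {zero} c f = sym (*0 c)
  Σ-* {suc n} c f = trans (cong (c * f zero +_) (Σ-* c (f ∘ suc))) (sym (*-distribˡ-+ c (f zero) _))

  Σ-*ʳ : ∀ {n} c (f : Fin n → ℕ) → Σ (λ x → f x * c) ≡ Σ f * c
  Σ-*ʳ c f = trans (Σ-cong λ x → *-comm (f x) c) (trans (Σ-* c f) (*-comm c _))

  Σ-const : ∀ n c → Σ {n} (λ _ → c) ≡ n * c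
  Σ-const zero c = refl
  Σ-const (suc n) c = cong (c +_) (Σ-const n c)

  Σ-zero : ∀ n → Σ {n} (λ _ → 0) ≡ 0
  Σ-zero n = trans (Σ-const n 0) (*0 n)

  term≤Σ : ∀ {n} (f : Fin n → ℕ) x → f x ≤ Σ f
  term≤Σ f zero = m≤m+n _ _
  term≤Σ f (suc x) = ≤-trans (term≤Σ (f ∘ suc) x) (m≤n+m _ _)

  -- The averaging principle behind most existence claims: two compared sums point out an index,
  -- without any division.
  Σ-<⇒∃ : ∀ {n} (f g : Fin n → ℕ) → Σ f < Σ g → ∃ λ x → f x < g x
  Σ-<⇒∃ {suc n} f g lt with ≤-<-connex (g zero) (f zero)
  ... | inj₂ f<g = zero , f<g
  ... | inj₁ g≤f with Σ-<⇒∃ (f ∘ suc) (g ∘ suc)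
            (lin 4 (Σ (f ∘ suc)) (Σ (g ∘ suc)) (f zero) (g zero) 0 (1+ v0) v1 (hyp (1+ (v2 :+ v0)) (v3 :+ v1) lt (hyp v3 v2 g≤f [])))
  ... | x , f<g = suc x , f<g

 # : ∀ {n} → (Fin n → Bool) → ℕ
 # S = Σ λ x → [ S x ]

 Σ-pos⇒∃ : ∀ {n} (S : Fin n → Bool) → 1 ≤ # S → ∃ λ x → T (S x)
 Σ-pos⇒∃ {n} S le with Σ-<⇒∃ (λ _ → 0) ([_] ∘ S) (subst (_< # S) (sym (Σ-zero n)) le)
 ... | x , lt = x , ⟨⟩⇒T lt

 at : ∀ {A : Set} → List (A → ℕ) → A → ℕ
 at [] x = 0
 at (f ∷ []) x = f x
 at (f ∷ fs@(_ ∷ _)) x = f x + at fs x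

 total : ∀ {n} → List (Fin n → ℕ) → ℕ
 total [] = 0
 total (f ∷ []) = Σ f
 total (f ∷ fs@(_ ∷ _)) = Σ f + total fs

 Σ-at : ∀ {n} (fs : List (Fin n → ℕ)) → Σ (at fs) ≡ total fs
 Σ-at {n} [] = Σ-zero n
 Σ-at (f ∷ []) = refl
 Σ-at (f ∷ fs@(_ ∷ _)) = trans (Σ-+ f (at fs)) (cong (Σ f +_) (Σ-at fs))

 -- The lists of summands allow one pointwise check to be summed into an inequality between several
 -- sums.
 Σ-≤ : ∀ {n} (fs gs : List (Fin n → ℕ)) → (∀ x → at fs x ≤ at gs x) → total fs ≤ total gs
 Σ-≤ fs gs le = subst₂ _≤_ (Σ-at fs) (Σ-at gs) (Σ-mono le)

 Σ-≡ : ∀ {n} (fs gs : List (Fin n → ℕ)) → (∀ x → at fs x ≡ at gs x) → total fs ≡ total gs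
 Σ-≡ fs gs eq = subst₂ _≡_ (Σ-at fs) (Σ-at gs) (Σ-cong eq)

 #-mono : ∀ {n} {S U : Fin n → Bool} → (∀ x → T (S x) → T (U x)) → # S ≤ # U
 #-mono le = Σ-mono λ x → ⟨⟩-mono (le x)

 #-not : ∀ {n} (S : Fin n → Bool) → # S + # (λ x → not (S x)) ≡ n
 #-not {n} S = trans (sym (Σ-+ ([_] ∘ S) _)) (trans (Σ-cong λ x → ⟨⟩-not (S x)) (trans (Σ-const n 1) (*1 n)))

 Σ-bij : ∀ {m n} (to : Fin m → Fin n) (from : Fin n → Fin m) →
     (∀ y → to (from y) ≡ y) → (∀ x → from (to x) ≡ x) → (f : Fin n → ℕ) → Σ (f ∘ to) ≡ Σ f
 Σ-bij to from to-from from-to f = trans (Σ≡sum (f ∘ to)) (trans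
  (sym (sum-permute f (Permutation.permutation to from to-from from-to))) (sym (Σ≡sum f)))

 Σ< : ℕ → (ℕ → ℕ) → ℕ
 Σ< zero f = 0
 Σ< (suc n) f = Σ< n f + f n

 #< : ℕ → (ℕ → Bool) → ℕ
 #< n S = Σ< n λ i → [ S i ]

 Σ<-mono : ∀ n {f g : ℕ → ℕ} → (∀ i → i < n → f i ≤ g i) → Σ< n f ≤ Σ< n g
 Σ<-mono zero le = z≤n
 Σ<-mono (suc n) le = +-mono-≤ (Σ<-mono n λ i i<n → le i (m≤n⇒m≤1+n i<n)) (le n ≤-refl)

 Σ<-cong : ∀ n {f g : ℕ → ℕ} → (∀ i → i < n → f i ≡ g i) → Σ< n f ≡ Σ< n g
 Σ<-cong n eq = ≤-antisym (Σ<-mono n λ i i<n → ≡⇒≤ (eq i i<n)) (Σ<-mono n λ i i<n → ≡⇒≤ (sym (eq i i<n)))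

 Σ<-+ : ∀ n (f g : ℕ → ℕ) → Σ< n (λ i → f i + g i) ≡ Σ< n f + Σ< n g
 Σ<-+ zero f g = refl
 Σ<-+ (suc n) f g = (linEq 5 (Σ< n (λ i → f i + g i)) (f n) (g n) (Σ< n f) (Σ< n g) (v0 :+ (v1 :+ v2)) (v3 :+ v1 :+ (v4 :+ v2)) 0 (eqn v0 (v3 :+ v4) (Σ<-+ n f g) []) 0 (eqn⁻ v0 (v3 :+ v4) (Σ<-+ n f g) []))

 Σ<-* : ∀ n c (f : ℕ → ℕ) → Σ< n (λ i → c * f i) ≡ c * Σ< n f
 Σ<-* zero c f = sym (*0 c)
 Σ<-* (suc n) c f = trans (cong (_+ c * f n) (Σ<-* n c f)) (sym (*-distribˡ-+ c _ (f n)))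

 Σ<-const : ∀ n c → Σ< n (λ _ → c) ≡ n * c
 Σ<-const zero c = refl
 Σ<-const (suc n) c = trans (cong (_+ c) (Σ<-const n c)) (+-comm (n * c) c)

 Σ<-swap : ∀ m n (f : ℕ → ℕ → ℕ) → Σ< m (λ i → Σ< n (f i)) ≡ Σ< n λ j → Σ< m λ i → f i j
 Σ<-swap zero n f = sym (trans (Σ<-const n 0) (*0 n))
 Σ<-swap (suc m) n f = trans (cong (_+ Σ< n (f m)) (Σ<-swap m n f)) (sym (Σ<-+ n _ (f m)))

 Σ<-split : ∀ m n (f : ℕ → ℕ) → Σ< (m + n) f ≡ Σ< m f + Σ< n λ i → f (m + i)
 Σ<-split m zero f = trans (cong (λ t → Σ< t f) (+0 m)) (sym (+0 _))
 Σ<-split m (suc n) f = trans (cong (λ t → Σ< t f) (+-suc m n)) (trans (cong (_+ f (m + n)) (Σ<-split m n f)) (+-assoc (Σ< m f) _ _))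

 Σ<-≤ : ∀ {m n} (f : ℕ → ℕ) → m ≤ n → Σ< m f ≤ Σ< n f
 Σ<-≤ {m} {n} f m≤n = subst (λ t → Σ< m f ≤ Σ< t f) (+∸ m≤n) (subst (Σ< m f ≤_) (sym (Σ<-split m (n ∸ m) f)) (m≤m+n _ _))

 term≤Σ< : ∀ {n i} (f : ℕ → ℕ) → i < n → f i ≤ Σ< n f
 term≤Σ< {i = i} f i<n = ≤-trans (m≤n+m (f i) (Σ< i f)) (Σ<-≤ f i<n)

 Σ<-<⇒∃ : ∀ n (f g : ℕ → ℕ) → Σ< n f < Σ< n g → ∃ λ i → i < n × f i < g i
 Σ<-<⇒∃ (suc n) f g lt with ≤-<-connex (g n) (f n)
 ... | inj₂ f<g = n , ≤-refl , f<g
 ... | inj₁ g≤f with Σ<-<⇒∃ n f g (lin 4 (Σ< n f) (Σ< n g) (f n) (g n) 0 (1+ v0) v1 (hyp (1+ (v0 :+ v2)) (v1 :+ v3) lt (hyp v3 v2 g≤f [])))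
 ... | i , i<n , f<g = i , m≤n⇒m≤1+n i<n , f<g

 Σ<-Fin : ∀ n (f : ℕ → ℕ) → Σ {n} (f ∘ toℕ) ≡ Σ< n f
 Σ<-Fin zero f = Σ-empty _
 Σ<-Fin (suc n) f = trans (Σ-suc (f ∘ toℕ)) (trans (cong (f 0 +_) (Σ<-Fin n (f ∘ suc))) (sym (Σ<-split 1 n f)))

 Σ<-reverse : ∀ n (f g : ℕ → ℕ) → (∀ k → k < n → f k ≡ g (n ∸ 1 ∸ k)) → Σ< n f ≡ Σ< n g
 Σ<-reverse zero f g eq = refl
 Σ<-reverse (suc n) f g eq = trans (cong₂ _+_ (Σ<-reverse n f (g ∘ suc) λ k k<n → trans (eq k (m≤n⇒m≤1+n k<n)) (cong g (trans (cong (_∸ k) (sym (suc-pred n {{ℕ.>-nonZero (≤-trans (s≤s z≤n) k<n)}}))) (+-∸-assoc 1 (≤-pred (subst (k <_) (sym (suc-pred n {{ℕ.>-nonZero (≤-trans (s≤s z≤n) k<n)}})) k<n)))))) (trans (eq n ≤-refl) (cong g (n∸n≡0 n))))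
  (trans (+-comm _ (g 0)) (sym (Σ<-split 1 n g)))

 #<-not : ∀ n S → #< n S + #< n (λ i → not (S i)) ≡ n
 #<-not n S = trans (sym (Σ<-+ n ([_] ∘ S) _)) (trans (Σ<-cong n λ i _ → ⟨⟩-not (S i)) (trans (Σ<-const n 1) (*1 n)))

 #<≤ : ∀ n S → #< n S ≤ n
 #<≤ n S = ≤-trans (m≤m+n _ _) (≡⇒≤ (#<-not n S))

 least : ∀ {P : ℕ → Set} → (∀ k → Dec (P k)) → ∀ n → P n → ∃ λ m → m ≤ n × P m × (∀ k → k < m → ¬ P k)
 least P? zero Pn = zero , z≤n , Pn , λ k ()
 least P? (suc n) Pn with P? 0
 ... | yes P0 = 0 , z≤n , P0 , λ k ()
 ... | no ¬P0 with least (P? ∘ suc) n Pn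
 ... | m , m≤n , Pm , before = suc m , s≤s m≤n , Pm , λ { zero _ → ¬P0 ; (suc k) (s≤s k<m) → before k k<m }

 greatest : ∀ {P : ℕ → Set} → (∀ k → Dec (P k)) → ∀ n → P 0 → ∃ λ m → m ≤ n × P m × (∀ k → m < k → k ≤ n → ¬ P k)
 greatest P? n P0 with P? n
 ... | yes Pn = n , ≤-refl , Pn , λ k n<k k≤n → ⊥-elim (<⇒≱ n<k k≤n)
 greatest P? zero P0 | no ¬P = ⊥-elim (¬P P0)
 greatest P? (suc n) P0 | no ¬P with greatest P? n P0
 ... | m , m≤n , Pm , after = m , m≤n⇒m≤1+n m≤n , Pm , λ k m<k k≤ → case m≤n⇒m<n∨m≡n k≤ of λ where
     (inj₁ k<) → after k m<k (≤-pred k<)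
     (inj₂ refl) → ¬P

 Σ<-sub : ∀ lo len n (f : ℕ → ℕ) → lo + len ≤ n → Σ< len (λ k → f (lo + k)) ≤ Σ< n f
 Σ<-sub lo len n f le = ≤-trans (m≤n+m _ (Σ< lo f)) (≤-trans (≡⇒≤ (sym (Σ<-split lo len f))) (Σ<-≤ f le))

 Σ<-*ʳ : ∀ n c (f : ℕ → ℕ) → Σ< n (λ i → f i * c) ≡ Σ< n f * c
 Σ<-*ʳ n c f = trans (Σ<-cong n λ i _ → *-comm (f i) c) (trans (Σ<-* n c f) (*-comm c _))

 between : ℕ → ℕ → ℕ → Bool
 between lo len k = (lo ≤ᵇ k) ∧ (suc k ≤ᵇ lo + len)

 between-inside : ∀ lo len k → k < len → T (between lo len (lo + k))
 between-inside lo len k k<len = T-pair (≤⇒≤ᵇ (m≤m+n lo k)) (≤⇒≤ᵇ (subst (_≤ lo + len) (+-suc lo k) (+-monoʳ-≤ lo k<len)))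

 between-elim : ∀ lo len k → T (between lo len k) → lo ≤ k × k < lo + len
 between-elim lo len k t = ≤ᵇ⇒≤ lo k (T-∧ˡ t) , ≤ᵇ⇒≤ (suc k) (lo + len) (T-∧ʳ {lo ≤ᵇ k} t)

 Σ<-between : ∀ lo len n (f : ℕ → ℕ) → lo + len ≤ n → Σ< n (λ k → [ between lo len k ] * f k) ≡ Σ< len λ k → f (lo + k)
 Σ<-between lo len n f le = begin
  Σ< n g ≡⟨ cong (λ t → Σ< t g) (sym (+∸ le)) ⟩
  Σ< (lo + len + (n ∸ (lo + len))) g ≡⟨ Σ<-split (lo + len) _ g ⟩
  Σ< (lo + len) g + Σ< (n ∸ (lo + len)) (λ k → g (lo + len + k))
   ≡⟨ cong₂ _+_ (Σ<-split lo len g) (vanish (n ∸ (lo + len)) λ k _ → g≡0 (λ t → <⇒≱ (proj₂ (between-elim lo len _ t)) (m≤m+n _ k))) ⟩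
  Σ< lo g + Σ< len (λ k → g (lo + k)) + 0
   ≡⟨ trans (+0 _) (cong (_+ Σ< len (λ k → g (lo + k))) (vanish lo λ k k<lo → g≡0 (λ t → <⇒≱ k<lo (proj₁ (between-elim lo len k t))))) ⟩
  Σ< len (λ k → g (lo + k)) ≡⟨ Σ<-cong len (λ k k<len → trans (cong (_* f (lo + k)) (T⇒⟨⟩ (between-inside lo len k k<len))) (+0 _)) ⟩
  Σ< len (λ k → f (lo + k)) ∎
  where
  open ≡-Reasoning
  g : ℕ → ℕ
  g k = [ between lo len k ] * f k
  g≡0 : ∀ {k} → ¬ T (between lo len k) → g k ≡ 0
  g≡0 {k} out = cong (_* f k) (¬T⇒⟨⟩ out)
  vanish : ∀ m {h : ℕ → ℕ} → (∀ k → k < m → h k ≡ 0) → Σ< m h ≡ 0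
  vanish m eq = trans (Σ<-cong m eq) (trans (Σ<-const m 0) (*0 m))

 #<-between : ∀ lo len n → #< n (between lo len) ≤ len
 #<-between lo len n = ≤-trans (Σ<-≤ ([_] ∘ between lo len) (m≤m+n n (lo + len))) (≡⇒≤ (trans (Σ<-cong (n + (lo + len)) λ k _ → sym (*1 [ between lo len k ]))
  (trans (Σ<-between lo len (n + (lo + len)) (λ _ → 1) (m≤n+m _ n)) (trans (Σ<-const len 1) (*1 len)))))

 Σ<-average : ∀ n (f : ℕ → ℕ) c → 1 ≤ n → Σ< n f ≤ c → ∃ λ k → k < n × f k * n ≤ c
 Σ<-average n f c 1≤n le = from (Σ<-<⇒∃ n (λ k → f k * n) (λ _ → suc c)
  (lin 5 (Σ< n (λ k → f k * n)) (Σ< n (λ _ → suc c)) (Σ< n f) n c 0 (1+ v0) v1 (eqn v0 (v2 :* v3) (Σ<-*ʳ n n f) (eqn⁻ v1 (v3 :* (1+ v4)) (Σ<-const n (suc c)) (mul v3 v2 v4 le (hyp k1 v3 1≤n []))))))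
  where
  from : (∃ λ k → k < n × f k * n < suc c) → ∃ λ k → k < n × f k * n ≤ c
  from (k , k<n , lt) = k , k<n , ≤-pred lt

 Σ<-blocks : ∀ k r (f : ℕ → ℕ) → Σ< k (λ a → Σ< r λ t → f (a * r + t)) ≡ Σ< (k * r) f
 Σ<-blocks zero r f = refl
 Σ<-blocks (suc k) r f = trans (cong (_+ Σ< r (λ t → f (k * r + t))) (Σ<-blocks k r f)) (trans (sym (Σ<-split (k * r) r f)) (cong (λ t → Σ< t f) (+-comm (k * r) r)))

 Σ<-countdown : ∀ r m (f : ℕ → ℕ) → r ≤ suc m → Σ< r (λ t → f (m ∸ t)) ≡ Σ< r λ t → f (suc m ∸ r + t)
 Σ<-countdown r m f le = Σ<-reverse r (λ t → f (m ∸ t)) (λ t → f (suc m ∸ r + t)) λ t t<r → cong f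
  (linEq 7 (m ∸ t) (suc m ∸ r) (r ∸ 1 ∸ t) t m r (r ∸ 1) v0 (v1 :+ v2) 0 (eqn (v3 :+ v0) v4 (+∸ (≤-pred (≤-trans t<r le))) (eqn⁻ (v5 :+ v1) (1+ v4) (+∸ le) (eqn⁻ (1+ v6) v5 (+∸ {1} {r} (≤-trans (s≤s z≤n) t<r)) (eqn⁻ (v3 :+ v2) v6 (+∸ (≤-pred (subst (t <_) (sym (+∸ {1} {r} (≤-trans (s≤s z≤n) t<r))) t<r))) [])))) 0 (eqn⁻
   (v3 :+ v0) v4 (+∸ (≤-pred (≤-trans t<r le))) (eqn (v5 :+ v1) (1+ v4) (+∸ le) (eqn (1+ v6) v5 (+∸ {1} {r} (≤-trans (s≤s z≤n) t<r)) (eqn (v3 :+ v2) v6 (+∸ (≤-pred (subst (t <_) (sym (+∸ {1} {r} (≤-trans (s≤s z≤n) t<r))) t<r))) [])))))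

 Σ<-cyclic : ∀ r .{{_ : NonZero r}} m (f : ℕ → ℕ) → Σ< r (λ t → f ((m + t) % r)) ≡ Σ< r f
 Σ<-cyclic r zero f = Σ<-cong r λ t t<r → cong f (m<n⇒m%n≡m t<r)
 Σ<-cyclic r (suc m) f = trans (+-cancelˡ-≡ (f (m % r)) _ _ (begin
  f (m % r) + Σ< r (λ t → f ((suc m + t) % r)) ≡⟨ cong₂ _+_ (cong (λ t → f (t % r)) (sym (+0 m))) (Σ<-cong r λ t _ → cong (λ u → f (u % r)) (sym (+-suc m t))) ⟩
  f ((m + 0) % r) + Σ< r (λ t → f ((m + suc t) % r)) ≡⟨ Σ<-split 1 r (λ t → f ((m + t) % r)) ⟨
  Σ< r (λ t → f ((m + t) % r)) + f ((m + r) % r) ≡⟨ cong (Σ< r (λ t → f ((m + t) % r)) +_) (cong f ([m+n]%n≡m%n m r)) ⟩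
  Σ< r (λ t → f ((m + t) % r)) + f (m % r) ≡⟨ +-comm _ (f (m % r)) ⟩
  f (m % r) + Σ< r (λ t → f ((m + t) % r)) ∎)) (Σ<-cyclic r m f)
  where open ≡-Reasoning

 #<-residues : ∀ r .{{_ : NonZero r}} c v → #< (c * r) (λ y → between v 1 (y % r)) ≤ c
 #<-residues r zero v = z≤n
 #<-residues r (suc c) v = ≤-trans (≡⇒≤ (Σ<-split r (c * r) λ y → [ between v 1 (y % r) ])) (+-mono-≤
  (≤-trans (≡⇒≤ (Σ<-cyclic r 0 λ y → [ between v 1 y ])) (#<-between v 1 r))
  (≤-trans (≡⇒≤ (Σ<-cong (c * r) λ y _ → cong ([_] ∘ between v 1) (trans (cong (_% r) (+-comm r y)) ([m+n]%n≡m%n y r)))) (#<-residues r c v)))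

 -- Sums of sets of integers, and their covering by sparse selections.

 sumOf unhit : (A B : ℕ → Bool) → ℕ → Bool
 sumOf A B z = 1 ≤ᵇ #< (suc z) λ i → A i ∧ B (z ∸ i)
 unhit A B z = not (sumOf A B z)

 sumOf-intro : ∀ A B i j → T (A i) → T (B j) → T (sumOf A B (i + j))
 sumOf-intro A B i j Ai Bj = ≤⇒≤ᵇ (≤-trans (≡⇒≤ (sym (T⇒⟨⟩ (T-pair Ai (subst (T ∘ B) (sym (m+n∸m≡n i j)) Bj)))))
  (term≤Σ< (λ k → [ A k ∧ B (i + j ∸ k) ]) (s≤s (m≤m+n i j))))

 sumOf-elim : ∀ A B z → T (sumOf A B z) → ∃ λ i → ∃ λ j → i + j ≡ z × T (A i) × T (B j)
 sumOf-elim A B z t = from (Σ<-<⇒∃ (suc z) (λ _ → 0) (λ i → [ A i ∧ B (z ∸ i) ]) (subst (_< #< (suc z) λ i → A i ∧ B (z ∸ i)) (sym (trans (Σ<-const (suc z) 0) (*0 (suc z)))) (≤ᵇ⇒≤ 1 _ t)))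
  where
  from : (∃ λ i → i < suc z × 0 < [ A i ∧ B (z ∸ i) ]) → ∃ λ i → ∃ λ j → i + j ≡ z × T (A i) × T (B j)
  from (i , i≤z , lt) = i , z ∸ i , +∸ (≤-pred i≤z) , T-∧ˡ (⟨⟩⇒T lt) , T-∧ʳ {A i} (⟨⟩⇒T lt)

 unhit-anti : ∀ A B A₁ B₁ → (∀ i → T (A i) → T (A₁ i)) → (∀ i → T (B i) → T (B₁ i)) → ∀ z → T (unhit A₁ B₁ z) → T (unhit A B z)
 unhit-anti A B A₁ B₁ f g z t = T-not λ h → from (sumOf-elim A B z h)
  where
  from : (∃ λ i → ∃ λ j → i + j ≡ z × T (A i) × T (B j)) → ⊥
  from (i , j , refl , Ai , Bj) = T-not⁻ t (sumOf-intro A₁ B₁ i j (f i Ai) (g j Bj))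

 -- Sizes are bounded on all initial segments at once, so that no range has to be fixed for the
 -- subsets.
 record Selection (α β : ℕ → Bool) (K L : ℕ) : Set where
  constructor selection
  field
   selA selB : ℕ → Bool
   selA⊆ : ∀ i → T (selA i) → T (α i)
   selB⊆ : ∀ i → T (selB i) → T (β i)
   #selA : ∀ n → #< n selA ≤ K
   #selB : ∀ n → #< n selB ≤ L

  missed : ℕ → Bool
  missed = unhit selA selB

 open Selection public

 infixl 6 _∨∨_
 _∨∨_ : (A B : ℕ → Bool) → ℕ → Bool
 (A ∨∨ B) i = A i ∨ B i

 join : ∀ {α β K L K' L'} → Selection α β K L → Selection α β K' L' → Selection α β (K + K') (L + L')
 join (selection A B a b #A #B) (selection A' B' a' b' #A' #B') = selection (A ∨∨ A') (B ∨∨ B') (either A a a') (either B b b') (sizes A A' #A #A') (sizes B B' #B #B')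
  where
  either : ∀ (S : ℕ → Bool) {U W : ℕ → Bool} → (∀ i → T (S i) → T (W i)) → (∀ i → T (U i) → T (W i)) → ∀ i → T (S i ∨ U i) → T (W i)
  either S s u i t with S i | s i
  ... | true | si = si tt
  ... | false | _ = u i t
  sizes : ∀ (S U : ℕ → Bool) {K K'} → (∀ n → #< n S ≤ K) → (∀ n → #< n U ≤ K') → ∀ n → #< n (S ∨∨ U) ≤ K + K'
  sizes S U s u n = ≤-trans (Σ<-mono n λ i _ → bool² (λ a b → [ a ∨ b ]) (λ a b → [ a ] + [ b ]) (S i) (U i)) (≤-trans (≡⇒≤ (Σ<-+ n _ λ i → [ U i ])) (+-mono-≤ (s n) (u n)))

 missed-joinˡ : ∀ {α β K L K' L'} (S : Selection α β K L) (S' : Selection α β K' L') z → T (missed (join S S') z) → T (missed S z)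
 missed-joinˡ S S' = unhit-anti (selA S) (selB S) (selA (join S S')) (selB (join S S')) (λ i → T-∨ˡ) (λ i → T-∨ˡ)

 missed-joinʳ : ∀ {α β K L K' L'} (S : Selection α β K L) (S' : Selection α β K' L') z → T (missed (join S S') z) → T (missed S' z)
 missed-joinʳ S S' = unhit-anti (selA S') (selB S') (selA (join S S')) (selB (join S S')) (λ i → T-∨ʳ {selA S i}) (λ i → T-∨ʳ {selB S i})

 -- A block of r consecutive elements of α and a residue class mod r of elements of β: over all r²
 -- choices each target z is represented once for every first summand in [x₀, x₀ + r²).
 module Round (r : ℕ) .{{_ : NonZero r}} (x₀ hi c H : ℕ) (α β : ℕ → Bool) (hi≤ : hi ≤ c * r)
  (holes : #< (r * r) (λ i → not (α (x₀ + i))) + #< hi (not ∘ β) ≤ H)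
  (lo len : ℕ) (above : x₀ + r * r ≤ lo) (below : lo + len ≤ x₀ + hi) where

  1≤r : 1 ≤ r
  1≤r = ℕ.>-nonZero⁻¹ r

  block class : ℕ → ℕ → Bool
  block k i = α i ∧ between (x₀ + k * r) r i
  class v y = β y ∧ (between v 1 (y % r) ∧ between 0 hi y)

  fail : ℕ → ℕ → ℕ → Bool
  fail k v = unhit (block k) (class v)

  choice : ℕ → ℕ → Selection α β r c
  choice k v = selection (block k) (class v) (λ i t → T-∧ˡ t) (λ i t → T-∧ˡ t)
   (λ n → ≤-trans (Σ<-mono n λ i _ → ⟨⟩-mono (T-∧ʳ {α i})) (#<-between (x₀ + k * r) r n))
   (λ n → begin
    #< n (class v) ≤⟨ Σ<-≤ ([_] ∘ class v) (m≤m+n n hi) ⟩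
    #< (n + hi) (class v) ≤⟨ Σ<-mono (n + hi) (λ y _ → bool³ (λ a b c → [ a ∧ (b ∧ c) ]) (λ a b c → [ c ] * [ b ]) (β y) (between v 1 (y % r)) (between 0 hi y)) ⟩
    Σ< (n + hi) (λ y → [ between 0 hi y ] * [ between v 1 (y % r) ]) ≡⟨ Σ<-between 0 hi (n + hi) _ (m≤n+m hi n) ⟩
    #< hi (λ y → between v 1 (y % r)) ≤⟨ Σ<-≤ (λ y → [ between v 1 (y % r) ]) hi≤ ⟩
    #< (c * r) (λ y → between v 1 (y % r)) ≤⟨ #<-residues r c v ⟩
    c ∎)
   where open ≤-Reasoning

  module _ (z : ℕ) (lo≤z : lo ≤ z) (z<hi : z < lo + len) where

   hole : ℕ → ℕ
   hole x = [ not (α x) ] + [ not (β (z ∸ x)) ]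

   x≤z : ∀ i → i < r * r → x₀ + i ≤ z
   x≤z i lt = (lin 5 x₀ i z r lo 0 (v0 :+ v1) v2 (hyp (1+ v1) (v3 :* v3) lt (hyp (v0 :+ v3 :* v3) v4 above (hyp v4 v2 lo≤z []))))

   inner : ∀ k t → k < r → t < r → k * r + t < r * r
   inner k t k<r t<r = (lin 3 k r t 0 (1+ (v0 :* v1 :+ v2)) (v1 :* v1) (hyp (1+ v2) v1 t<r (mul v1 (1+ v0) v1 k<r [])))

   -- If both `x` and `y = z - x` are present, the block through `x` and the class of `y` contain
   -- them and hit `z`; a failure therefore forces a hole.
   fail-at : ∀ k t → k < r → t < r → [ fail k ((z ∸ (x₀ + (k * r + t))) % r) z ] ≤ hole (x₀ + (k * r + t))
   fail-at k t k<r t<r = by (α x) refl (β y) refl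
    where
    x = x₀ + (k * r + t)
    y = z ∸ x
    x+y : x + y ≡ z
    x+y = +∸ (x≤z (k * r + t) (inner k t k<r t<r))
    y<hi : y < hi
    y<hi = (lin 9 y hi x₀ k r t z lo len 0 (1+ v0) v1 (eqn (v2 :+ (v3 :* v4 :+ v5) :+ v0) v6 x+y (hyp (1+ v6) (v7 :+ v8) z<hi (hyp (v7 :+ v8) (v2 :+ v1) below []))))
    by : ∀ a → α x ≡ a → ∀ b → β y ≡ b → [ fail k (y % r) z ] ≤ [ not a ] + [ not b ]
    by false _ _ _ = ≤-trans (⟨⟩≤1 (fail k (y % r) z)) (s≤s z≤n)
    by true _ false _ = ⟨⟩≤1 (fail k (y % r) z)
    by true αx true βy = ≡⇒≤ (¬T⇒⟨⟩ λ miss → T-not⁻ miss (subst (T ∘ sumOf (block k) (class (y % r))) x+y (sumOf-intro (block k) (class (y % r)) x y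
     (T-pair (T! αx) (subst (T ∘ between (x₀ + k * r) r) (+-assoc x₀ (k * r) t) (between-inside (x₀ + k * r) r t t<r)))
     (T-pair (T! βy) (T-pair (subst (T ∘ between (y % r) 1) (+0 (y % r)) (between-inside (y % r) 1 0 ≤-refl)) (between-inside 0 hi y y<hi))))))

   fails : Σ< r (λ k → Σ< r λ v → [ fail k v z ]) ≤ H
   fails = begin
    Σ< r (λ k → Σ< r λ v → [ fail k v z ]) ≤⟨ Σ<-mono r row ⟩
    Σ< r (λ k → Σ< r λ t → hole (x₀ + (k * r + t))) ≡⟨ Σ<-blocks r r (λ i → hole (x₀ + i)) ⟩
    Σ< (r * r) (λ i → hole (x₀ + i)) ≡⟨ Σ<-+ (r * r) (λ i → [ not (α (x₀ + i)) ]) (λ i → [ not (β (z ∸ (x₀ + i))) ]) ⟩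
    #< (r * r) (λ i → not (α (x₀ + i))) + #< (r * r) (λ i → not (β (z ∸ (x₀ + i)))) ≤⟨ +-monoʳ-≤ _ reversed ⟩
    #< (r * r) (λ i → not (α (x₀ + i))) + #< hi (not ∘ β) ≤⟨ holes ⟩
    H ∎
    where
    open ≤-Reasoning
    x₀≤z : x₀ ≤ z
    x₀≤z = (lin 4 x₀ z r lo 0 v0 v1 (hyp (v0 :+ v2 :* v2) v3 above (hyp v3 v1 lo≤z [])))
    deep : r * r ≤ suc (z ∸ x₀)
    deep = (lin 5 r (z ∸ x₀) x₀ lo z 0 (v0 :* v0) (1+ v1) (hyp (v2 :+ v0 :* v0) v3 above (hyp v3 v4 lo≤z (eqn⁻ (v2 :+ v1) v4 (+∸ x₀≤z) []))))
    reversed : #< (r * r) (λ i → not (β (z ∸ (x₀ + i)))) ≤ #< hi (not ∘ β)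
    reversed = ≤-trans (≡⇒≤ (trans (Σ<-cong (r * r) λ i _ → cong (λ t → [ not (β t) ]) (sym (∸-+-assoc z x₀ i))) (Σ<-countdown (r * r) (z ∸ x₀) (λ t → [ not (β t) ]) deep)))
     (Σ<-sub (suc (z ∸ x₀) ∸ r * r) (r * r) hi (λ t → [ not (β t) ])
      (lin 8 (suc (z ∸ x₀) ∸ r * r) r hi (z ∸ x₀) x₀ z lo len 0 (v0 :+ v1 :* v1) v2 (eqn (v1 :* v1 :+ v0) (1+ v3) (+∸ deep) (eqn (v4 :+ v3) v5 (+∸ x₀≤z) (hyp (1+ v5) (v6 :+ v7) z<hi (hyp (v6 :+ v7) (v4 :+ v2) below []))))))
    -- As `t` runs through the block, the residue of `z - x` runs once through all classes mod `r`;
    -- summing over `v` is summing over `t`.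
    row : ∀ k → k < r → Σ< r (λ v → [ fail k v z ]) ≤ Σ< r λ t → hole (x₀ + (k * r + t))
    row k k<r = ≤-trans (≡⇒≤ (trans (sym (trans (Σ<-countdown r (z ∸ (x₀ + k * r)) (λ y → [ fail k (y % r) z ]) far) (Σ<-cyclic r (suc (z ∸ (x₀ + k * r)) ∸ r) λ v → [ fail k v z ])))
      (Σ<-cong r λ t _ → cong (λ y → [ fail k (y % r) z ]) (trans (∸-+-assoc z (x₀ + k * r) t) (cong (z ∸_) (+-assoc x₀ (k * r) t))))))
     (Σ<-mono r λ t t<r → fail-at k t k<r t<r)
     where
     far : r ≤ suc (z ∸ (x₀ + k * r))
     far = (lin 6 r (z ∸ (x₀ + k * r)) z x₀ k lo 0 v0 (1+ v1) (hyp v2 (v3 :+ v4 :* v0 :+ v1) (m≤n+m∸n z (x₀ + k * r)) (hyp (v3 :+ v0 :* v0) v5 above (hyp v5 v2 lo≤z (mul v0 (1+ v4) v0 k<r [])))))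

  Reduced : (ℕ → Bool) → Set
  Reduced Z = ∃ λ (S : Selection α β r c) → #< len (λ i → Z i ∧ missed S (lo + i)) * (r * r) ≤ #< len Z * H

  Covered : Set
  Covered = ∃ λ (S : Selection α β (r + r) (c + c)) → #< len (λ i → missed S (lo + i)) * (r * r) * (r * r) ≤ len * (H * H)

  -- Among the `r * r` choices, one leaves at most the average share `H / (r * r)` of the targets in
  -- `Z`.
  round : ∀ Z → Reduced Z
  round Z = best (Σ<-average r (λ k → Σ< r (score k)) (#< len Z * H) 1≤r (begin
   Σ< r (λ k → Σ< r λ v → Σ< len λ i → [ Z i ∧ fail k v (lo + i) ]) ≡⟨ Σ<-cong r (λ k _ → Σ<-swap r len λ v i → [ Z i ∧ fail k v (lo + i) ]) ⟩
   Σ< r (λ k → Σ< len λ i → Σ< r λ v → [ Z i ∧ fail k v (lo + i) ]) ≡⟨ Σ<-swap r len (λ k i → Σ< r λ v → [ Z i ∧ fail k v (lo + i) ]) ⟩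
   Σ< len (λ i → Σ< r λ k → Σ< r λ v → [ Z i ∧ fail k v (lo + i) ]) ≤⟨ Σ<-mono len (λ i i<len → target (Z i) (lo + i) (m≤m+n lo i) (+-monoʳ-< lo i<len)) ⟩
   Σ< len (λ i → [ Z i ] * H) ≡⟨ Σ<-*ʳ len H ([_] ∘ Z) ⟩
   #< len Z * H ∎))
   where
   open ≤-Reasoning
   score : ℕ → ℕ → ℕ
   score k v = #< len λ i → Z i ∧ fail k v (lo + i)
   target : ∀ q z → lo ≤ z → z < lo + len → Σ< r (λ k → Σ< r λ v → [ q ∧ fail k v z ]) ≤ [ q ] * H
   target true z lo≤z z<hi = ≤-trans (fails z lo≤z z<hi) (m≤m+n H 0)
   target false z _ _ = ≡⇒≤ (trans (Σ<-cong r λ k _ → Σ<-zero) Σ<-zero)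
    where
    Σ<-zero : Σ< r (λ _ → 0) ≡ 0
    Σ<-zero = trans (Σ<-const r 0) (*0 r)
   best : (∃ λ k → k < r × Σ< r (score k) * r ≤ #< len Z * H) → Reduced Z
   best (k , _ , le) = pick (Σ<-average r (score k) _ 1≤r ≤-refl)
    where
    pick : (∃ λ v → v < r × score k v * r ≤ Σ< r (score k)) → Reduced Z
    pick (v , _ , le') = choice k v , ≤-trans (≡⇒≤ (sym (*-assoc (score k v) r r))) (≤-trans (*-monoˡ-≤ r le') le)

  -- The second round aims only at what the first one missed, which squares the share `H / (r * r)`.
  two-rounds : Covered
  two-rounds = from (round λ _ → true)
   where
   open ≤-Reasoning
   from : Reduced (λ _ → true) → Covered
   from (S₁ , le₁) = again (round λ i → missed S₁ (lo + i))
    where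
    again : Reduced (λ i → missed S₁ (lo + i)) → Covered
    again (S₂ , le₂) = join S₁ S₂ , (begin
     #< len (λ i → missed (join S₁ S₂) (lo + i)) * (r * r) * (r * r)
      ≤⟨ *-monoˡ-≤ (r * r) (*-monoˡ-≤ (r * r) (Σ<-mono len λ i _ → ⟨⟩-mono λ t → T-pair (missed-joinˡ S₁ S₂ (lo + i) t) (missed-joinʳ S₁ S₂ (lo + i) t))) ⟩
     #< len (λ i → missed S₁ (lo + i) ∧ missed S₂ (lo + i)) * (r * r) * (r * r) ≤⟨ *-monoˡ-≤ (r * r) le₂ ⟩
     #< len (λ i → missed S₁ (lo + i)) * H * (r * r)
      ≤⟨ (lin 5 (#< len (λ i → missed S₁ (lo + i))) H r len (#< len (λ _ → true)) 0 (v0 :* v1 :* (v2 :* v2)) (v3 :* (v1 :* v1)) (mul v1 (v0 :* (v2 :* v2)) (v4 :* v1) le₁ (mul (v1 :* v1) v4 v3 (#<≤ len (λ _ → true)) []))) ⟩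
     len * (H * H) ∎)

 weaken : ∀ {α β K L K' L'} → K ≤ K' → L ≤ L' → (S : Selection α β K L) → ∃ λ (S' : Selection α β K' L') → ∀ z → missed S' z ≡ missed S z
 weaken K≤ L≤ (selection A B a b #A #B) = selection A B a b (λ n → ≤-trans (#A n) K≤) (λ n → ≤-trans (#B n) L≤) , λ z → refl

 -- With h_j holes below 4^j, the round at scale 4^j leaves at most 3 h_{j+1}² / 4^j sums uncovered.
 -- The losses are summed by carrying the term 4 h_j² / 4^j along.
 module Prefix (α β : ℕ → Bool) (α-dense : ∀ y → #< y (not ∘ α) * 400 ≤ y) (β-dense : ∀ y → #< y (not ∘ β) * 400 ≤ y) where

  holes : ℕ → ℕ
  holes y = #< y (not ∘ α) + #< y (not ∘ β)

  Good : ℕ → ℕ → Set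
  Good r q = ∃ λ (S : Selection α β (r * 8) (r * 8)) → #< q (missed S) * q * 100 + holes q * holes q * 400 ≤ holes q * q * 16

  cover : ∀ j → Good (2 ℕ.^ j) (2 ℕ.^ j * 2 ℕ.^ j)
  -- At length 1 the density bounds leave no room for a hole, so 0 lies in both sets.
  cover zero = S , ≡⇒≤ (trans (cong₂ (λ u v → u * 1 * 100 + v * v * 400) (cong (0 +_) (¬T⇒⟨⟩ {missed S 0} λ t → T-not⁻ t (sumOf-intro start start 0 0 tt tt))) none) (sym (cong (λ t → t * 1 * 16) none)))
   where
   start : ℕ → Bool
   start = between 0 1
   first : ∀ (f : ℕ → Bool) → (∀ y → #< y (not ∘ f) * 400 ≤ y) → T (f 0)
   first f dense with f 0 | dense 1
   ... | true | _ = tt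
   ... | false | s≤s ()
   only : ∀ (f : ℕ → Bool) → T (f 0) → ∀ i → T (start i) → T (f i)
   only f f0 zero _ = f0
   only f f0 (suc i) ()
   S : Selection α β 8 8
   S = selection start start (only α (first α α-dense)) (only β (first β β-dense)) (λ n → ≤-trans (#<-between 0 1 n) ≤-dec) (λ n → ≤-trans (#<-between 0 1 n) ≤-dec)
   none : holes 1 ≡ 0
   none = n≤0⇒n≡0 (≮⇒≥ λ 0<h → (absurd (lin 2 (#< 1 (not ∘ α)) (#< 1 (not ∘ β)) 397 k1 k0 (hyp* 400 (1+ k0) (v0 :+ v1) 0<h (hyp (v0 :* & 400) k1 (α-dense 1) (hyp (v1 :* & 400) k1 (β-dense 1) []))))))
  cover (suc j) = extend (cover j)
   where
   r = 2 ℕ.^ j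
   q = r * r
   Q = 2 * r * (2 * r)
   instance
    r≢0 : NonZero r
    r≢0 = ℕ.>-nonZero (m^n>0 2 j)
   h h' : ℕ
   h = holes q
   h' = holes Q
   q≤Q : q ≤ Q
   q≤Q = (lin 1 r 0 (v0 :* v0) (k2 :* v0 :* (k2 :* v0)) [])
   H≤ : #< q (λ i → not (α (0 + i))) + #< Q (not ∘ β) ≤ h'
   H≤ = +-monoˡ-≤ _ (Σ<-≤ (λ i → [ not (α i) ]) q≤Q)
   h≤h' : h ≤ h'
   h≤h' = +-mono-≤ (Σ<-≤ (λ i → [ not (α i) ]) q≤Q) (Σ<-≤ (λ i → [ not (β i) ]) q≤Q)
   h'≤ : h' * 400 ≤ 2 * Q
   h'≤ = (lin 4 (holes Q) Q (#< Q (not ∘ α)) (#< Q (not ∘ β)) 0 (v0 :* & 400) (k2 :* v1) (eqn* 400 v0 (v2 :+ v3) refl (hyp (v2 :* & 400) v1 (α-dense Q) (hyp (v3 :* & 400) v1 (β-dense Q) []))))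
   -- The blocks fill `[0 , q)` and the classes `[0 , 4 q)`, so the targets are the new indices from
   -- `q` to `4 q`. Two rounds add `2 r` and `8 r` elements, which the growth of the budget from
   -- `8 r` to `16 r` absorbs.
   open Round r 0 Q (r * 4) h' α β (lin 1 r 0 (k2 :* v0 :* (k2 :* v0)) (v0 :* k4 :* v0) []) H≤ q (3 * q) ≤-refl (lin 1 r 0 (v0 :* v0 :+ k3 :* (v0 :* v0)) (k2 :* v0 :* (k2 :* v0)) []) using (two-rounds)
   extend : Good r q →
        Good (2 * r) Q
   extend (S₁ , le₁) = combine two-rounds
    where
    combine : (∃ λ (S : Selection α β (r + r) (r * 4 + r * 4)) → #< (3 * q) (λ i → missed S (q + i)) * (r * r) * (r * r) ≤ 3 * q * (h' * h')) →
         Good (2 * r) Q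
    combine (S₂ , le₂) = finish (weaken (lin 1 r 0 (v0 :* k8 :+ (v0 :+ v0)) (k2 :* v0 :* k8) []) (lin 1 r 0 (v0 :* k8 :+ (v0 :* k4 :+ v0 :* k4)) (k2 :* v0 :* k8) []) (join S₁ S₂))
     where
     F m F' d : ℕ
     F = #< q (missed S₁)
     m = #< (3 * q) λ i → missed S₂ (q + i)
     F' = #< Q (missed (join S₁ S₂))
     d = h' ∸ h
     h+d : h + d ≡ h'
     h+d = +∸ h≤h'
     loss : m * q ≤ 3 * (h' * h')
     loss = *-cancelʳ-≤ (m * q) (3 * (h' * h')) q {{m*n≢0 r r}} (lin 3 m q h' 0 (v0 :* v1 :* v1) (k3 :* (v2 :* v2) :* v1) (hyp (v0 :* v1 :* v1) (k3 :* v1 :* (v2 :* v2)) le₂ []))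
     F'≤ : F' ≤ F + m
     F'≤ = ≤-trans (≡⇒≤ (trans (cong (λ t → #< t (missed (join S₁ S₂))) (linEq 1 r (k2 :* v0 :* (k2 :* v0)) (v0 :* v0 :+ k3 :* (v0 :* v0)) 0 [] 0 [])) (Σ<-split q (3 * q) λ i → [ missed (join S₁ S₂) i ])))
      (+-mono-≤ (Σ<-mono q λ i _ → ⟨⟩-mono (missed-joinˡ S₁ S₂ i)) (Σ<-mono (3 * q) λ i _ → ⟨⟩-mono (missed-joinʳ S₁ S₂ (q + i))))
     bound : F' * Q * 100 + h' * h' * 400 ≤ h' * Q * 16
     bound = (lin 8 F' Q h' q F m h d 0 (v0 :* v1 :* & 100 :+ v2 :* v2 :* & 400) (v2 :* v1 :* & 16) (mul* 100 v0 v1 (k4 :* v3) (≡⇒≤ Q≡) (mul* 16 v2 (k4 :* v3) v1 (≡⇒≤ (sym Q≡)) (mul* 400 v3 v0 (v4 :+ v5) F'≤ (hyp* 400 (v5 :* v3) (k3 :* (v2 :* v2)) loss (hyp* 4 (v4 :* v3 :* & 100 :+ v6 :* v6 :* & 400) (v6 :* v3 :* &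
      16) le₁ (mul* 1600 v2 v2 (v6 :+ v7) (≡⇒≤ (sym h+d)) (mul* 1600 v6 v2 (v6 :+ v7) (≡⇒≤ (sym h+d)) (mul* 64 v3 (v6 :+ v7) v2 (≡⇒≤ h+d) (mul* 1600 v7 v6 v2 h≤h' (mul* 8 v7 (v2 :* & 400) (k2 :* v1) h'≤ (mul* 16 v7 v1 (k4 :* v3) (≡⇒≤ Q≡) []))))))))))))
      where
      Q≡ : Q ≡ 4 * q
      Q≡ = (linEq 1 r (k2 :* v0 :* (k2 :* v0)) (k4 :* (v0 :* v0)) 0 [] 0 [])
     finish : (∃ λ (S : Selection α β (2 * r * 8) (2 * r * 8)) → ∀ z → missed S z ≡ missed (join S₁ S₂) z) → Good (2 * r) Q
     finish (S , same) = S , subst (λ t → t * Q * 100 + h' * h' * 400 ≤ h' * Q * 16) (Σ<-cong Q λ z _ → cong [_] (sym (same z))) bound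

 quotient : ∀ n m → 1 ≤ m → ∃ λ q → q * m ≤ n × n < q * m + m
 quotient n m 1≤m = n / m , subst (n / m * m ≤_) (sym split) (m≤n+m _ _) , (lin 4 n (n / m) m (n % m) 0 (1+ v0) (v1 :* v2 :+ v2) (eqn v0 (v3 :+ v1 :* v2) split (hyp (1+ v3) v2 (m%n<n n m) [])))
  where
  instance
   m≢0 : NonZero m
   m≢0 = ℕ.>-nonZero 1≤m
  split : n ≡ n % m + n / m * m
  split = m≡m%n+[m/n]*n n m

 root : ∀ n → ∃ λ s → s * s ≤ n × n < (s + 1) * (s + 1)
 root n = from (greatest (λ s → s * s ℕ.≤? n) n z≤n)
  where
  from : (∃ λ s → s ≤ n × s * s ≤ n × (∀ t → s < t → t ≤ n → ¬ (t * t ≤ n))) → ∃ λ s → s * s ≤ n × n < (s + 1) * (s + 1)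
  from (s , s≤n , le , max) = s , le , by (s + 1 ℕ.≤? n)
   where
   by : Dec (s + 1 ≤ n) → n < (s + 1) * (s + 1)
   by (yes s<n) = ≰⇒> (max (s + 1) (≡⇒≤ (+-comm 1 s)) s<n)
   by (no s≮n) = (lin 2 n s 0 (1+ v0) ((v1 :+ k1) :* (v1 :+ k1)) (hyp (1+ v0) (v1 :+ k1) (≰⇒> s≮n) []))

 -- `k` is the number of cuts that shrink a set below the proportion `1 / h` when each cut keeps at
 -- most 3/4. Three more factors 4/3 give 64/27, more than the factor 2 that passing from `h` to
 -- `suc h` can require.
 exponent : ∀ h → ∃ λ k → h * 3 ℕ.^ k ≤ 4 ℕ.^ k
 exponent zero = 0 , z≤n
 exponent (suc h) = step (exponent h)
  where
  step : (∃ λ k → h * 3 ℕ.^ k ≤ 4 ℕ.^ k) → ∃ λ k → suc h * 3 ℕ.^ k ≤ 4 ℕ.^ k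
  step (k , le) = 3 + k , (lin 3 h (3 ℕ.^ k) (4 ℕ.^ k) 0 ((1+ v0) :* (k3 :* (k3 :* (k3 :* v1)))) (k4 :* (k4 :* (k4 :* v2))) (hyp* 27 (v0 :* v1) v2 le (hyp* 27 v1 v2 (^-monoˡ-≤ k (n≤1+n 3)) [])))

 power-of-two : ∀ m → ∃ λ j → m ≤ 2 ℕ.^ j × 2 ℕ.^ j ≤ 2 * m + 1
 power-of-two zero = 0 , z≤n , ≤-refl
 power-of-two (suc m) = step (power-of-two m)
  where
  step : (∃ λ j → m ≤ 2 ℕ.^ j × 2 ℕ.^ j ≤ 2 * m + 1) → ∃ λ j → suc m ≤ 2 ℕ.^ j × 2 ℕ.^ j ≤ 2 * suc m + 1
  step (j , lo , hi) = by (≤-<-connex (suc m) (2 ℕ.^ j))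
   where
   by : suc m ≤ 2 ℕ.^ j ⊎ 2 ℕ.^ j < suc m → ∃ λ j → suc m ≤ 2 ℕ.^ j × 2 ℕ.^ j ≤ 2 * suc m + 1
   by (inj₁ le) = j , le , (lin 2 (2 ℕ.^ j) m 0 v0 (k2 :* (1+ v1) :+ k1) (hyp v0 (k2 :* v1 :+ k1) hi []))
   by (inj₂ lt) = suc j , (lin 2 m (2 ℕ.^ j) 0 (1+ v0) (k2 :* v1) (hyp v0 v1 lo (hyp k1 v1 (m^n>0 2 j) []))) , (lin 2 (2 ℕ.^ j) m 0 (k2 :* v0) (k2 :* (1+ v1) :+ k1) (hyp* 2 (1+ v0) (1+ v1) lt []))

 -- All constants of the argument, given that 2 n + n / N ≤ p; τ is the ratio of n to the precision
 -- of the arc structure.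
 record Scales (N : ℕ) : Set where
  field
   W τ h k Z Y n₀ M C : ℕ
   W≡ : W ≡ N * 5
   τ≡ : τ ≡ W * 1000000000
   h≡ : h ≡ τ * 16000000
   k-large : h * 3 ℕ.^ k ≤ 4 ℕ.^ k
   Z≡ : Z ≡ h * h * 5 ℕ.^ k * 2000
   Y≡ : Y ≡ τ * Z * 8000000
   n₀≡ : n₀ ≡ τ * (Z + 3) * 1000000
   M≡ : M ≡ 100000000000
   C≡ : C ≡ M * 2400000 + W * 48000 + Y * Y * 12 + n₀ + 140

 abstract
  -- Abstract, so that these huge numerals are never evaluated; what follows relies only on the
  -- equations in the record.
  scales : ∀ N → Scales N
  scales N = from (exponent (N * 5 * 1000000000 * 16000000))
   where
   from : (∃ λ k → N * 5 * 1000000000 * 16000000 * 3 ℕ.^ k ≤ 4 ℕ.^ k) → Scales N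
   from (k , le) = record { k = k ; W≡ = refl ; τ≡ = refl ; h≡ = refl ; k-large = le ; Z≡ = refl ; Y≡ = refl ; n₀≡ = refl ; M≡ = refl ; C≡ = refl }

 -- The final size count: `C * s` for the first `2 n - 1` sums, `2 s + 2` lines and `suc v` selected
 -- elements, where `v ≤ c √n`. The excess goes into the constant in front of `s`.
 sizes : ∀ C s v → 1 ≤ s → C * s + (2 * s + 2) + suc v ≤ (C + 5) * s + v
 sizes C s v 1≤s = (lin 3 C s v 0 (v0 :* v1 :+ (k2 :* v1 :+ k2) :+ (1+ v2)) ((v0 :+ k5) :* v1 :+ v2) (hyp* 3 k1 v1 1≤s []))

open import Data.Nat using (ℕ)
open import Data.Nat.Primality using (Prime)

-- Arithmetic in the cyclic group of prime order.

module Residues (p : ℕ) (p-prime : Prime p) where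

 open import Data.Fin as Fin using (Fin; zero; suc; toℕ; fromℕ<)
 import Data.Fin.Properties as Finₚ
 open import Data.Nat as ℕ using (ℕ; zero; suc; _≥_; z≤n; s≤s; NonZero; _≤ᵇ_; _≡ᵇ_; _∸_; _/_; _%_; _⊓_; ∣_-_∣) renaming (_+_ to infixl 6 _+_; _*_ to infixl 7 _*_; _≤_ to infix 4 _≤_; _<_ to infix 4 _<_)
 import Algebra.Properties.CommutativeMonoid.Sum as CommutativeMonoidSum
 import Data.Fin.Permutation as Permutation
 import Data.Nat.GCD as GCD
 open GCD.Bézout using (+-; -+)
 open Counting

 instance
  p≢0 : NonZero p
  p≢0 = prime⇒nonZero p-prime

 G : Set
 G = Fin p

 infixl 6 _⊹_ _⊖_

 abstract
  residue : ℕ → G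
  residue m = m mod p

  _⊹_ : G → G → G
  x ⊹ y = residue (toℕ x + toℕ y)

  𝟘 : G
  𝟘 = residue 0

  ⊝_ : G → G
  ⊝ x = residue (p ∸ toℕ x)

 _⊖_ : G → G → G
 x ⊖ y = x ⊹ (⊝ y)

 toℕ<p : (x : G) → toℕ x < p
 toℕ<p = Finₚ.toℕ<n

 abstract
  toℕ-residue : ∀ m → toℕ (residue m) ≡ m % p
  toℕ-residue m = Finₚ.toℕ-fromℕ< (m%n<n m p)

  ⊹-residue : ∀ x y → x ⊹ y ≡ residue (toℕ x + toℕ y)
  ⊹-residue x y = refl

  𝟘-residue : 𝟘 ≡ residue 0
  𝟘-residue = refl

  residue-toℕ : ∀ x → residue (toℕ x) ≡ x
  residue-toℕ x = Finₚ.toℕ-injective (trans (toℕ-residue (toℕ x)) (m<n⇒m%n≡m (toℕ<p x)))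

  residue-cong : ∀ {m n} → m % p ≡ n % p → residue m ≡ residue n
  residue-cong {m} {n} eq = Finₚ.toℕ-injective (trans (toℕ-residue m) (trans eq (sym (toℕ-residue n))))

  residue-+ : ∀ m n → residue (m + n) ≡ residue m ⊹ residue n
  residue-+ m n = residue-cong (trans (%-distribˡ-+ m n p)
   (cong₂ (λ a b → (a + b) % p) (sym (toℕ-residue m)) (sym (toℕ-residue n))))

  ⊹-comm : ∀ x y → x ⊹ y ≡ y ⊹ x
  ⊹-comm x y = cong residue (+-comm (toℕ x) (toℕ y))

  ⊹-assoc : ∀ x y z → x ⊹ y ⊹ z ≡ x ⊹ (y ⊹ z)
  ⊹-assoc x y z = begin
   x ⊹ y ⊹ z ≡⟨ cong (x ⊹ y ⊹_) (residue-toℕ z) ⟨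
   x ⊹ y ⊹ residue (toℕ z) ≡⟨ residue-+ (toℕ x + toℕ y) (toℕ z) ⟨
   residue (toℕ x + toℕ y + toℕ z) ≡⟨ cong residue (+-assoc (toℕ x) (toℕ y) (toℕ z)) ⟩
   residue (toℕ x + (toℕ y + toℕ z)) ≡⟨ residue-+ (toℕ x) (toℕ y + toℕ z) ⟩
   residue (toℕ x) ⊹ (y ⊹ z) ≡⟨ cong (_⊹ (y ⊹ z)) (residue-toℕ x) ⟩
   x ⊹ (y ⊹ z) ∎
   where open ≡-Reasoning

  ⊹-identityˡ : ∀ x → 𝟘 ⊹ x ≡ x
  ⊹-identityˡ x = begin
   𝟘 ⊹ x ≡⟨ cong (𝟘 ⊹_) (residue-toℕ x) ⟨
   𝟘 ⊹ residue (toℕ x) ≡⟨ residue-+ 0 (toℕ x) ⟨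
   residue (toℕ x) ≡⟨ residue-toℕ x ⟩
   x ∎
   where open ≡-Reasoning

  residue-p : residue p ≡ 𝟘
  residue-p = residue-cong (trans (n%n≡0 p) (sym (m<n⇒m%n≡m (ℕ.>-nonZero⁻¹ p))))

  ⊹-inverseʳ : ∀ x → x ⊖ x ≡ 𝟘
  ⊹-inverseʳ x = begin
   x ⊖ x ≡⟨ cong (_⊖ x) (residue-toℕ x) ⟨
   residue (toℕ x) ⊹ residue (p ∸ toℕ x) ≡⟨ residue-+ (toℕ x) (p ∸ toℕ x) ⟨
   residue (toℕ x + (p ∸ toℕ x)) ≡⟨ cong residue (m+[n∸m]≡n (<⇒≤ (toℕ<p x))) ⟩
   residue p ≡⟨ residue-p ⟩
   𝟘 ∎
   where open ≡-Reasoning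

 ⊹-identityʳ : ∀ x → x ⊹ 𝟘 ≡ x
 ⊹-identityʳ x = trans (⊹-comm x 𝟘) (⊹-identityˡ x)

 infixr 8 _•_
 _•_ : ℕ → G → G
 zero • x = 𝟘
 suc n • x = x ⊹ n • x

 •-+ : ∀ m n x → (m + n) • x ≡ m • x ⊹ n • x
 •-+ zero n x = sym (⊹-identityˡ _)
 •-+ (suc m) n x = trans (cong (x ⊹_) (•-+ m n x)) (sym (⊹-assoc x _ _))

 ⊹-exchange : ∀ a b c d → (a ⊹ b) ⊹ (c ⊹ d) ≡ (a ⊹ c) ⊹ (b ⊹ d)
 ⊹-exchange a b c d = begin
  (a ⊹ b) ⊹ (c ⊹ d) ≡⟨ ⊹-assoc a b (c ⊹ d) ⟩
  a ⊹ (b ⊹ (c ⊹ d)) ≡⟨ cong (a ⊹_) (⊹-assoc b c d) ⟨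
  a ⊹ (b ⊹ c ⊹ d) ≡⟨ cong (λ t → a ⊹ (t ⊹ d)) (⊹-comm b c) ⟩
  a ⊹ (c ⊹ b ⊹ d) ≡⟨ cong (a ⊹_) (⊹-assoc c b d) ⟩
  a ⊹ (c ⊹ (b ⊹ d)) ≡⟨ ⊹-assoc a c (b ⊹ d) ⟨
  (a ⊹ c) ⊹ (b ⊹ d) ∎
  where open ≡-Reasoning

 ⊹-cancelʳ : ∀ {x y} z → x ⊹ z ≡ y ⊹ z → x ≡ y
 ⊹-cancelʳ {x} {y} z eq = trans (sym (undo x)) (trans (cong (_⊖ z) eq) (undo y))
  where
  undo : ∀ t → t ⊹ z ⊖ z ≡ t
  undo t = trans (⊹-assoc t z _) (trans (cong (t ⊹_) (⊹-inverseʳ z)) (⊹-identityʳ t))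

 -- Identities in abelian groups, by comparing integer coefficients; each coefficient is kept as
 -- a difference of natural numbers.

 data GroupExpr : Set where
  gvar : ℕ → GroupExpr
  gnil : GroupExpr
  _:+_ _:-_ : GroupExpr → GroupExpr → GroupExpr
  :~_ : GroupExpr → GroupExpr

 infixl 6 _:-_
 infix 8 :~_

 g0 g1 g2 g3 : GroupExpr
 g0 = gvar 0
 g1 = gvar 1
 g2 = gvar 2
 g3 = gvar 3

 _!_ : List G → ℕ → G
 [] ! _ = 𝟘
 (x ∷ ρ) ! zero = x
 (x ∷ ρ) ! suc i = ρ ! i

 evalᵍ : List G → GroupExpr → G
 evalᵍ ρ (gvar i) = ρ ! i
 evalᵍ ρ gnil = 𝟘
 evalᵍ ρ (a :+ b) = evalᵍ ρ a ⊹ evalᵍ ρ b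
 evalᵍ ρ (a :- b) = evalᵍ ρ a ⊖ evalᵍ ρ b
 evalᵍ ρ (:~ a) = ⊝ evalᵍ ρ a

 combine : List ℕ → List G → G
 combine [] ρ = 𝟘
 combine (n ∷ ns) [] = 𝟘
 combine (n ∷ ns) (x ∷ ρ) = n • x ⊹ combine ns ρ

 _+ˡ_ : List ℕ → List ℕ → List ℕ
 [] +ˡ ns = ns
 (m ∷ ms) +ˡ [] = m ∷ ms
 (m ∷ ms) +ˡ (n ∷ ns) = m + n ∷ ms +ˡ ns

 unit : ℕ → List ℕ
 unit zero = 1 ∷ []
 unit (suc i) = 0 ∷ unit i

 positive negative : GroupExpr → List ℕ
 positive (gvar i) = unit i
 positive gnil = []
 positive (a :+ b) = positive a +ˡ positive b
 positive (a :- b) = positive a +ˡ negative b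
 positive (:~ a) = negative a
 negative (gvar i) = []
 negative gnil = []
 negative (a :+ b) = negative a +ˡ negative b
 negative (a :- b) = negative a +ˡ positive b
 negative (:~ a) = positive a

 combine-+ : ∀ ms ns ρ → combine (ms +ˡ ns) ρ ≡ combine ms ρ ⊹ combine ns ρ
 combine-+ [] ns ρ = sym (⊹-identityˡ _)
 combine-+ (m ∷ ms) [] ρ = sym (⊹-identityʳ _)
 combine-+ (m ∷ ms) (n ∷ ns) [] = sym (⊹-identityʳ _)
 combine-+ (m ∷ ms) (n ∷ ns) (x ∷ ρ) =
  trans (cong₂ _⊹_ (•-+ m n x) (combine-+ ms ns ρ)) (⊹-exchange (m • x) (n • x) _ _)

 combine-unit : ∀ i ρ → combine (unit i) ρ ≡ ρ ! i
 combine-unit zero [] = refl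
 combine-unit (suc i) [] = refl
 combine-unit zero (x ∷ ρ) = trans (⊹-identityʳ _) (⊹-identityʳ x)
 combine-unit (suc i) (x ∷ ρ) = trans (⊹-identityˡ _) (combine-unit i ρ)

 merge : ∀ ρ ms ps ns qs {x y} → x ⊹ combine ms ρ ≡ combine ps ρ → y ⊹ combine ns ρ ≡ combine qs ρ →
     x ⊹ y ⊹ combine (ms +ˡ ns) ρ ≡ combine (ps +ˡ qs) ρ
 merge ρ ms ps ns qs {x} {y} eq eq' = begin
  x ⊹ y ⊹ combine (ms +ˡ ns) ρ ≡⟨ cong (x ⊹ y ⊹_) (combine-+ ms ns ρ) ⟩
  x ⊹ y ⊹ (combine ms ρ ⊹ combine ns ρ) ≡⟨ ⊹-exchange x y _ _ ⟩
  (x ⊹ combine ms ρ) ⊹ (y ⊹ combine ns ρ) ≡⟨ cong₂ _⊹_ eq eq' ⟩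
  combine ps ρ ⊹ combine qs ρ ≡⟨ combine-+ ps qs ρ ⟨
  combine (ps +ˡ qs) ρ ∎
  where open ≡-Reasoning

 opposite : ∀ ρ ms ps {x} → x ⊹ combine ms ρ ≡ combine ps ρ → ⊝ x ⊹ combine ps ρ ≡ combine ms ρ
 opposite ρ ms ps {x} eq = begin
  ⊝ x ⊹ combine ps ρ ≡⟨ cong (⊝ x ⊹_) eq ⟨
  ⊝ x ⊹ (x ⊹ combine ms ρ) ≡⟨ ⊹-assoc (⊝ x) x _ ⟨
  ⊝ x ⊹ x ⊹ combine ms ρ ≡⟨ cong (_⊹ combine ms ρ) (trans (⊹-comm _ x) (⊹-inverseʳ x)) ⟩
  𝟘 ⊹ combine ms ρ ≡⟨ ⊹-identityˡ _ ⟩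
  combine ms ρ ∎
  where open ≡-Reasoning

 signs-correct : ∀ ρ e → evalᵍ ρ e ⊹ combine (negative e) ρ ≡ combine (positive e) ρ
 signs-correct ρ (gvar i) = trans (⊹-identityʳ _) (sym (combine-unit i ρ))
 signs-correct ρ gnil = ⊹-identityʳ 𝟘
 signs-correct ρ (a :+ b) =
  merge ρ (negative a) (positive a) (negative b) (positive b) (signs-correct ρ a) (signs-correct ρ b)
 signs-correct ρ (:~ a) = opposite ρ (negative a) (positive a) (signs-correct ρ a)
 signs-correct ρ (a :- b) =
  merge ρ (negative a) (positive a) (positive b) (negative b) (signs-correct ρ a)
   (opposite ρ (negative b) (positive b) (signs-correct ρ b))

 _==ˡ_ : List ℕ → List ℕ → Bool
 [] ==ˡ [] = true
 [] ==ˡ (n ∷ ns) = (0 ≡ᵇ n) ∧ ([] ==ˡ ns)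
 (m ∷ ms) ==ˡ [] = (m ≡ᵇ 0) ∧ (ms ==ˡ [])
 (m ∷ ms) ==ˡ (n ∷ ns) = (m ≡ᵇ n) ∧ (ms ==ˡ ns)

 ==ˡ-sound : ∀ ms ns ρ → T (ms ==ˡ ns) → combine ms ρ ≡ combine ns ρ
 ==ˡ-sound [] [] ρ _ = refl
 ==ˡ-sound [] (n ∷ ns) [] _ = refl
 ==ˡ-sound [] (zero ∷ ns) (x ∷ ρ) ok = trans (==ˡ-sound [] ns ρ ok) (sym (⊹-identityˡ _))
 ==ˡ-sound (m ∷ ms) [] [] _ = refl
 ==ˡ-sound (zero ∷ ms) [] (x ∷ ρ) ok = trans (⊹-identityˡ _) (==ˡ-sound ms [] ρ ok)
 ==ˡ-sound (m ∷ ms) (n ∷ ns) [] _ = refl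
 ==ˡ-sound (m ∷ ms) (n ∷ ns) (x ∷ ρ) ok =
  cong₂ (λ c r → c • x ⊹ r) (≡ᵇ⇒≡ m n (T-∧ˡ ok)) (==ˡ-sound ms ns ρ (T-∧ʳ {m ≡ᵇ n} ok))

 normalised : ∀ ρ a b → {T ((positive a +ˡ negative b) ==ˡ (positive b +ˡ negative a))} →
     evalᵍ ρ a ≡ evalᵍ ρ b
 normalised ρ a b {ok} = ⊹-cancelʳ (combine (negative a +ˡ negative b) ρ) (begin
  evalᵍ ρ a ⊹ combine (negative a +ˡ negative b) ρ
   ≡⟨ regroup (evalᵍ ρ a) (negative a) (negative b) {positive a} (signs-correct ρ a) ⟩
  combine (positive a +ˡ negative b) ρ
   ≡⟨ ==ˡ-sound (positive a +ˡ negative b) (positive b +ˡ negative a) ρ ok ⟩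
  combine (positive b +ˡ negative a) ρ
   ≡⟨ regroup (evalᵍ ρ b) (negative b) (negative a) {positive b} (signs-correct ρ b) ⟨
  evalᵍ ρ b ⊹ combine (negative b +ˡ negative a) ρ
   ≡⟨ cong (evalᵍ ρ b ⊹_) (trans (combine-+ (negative b) (negative a) ρ)
      (trans (⊹-comm _ _) (sym (combine-+ (negative a) (negative b) ρ)))) ⟩
  evalᵍ ρ b ⊹ combine (negative a +ˡ negative b) ρ ∎)
  where
  open ≡-Reasoning
  regroup : ∀ x ms ns {ps} → x ⊹ combine ms ρ ≡ combine ps ρ →
       x ⊹ combine (ms +ˡ ns) ρ ≡ combine (ps +ˡ ns) ρ
  regroup x ms ns {ps} eq = trans (cong (x ⊹_) (combine-+ ms ns ρ))
   (trans (sym (⊹-assoc x _ _)) (trans (cong (_⊹ combine ns ρ) eq) (sym (combine-+ ps ns ρ))))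

 abstract
  group : ∀ n → ForAll n λ ρ → ∀ a b → {T ((positive a +ˡ negative b) ==ˡ (positive b +ˡ negative a))} →
      evalᵍ ρ a ≡ evalᵍ ρ b
  group n = forAll n λ ρ a b {ok} → normalised ρ a b {ok}

 •-distrib-⊹ : ∀ n x y → n • (x ⊹ y) ≡ n • x ⊹ n • y
 •-distrib-⊹ zero x y = sym (⊹-identityʳ 𝟘)
 •-distrib-⊹ (suc n) x y = trans (cong (x ⊹ y ⊹_) (•-distrib-⊹ n x y)) (⊹-exchange x y _ _)

 •-⊝ : ∀ n x → n • (⊝ x) ≡ ⊝ (n • x)
 •-⊝ zero x = (group 0 gnil (:~ gnil))
 •-⊝ (suc n) x = trans (cong (⊝ x ⊹_) (•-⊝ n x)) (group 2 x (n • x) (:~ g0 :+ :~ g1) (:~ (g0 :+ g1)))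

 •-residue : ∀ n x → n • x ≡ residue (n * toℕ x)
 •-residue zero x = 𝟘-residue
 •-residue (suc n) x = trans (cong₂ _⊹_ (sym (residue-toℕ x)) (•-residue n x)) (sym (residue-+ (toℕ x) _))

 •-assoc : ∀ m n x → m • n • x ≡ (m * n) • x
 •-assoc zero n x = refl
 •-assoc (suc m) n x = trans (cong (n • x ⊹_) (•-assoc m n x)) (sym (•-+ n (m * n) x))

 abstract
  inverse : ∀ d → d ≢ 𝟘 → ∃ λ u → u • d ≡ residue 1
  inverse d d≢0 with coprime-Bézout (prime⇒coprime p-prime {{ℕ.≢-nonZero toℕd≢0}} (toℕ<p d))
   where
   toℕd≢0 : toℕ d ≢ 0
   toℕd≢0 eq = d≢0 (trans (sym (residue-toℕ d)) (trans (cong residue eq) (sym 𝟘-residue)))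
  -- Here `1 + y * d` is a multiple of `p`: `y` inverts `d` up to sign, and `p - 1` stands for -1.
  ... | +- x y eq = (p ∸ 1) * y , (begin
   ((p ∸ 1) * y) • d ≡⟨ •-residue ((p ∸ 1) * y) d ⟩
   residue ((p ∸ 1) * y * toℕ d) ≡⟨ residue-cong (mod-eq) ⟩
   residue 1 ∎)
   where
   open ≡-Reasoning
   q : ℕ
   q = p ∸ 1
   p≡ : p ≡ suc q
   p≡ = sym (m+[n∸m]≡n (ℕ.>-nonZero⁻¹ p))
   yd : ℕ
   yd = y * toℕ d
   shift : q * y * toℕ d + x * p ≡ 1 + yd * p
   shift = (linEq 6 q y (toℕ d) x p yd (v0 :* v1 :* v2 :+ v3 :* v4) (1+ (v5 :* v4)) 0 (eqn⁻ (1+ v5) (v3 :* v4) eq (mul v5 (1+ v0) v4 (≡⇒≤ (sym p≡)) (eqn (v0 :* v1 :* v2) (v0 :* v5) (*-assoc q y (toℕ d)) []))) 0 (eqn (1+ v5) (v3 :* v4) eq (mul v5 v4 (1+ v0) (≡⇒≤ p≡) (eqn⁻ (v0 :* v1 :* v2) (v0 :* v5) (*-assoc q y (toℕ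
    d)) []))))
   mod-eq : (q * y * toℕ d) % p ≡ 1 % p
   mod-eq = trans (sym ([m+kn]%n≡m%n (q * y * toℕ d) x p)) (trans (cong (_% p) shift) ([m+kn]%n≡m%n 1 yd p))
  ... | -+ x y eq = y , (begin
   y • d ≡⟨ •-residue y d ⟩
   residue (y * toℕ d) ≡⟨ cong residue eq ⟨
   residue (1 + x * p) ≡⟨ residue-cong ([m+kn]%n≡m%n 1 x p) ⟩
   residue 1 ∎)
   where open ≡-Reasoning

 residue-• : ∀ n → n • residue 1 ≡ residue n
 residue-• zero = 𝟘-residue
 residue-• (suc n) = trans (cong (residue 1 ⊹_) (residue-• n)) (sym (residue-+ 1 n))

 generates : ∀ d → d ≢ 𝟘 → ∀ x → ∃ λ k → k • d ≡ x
 generates d d≢0 x with inverse d d≢0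
 ... | u , ud≡1 = toℕ x * u , (begin
  (toℕ x * u) • d ≡⟨ •-assoc (toℕ x) u d ⟨
  toℕ x • u • d ≡⟨ cong (toℕ x •_) ud≡1 ⟩
  toℕ x • residue 1 ≡⟨ residue-• (toℕ x) ⟩
  residue (toℕ x) ≡⟨ residue-toℕ x ⟩
  x ∎)
  where open ≡-Reasoning

 -- Primality enters as the absence of proper subgroups: repeated translation by a nonzero `d`
 -- reaches everything.
 closed⇒full : ∀ (S : G → Set) d → d ≢ 𝟘 → (∀ x → S x → S (x ⊹ d)) → ∀ x → S x → ∀ y → S y
 closed⇒full S d d≢0 closed x Sx y with generates d d≢0 (y ⊖ x)
 ... | k , kd = subst S (trans (cong (x ⊹_) kd) (group 2 x y (g0 :+ (g1 :- g0)) g1)) (go k)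
  where
  go : ∀ k → S (x ⊹ k • d)
  go zero = subst S (sym (⊹-identityʳ x)) Sx
  go (suc k) = subst S (group 3 x (k • d) d (g0 :+ g1 :+ g2) (g0 :+ (g2 :+ g1))) (closed _ (go k))

 _≟ᴳ_ : (x y : G) → Dec (x ≡ y)
 _≟ᴳ_ = Finₚ._≟_

 Σ-shift : ∀ d (f : G → ℕ) → Σ (λ x → f (x ⊹ d)) ≡ Σ f
 Σ-shift d = Σ-bij (_⊹ d) (_⊖ d) (λ y → (group 2 y d (g0 :- g1 :+ g1) g0)) (λ x → (group 2 x d (g0 :+ g1 :- g1) g0))

 Σ-unshift : ∀ d (f : G → ℕ) → Σ (λ x → f (x ⊖ d)) ≡ Σ f
 Σ-unshift d = Σ-shift (⊝ d)

 Σ-reflect : ∀ d (f : G → ℕ) → Σ (λ x → f (d ⊖ x)) ≡ Σ f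
 Σ-reflect d = Σ-bij (d ⊖_) (d ⊖_) (λ y → (group 2 d y (g0 :- (g0 :- g1)) g1)) (λ x → (group 2 d x (g0 :- (g0 :- g1)) g1))

 Σ-neg : ∀ (f : G → ℕ) → Σ (λ x → f (⊝ x)) ≡ Σ f
 Σ-neg = Σ-bij ⊝_ ⊝_ (λ y → (group 1 y (:~ :~ g0) g0)) (λ x → (group 1 x (:~ :~ g0) g0))

 δ : ∀ {n} → Fin n → Fin n → Bool
 δ x y = does (x Finₚ.≟ y)

 δ-sound : ∀ {n} {x y : Fin n} → T (δ x y) → x ≡ y
 δ-sound {x = x} {y} t with x Finₚ.≟ y
 ... | yes eq = eq

 δ-refl : ∀ {n} (x : Fin n) → T (δ x x)
 δ-refl x with x Finₚ.≟ x
 ... | yes _ = tt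
 ... | no ≢ = ⊥-elim (≢ refl)

 δ-suc : ∀ {n} (x y : Fin n) → [ δ (suc x) (suc y) ] ≡ [ δ x y ]
 δ-suc x y with x Finₚ.≟ y
 ... | yes _ = refl
 ... | no _ = refl

 Σ-δ : ∀ {n} (f : Fin n → ℕ) x → Σ (λ y → [ δ y x ] * f y) ≡ f x
 Σ-δ {suc n} f zero = trans (Σ-suc (λ y → [ δ y zero ] * f y))
  (trans (cong₂ _+_ (+0 (f zero)) (Σ-zero n)) (+0 (f zero)))
 Σ-δ {suc n} f (suc x) = trans (Σ-suc (λ y → [ δ y (suc x) ] * f y))
  (trans (Σ-cong λ y → cong (_* f (suc y)) (δ-suc y x)) (Σ-δ (f ∘ suc) x))

 #-δ : ∀ {n} (x : Fin n) → # (λ y → δ y x) ≡ 1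
 #-δ x = trans (Σ-cong λ y → sym (*1 [ δ y x ])) (Σ-δ (λ _ → 1) x)

 two-elements : ∀ {n} (S : Fin n → Bool) → 2 ≤ # S → ∃ λ x → ∃ λ y → x ≢ y × T (S x) × T (S y)
 two-elements S 2≤ with Σ-pos⇒∃ S (≤-trans (n≤1+n 1) 2≤)
 ... | x , Sx with Σ-pos⇒∃ (λ y → S y ∧ not (δ y x)) (lin 3 (# (λ y → S y ∧ not (δ y x))) (# S) (# (λ y → δ y x)) 0 k1 v0 (hyp k2 v1 2≤ (hyp v1 (v0 :+ v2) (Σ-≤ (([_] ∘ S) ∷ []) ((λ y → [ S y ∧ not (δ y x) ]) ∷ (λ y → [ δ y x ]) ∷ []) (λ y → bool² (λ a b → [ a ]) (λ a b → [ a ∧ not b ] + [ b ]) (S y) (δ y x))) (eqn v2 k1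
  (#-δ x) []))))
 ... | y , Sy = x , y , (λ { refl → T-not⁻ (T-∧ʳ {S x} Sy) (δ-refl x) }) , Sx , T-∧ˡ Sy

 ∧-full⇒⊆ : ∀ {n} (P Q : Fin n → Bool) → # Q ≤ # (λ x → P x ∧ Q x) → ∀ x → T (Q x) → T (P x)
 ∧-full⇒⊆ P Q le x Qx with P x in eq
 ... | true = tt
 ... | false = (absurd (lin 4 (# (λ x → P x ∧ Q x)) (# (λ y → not (P y) ∧ Q y)) (# Q) ([ not (P x) ∧ Q x ]) 0 k1 k0 (hyp (v0 :+ v1) v2 (Σ-≤ ((λ y → [ P y ∧ Q y ]) ∷ (λ y → [ not (P y) ∧ Q y ]) ∷ []) (([_] ∘ Q) ∷ []) (λ y → bool² (λ a b → [ a ∧ b ] + [ not a ∧ b ]) (λ a b → [ b ]) (P y) (Q y))) (hyp v2 v0 le (hyp v3 v1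
  (term≤Σ (λ y → [ not (P y) ∧ Q y ]) x) (eqn⁻ v3 k1 missing []))))))
  where
  missing : [ not (P x) ∧ Q x ] ≡ 1
  missing = T⇒⟨⟩ (T-pair (subst (T ∘ not) (sym eq) tt) Qx)

 -- Representation counts and Pollard's theorem.

 rep : (P Q : G → Bool) → G → ℕ
 rep P Q z = # λ x → P x ∧ Q (z ⊖ x)

 Σ-rep : ∀ P Q → Σ (rep P Q) ≡ # P * # Q
 Σ-rep P Q = begin
  Σ (λ z → Σ λ x → [ P x ∧ Q (z ⊖ x) ]) ≡⟨ Σ-swap (λ z x → [ P x ∧ Q (z ⊖ x) ]) ⟩
  Σ (λ x → Σ λ z → [ P x ∧ Q (z ⊖ x) ]) ≡⟨ Σ-cong (λ x → trans (Σ-cong λ z → ⟨⟩-∧ (P x) _)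
                          (trans (Σ-* [ P x ] _) (cong ([ P x ] *_) (Σ-unshift x ([_] ∘ Q))))) ⟩
  Σ (λ x → [ P x ] * # Q) ≡⟨ Σ-*ʳ (# Q) ([_] ∘ P) ⟩
  # P * # Q ∎
  where open ≡-Reasoning

 rep≤right : ∀ P Q z → rep P Q z ≤ # Q
 rep≤right P Q z = ≤-trans (Σ-mono λ x → bool² (λ a b → [ a ∧ b ]) (λ a b → [ b ]) (P x) (Q (z ⊖ x)))
  (≡⇒≤ (Σ-reflect z ([_] ∘ Q)))

 -- The e-transform splits every representation count into those of the union with the
 -- intersection and of the two differences.
 rep-transform : ∀ P Q z →
  rep (λ x → P x ∨ Q x) (λ x → P x ∧ Q x) z + rep (λ x → P x ∧ not (Q x)) (λ x → Q x ∧ not (P x)) z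
   ≤ rep P Q z
 rep-transform P Q z = (lin 6 UI PQ R (Σ (λ x → [ U x ∧ I (z ⊖ x) ] + [ U (z ⊖ x) ∧ I x ])) (Σ (λ x → [ P' x ∧ Q' (z ⊖ x) ] + [ P' (z ⊖ x) ∧ Q' x ])) (Σ (λ x → [ P x ∧ Q (z ⊖ x) ] + [ P (z ⊖ x) ∧ Q x ])) 1 (v0 :+ v1) v2 (eqn (v0 :+ v0) v3 (double U I) (eqn (v1 :+ v1) v4 (double P' Q') (eqn⁻ (v2 :+ v2) v5 (double P Q)
  (hyp (v3 :+ v4) v5 pointwise [])))))
  where
  U I P' Q' : G → Bool
  U x = P x ∨ Q x
  I x = P x ∧ Q x
  P' x = P x ∧ not (Q x)
  Q' x = Q x ∧ not (P x)
  UI = rep U I z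
  PQ = rep P' Q' z
  R = rep P Q z
  -- The doubled count is symmetric under `x ↦ z - x`, and in this symmetric form the inequality
  -- holds term by term.
  double : ∀ S V → rep S V z + rep S V z ≡ Σ (λ x → [ S x ∧ V (z ⊖ x) ] + [ S (z ⊖ x) ∧ V x ])
  double S V = trans (cong (rep S V z +_) (sym (trans
    (Σ-cong (λ x → cong (λ y → [ S (z ⊖ x) ∧ V y ]) (group 2 x z g0 (g1 :- (g1 :- g0)))))
    (Σ-reflect z (λ x → [ S x ∧ V (z ⊖ x) ])))))
   (sym (Σ-+ (λ x → [ S x ∧ V (z ⊖ x) ]) (λ x → [ S (z ⊖ x) ∧ V x ])))
  pointwise : Σ (λ x → [ U x ∧ I (z ⊖ x) ] + [ U (z ⊖ x) ∧ I x ]) +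
        Σ (λ x → [ P' x ∧ Q' (z ⊖ x) ] + [ P' (z ⊖ x) ∧ Q' x ]) ≤
        Σ (λ x → [ P x ∧ Q (z ⊖ x) ] + [ P (z ⊖ x) ∧ Q x ])
  pointwise = Σ-≤ ((λ x → [ U x ∧ I (z ⊖ x) ] + [ U (z ⊖ x) ∧ I x ]) ∷
           (λ x → [ P' x ∧ Q' (z ⊖ x) ] + [ P' (z ⊖ x) ∧ Q' x ]) ∷ [])
          ((λ x → [ P x ∧ Q (z ⊖ x) ] + [ P (z ⊖ x) ∧ Q x ]) ∷ [])
   λ x → bool⁴ (λ a b c d → [ (a ∨ b) ∧ (c ∧ d) ] + [ (c ∨ d) ∧ (a ∧ b) ] +
           ([ (a ∧ not b) ∧ (d ∧ not c) ] + [ (c ∧ not d) ∧ (b ∧ not a) ]))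
         (λ a b c d → [ a ∧ d ] + [ c ∧ b ]) (P x) (Q x) (P (z ⊖ x)) (Q (z ⊖ x))

 common : (P Q : G → Bool) → G → ℕ
 common P Q e = # λ x → P x ∧ Q (x ⊖ e)

 -- Otherwise `P` contains every translate of `Q` that it meets. It is then closed under the
 -- difference of two elements of `Q`, hence the whole group, against the bound on the sizes.
 partial-common : ∀ P Q t → 2 ≤ # Q → 1 ≤ # P → t < # Q → # P + # Q ≤ p + t →
          ∃ λ e → 1 ≤ common P Q e × common P Q e < # Q
 partial-common P Q t 2≤Q 1≤P t<Q bound
  with Finₚ.any? (λ e → (1 ℕ.≤? common P Q e) ×-dec (common P Q e ℕ.<? # Q))
 ... | yes found = found
 ... | no none = ⊥-elim (<⇒≱ t<Q (lin 4 (# Q) t (# P) p 0 v0 v1 (hyp (v2 :+ v0) (v3 :+ v1) bound (hyp v3 v2 (≡⇒≤ (sym (trans (Σ-cong λ x → T⇒⟨⟩ (full x)) (trans (Σ-const p 1) (*1 p))))) []))))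
  where
  full : ∀ y → T (P y)
  full y with two-elements Q 2≤Q | Σ-pos⇒∃ P 1≤P
  ... | q , q' , q≢q' , Qq , Qq' | x , Px = closed⇒full (λ x → T (P x)) (q' ⊖ q)
   (λ d≡0 → q≢q' (trans (sym (⊹-identityˡ q)) (trans (cong (_⊹ q) (sym d≡0)) (group 2 q' q (g0 :- g1 :+ g1) g0))))
   step x Px y
   where
   step : ∀ x → T (P x) → T (P (x ⊹ (q' ⊖ q)))
   step x Px = ∧-full⇒⊆ P (λ y → Q (y ⊖ (x ⊖ q)))
    (subst (_≤ common P Q (x ⊖ q)) (sym (Σ-unshift (x ⊖ q) ([_] ∘ Q)))
     (≮⇒≥ λ lt → none (x ⊖ q ,
      ≤-trans (≡⇒≤ (sym (T⇒⟨⟩ (T-pair Px (subst (T ∘ Q) (group 2 q x g0 (g1 :- (g1 :- g0))) Qq)))))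
       (term≤Σ (λ y → [ P y ∧ Q (y ⊖ (x ⊖ q)) ]) x) , lt)))
    (x ⊹ (q' ⊖ q)) (subst (T ∘ Q) (group 3 q' x q g0 (g1 :+ (g0 :- g2) :- (g1 :- g2))) Qq')

 -- Pollard's theorem, by induction on the size of `Q`. If `# Q ≤ t`, truncation changes nothing and
 -- the counts add up to `# P * # Q`. Otherwise `Q` is translated so as to meet `P` properly, and
 -- the e-transform makes it smaller.
 pollard-bounded : ∀ l t P Q → # Q ≤ l → t ≤ # Q → t ≤ # P → # P + # Q ≤ p + t →
          t * (# P + # Q) ≤ Σ (λ z → rep P Q z ⊓ t) + t * t
 pollard-step : ∀ l t P Q → # Q ≤ suc l → t < # Q → t ≤ # P → 1 ≤ t → # P + # Q ≤ p + t →
         1 ≤ # (λ x → P x ∧ Q x) → # (λ x → P x ∧ Q x) < # Q →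
         t * (# P + # Q) ≤ Σ (λ z → rep P Q z ⊓ t) + t * t

 pollard-bounded l zero P Q _ _ _ _ = z≤n
 pollard-bounded zero t@(suc _) P Q Q≤l t≤Q _ _ = (lin 4 t (# P) (# Q) (Σ (λ z → rep P Q z ⊓ t)) 0 (v0 :* (v1 :+ v2)) (v3 :+ v0 :* v0) (mul (v1 :+ v2) v0 k0 (≤-trans t≤Q Q≤l) []))
 pollard-bounded (suc l) t@(suc _) P Q Q≤l t≤Q t≤P bound with ≤-<-connex (# Q) t
 ... | inj₁ Q≤t = begin
  t * (# P + # Q) ≤⟨ (lin 3 t (# P) (# Q) 0 (v0 :* (v1 :+ v2)) (v1 :* v2 :+ v0 :* v0) (mul v1 v0 v2 t≤Q (mul v0 v2 v0 Q≤t []))) ⟩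
  # P * # Q + t * t ≡⟨ cong (_+ t * t) (Σ-rep P Q) ⟨
  Σ (rep P Q) + t * t ≡⟨ cong (_+ t * t) (Σ-cong λ z → m≤n⇒m⊓n≡m (≤-trans (rep≤right P Q z) Q≤t)) ⟨
  Σ (λ z → rep P Q z ⊓ t) + t * t ∎
  where open ≤-Reasoning
 ... | inj₂ t<Q with partial-common P Q t (≤-trans (s≤s (s≤s z≤n)) t<Q) (≤-trans (s≤s z≤n) t≤P) t<Q bound
 ... | e , I≥1 , I<Q = subst₂ (λ q s → t * (# P + q) ≤ s + t * t) #Qₑ
   (trans (Σ-cong λ z → cong (_⊓ t) (Σ-cong λ x → cong (λ y → [ P x ∧ Q y ]) (group 3 z x e (g0 :- g1 :- g2) (g0 :- g2 :- g1)))) (Σ-unshift e (λ z → rep P Q z ⊓ t)))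
   (pollard-step l t P Qₑ (subst (_≤ suc l) (sym #Qₑ) Q≤l) (subst (t <_) (sym #Qₑ) t<Q) t≤P (s≤s z≤n)
    (subst (λ q → # P + q ≤ p + t) (sym #Qₑ) bound) I≥1 (subst (common P Q e <_) (sym #Qₑ) I<Q))
  where
  Qₑ : G → Bool
  Qₑ x = Q (x ⊖ e)
  #Qₑ : # Qₑ ≡ # Q
  #Qₑ = Σ-unshift e ([_] ∘ Q)

 pollard-step l t P Q Q≤l t<Q t≤P 1≤t bound 1≤I I<Q with ≤-<-connex t (# (λ x → P x ∧ Q x))
 ... | inj₁ t≤I = begin
  t * (# P + # Q) ≡⟨ cong (t *_) #U+#I ⟨
  t * (# U + # I) ≤⟨ pollard-bounded l t U I (lin 3 (# I) l (# Q) 0 v0 v1 (hyp (1+ v0) v2 I<Q (hyp v2 (1+ v1) Q≤l []))) t≤I (≤-trans t≤P P≤U) (subst (_≤ p + t) (sym #U+#I) bound) ⟩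
  Σ (λ z → rep U I z ⊓ t) + t * t ≤⟨ +-monoˡ-≤ (t * t) (Σ-mono λ z → ⊓-monoˡ-≤ t (≤-trans (m≤m+n _ _) (rep-transform P Q z))) ⟩
  Σ (λ z → rep P Q z ⊓ t) + t * t ∎
  where
  open ≤-Reasoning
  U I : G → Bool
  U x = P x ∨ Q x
  I x = P x ∧ Q x
  #U+#I : # U + # I ≡ # P + # Q
  #U+#I = Σ-≡ (([_] ∘ U) ∷ ([_] ∘ I) ∷ []) (([_] ∘ P) ∷ ([_] ∘ Q) ∷ []) λ x →
   ≤-antisym (bool² (λ a b → [ a ∨ b ] + [ a ∧ b ]) (λ a b → [ a ] + [ b ]) (P x) (Q x))
        (bool² (λ a b → [ a ] + [ b ]) (λ a b → [ a ∨ b ] + [ a ∧ b ]) (P x) (Q x))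
  P≤U : # P ≤ # U
  P≤U = Σ-mono λ x → bool² (λ a b → [ a ]) (λ a b → [ a ∨ b ]) (P x) (Q x)
 -- A small intersection keeps all its `# U * # I` representations, at most `# I` for each sum; the
 -- differences are treated with the remaining truncation `u = t - # I`.
 ... | inj₂ I<t = (lin 11 t (# P) (# Q) S (# I) u (# P') (# Q') (Σ (λ z → rep P' Q' z ⊓ u)) (Σ (rep U I)) (# U) 0 (v0 :* (v1 :+ v2)) (v3 :+ v0 :* v0) (eqn (v0 :* (v1 :+ v2)) ((v4 :+ v5) :* (v6 :+ v7 :+ v4 :+ v4)) *-cong-≡ (hyp (v5 :* (v6 :+ v7)) (v8 :+ v5 :* v5) IH (hyp (v9 :+ v8) v3 split (eqn⁻ v9 (v10 :* v4) (Σ-rep U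
  I) (mul v4 (v6 :+ v7 :+ v4) v10 (≡⇒≤ (sym U≡)) (eqn⁻ (v0 :* v0) ((v4 :+ v5) :* (v4 :+ v5)) tt≡ [])))))))
  where
  U I P' Q' : G → Bool
  U x = P x ∨ Q x
  I x = P x ∧ Q x
  P' x = P x ∧ not (Q x)
  Q' x = Q x ∧ not (P x)
  u = t ∸ # I
  S = Σ (λ z → rep P Q z ⊓ t)
  t≡ : # I + u ≡ t
  t≡ = m+[n∸m]≡n (<⇒≤ I<t)
  P≡ : # P ≡ # P' + # I
  P≡ = Σ-≡ (([_] ∘ P) ∷ []) (([_] ∘ P') ∷ ([_] ∘ I) ∷ []) λ x →
   ≤-antisym (bool² (λ a b → [ a ]) (λ a b → [ a ∧ not b ] + [ a ∧ b ]) (P x) (Q x))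
        (bool² (λ a b → [ a ∧ not b ] + [ a ∧ b ]) (λ a b → [ a ]) (P x) (Q x))
  Q≡ : # Q ≡ # Q' + # I
  Q≡ = Σ-≡ (([_] ∘ Q) ∷ []) (([_] ∘ Q') ∷ ([_] ∘ I) ∷ []) λ x →
   ≤-antisym (bool² (λ a b → [ b ]) (λ a b → [ b ∧ not a ] + [ a ∧ b ]) (P x) (Q x))
        (bool² (λ a b → [ b ∧ not a ] + [ a ∧ b ]) (λ a b → [ b ]) (P x) (Q x))
  U≡ : # U ≡ # P' + # Q' + # I
  U≡ = trans (Σ-≡ (([_] ∘ U) ∷ []) (([_] ∘ P') ∷ ([_] ∘ Q') ∷ ([_] ∘ I) ∷ []) (λ x →
   ≤-antisym (bool² (λ a b → [ a ∨ b ]) (λ a b → [ a ∧ not b ] + ([ b ∧ not a ] + [ a ∧ b ])) (P x) (Q x))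
        (bool² (λ a b → [ a ∧ not b ] + ([ b ∧ not a ] + [ a ∧ b ])) (λ a b → [ a ∨ b ]) (P x) (Q x))))
   (sym (+-assoc (# P') _ _))
  *-cong-≡ : t * (# P + # Q) ≡ (# I + u) * (# P' + # Q' + # I + # I)
  *-cong-≡ = cong₂ _*_ (sym t≡) (linEq 5 (# P) (# Q) (# P') (# Q') (# I) (v0 :+ v1) (v2 :+ v3 :+ v4 :+ v4) 0 (eqn v0 (v2 :+ v4) P≡ (eqn v1 (v3 :+ v4) Q≡ [])) 0 (eqn⁻ v0 (v2 :+ v4) P≡ (eqn⁻ v1 (v3 :+ v4) Q≡ [])))
  tt≡ : t * t ≡ (# I + u) * (# I + u)
  tt≡ = cong₂ _*_ (sym t≡) (sym t≡)
  IH : u * (# P' + # Q') ≤ Σ (λ z → rep P' Q' z ⊓ u) + u * u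
  IH = pollard-bounded l u P' Q'
   (lin 4 (# Q') l (# Q) (# I) 0 v0 v1 (eqn⁻ v2 (v0 :+ v3) Q≡ (hyp k1 v3 1≤I (hyp v2 (1+ v1) Q≤l []))))
   (lin 5 u (# Q') (# Q) (# I) t 0 v0 v1 (eqn v2 (v1 :+ v3) Q≡ (eqn (v3 :+ v0) v4 t≡ (hyp (1+ v4) v2 t<Q []))))
   (lin 5 u (# P') (# P) (# I) t 0 v0 v1 (eqn v2 (v1 :+ v3) P≡ (eqn (v3 :+ v0) v4 t≡ (hyp v4 v2 t≤P []))))
   (lin 8 (# P') (# Q') p u (# P) (# I) (# Q) t 0 (v0 :+ v1) (v2 :+ v3) (eqn⁻ v4 (v0 :+ v5) P≡ (eqn⁻ v6 (v1 :+ v5) Q≡ (eqn⁻ (v5 :+ v3) v7 t≡ (hyp (v4 :+ v6) (v2 :+ v7) bound [])))))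
  split : Σ (rep U I) + Σ (λ z → rep P' Q' z ⊓ u) ≤ S
  split = Σ-≤ (rep U I ∷ (λ z → rep P' Q' z ⊓ u) ∷ []) ((λ z → rep P Q z ⊓ t) ∷ []) λ z →
   ⊓-glb (≤-trans (+-monoʳ-≤ (rep U I z) (m⊓n≤m _ u)) (rep-transform P Q z))
      (subst (rep U I z + (rep P' Q' z ⊓ u) ≤_) t≡ (+-mono-≤ (rep≤right U I z) (m⊓n≤n _ u)))

 pollard : ∀ t P Q → t ≤ # Q → t ≤ # P → # P + # Q ≤ p + t →
      t * (# P + # Q) ≤ Σ (λ z → rep P Q z ⊓ t) + t * t
 pollard t P Q = pollard-bounded (# Q) t P Q ≤-refl

 -- Sumsets in the group and greedy selection of subsets with many sums.

 infix 4 _⊑_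
 _⊑_ : (S U : G → Bool) → Set
 S ⊑ U = ∀ x → T (S x) → T (U x)

 infixl 5 _∪_
 _∪_ : (S U : G → Bool) → G → Bool
 (S ∪ U) x = S x ∨ U x

 ∅ : G → Bool
 ∅ _ = false

 T-∨-elim : ∀ {a b} → T (a ∨ b) → T a ⊎ T b
 T-∨-elim {true} t = inj₁ tt
 T-∨-elim {false} t = inj₂ t

 ∪-⊑ : ∀ {S U V} → S ⊑ V → U ⊑ V → S ∪ U ⊑ V
 ∪-⊑ {S} s u x t with T-∨-elim {S x} t
 ... | inj₁ a = s x a
 ... | inj₂ b = u x b

 #-∪ : ∀ S U → # (S ∪ U) ≤ # S + # U
 #-∪ S U = Σ-≤ ((λ x → [ S x ∨ U x ]) ∷ []) (([_] ∘ S) ∷ ([_] ∘ U) ∷ [])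
  λ x → bool² (λ a b → [ a ∨ b ]) (λ a b → [ a ] + [ b ]) (S x) (U x)

 #∅ : # ∅ ≡ 0
 #∅ = Σ-zero p

 infixl 6 _⊞_
 abstract
  _⊞_ : (P Q : G → Bool) → G → Bool
  (P ⊞ Q) z = does (Finₚ.any? λ x → T? (P x ∧ Q (z ⊖ x)))

  ⊞-intro : ∀ P Q {x y} → T (P x) → T (Q y) → T ((P ⊞ Q) (x ⊹ y))
  ⊞-intro P Q {x} {y} Px Qy with Finₚ.any? (λ w → T? (P w ∧ Q (x ⊹ y ⊖ w)))
  ... | yes _ = tt
  ... | no none = ⊥-elim (none (x , T-pair Px (subst (T ∘ Q) (group 2 y x g0 (g1 :+ g0 :- g1)) Qy)))

  ⊞-elim : ∀ P Q z → T ((P ⊞ Q) z) → ∃ λ x → T (P x) × T (Q (z ⊖ x))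
  ⊞-elim P Q z t with Finₚ.any? (λ x → T? (P x ∧ Q (z ⊖ x)))
  ... | yes (x , PQ) = x , T-∧ˡ PQ , T-∧ʳ {P x} PQ

 ⊞-mono : ∀ {P P' Q Q'} → P ⊑ P' → Q ⊑ Q' → P ⊞ Q ⊑ P' ⊞ Q'
 ⊞-mono {P} {P'} {Q} {Q'} P⊑ Q⊑ z t with ⊞-elim P Q z t
 ... | x , Px , Qy = subst (T ∘ (P' ⊞ Q')) (group 2 x z (g0 :+ (g1 :- g0)) g1) (⊞-intro P' Q' (P⊑ x Px) (Q⊑ (z ⊖ x) Qy))

 -- How far `V` is from containing all sums, measured in pairs: a popular missing sum counts with
 -- its multiplicity.
 bad : (P Q V : G → Bool) → ℕ
 bad P Q V = Σ λ x → # λ y → (P x ∧ Q y) ∧ not (V (x ⊹ y))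

 bad-swap : ∀ P Q V → bad P Q V ≡ Σ λ y → [ Q y ] * # λ x → P x ∧ not (V (x ⊹ y))
 bad-swap P Q V = trans (Σ-swap λ x y → [ (P x ∧ Q y) ∧ not (V (x ⊹ y)) ])
  (Σ-cong λ y → trans (Σ-cong λ x → shuffle (P x) (Q y) (not (V (x ⊹ y)))) (Σ-* [ Q y ] _))
  where
  shuffle : ∀ a b c → [ (a ∧ b) ∧ c ] ≡ [ b ] * [ a ∧ c ]
  shuffle a b c = ≤-antisym (bool³ (λ a b c → [ (a ∧ b) ∧ c ]) (λ a b c → [ b ] * [ a ∧ c ]) a b c)
               (bool³ (λ a b c → [ b ] * [ a ∧ c ]) (λ a b c → [ (a ∧ b) ∧ c ]) a b c)

 remove : (G → Bool) → G → G → Bool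
 remove S y x = S x ∧ not (δ x y)

 Σ-remove : ∀ S y → T (S y) → (D : G → ℕ) → Σ (λ x → [ S x ] * D x) ≡ Σ (λ x → [ remove S y x ] * D x) + D y
 Σ-remove S y Sy D = trans (Σ-cong split) (trans (Σ-+ _ (λ x → [ δ x y ] * D x)) (cong (Σ (λ x → [ remove S y x ] * D x) +_) (Σ-δ D y)))
  where
  case : ∀ a b d → (T b → T a) → [ a ] * d ≡ [ a ∧ not b ] * d + [ b ] * d
  case true true d _ = refl
  case true false d _ = sym (+0 _)
  case false true d f = ⊥-elim (f tt)
  case false false d _ = refl
  split : ∀ x → [ S x ] * D x ≡ [ remove S y x ] * D x + [ δ x y ] * D x
  split x = case (S x) (δ x y) (D x) λ t → subst (T ∘ S) (sym (δ-sound t)) Sy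

 #-as-Σ : ∀ (S : G → Bool) → # S ≡ Σ (λ x → [ S x ] * 1)
 #-as-Σ S = Σ-cong λ x → sym (*1 [ S x ])

 #-remove : ∀ S y → T (S y) → # S ≡ # (remove S y) + 1
 #-remove S y Sy = trans (#-as-Σ S) (trans (Σ-remove S y Sy (λ _ → 1)) (cong (_+ 1) (sym (#-as-Σ (remove S y)))))

 light-element : ∀ S (D : G → ℕ) → 1 ≤ # S → ∃ λ y → T (S y) × # S * D y ≤ Σ (λ x → [ S x ] * D x)
 light-element S D 1≤S
  with Σ-<⇒∃ (λ x → [ S x ] * (# S * D x)) (λ x → [ S x ] * (1 + Σ λ x → [ S x ] * D x)) less
  where
  total-D = Σ λ x → [ S x ] * D x
  less : Σ (λ x → [ S x ] * (# S * D x)) < Σ (λ x → [ S x ] * (1 + total-D))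
  less = (lin 4 (Σ (λ x → [ S x ] * (# S * D x))) (Σ (λ x → [ S x ] * (1 + total-D))) (# S) total-D 0 (1+ v0) v1 (eqn⁻ v1 (v2 :* (1+ v3)) (Σ-*ʳ (1 + total-D) ([_] ∘ S)) (eqn v0 (v2 :* v3) (trans (Σ-cong λ x → trans (sym (*-assoc [ S x ] (# S) (D x))) (trans (cong (_* D x) (*-comm [ S x ] (# S))) (*-assoc (# S) [ S x ]
   (D x)))) (Σ-* (# S) (λ x → [ S x ] * D x))) (hyp k1 v2 1≤S []))))
 ... | y , lt with S y in eq
 ... | true = y , T! eq , ≤-pred (lin 3 (# S) (D y) (Σ (λ x → [ S x ] * D x)) 0 (1+ (v0 :* v1)) (1+ v2) (hyp (1+ (k1 :* (v0 :* v1))) (k1 :* (1+ v2)) lt []))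
 ... | false = ⊥-elim (n≮0 lt)

 -- Removing an element of least weight never lowers the average weight, so `s` elements can retain
 -- at least the share `s / # Q` of the total.
 heavy-subset : ∀ j s Q (D : G → ℕ) → # Q ≡ s + j →
         ∃ λ Q' → Q' ⊑ Q × # Q' ≡ s × s * Σ (λ x → [ Q x ] * D x) ≤ # Q * Σ (λ x → [ Q' x ] * D x)
 heavy-subset zero s Q D #Q = Q , (λ _ t → t) , trans #Q (+0 s) ,
  *-monoˡ-≤ (Σ λ x → [ Q x ] * D x) (≡⇒≤ (sym (trans #Q (+0 s))))
 heavy-subset (suc j) zero Q D #Q = ∅ , (λ _ ()) , #∅ , z≤n
 heavy-subset (suc j) s@(suc _) Q D #Q with light-element Q D (lin 3 (# Q) s j 0 k1 v0 (eqn⁻ v0 (v1 :+ (1+ v2)) #Q []))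
 ... | y , Qy , light
  with heavy-subset j s (remove Q y) D (linEq 4 (# (remove Q y)) s j (# Q) v0 (v1 :+ v2) 0 (eqn v3 (v1 :+ (1+ v2)) #Q (eqn⁻ v3 (v0 :+ k1) (#-remove Q y Qy) [])) 0 (eqn⁻ v3 (v1 :+ (1+ v2)) #Q (eqn v3 (v0 :+ k1) (#-remove Q y Qy) [])))
 ... | Q' , Q'⊑ , #Q' , heavy = Q' , (λ x t → T-∧ˡ (Q'⊑ x t)) , #Q' , cancelˡ (# (remove Q y)) R>0 (begin
   R * (s * ΣQ) ≤⟨ (lin 6 R s ΣQ (# Q) ΣR (D y) 0 (v0 :* (v1 :* v2)) (v3 :* (v1 :* v4)) (mul (v0 :* v1) v2 (v4 :+ v5) (≡⇒≤ (Σ-remove Q y Qy D)) (mul (v1 :* v4) (v0 :+ k1) v3 (≡⇒≤ (sym (#-remove Q y Qy))) (mul v1 (v3 :* v5) v2 light (mul (v1 :* v5) (v0 :+ k1) v3 (≡⇒≤ (sym (#-remove Q y Qy))) (mul v1 v2 (v4 :+ v5)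
    (≡⇒≤ (Σ-remove Q y Qy D)) [])))))) ⟩
   # Q * (s * ΣR) ≤⟨ *-monoʳ-≤ (# Q) heavy ⟩
   # Q * (R * ΣQ') ≡⟨ (linEq 3 (# Q) R ΣQ' (v0 :* (v1 :* v2)) (v1 :* (v0 :* v2)) 0 [] 0 []) ⟩
   R * (# Q * ΣQ') ∎)
  where
  open ≤-Reasoning
  R = # (remove Q y)
  ΣQ = Σ λ x → [ Q x ] * D x
  ΣR = Σ λ x → [ remove Q y x ] * D x
  ΣQ' = Σ λ x → [ Q' x ] * D x
  R>0 : 0 < R
  R>0 = (lin 4 R (# Q) s j 0 (1+ k0) v0 (eqn⁻ v1 (v2 :+ (1+ v3)) #Q (eqn v1 (v0 :+ k1) (#-remove Q y Qy) (hyp k1 v2 (s≤s z≤n) []))))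

 fresh : (P Q V : G → Bool) → G → Bool
 fresh P Q V z = (P ⊞ Q) z ∧ not (V z)

 -- Adding the elements of P one at a time, each step captures an average share of the pairs whose
 -- sum is still missing; a captured sum spoils at most # Q' pairs.
 greedy-steps : ∀ M P Q' V → # Q' * # P ≤ M * bad P Q' V → ∀ j →
  ∃ λ P' → P' ⊑ P × # P' ≤ j × (# P ⊓ (j * # Q') ≤ 2 * M * # (fresh P' Q' V))
 greedy-steps M P Q' V dense zero = ∅ , (λ _ ()) , ≡⇒≤ #∅ , ≤-trans (m⊓n≤n (# P) 0) z≤n
 greedy-steps M P Q' V dense (suc j) with greedy-steps M P Q' V dense j
 ... | P' , P'⊑P , #P' , gain with ≤-<-connex (# P) (2 * M * # (fresh P' Q' V))
 ... | inj₁ enough = P' , P'⊑P , ≤-trans #P' (n≤1+n j) , ≤-trans (m⊓n≤m (# P) _) enough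
 ... | inj₂ short = extend (Σ-<⇒∃ (λ x → [ P x ] * s) (λ x → [ P x ] * (1 + 2 * M * new x)) average)
  where
  s = # Q'
  N = fresh P' Q' V
  g = # N
  W : G → Bool
  W z = V z ∨ N z
  new : G → ℕ
  new x = # λ y → Q' y ∧ not (W (x ⊹ y))
  R = Σ λ x → [ P x ] * new x
  bad-R : bad P Q' V ≤ R + g * s
  bad-R = begin
   bad P Q' V
    ≤⟨ Σ-≤ ((λ x → # λ y → (P x ∧ Q' y) ∧ not (V (x ⊹ y))) ∷ []) ((λ x → [ P x ] * new x) ∷ (λ x → # λ y → Q' y ∧ N (x ⊹ y)) ∷ []) row ⟩
   R + Σ (λ x → # λ y → Q' y ∧ N (x ⊹ y))
    ≡⟨ cong (R +_) lost ⟩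
   R + g * s ∎
   where
   open ≤-Reasoning
   row : ∀ x → # (λ y → (P x ∧ Q' y) ∧ not (V (x ⊹ y))) ≤ [ P x ] * new x + # λ y → Q' y ∧ N (x ⊹ y)
   row x = subst (λ t → # (λ y → (P x ∧ Q' y) ∧ not (V (x ⊹ y))) ≤ t + # λ y → Q' y ∧ N (x ⊹ y)) (Σ-* [ P x ] _)
    (Σ-≤ ((λ y → [ (P x ∧ Q' y) ∧ not (V (x ⊹ y)) ]) ∷ [])
       ((λ y → [ P x ] * [ Q' y ∧ not (W (x ⊹ y)) ]) ∷ (λ y → [ Q' y ∧ N (x ⊹ y) ]) ∷ [])
    λ y → bool⁴ (λ a b c d → [ (a ∧ b) ∧ not c ]) (λ a b c d → [ a ] * [ b ∧ not (c ∨ d) ] + [ b ∧ d ])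
        (P x) (Q' y) (V (x ⊹ y)) (N (x ⊹ y)))
   lost : Σ (λ x → # λ y → Q' y ∧ N (x ⊹ y)) ≡ g * s
   lost = trans (Σ-swap λ x y → [ Q' y ∧ N (x ⊹ y) ]) (trans
    (Σ-cong λ y → trans (Σ-cong λ x → ⟨⟩-∧ (Q' y) (N (x ⊹ y))) (trans (Σ-* [ Q' y ] (λ x → [ N (x ⊹ y) ]))
     (cong ([ Q' y ] *_) (Σ-shift y ([_] ∘ N)))))
    (trans (Σ-*ʳ g ([_] ∘ Q')) (*-comm s g)))
  average : Σ (λ x → [ P x ] * s) < Σ (λ x → [ P x ] * (1 + 2 * M * new x))
  average = (lin 8 (Σ (λ x → [ P x ] * s)) (Σ (λ x → [ P x ] * (1 + 2 * M * new x))) (# P) s M R (bad P Q' V) g 0 (1+ v0) v1 (eqn v0 (v2 :* v3) (Σ-*ʳ s ([_] ∘ P)) (eqn⁻ v1 (v2 :+ k2 :* v4 :* v5) right (mul (k2 :* v4) v6 (v5 :+ v7 :* v3) bad-R (hyp* 2 (v3 :* v2) (v4 :* v6) dense (mul v3 (k2 :* v4 :* v7) v2 (<⇒≤ short)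
   (hyp k1 v2 P>0 [])))))))
   where
   P>0 : 1 ≤ # P
   P>0 = ≤-trans (s≤s z≤n) short
   right : Σ (λ x → [ P x ] * (1 + 2 * M * new x)) ≡ # P + 2 * M * R
   right = trans (Σ-cong λ x → (linEq 3 ([ P x ]) M (new x) (v0 :* (1+ (k2 :* v1 :* v2))) (v0 :+ k2 :* v1 :* (v0 :* v2)) 0 [] 0 []))
    (trans (Σ-+ ([_] ∘ P) _) (cong (# P +_) (Σ-* (2 * M) (λ x → [ P x ] * new x))))
  extend : (∃ λ x → [ P x ] * s < [ P x ] * (1 + 2 * M * new x)) →
       ∃ λ P″ → P″ ⊑ P × # P″ ≤ suc j × (# P ⊓ (suc j * s) ≤ 2 * M * # (fresh P″ Q' V))
  extend (x , lt) with P x in Px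
  ... | false = ⊥-elim (n≮0 lt)
  ... | true = P″ , ∪-⊑ {P'} P'⊑P (λ w t → subst (T ∘ P) (sym (δ-sound t)) (T! Px)) ,
   (lin 4 (# P″) j (# P') (# (λ w → δ w x)) 0 v0 (1+ v1) (hyp v0 (v2 :+ v3) (#-∪ P' (λ w → δ w x)) (eqn v3 k1 (#-δ x) (hyp v2 v1 #P' [])))) ,
   ≤-trans (m⊓n≤n (# P) (suc j * s)) (lin 6 j s M (# (fresh P″ Q' V)) g (new x) 0 ((1+ v0) :* v1) (k2 :* v2 :* v3) (hyp (v0 :* v1) (k2 :* v2 :* v4) js (hyp (1+ (k1 :* v1)) (k1 :* (1+ (k2 :* v2 :* v5))) lt (mul (k2 :* v2) (v4 :+ v5) v3 grows []))))
   where
   P″ = P' ∪ λ w → δ w x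
   js : j * s ≤ 2 * M * g
   js with ⊓-sel (# P) (j * s)
   ... | inj₁ eq = ⊥-elim (<⇒≱ short (subst (_≤ 2 * M * g) eq gain))
   ... | inj₂ eq = subst (_≤ 2 * M * g) eq gain
   grows : g + new x ≤ # (fresh P″ Q' V)
   grows = subst (λ t → g + t ≤ # (fresh P″ Q' V))
    (trans (Σ-cong λ y → cong (λ t → [ Q' (y ⊖ x) ∧ not (W t) ]) (group 2 y x g0 (g1 :+ (g0 :- g1)))) (Σ-unshift x λ y → [ Q' y ∧ not (W (x ⊹ y)) ]))
    (Σ-≤ (([_] ∘ N) ∷ (λ z → [ Q' (z ⊖ x) ∧ not (W z) ]) ∷ []) (([_] ∘ fresh P″ Q' V) ∷ []) λ z →
     case (V z) (N z) (Q' (z ⊖ x)) (fresh P″ Q' V z)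
      (λ t → T-pair (⊞-mono {P'} {P″} (λ w → T-∨ˡ) (λ _ q → q) z (T-∧ˡ t)) (T-∧ʳ {(P' ⊞ Q') z} t))
      (λ q nv → T-pair (subst (T ∘ (P″ ⊞ Q')) (group 2 x z (g0 :+ (g1 :- g0)) g1) (⊞-intro P″ Q' (T-∨ʳ {P' x} (δ-refl x)) q)) nv))
    where
    case : ∀ v n q f → (T n → T f) → (T q → T (not v) → T f) → [ n ] + [ q ∧ not (v ∨ n) ] ≤ [ f ]
    case v true true true _ _ = ≤-trans (≡⇒≤ (cong (λ t → 1 + [ not t ]) (∨-zeroʳ v))) ≤-refl
    case v true false true _ _ = ≤-refl
    case v true q false n→ _ = ⊥-elim (n→ tt)
    case v false false f _ _ = z≤n
    case true false true f _ _ = z≤n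
    case false false true true _ _ = ≤-refl
    case false false true false _ q→ = ⊥-elim (q→ tt tt)

 -- `Q` is first reduced to `s` elements with many missing pairs, which does not lower the
 -- proportion of missing pairs; then elements of `P` are added one at a time.
 greedy : ∀ M s j P Q V → s ≤ # Q → # P * # Q ≤ M * bad P Q V →
  ∃ λ P' → ∃ λ Q' → P' ⊑ P × Q' ⊑ Q × # P' ≤ j × # Q' ≤ s × # P ⊓ (j * s) ≤ 2 * M * # (fresh P' Q' V)
 greedy M zero j P Q V _ dense = ∅ , ∅ , (λ _ ()) , (λ _ ()) , ≤-trans (≡⇒≤ #∅) z≤n , ≡⇒≤ #∅ ,
  ≤-trans (m⊓n≤n (# P) (j * 0)) (≤-trans (≡⇒≤ (*0 j)) z≤n)
 greedy M s@(suc _) j P Q V s≤Q dense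
  with heavy-subset (# Q ∸ s) s Q (λ y → # λ x → P x ∧ not (V (x ⊹ y))) (sym (m+[n∸m]≡n s≤Q))
 ... | Q' , Q'⊑Q , #Q' , heavy with greedy-steps M P Q' V dense' j
  where
  open ≤-Reasoning
  dense' : # Q' * # P ≤ M * bad P Q' V
  dense' = cancelˡ (# Q) (≤-trans (s≤s z≤n) s≤Q) (begin
   # Q * (# Q' * # P) ≡⟨ (linEq 3 (# Q) (# Q') (# P) (v0 :* (v1 :* v2)) (v1 :* (v2 :* v0)) 0 [] 0 []) ⟩
   # Q' * (# P * # Q) ≤⟨ *-monoʳ-≤ (# Q') dense ⟩
   # Q' * (M * bad P Q V) ≡⟨ cong₂ (λ a b → a * (M * b)) #Q' (bad-swap P Q V) ⟩
   s * (M * Σ (λ y → [ Q y ] * # λ x → P x ∧ not (V (x ⊹ y))))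
    ≤⟨ (lin 5 s M X (# Q) Y 0 (v0 :* (v1 :* v2)) (v3 :* (v1 :* v4)) (mul v1 (v0 :* v2) (v3 :* v4) heavy [])) ⟩
   # Q * (M * Σ (λ y → [ Q' y ] * # λ x → P x ∧ not (V (x ⊹ y))))
    ≡⟨ cong (λ b → # Q * (M * b)) (bad-swap P Q' V) ⟨
   # Q * (M * bad P Q' V) ∎)
   where
   X = Σ (λ y → [ Q y ] * # λ x → P x ∧ not (V (x ⊹ y)))
   Y = Σ (λ y → [ Q' y ] * # λ x → P x ∧ not (V (x ⊹ y)))
 ... | P' , P'⊑P , #P' , gain = P' , Q' , P'⊑P , Q'⊑Q , #P' , ≡⇒≤ #Q' ,
     subst (λ t → # P ⊓ (j * t) ≤ 2 * M * # (fresh P' Q' V)) #Q' gain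

 -- A greedy round brings `# P / 2 M` new sums as long as more than the proportion `1 / M` of the
 -- pairs is missing, so `t` rounds end with many sums or few missing pairs. The bound `# P ≤ j * s`
 -- makes the minimum in `greedy` equal to `# P`.
 saturate : ∀ M s j P Q V → s ≤ # Q → # P ≤ j * s → ∀ t →
  ∃ λ P' → ∃ λ Q' → P' ⊑ P × Q' ⊑ Q × # P' ≤ t * j × # Q' ≤ t * s ×
   (t * # P ≤ 2 * M * # (fresh P' Q' V) ⊎ M * bad P Q (V ∪ P' ⊞ Q') ≤ # P * # Q)
 saturate M s j P Q V s≤Q P≤js zero = ∅ , ∅ , (λ _ ()) , (λ _ ()) , ≡⇒≤ #∅ , ≡⇒≤ #∅ , inj₁ z≤n
 saturate M s j P Q V s≤Q P≤js (suc t) with saturate M s j P Q V s≤Q P≤js t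
 ... | P' , Q' , P'⊑ , Q'⊑ , #P' , #Q' , inj₂ few = P' , Q' , P'⊑ , Q'⊑ ,
  ≤-trans #P' (m≤n+m _ j) , ≤-trans #Q' (m≤n+m _ s) , inj₂ few
 ... | P' , Q' , P'⊑ , Q'⊑ , #P' , #Q' , inj₁ many
  with ≤-<-connex (M * bad P Q (V ∪ P' ⊞ Q')) (# P * # Q)
 ... | inj₁ few = P' , Q' , P'⊑ , Q'⊑ , ≤-trans #P' (m≤n+m _ j) , ≤-trans #Q' (m≤n+m _ s) , inj₂ few
 ... | inj₂ lots with greedy M s j P Q (V ∪ P' ⊞ Q') s≤Q (<⇒≤ lots)
 ... | P″ , Q″ , P″⊑ , Q″⊑ , #P″ , #Q″ , gain = P' ∪ P″ , Q' ∪ Q″ , ∪-⊑ {P'} P'⊑ P″⊑ , ∪-⊑ {Q'} Q'⊑ Q″⊑ ,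
  (lin 5 (# (P' ∪ P″)) t j (# P') (# P″) 0 v0 ((1+ v1) :* v2) (hyp v0 (v3 :+ v4) (#-∪ P' P″) (hyp v3 (v1 :* v2) #P' (hyp v4 v2 #P″ [])))) ,
  (lin 5 (# (Q' ∪ Q″)) t s (# Q') (# Q″) 0 v0 ((1+ v1) :* v2) (hyp v0 (v3 :+ v4) (#-∪ Q' Q″) (hyp v3 (v1 :* v2) #Q' (hyp v4 v2 #Q″ [])))) ,
  inj₁ (lin 6 t (# P) M (# (fresh (P' ∪ P″) (Q' ∪ Q″) V)) (# (fresh P' Q' V)) (# (fresh P″ Q″ (V ∪ P' ⊞ Q'))) 0 ((1+ v0) :* v1) (k2 :* v2 :* v3) (hyp (v0 :* v1) (k2 :* v2 :* v4) many (hyp v1 (k2 :* v2 :* v5) (subst (_≤ 2 * M * # (fresh P″ Q″ (V ∪ P' ⊞ Q'))) (m≤n⇒m⊓n≡m P≤js) gain) (mul (k2 :* v2) (v4 :+ v5) v3 union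
   []))))
  where
  case : ∀ v a b c → (T a → T c) → (T b → T c) → [ a ∧ not v ] + [ b ∧ not (v ∨ a) ] ≤ [ c ∧ not v ]
  case true a b c _ _ rewrite ∧-zeroʳ a | ∧-zeroʳ b = z≤n
  case false true b true _ _ rewrite ∧-zeroʳ b = ≤-refl
  case false true b false a→ _ = ⊥-elim (a→ tt)
  case false false true true _ _ = ≤-refl
  case false false true false _ b→ = ⊥-elim (b→ tt)
  case false false false c _ _ = z≤n
  union : # (fresh P' Q' V) + # (fresh P″ Q″ (V ∪ P' ⊞ Q')) ≤ # (fresh (P' ∪ P″) (Q' ∪ Q″) V)
  union = Σ-≤ (([_] ∘ fresh P' Q' V) ∷ (λ z → [ fresh P″ Q″ (V ∪ P' ⊞ Q') z ]) ∷ [])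
        ((λ z → [ fresh (P' ∪ P″) (Q' ∪ Q″) V z ]) ∷ []) λ z →
   case (V z) ((P' ⊞ Q') z) ((P″ ⊞ Q″) z) (((P' ∪ P″) ⊞ (Q' ∪ Q″)) z)
    (⊞-mono {P'} {P' ∪ P″} (λ _ → T-∨ˡ) (λ _ → T-∨ˡ) z)
    (⊞-mono {P″} {P' ∪ P″} (λ x → T-∨ʳ {P' x}) (λ x → T-∨ʳ {Q' x}) z)

 -- Widths of translations and almost extremal triples.

 ∁ : (G → Bool) → G → Bool
 ∁ S x = not (S x)

 #-∁ : ∀ S → # S + # (∁ S) ≡ p
 #-∁ = #-not

 cut : (G → Bool) → G → G → Bool
 cut S d x = S x ∧ S (x ⊖ d)

 -- Half the symmetric difference of `S` and its translate by `d`, hence a seminorm in `d`; this is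
 -- the norm from which the structure of the sets is read off.
 width : (G → Bool) → G → ℕ
 width S d = # λ x → S x ∧ not (S (x ⊖ d))

 cut+width : ∀ S d → # (cut S d) + width S d ≡ # S
 cut+width S d = Σ-≡ (([_] ∘ cut S d) ∷ (λ x → [ S x ∧ not (S (x ⊖ d)) ]) ∷ []) (([_] ∘ S) ∷ [])
  λ x → case (S x) (S (x ⊖ d))
  where
  case : ∀ a b → [ a ∧ b ] + [ a ∧ not b ] ≡ [ a ]
  case true b = ⟨⟩-not b
  case false b = refl

 cut-sym : ∀ S d → # (cut S (⊝ d)) ≡ # (cut S d)
 cut-sym S d = trans (sym (Σ-unshift d (λ x → [ cut S (⊝ d) x ]))) (Σ-cong λ x →
  trans (cong (λ y → [ S (x ⊖ d) ∧ S y ]) (group 2 x d (g0 :- g1 :- :~ g1) g0)) (∧-swap (S (x ⊖ d)) (S x)))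
  where
  ∧-swap : ∀ a b → [ a ∧ b ] ≡ [ b ∧ a ]
  ∧-swap a b = cong [_] (∧-comm a b)

 width-sym : ∀ S d → width S (⊝ d) ≡ width S d
 width-sym S d = (linEq 5 (width S (⊝ d)) (width S d) (# (cut S d)) (# S) (# (cut S (⊝ d))) v0 v1 0 (eqn⁻ (v2 :+ v1) v3 (cut+width S d) (eqn (v4 :+ v0) v3 (cut+width S (⊝ d)) (eqn⁻ v4 v2 (cut-sym S d) []))) 0 (eqn (v2 :+ v1) v3 (cut+width S d) (eqn⁻ (v4 :+ v0) v3 (cut+width S (⊝ d)) (eqn v4 v2 (cut-sym S d) []))))

 width-+ : ∀ S d e → width S (d ⊹ e) ≤ width S d + width S e
 width-+ S d e = subst (λ t → width S (d ⊹ e) ≤ width S d + t) shifted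
  (Σ-≤ ((λ x → [ S x ∧ not (S (x ⊖ (d ⊹ e))) ]) ∷ [])
     ((λ x → [ S x ∧ not (S (x ⊖ d)) ]) ∷ (λ x → [ S (x ⊖ d) ∧ not (S (x ⊖ (d ⊹ e))) ]) ∷ [])
     λ x → bool³ (λ a b c → [ a ∧ not c ]) (λ a b c → [ a ∧ not b ] + [ b ∧ not c ]) (S x) (S (x ⊖ d)) (S (x ⊖ (d ⊹ e))))
  where
  shifted : # (λ x → S (x ⊖ d) ∧ not (S (x ⊖ (d ⊹ e)))) ≡ width S e
  shifted = trans (Σ-cong λ x → cong (λ y → [ S (x ⊖ d) ∧ not (S y) ]) (group 3 x d e (g0 :- (g1 :+ g2)) (g0 :- g1 :- g2)))
   (Σ-unshift d (λ x → [ S x ∧ not (S (x ⊖ e)) ]))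

 width-0 : ∀ S → width S 𝟘 ≡ 0
 width-0 S = trans (Σ-cong λ x → trans (cong (λ y → [ S x ∧ not (S y) ]) (group 1 x (g0 :- gnil) g0)) (case (S x))) (Σ-zero p)
  where
  case : ∀ a → [ a ∧ not a ] ≡ 0
  case true = refl
  case false = refl

 width-∁ : ∀ S d → width (∁ S) d ≡ width S d
 width-∁ S d = (linEq 5 (width (∁ S) d) (width S d) (# (cut S d)) (# S) (# (λ x → S (x ⊖ d))) v0 v1 0 (eqn⁻ (v2 :+ v1) v3 (cut+width S d) (eqn (v0 :+ v2) v4 both-ways (eqn v4 v3 (Σ-unshift d ([_] ∘ S)) []))) 0 (eqn (v2 :+ v1) v3 (cut+width S d) (eqn⁻ (v0 :+ v2) v4 both-ways (eqn⁻ v4 v3 (Σ-unshift d ([_] ∘ S)) []))))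
  where
  case : ∀ a b → [ not a ∧ not (not b) ] + [ a ∧ b ] ≡ [ b ]
  case true b = refl
  case false true = refl
  case false false = refl
  both-ways : width (∁ S) d + # (cut S d) ≡ # (λ x → S (x ⊖ d))
  both-ways = Σ-≡ ((λ x → [ not (S x) ∧ not (not (S (x ⊖ d))) ]) ∷ ([_] ∘ cut S d) ∷ []) ((λ x → [ S (x ⊖ d) ]) ∷ [])
   λ x → case (S x) (S (x ⊖ d))

 negate : (G → Bool) → G → Bool
 negate S x = S (⊝ x)

 #-negate : ∀ S → # (negate S) ≡ # S
 #-negate S = Σ-neg λ x → [ S x ]

 width-negate : ∀ S d → width (negate S) d ≡ width S d
 width-negate S d = trans (sym (Σ-neg λ x → [ negate S x ∧ not (negate S (x ⊖ d)) ])) (trans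
  (Σ-cong λ x → cong₂ (λ y z → [ S y ∧ not (S z) ]) (group 1 x (:~ :~ g0) g0) (group 2 x d (:~ (:~ g0 :- g1)) (g0 :- :~ g1)))
  (width-sym S d))

 -- Near-equality in Cauchy-Davenport, in a form that tolerates missing pairs: `e * e` of them are
 -- what Pollard's theorem truncated at `e` can ignore at a cost of order `e`.
 record Extremal (P F X : G → Bool) (e : ℕ) : Set where
  constructor extremal
  field
   small : # X ≤ # P + # F + e
   few : bad P F X ≤ e * e

 open Extremal public

 bad-comm : ∀ P F X → bad F P X ≡ bad P F X
 bad-comm P F X = trans (Σ-swap λ x y → [ (F x ∧ P y) ∧ not (X (x ⊹ y)) ]) (Σ-cong λ x → Σ-cong λ y →
  cong₂ (λ a z → [ a ∧ not (X z) ]) (∧-comm (F y) (P x)) (⊹-comm y x))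

 extremal-comm : ∀ {P F X e} → Extremal P F X e → Extremal F P X e
 extremal-comm {P} {F} {X} {e} E = extremal
  (subst (λ t → # X ≤ t + e) (+-comm (# P) (# F)) (small E)) (subst (_≤ e * e) (sym (bad-comm P F X)) (few E))

 -- x + y = z with x ∈ P, y ∈ F, z ∉ X reads x - z = - y: P, F and - ∁ X play symmetric roles.
 extremal-rotate : ∀ {P F X e} → Extremal P F X e → Extremal P (negate (∁ X)) (negate (∁ F)) e
 extremal-rotate {P} {F} {X} {e} E = extremal
  (lin 9 (# (negate (∁ F))) (# P) (# (negate (∁ X))) e (# X) (# F) (# (∁ F)) (# (∁ X)) p 0 v0 (v1 :+ v2 :+ v3) (hyp v4 (v1 :+ v5 :+ v3) (small E) (eqn v0 v6 (#-negate (∁ F)) (eqn⁻ v2 v7 (#-negate (∁ X)) (eqn⁻ (v4 :+ v7) v8 (#-∁ X) (eqn (v5 :+ v6) v8 (#-∁ F) []))))))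
  (subst (_≤ e * e) (sym (Σ-cong row)) (few E))
  where
  case : ∀ a x f → [ (a ∧ not x) ∧ not (not f) ] ≡ [ (a ∧ f) ∧ not x ]
  case true true true = refl
  case true true false = refl
  case true false true = refl
  case true false false = refl
  case false _ _ = refl
  row : ∀ x → # (λ y → (P x ∧ negate (∁ X) y) ∧ not (negate (∁ F) (x ⊹ y))) ≡ # (λ y → (P x ∧ F y) ∧ not (X (x ⊹ y)))
  row x = trans (sym (Σ-reflect (⊝ x) (λ y → [ (P x ∧ negate (∁ X) y) ∧ not (negate (∁ F) (x ⊹ y)) ])))
   (Σ-cong λ y → trans (cong₂ (λ u v → [ (P x ∧ not (X u)) ∧ not (not (F v)) ]) (group 2 x y (:~ (:~ g0 :- g1)) (g0 :+ g1)) (group 2 x y (:~ (g0 :+ (:~ g0 :- g1))) g1))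
    (case (P x) (X (x ⊹ y)) (F y)))

 missing-from : (P X : G → Bool) → G → ℕ
 missing-from P X y = # λ x → P x ∧ not (X (x ⊹ y))

 -- Some element of `F` has at most the average number `e * e / # F ≤ e` of bad pairs, and its
 -- translate of `P` lies in `X` up to these.
 left≤X : ∀ {P F X e} → Extremal P F X e → 1 ≤ e → e ≤ # F → # P ≤ # X + e
 left≤X {P} {F} {X} {e} E 1≤e e≤F with light-element F (missing-from P X) (≤-trans 1≤e e≤F)
 ... | f , Ff , light = (lin 5 (# P) (# X) e (# (λ x → X (x ⊹ f))) (missing-from P X f) 0 v0 (v1 :+ v2) (hyp v0 (v3 :+ v4) covered (eqn v3 v1 (Σ-shift f ([_] ∘ X)) (hyp v4 v2 few-missing []))))
  where
  covered : # P ≤ # (λ x → X (x ⊹ f)) + missing-from P X f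
  covered = Σ-≤ (([_] ∘ P) ∷ []) ((λ x → [ X (x ⊹ f) ]) ∷ (λ x → [ P x ∧ not (X (x ⊹ f)) ]) ∷ [])
   λ x → bool² (λ a b → [ a ]) (λ a b → [ b ] + [ a ∧ not b ]) (P x) (X (x ⊹ f))
  few-missing : missing-from P X f ≤ e
  few-missing = cancelˡ e 1≤e (≤-trans (*-monoˡ-≤ (missing-from P X f) e≤F)
   (≤-trans light (subst (_≤ e * e) (bad-swap P F X) (few E))))

 -- Pollard's theorem truncated at `e` is applied to `- P` and to the overlap `Y` of the complement
 -- of `X` with its translate. If `z` or `z - d` lies in `F`, the representations of `z` are bad
 -- pairs; so the truncated counts live on `W` up to `2 e * e`, and `# P + # Y ≤ # W + 3 e`. The
 -- size bound of the triple turns this into a comparison of widths.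
 width-transfer : ∀ {P F X e} → Extremal P F X e → 1 ≤ e → e ≤ # F → e ≤ # P →
          ∀ d → e ≤ # (cut (∁ X) d) → width F d ≤ width X d + 4 * e
 width-transfer {P} {F} {X} {e} E 1≤e e≤F e≤P d e≤Y =
  (lin 13 (width F d) (width X d) e (# P) (# Y) (# W) (width (∁ X) d) (# (∁ X)) (# X) p (width (∁ F) d) (# (∁ F)) (# F) 0 v0 (v1 :+ k4 :* v2) (hyp (v3 :+ v4) (v5 :+ k3 :* v2) robust (eqn⁻ (v4 :+ v6) v7 (cut+width (∁ X) d) (eqn v6 v1 (width-∁ X d) (eqn⁻ (v8 :+ v7) v9 (#-∁ X) (eqn (v5 :+ v10) v11 (cut+width (∁ F) d)
   (eqn⁻ v10 v0 (width-∁ F d) (eqn (v12 :+ v11) v9 (#-∁ F) (hyp v8 (v3 :+ v12 :+ v2) (small E) [])))))))))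
  where
  Y W : G → Bool
  Y = cut (∁ X) d
  W = cut (∁ F) d
  r : G → ℕ
  r = rep (negate P) Y
  escape₁ escape₂ : G → ℕ
  escape₁ z = # λ x → (P x ∧ F z) ∧ not (X (x ⊹ z))
  escape₂ z = # λ x → (P x ∧ F (z ⊖ d)) ∧ not (X (x ⊹ (z ⊖ d)))
  pointwise : ∀ z → r z ⊓ e ≤ [ W z ] * e + (escape₁ z + escape₂ z)
  pointwise z with F z in Fz | F (z ⊖ d) in Fzd
  ... | false | false = ≤-trans (m⊓n≤n (r z) e) (lin 3 e (# λ x → (P x ∧ false) ∧ not (X (x ⊹ z))) (# λ x → (P x ∧ false) ∧ not (X (x ⊹ (z ⊖ d)))) 0 v0 (k1 :* v0 :+ (v1 :+ v2)) [])
  ... | true | b = ≤-trans (m⊓n≤m (r z) e) (≤-trans (≡⇒≤ (sym (Σ-neg λ x → [ negate P x ∧ Y (z ⊖ x) ])))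
   (≤-trans (Σ-mono λ x → subst₂ (λ u v → [ P u ∧ Y v ] ≤ [ (P x ∧ true) ∧ not (X (x ⊹ z)) ]) (group 1 x g0 (:~ :~ g0)) (group 2 x z (g0 :+ g1) (g1 :- :~ g0))
     (bool³ (λ a b c → [ a ∧ (not b ∧ c) ]) (λ a b c → [ (a ∧ true) ∧ not b ]) (P x) (X (x ⊹ z)) (not (X (x ⊹ z ⊖ d)))))
    (m≤m+n _ _)))
  ... | false | true = ≤-trans (m⊓n≤m (r z) e) (≤-trans (≡⇒≤ (sym (Σ-neg λ x → [ negate P x ∧ Y (z ⊖ x) ])))
   (≤-trans (Σ-mono λ x → subst₂ (λ u v → [ P u ∧ (not (X (z ⊖ (⊝ x))) ∧ not (X v)) ] ≤ [ (P x ∧ true) ∧ not (X (x ⊹ (z ⊖ d))) ]) (group 1 x g0 (:~ :~ g0)) (group 3 x z d (g0 :+ (g1 :- g2)) (g1 :- :~ g0 :- g2))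
     (bool³ (λ a b c → [ a ∧ (c ∧ not b) ]) (λ a b c → [ (a ∧ true) ∧ not b ]) (P x) (X (x ⊹ (z ⊖ d))) (not (X (z ⊖ (⊝ x))))))
    (m≤n+m _ _)))
  escapes₁ : Σ escape₁ ≤ e * e
  escapes₁ = ≤-trans (≡⇒≤ (Σ-swap λ z x → [ (P x ∧ F z) ∧ not (X (x ⊹ z)) ])) (few E)
  escapes₂ : Σ escape₂ ≤ e * e
  escapes₂ = ≤-trans (≡⇒≤ (Σ-unshift d escape₁)) escapes₁
  upper : Σ (λ z → r z ⊓ e) ≤ # W * e + (Σ escape₁ + Σ escape₂)
  upper = subst (λ t → Σ (λ z → r z ⊓ e) ≤ t + (Σ escape₁ + Σ escape₂)) (Σ-*ʳ e λ z → [ W z ])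
   (Σ-≤ ((λ z → r z ⊓ e) ∷ []) ((λ z → [ W z ] * e) ∷ escape₁ ∷ escape₂ ∷ []) pointwise)
  P≤ : # P ≤ # X + e
  P≤ = left≤X E 1≤e e≤F
  lower : e * (# P + # Y) ≤ Σ (λ z → r z ⊓ e) + e * e
  lower = subst (λ t → e * (t + # Y) ≤ Σ (λ z → r z ⊓ e) + e * e) (#-negate P)
   (pollard e (negate P) Y e≤Y (subst (e ≤_) (sym (#-negate P)) e≤P)
    (lin 8 (# (negate P)) (# Y) p e (# P) (# X) (width (∁ X) d) (# (∁ X)) 0 (v0 :+ v1) (v2 :+ v3) (eqn v0 v4 (#-negate P) (hyp v4 (v5 :+ v3) P≤ (eqn (v1 :+ v6) v7 (cut+width (∁ X) d) (eqn (v5 :+ v7) v2 (#-∁ X) []))))))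
  robust : # P + # Y ≤ # W + 3 * e
  robust = cancelˡ e 1≤e (lin 7 e (# P) (# Y) (# W) (Σ (λ z → r z ⊓ e)) (Σ escape₁) (Σ escape₂) 0 (v0 :* (v1 :+ v2)) (v0 :* (v3 :+ k3 :* v0)) (hyp (v0 :* (v1 :+ v2)) (v4 :+ v0 :* v0) lower (hyp v4 (v3 :* v0 :+ (v5 :+ v6)) upper (hyp v5 (v0 :* v0) escapes₁ (hyp v6 (v0 :* v0) escapes₂ [])))))

 -- Cutting `F` and `X` by the same `d` at most doubles the bad pairs, and by `width-transfer` `X`
 -- loses nearly as much as `F`. If the complement of `X` overlaps its translate in fewer than `e`
 -- elements, the width of `X` is nearly the size of that complement, and `room` gives the bound
 -- directly.
 extremal-cut : ∀ {P F X e} → Extremal P F X e → 1 ≤ e → e ≤ # F → e ≤ # P → # F + # X ≤ p →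
         ∀ d → Extremal P (cut F d) (cut X d) (5 * e)
 extremal-cut {P} {F} {X} {e} E 1≤e e≤F e≤P room d = extremal size
  (lin 4 (bad P (cut F d) (cut X d)) e (bad P F X) (bad P (λ y → F (y ⊖ d)) (λ z → X (z ⊖ d))) 0 v0 (k5 :* v1 :* (k5 :* v1)) (hyp v0 (v2 :+ v3) bads (eqn v3 v2 shifted (hyp* 2 v2 (v1 :* v1) (few E) []))))
  where
  size : # (cut X d) ≤ # P + # (cut F d) + 5 * e
  size with ≤-<-connex e (# (cut (∁ X) d))
  ... | inj₁ e≤Y = (lin 8 (# (cut X d)) (# P) (# (cut F d)) e (width F d) (width X d) (# X) (# F) 0 v0 (v1 :+ v2 :+ k5 :* v3) (hyp v4 (v5 :+ k4 :* v3) (width-transfer E 1≤e e≤F e≤P d e≤Y) (eqn (v0 :+ v5) v6 (cut+width X d) (eqn⁻ (v2 :+ v4) v7 (cut+width F d) (hyp v6 (v1 :+ v7 :+ v3) (small E) [])))))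
  ... | inj₂ Y<e = (lin 11 (# (cut X d)) (# P) (# (cut F d)) e (# (cut (∁ X) d)) (width (∁ X) d) (# (∁ X)) (width X d) (# X) p (# F) 0 v0 (v1 :+ v2 :+ k5 :* v3) (hyp (1+ v4) v3 Y<e (eqn⁻ (v4 :+ v5) v6 (cut+width (∁ X) d) (eqn v5 v7 (width-∁ X d) (eqn⁻ (v8 :+ v6) v9 (#-∁ X) (eqn (v0 :+ v7) v8 (cut+width X d) (hyp v8 (v1
   :+ v10 :+ v3) (small E) (hyp (v10 :+ v8) v9 room []))))))))
  shifted : bad P (λ y → F (y ⊖ d)) (λ z → X (z ⊖ d)) ≡ bad P F X
  shifted = Σ-cong λ x → trans (Σ-cong λ y → cong (λ z → [ (P x ∧ F (y ⊖ d)) ∧ not (X z) ]) (group 3 x y d (g0 :+ g1 :- g2) (g0 :+ (g1 :- g2))))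
   (Σ-unshift d (λ y → [ (P x ∧ F y) ∧ not (X (x ⊹ y)) ]))
  case : ∀ a f f' x x' → [ (a ∧ (f ∧ f')) ∧ not (x ∧ x') ] ≤ [ (a ∧ f) ∧ not x ] + [ (a ∧ f') ∧ not x' ]
  case a f f' true x' = ≤-trans (bool⁴ (λ a f f' x' → [ (a ∧ (f ∧ f')) ∧ not x' ]) (λ a f f' x' → [ (a ∧ f') ∧ not x' ]) a f f' x') (m≤n+m _ _)
  case a f f' false x' = ≤-trans (bool³ (λ a f f' → [ (a ∧ (f ∧ f')) ∧ true ]) (λ a f f' → [ (a ∧ f) ∧ true ]) a f f') (m≤m+n _ _)
  bads : bad P (cut F d) (cut X d) ≤ bad P F X + bad P (λ y → F (y ⊖ d)) (λ z → X (z ⊖ d))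
  bads = Σ-≤ ((λ x → # λ y → (P x ∧ cut F d y) ∧ not (cut X d (x ⊹ y))) ∷ [])
        ((λ x → # λ y → (P x ∧ F y) ∧ not (X (x ⊹ y))) ∷ (λ x → # λ y → (P x ∧ F (y ⊖ d)) ∧ not (X (x ⊹ y ⊖ d))) ∷ []) λ x →
      Σ-≤ ((λ y → [ (P x ∧ cut F d y) ∧ not (cut X d (x ⊹ y)) ]) ∷ [])
        ((λ y → [ (P x ∧ F y) ∧ not (X (x ⊹ y)) ]) ∷ (λ y → [ (P x ∧ F (y ⊖ d)) ∧ not (X (x ⊹ y ⊖ d)) ]) ∷ []) λ y →
      case (P x) (F y) (F (y ⊖ d)) (X (x ⊹ y)) (X (x ⊹ y ⊖ d))

 -- Shrinking one summand of an extremal triple.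

 Σ-square : ∀ (f : G → ℕ) → Σ f * Σ f ≡ Σ λ x → Σ λ y → f x * f y
 Σ-square f = trans (sym (Σ-*ʳ (Σ f) f)) (Σ-cong λ x → sym (Σ-* (f x) f))

 energy : ∀ P F → Σ (λ z → rep P F z * rep P F z) ≡ Σ λ x → Σ λ y → [ P x ∧ P y ] * # (cut F (y ⊖ x))
 energy P F = begin
  Σ (λ z → rep P F z * rep P F z)
   ≡⟨ Σ-cong (λ z → Σ-square λ x → [ P x ∧ F (z ⊖ x) ]) ⟩
  Σ (λ z → Σ λ x → Σ λ y → [ P x ∧ F (z ⊖ x) ] * [ P y ∧ F (z ⊖ y) ])
   ≡⟨ Σ-swap (λ z x → Σ λ y → [ P x ∧ F (z ⊖ x) ] * [ P y ∧ F (z ⊖ y) ]) ⟩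
  Σ (λ x → Σ λ z → Σ λ y → [ P x ∧ F (z ⊖ x) ] * [ P y ∧ F (z ⊖ y) ])
   ≡⟨ Σ-cong (λ x → trans (Σ-swap λ z y → [ P x ∧ F (z ⊖ x) ] * [ P y ∧ F (z ⊖ y) ]) (Σ-cong (inner x))) ⟩
  Σ (λ x → Σ λ y → [ P x ∧ P y ] * # (cut F (y ⊖ x))) ∎
  where
  open ≡-Reasoning
  case : ∀ a b c d → [ a ∧ b ] * [ c ∧ d ] ≡ [ a ∧ c ] * [ b ∧ d ]
  case a b c d = ≤-antisym (bool⁴ (λ a b c d → [ a ∧ b ] * [ c ∧ d ]) (λ a b c d → [ a ∧ c ] * [ b ∧ d ]) a b c d)
               (bool⁴ (λ a b c d → [ a ∧ c ] * [ b ∧ d ]) (λ a b c d → [ a ∧ b ] * [ c ∧ d ]) a b c d)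
  inner : ∀ x y → Σ (λ z → [ P x ∧ F (z ⊖ x) ] * [ P y ∧ F (z ⊖ y) ]) ≡ [ P x ∧ P y ] * # (cut F (y ⊖ x))
  inner x y = trans (Σ-cong λ z → case (P x) (F (z ⊖ x)) (P y) (F (z ⊖ y))) (trans (Σ-* [ P x ∧ P y ] _)
   (cong ([ P x ∧ P y ] *_) (trans (Σ-cong λ z → cong (λ t → [ F (z ⊖ x) ∧ F t ]) (group 3 z y x (g0 :- g1) (g0 :- g2 :- (g1 :- g2))))
    (Σ-unshift x λ z → [ cut F (y ⊖ x) z ]))))

 2ab≤a²+b² : ∀ a b → 2 * (a * b) ≤ a * a + b * b
 2ab≤a²+b² a b with ≤-total a b
 ... | inj₁ a≤b = (lin 3 a b (b ∸ a) 0 (k2 :* (v0 :* v1)) (v0 :* v0 :+ v1 :* v1) (mul v0 v1 (v0 :+ v2) (≡⇒≤ (sym (+∸ a≤b))) (mul v1 (v0 :+ v2) v1 (≡⇒≤ (+∸ a≤b)) (mul v2 (v0 :+ v2) v1 (≡⇒≤ (+∸ a≤b)) []))))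
 ... | inj₂ b≤a = (lin 3 a b (a ∸ b) 0 (k2 :* (v0 :* v1)) (v0 :* v0 :+ v1 :* v1) (mul v0 (v1 :+ v2) v0 (≡⇒≤ (+∸ b≤a)) (mul v1 v0 (v1 :+ v2) (≡⇒≤ (sym (+∸ b≤a))) (mul v2 (v1 :+ v2) v0 (≡⇒≤ (+∸ b≤a)) []))))

 -- The sums concentrate on `X`, of size `O(# P)`, so the additive energy is of order
 -- `# P * # F * # F`. If all overlaps at nonzero shifts were smaller than claimed, the identity
 -- `energy` could not reach this.
 popular-difference : ∀ {P F X e} → Extremal P F X e → e ≤ # F → 8 * e ≤ # P → # F ≤ # P → 16 ≤ # F →
  ∃ λ d → d ≢ 𝟘 × # F * # F ≤ # P * # (cut F d) * 64
 popular-difference {P} {F} {X} {e} E e≤F 8e≤P F≤P 16≤F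
  with Finₚ.any? (λ d → ¬? (d ≟ᴳ 𝟘) ×-dec (# F * # F ℕ.≤? # P * # (cut F d) * 64))
 ... | yes found = found
 ... | no none = (absurd (lin 5 n m e En (# X) 21 k1 k0 (mul (k8 :* v0) (k8 :* v1 :* (v0 :* v1)) (k8 :* v1 :* (v2 :* v2) :+ (v3 :* & 16 :+ v1 :* v1 :* v4)) lower (hyp* 2 (v0 :* & 64 :* v3) (v0 :* (v0 :* v1 :* & 64 :+ v0 :* (v1 :* v1))) upper (mul (k8 :* v0 :* (v1 :* v1)) v4 (v0 :+ v1 :+ v2) (small E) (mul (k8 :* v0 :*
  (v1 :* v1)) v2 v1 e≤F (mul* 2 (k8 :* v0 :* (v1 :* v1)) v1 v0 F≤P (mul (k8 :* v0 :* (v1 :* v2)) (k8 :* v2) v0 8e≤P (mul (k8 :* v0 :* (v1 :* v0)) v2 v1 e≤F (mul* 8 (v0 :* v0 :* v1) (& 16) v1 16≤F (hyp* 22 k1 (v0 :* v0 :* v1 :* v1) nonzero [])))))))))))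
  where
  n = # P
  m = # F
  En = Σ λ z → rep P F z * rep P F z
  nonzero : 1 ≤ n * n * m * m
  nonzero = *-mono-≤ (*-mono-≤ (*-mono-≤ n≥1 n≥1) m≥1) m≥1
   where
   m≥1 : 1 ≤ m
   m≥1 = ≤-trans (s≤s z≤n) 16≤F
   n≥1 : 1 ≤ n
   n≥1 = ≤-trans m≥1 F≤P
  rare : ∀ d → d ≢ 𝟘 → n * # (cut F d) * 64 ≤ m * m
  rare d d≢0 = <⇒≤ (≰⇒> λ le → none (d , d≢0 , le))
  lower : 8 * m * (n * m) ≤ 8 * m * (e * e) + (En * 16 + m * m * # X)
  lower = ≤-trans (*-monoʳ-≤ (8 * m) reps) (≤-trans (≡⇒≤ (*-distribˡ-+ (8 * m) (e * e) _)) (+-monoʳ-≤ (8 * m * (e * e)) covered))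
   where
   RX = Σ λ z → [ X z ] * rep P F z
   reps : n * m ≤ e * e + RX
   reps = ≤-trans (≡⇒≤ (sym (Σ-rep P F))) (≤-trans
    (Σ-≤ (rep P F ∷ []) ((λ z → [ not (X z) ] * rep P F z) ∷ (λ z → [ X z ] * rep P F z) ∷ []) (λ z → case (X z) (rep P F z)))
    (+-monoˡ-≤ RX (≤-trans (≡⇒≤ escaped) (few E))))
    where
    case : ∀ b r → r ≤ [ not b ] * r + [ b ] * r
    case true r = ≡⇒≤ (sym (+0 r))
    case false r = ≡⇒≤ (sym (trans (+0 (r + 0)) (+0 r)))
    swap : ∀ a b c → [ c ] * [ a ∧ b ] ≡ [ (a ∧ b) ∧ c ]
    swap true true c = *1 [ c ]
    swap true false c = *0 [ c ]
    swap false b c = *0 [ c ]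
    escaped : Σ (λ z → [ not (X z) ] * rep P F z) ≡ bad P F X
    escaped = trans (Σ-cong λ z → sym (Σ-* [ not (X z) ] λ x → [ P x ∧ F (z ⊖ x) ])) (trans
     (Σ-swap λ z x → [ not (X z) ] * [ P x ∧ F (z ⊖ x) ]) (Σ-cong λ x → trans
     (sym (Σ-shift x λ z → [ not (X z) ] * [ P x ∧ F (z ⊖ x) ])) (Σ-cong λ y →
     trans (cong₂ (λ u v → [ not (X u) ] * [ P x ∧ F v ]) (⊹-comm y x) (group 2 y x (g0 :+ g1 :- g1) g0)) (swap (P x) (F y) (not (X (x ⊹ y)))))))
   covered : 8 * m * RX ≤ En * 16 + m * m * # X
   covered = subst₂ _≤_ (Σ-* (8 * m) λ z → [ X z ] * rep P F z)
    (trans (Σ-+ (λ z → rep P F z * rep P F z * 16) (λ z → m * m * [ X z ])) (cong₂ _+_ (Σ-*ʳ 16 λ z → rep P F z * rep P F z) (Σ-* (m * m) λ z → [ X z ])))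
    (Σ-mono λ z → case (X z) (rep P F z))
    where
    case : ∀ b r → 8 * m * ([ b ] * r) ≤ r * r * 16 + m * m * [ b ]
    -- Cauchy-Schwarz in linear form: `8 m r ≤ 16 r² + m²` is `(4 r - m)² ≥ 0`.
    case true r = (lin 2 m r 0 (k8 :* v0 :* (k1 :* v1)) (v1 :* v1 :* & 16 :+ v0 :* v0 :* k1) (hyp (k2 :* (k4 :* v1 :* v0)) (k4 :* v1 :* (k4 :* v1) :+ v0 :* v0) (2ab≤a²+b² (4 * r) m) []))
    case false r = ≤-trans (≡⇒≤ (*0 (8 * m))) z≤n
  upper : n * 64 * En ≤ n * (n * m * 64 + n * (m * m))
  upper = begin
   n * 64 * En
    ≡⟨ cong (n * 64 *_) (energy P F) ⟩
   n * 64 * (Σ λ x → Σ λ y → [ P x ∧ P y ] * # (cut F (y ⊖ x)))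
    ≡⟨ Σ-* (n * 64) (λ x → Σ λ y → [ P x ∧ P y ] * # (cut F (y ⊖ x))) ⟨
   Σ (λ x → n * 64 * Σ λ y → [ P x ∧ P y ] * # (cut F (y ⊖ x)))
    ≤⟨ Σ-mono row ⟩
   Σ (λ x → [ P x ] * (n * m * 64 + n * (m * m)))
    ≡⟨ Σ-*ʳ (n * m * 64 + n * (m * m)) ([_] ∘ P) ⟩
   n * (n * m * 64 + n * (m * m)) ∎
   where
   open ≤-Reasoning
   row : ∀ x → n * 64 * Σ (λ y → [ P x ∧ P y ] * # (cut F (y ⊖ x))) ≤ [ P x ] * (n * m * 64 + n * (m * m))
   row x with P x
   ... | false = ≤-trans (≡⇒≤ (trans (cong (n * 64 *_) (Σ-zero p)) (*0 (n * 64)))) z≤n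
   ... | true = ≤-trans (≡⇒≤ (sym (Σ-* (n * 64) λ y → [ P y ] * # (cut F (y ⊖ x)))))
    (≤-trans (Σ-≤ ((λ y → n * 64 * ([ P y ] * # (cut F (y ⊖ x)))) ∷ []) ((λ y → [ δ y x ] * (n * m * 64)) ∷ (λ y → [ P y ] * (m * m)) ∷ []) entry)
    (≡⇒≤ (trans (cong₂ _+_ (Σ-δ (λ _ → n * m * 64) x) (Σ-*ʳ (m * m) λ y → [ P y ])) (sym (+0 _)))))
    where
    r≤m : ∀ d → # (cut F d) ≤ m
    r≤m d = Σ-mono λ x → bool² (λ a b → [ a ∧ b ]) (λ a b → [ a ]) (F x) (F (x ⊖ d))
    entry : ∀ y → n * 64 * ([ P y ] * # (cut F (y ⊖ x))) ≤ [ δ y x ] * (n * m * 64) + [ P y ] * (m * m)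
    entry y with P y | y Finₚ.≟ x
    ... | false | _ = ≤-trans (≡⇒≤ (*0 (n * 64))) z≤n
    ... | true | yes _ = (lin 3 n c m 0 (v0 :* & 64 :* (k1 :* v1)) (k1 :* (v0 :* v2 :* & 64) :+ k1 :* (v2 :* v2)) (mul* 64 v0 v1 v2 (r≤m (y ⊖ x)) []))
     where c = # (cut F (y ⊖ x))
    ... | true | no y≢x = (lin 3 n c m 0 (v0 :* & 64 :* (k1 :* v1)) (k0 :* (v0 :* v2 :* & 64) :+ k1 :* (v2 :* v2)) (hyp (v0 :* v1 :* & 64) (v2 :* v2) (rare (y ⊖ x) (λ eq → y≢x (trans (group 2 y x g0 (g0 :- g1 :+ g1)) (trans (cong (_⊹ x) eq) (⊹-identityˡ x))))) []))
     where c = # (cut F (y ⊖ x))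

 Σ-cut : ∀ F → Σ (λ d → # (cut F d)) ≡ # F * # F
 Σ-cut F = trans (Σ-swap λ d x → [ F x ∧ F (x ⊖ d) ]) (trans (Σ-cong λ x →
  trans (Σ-cong λ d → ⟨⟩-∧ (F x) (F (x ⊖ d))) (trans (Σ-* [ F x ] λ d → [ F (x ⊖ d) ]) (cong ([ F x ] *_) (Σ-reflect x λ y → [ F y ]))))
  (Σ-*ʳ (# F) λ x → [ F x ]))

 -- If no overlap had intermediate size, the translations with large overlap would form a subgroup.
 middle-overlap : ∀ {P F X e} → Extremal P F X e → e ≤ # F → 8 * e ≤ # P → # F ≤ # P → 16 ≤ # F → 4 * # F < 3 * p →
  ∃ λ d → # F * # F ≤ # P * # (cut F d) * 64 × 4 * # (cut F d) ≤ 3 * # F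
 middle-overlap {P} {F} {X} {e} E e≤F 8e≤P F≤P 16≤F 4F<3p
  with Finₚ.any? (λ d → (# F * # F ℕ.≤? # P * # (cut F d) * 64) ×-dec (4 * # (cut F d) ℕ.≤? 3 * # F))
 ... | yes found = found
 ... | no none with popular-difference E e≤F 8e≤P F≤P 16≤F
 ... | d , d≢0 , popular = ⊥-elim (<⇒≱ 4F<3p (*-cancelʳ-≤ (3 * p) (4 * # F) (# F) {{ℕ.>-nonZero (≤-trans (s≤s z≤n) 16≤F)}} full))
  where
  m = # F
  Large : G → Set
  Large x = 3 * m < 4 * # (cut F x)
  large-d : Large d
  large-d = ≰⇒> λ le → none (d , popular , le)
  step : ∀ x → Large x → Large (x ⊹ d)
  step x large-x = ≰⇒> λ le → none (x ⊹ d , (lin 3 m (# P) (# (cut F (x ⊹ d))) 31 (v0 :* v0) (v1 :* v2 :* & 64) (mul (v1 :* & 32) v0 (k2 :* v2) half (mul* 32 v0 v0 v1 F≤P []))) , le)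
   where
   half : m ≤ 2 * # (cut F (x ⊹ d))
   half = (lin 7 m (# (cut F (x ⊹ d))) (width F (x ⊹ d)) (width F x) (width F d) (# (cut F x)) (# (cut F d)) 1 v0 (k2 :* v1) (hyp* 4 v2 (v3 :+ v4) (width-+ F x d) (eqn* 4 (v5 :+ v3) v0 (cut+width F x) (eqn* 4 (v6 :+ v4) v0 (cut+width F d) (eqn⁻* 4 (v1 :+ v2) v0 (cut+width F (x ⊹ d)) (hyp (1+ (k3 :* v0)) (k4 :* v5)
    large-x (hyp (1+ (k3 :* v0)) (k4 :* v6) large-d [])))))))
  all-large : ∀ x → Large x
  all-large = closed⇒full Large d d≢0 step d large-d
  full : 3 * p * m ≤ 4 * m * m
  full = (lin 3 p m (Σ (λ x → # (cut F x))) 0 (k3 :* v0 :* v1) (k4 :* v1 :* v1) (hyp (v0 :* (k3 :* v1)) (k4 :* v2) (subst₂ _≤_ (Σ-const p (3 * m)) (Σ-* 4 λ x → # (cut F x)) (Σ-mono λ x → <⇒≤ (all-large x))) (eqn* 4 v2 (v1 :* v1) (Σ-cut F) [])))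

 -- `thick` keeps `F` well above the error `e`; `thin` makes it small enough to measure radii in
 -- steps of its size.
 record Shrunk (h e : ℕ) (P : G → Bool) : Set where
  constructor shrunk
  field
   F X : G → Bool
   extremal-pair : Extremal P F X e
   thin : h * # F ≤ # P
   thick : # P ≤ h * h * # F * 64

 5^ : ℕ → ℕ
 5^ = 5 ℕ.^_

 5^≥1 : ∀ k → 1 ≤ 5^ k
 5^≥1 zero = ≤-refl
 5^≥1 (suc k) = *-mono-≤ {1} {5} (s≤s z≤n) (5^≥1 k)

 -- Each cut keeps at most 3/4 of `F` and multiplies the error by 5. While `h * # F > # P`, it also
 -- keeps at least the proportion `# F / 64 # P` of `F`, so `F` never falls below `# P / 64 h²`. The
 -- hypothesis comparing `3 ^ k` and `4 ^ k` says that `k` cuts suffice.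
 shrink : ∀ h k e {P F X} → Extremal P F X e → 1 ≤ h → 1 ≤ e → h * h * (5^ k * e) * 1024 ≤ # P → # F ≤ # P →
  # F + # X ≤ p → 4 * # P < 3 * p → # P ≤ h * h * # F * 64 → h * # F * 3 ℕ.^ k ≤ # P * 4 ℕ.^ k →
  ∃ λ j → Shrunk h (5^ j * e) P × j ≤ k
 shrink h zero e {P} {F} {X} E 1≤h 1≤e big F≤P room 4P<3p thick thin = 0 ,
  shrunk F X (subst (Extremal P F X) (sym (+0 e)) E) (subst₂ _≤_ (*1 (h * # F)) (*1 (# P)) thin) thick , z≤n
 shrink h (suc k) e {P} {F} {X} E 1≤h 1≤e big F≤P room 4P<3p thick thin with ≤-<-connex (h * # F) (# P)
 ... | inj₁ hF≤P = 0 , shrunk F X (subst (Extremal P F X) (sym (+0 e)) E) hF≤P thick , z≤n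
 ... | inj₂ P<hF with middle-overlap E e≤F 8e≤P F≤P 16≤F (≤-<-trans (*-monoʳ-≤ 4 F≤P) 4P<3p)
  where
  hh≥1 : 1 ≤ h * h
  hh≥1 = *-mono-≤ 1≤h 1≤h
  E≥e : e ≤ 5^ (suc k) * e
  E≥e = ≤-trans (≡⇒≤ (sym (*-identityˡ e))) (*-monoˡ-≤ e (5^≥1 (suc k)))
  big' : h * h * e * 1024 ≤ # P
  big' = ≤-trans (*-monoˡ-≤ 1024 (*-monoʳ-≤ (h * h) E≥e)) big
  16e≤F : e * 16 ≤ # F
  16e≤F = cancelˡ (h * h * 64) (lin 1 h 0 (1+ k0) (v0 :* v0 :* & 64) (hyp k1 (v0 :* v0) hh≥1 [])) (lin 4 h e (# F) (# P) 0 (v0 :* v0 :* & 64 :* (v1 :* & 16)) (v0 :* v0 :* & 64 :* v2) (hyp (v0 :* v0 :* v1 :* & 1024) v3 big' (hyp v3 (v0 :* v0 :* v2 :* & 64) thick [])))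
  e≤F : e ≤ # F
  e≤F = (lin 2 e (# F) 15 v0 v1 (hyp (v0 :* & 16) v1 16e≤F []))
  16≤F : 16 ≤ # F
  16≤F = (lin 2 (# F) e 0 (& 16) v0 (hyp (v1 :* & 16) v0 16e≤F (hyp* 16 k1 v1 1≤e [])))
  8e≤P : 8 * e ≤ # P
  8e≤P = (lin 3 e (# P) (# F) 1 (k8 :* v0) v1 (hyp (v0 :* & 16) v2 16e≤F (hyp v2 v1 F≤P [])))
 ... | d , lower , upper with shrink h k (5 * e) {P} {cut F d} {cut X d}
     (extremal-cut E 1≤e e≤F e≤P room d) 1≤h (lin 1 e 0 k1 (k5 :* v0) (hyp k1 v0 1≤e []))
     (lin 4 h (5^ k) e (# P) 0 (v0 :* v0 :* (v1 :* (k5 :* v2)) :* & 1024) v3 (hyp (v0 :* v0 :* (k5 :* v1 :* v2) :* & 1024) v3 big []))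
     (≤-trans cut≤ F≤P) (≤-trans (+-mono-≤ cut≤ cutX≤) room) 4P<3p thick' thin'
  where
  cut≤ : # (cut F d) ≤ # F
  cut≤ = Σ-mono λ x → bool² (λ a b → [ a ∧ b ]) (λ a b → [ a ]) (F x) (F (x ⊖ d))
  cutX≤ : # (cut X d) ≤ # X
  cutX≤ = Σ-mono λ x → bool² (λ a b → [ a ∧ b ]) (λ a b → [ a ]) (X x) (X (x ⊖ d))
  hh≥1 : 1 ≤ h * h
  hh≥1 = *-mono-≤ 1≤h 1≤h
  e≤big : h * h * e * 1024 ≤ # P
  e≤big = ≤-trans (*-monoˡ-≤ 1024 (*-monoʳ-≤ (h * h) (≤-trans (≡⇒≤ (sym (*-identityˡ e))) (*-monoˡ-≤ e (5^≥1 (suc k)))))) big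
  e≤P : e ≤ # P
  e≤P = (lin 3 e (# P) h 1023 v0 v1 (mul (v0 :* & 1024) k1 (v2 :* v2) hh≥1 (hyp (v2 :* v2 :* v0 :* & 1024) v1 e≤big [])))
  e≤F : e ≤ # F
  e≤F = cancelˡ (h * h * 64) (lin 1 h 0 (1+ k0) (v0 :* v0 :* & 64) (hyp k1 (v0 :* v0) hh≥1 []))
   (lin 4 h e (# F) (# P) 15 (v0 :* v0 :* & 64 :* v1) (v0 :* v0 :* & 64 :* v2) (hyp (v0 :* v0 :* v1 :* & 1024) v3 e≤big (hyp v3 (v0 :* v0 :* v2 :* & 64) thick [])))
  P>0 : 1 ≤ # P
  P>0 = ≤-trans 1≤e e≤P
  thick' : # P ≤ h * h * # (cut F d) * 64
  thick' = cancelˡ (# P) P>0 (lin 4 (# P) h (# (cut F d)) (# F) 0 (v0 :* v0) (v0 :* (v1 :* v1 :* v2 :* & 64)) (mul (v1 :* v1) (v3 :* v3) (v0 :* v2 :* & 64) lower (mul v0 v0 (v1 :* v3) (<⇒≤ P<hF) (mul (v1 :* v3) v0 (v1 :* v3) (<⇒≤ P<hF) []))))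
  thin' : h * # (cut F d) * 3 ℕ.^ k ≤ # P * 4 ℕ.^ k
  thin' = *-cancelˡ-≤ 4 (lin 6 h (# (cut F d)) (3 ℕ.^ k) (# P) (4 ℕ.^ k) (# F) 0 (k4 :* (v0 :* v1 :* v2)) (k4 :* (v3 :* v4)) (mul (v0 :* v2) (k4 :* v1) (k3 :* v5) upper (hyp (v0 :* v5 :* (k3 :* v2)) (v3 :* (k4 :* v4)) thin [])))
 ... | j , S , j≤k = suc j , subst (λ t → Shrunk h t P) (linEq 2 (5^ j) e (v0 :* (k5 :* v1)) (k5 :* v0 :* v1) 0 [] 0 []) S , s≤s j≤k

 #-full : ∀ {S : G → Bool} → (∀ x → T (S x)) → # S ≡ p
 #-full {S} all = trans (Σ-cong λ x → T⇒⟨⟩ (all x)) (trans (Σ-const p 1) (*1 p))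

 -- Cauchy-Davenport, norms and the growth of their balls.

 rep≤⊞ : ∀ U V z → rep U V z ⊓ 1 ≤ [ (U ⊞ V) z ]
 rep≤⊞ U V z with rep U V z in eq
 ... | zero = z≤n
 ... | suc r with Σ-pos⇒∃ (λ x → U x ∧ V (z ⊖ x)) (≤-trans (s≤s z≤n) (≡⇒≤ (sym eq)))
 ... | x , t = ≤-trans (m⊓n≤n (suc r) 1) (≡⇒≤ (sym (T⇒⟨⟩ (subst (T ∘ (U ⊞ V)) (group 2 x z (g0 :+ (g1 :- g0)) g1) (⊞-intro U V (T-∧ˡ t) (T-∧ʳ {U x} t))))))

 -- Pollard's theorem at `t = 1`; if the sizes exceed `p` together, every `z - V` meets `U` by the
 -- pigeonhole principle.
 cauchy-davenport : ∀ U V → 1 ≤ # U → 1 ≤ # V → # U + # V ≤ # (U ⊞ V) + 1 ⊎ p ≤ # (U ⊞ V)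
 cauchy-davenport U V 1≤U 1≤V with ≤-<-connex (# U + # V) p
 ... | inj₁ le = inj₁ (lin 4 (# U) (# V) (# (U ⊞ V)) (Σ (λ z → rep U V z ⊓ 1)) 0 (v0 :+ v1) (v2 :+ k1) (hyp (k1 :* (v0 :+ v1)) (v3 :+ k1) (pollard 1 U V 1≤V 1≤U (≤-trans le (m≤m+n p 1))) (hyp v3 v2 (Σ-mono (rep≤⊞ U V)) [])))
 ... | inj₂ gt = inj₂ (≡⇒≤ (sym (#-full all)))
  where
  all : ∀ z → T ((U ⊞ V) z)
  all z with Σ-pos⇒∃ (λ x → U x ∧ V (z ⊖ x)) (lin 5 (# (λ x → U x ∧ V (z ⊖ x))) p (# U) (# V) (# (λ x → V (z ⊖ x))) 0 k1 v0 (hyp (1+ v1) (v2 :+ v3) gt (eqn⁻ v4 v3 (Σ-reflect z ([_] ∘ V)) (hyp (v2 :+ v4) (v1 :+ v0) (≤-trans (Σ-≤ (([_] ∘ U) ∷ (λ x → [ V (z ⊖ x) ]) ∷ []) ((λ _ → 1) ∷ (λ x → [ U x ∧ V (z ⊖ x) ]) ∷ []) (λ x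
   → bool² (λ a b → [ a ] + [ b ]) (λ a b → 1 + [ a ∧ b ]) (U x) (V (z ⊖ x)))) (≡⇒≤ (cong (_+ # (λ x → U x ∧ V (z ⊖ x))) (trans (Σ-const p 1) (*1 p))))) []))))
  ... | x , t = subst (T ∘ (U ⊞ V)) (group 2 x z (g0 :+ (g1 :- g0)) g1) (⊞-intro U V (T-∧ˡ t) (T-∧ʳ {U x} t))

 ball : (G → ℕ) → ℕ → G → Bool
 ball w t x = w x ≤ᵇ t

 record IsNorm (w : G → ℕ) : Set where
  field
   zero-norm : w 𝟘 ≡ 0
   sym-norm : ∀ x → w (⊝ x) ≡ w x
   triangle : ∀ x y → w (x ⊹ y) ≤ w x + w y

 -- Balls grow at the rate of intervals of integers, up to an error E, at all radii up to T.
 record Linear (w : G → ℕ) (R E : ℕ) : Set where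
  field
   is-norm : IsNorm w
   growth-lower : ∀ t → t ≤ R → 2 * t ≤ # (ball w t) + E
   growth-upper : ∀ t → t ≤ R → # (ball w t) ≤ 2 * t + E
  open IsNorm is-norm public

 width-norm : ∀ S → IsNorm (width S)
 width-norm S = record { zero-norm = width-0 S ; sym-norm = width-sym S ; triangle = width-+ S }

 ball-⊞ : ∀ {w} → IsNorm w → ∀ s t → ball w s ⊞ ball w t ⊑ ball w (s + t)
 ball-⊞ {w} N s t z zt with ⊞-elim (ball w s) (ball w t) z zt
 ... | x , sx , ty = ≤⇒≤ᵇ (≤-trans (subst (λ y → w y ≤ w x + w (z ⊖ x)) (group 2 x z (g0 :+ (g1 :- g0)) g1) (IsNorm.triangle N x (z ⊖ x)))
  (+-mono-≤ (≤ᵇ⇒≤ (w x) s sx) (≤ᵇ⇒≤ (w (z ⊖ x)) t ty)))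

 ball-nonempty : ∀ {w} → IsNorm w → ∀ t → 1 ≤ # (ball w t)
 ball-nonempty {w} N t = ≤-trans (≡⇒≤ (sym (T⇒⟨⟩ (≤⇒≤ᵇ (≤-trans (≡⇒≤ (IsNorm.zero-norm N)) z≤n))))) (term≤Σ ([_] ∘ ball w t) 𝟘)

 ball-mono : ∀ w {s t} → s ≤ t → ball w s ⊑ ball w t
 ball-mono w {s} s≤t x sx = ≤⇒≤ᵇ (≤-trans (≤ᵇ⇒≤ (w x) s sx) s≤t)

 ball-superadditive : ∀ {w} → IsNorm w → ∀ s t →
  # (ball w s) + # (ball w t) ≤ # (ball w (s + t)) + 1 ⊎ p ≤ # (ball w (s + t))
 ball-superadditive {w} N s t
  with cauchy-davenport (ball w s) (ball w t) (ball-nonempty N s) (ball-nonempty N t)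
 ... | inj₁ le = inj₁ (≤-trans le (+-monoˡ-≤ 1 (#-mono (ball-⊞ N s t))))
 ... | inj₂ le = inj₂ (≤-trans le (#-mono (ball-⊞ N s t)))

 -- Differences of elements of `F` are mostly short for the width of `P`: they give a ball of radius
 -- about `m` with about `2 m` elements. Its multiples determine the growth at all larger scales, up
 -- to errors governed by `m` and `e`.
 module Growth {P F X e} (E : Extremal P F X e) (1≤e : 1 ≤ e) (e<F : e < # F) where

  n m M : ℕ
  n = # P
  m = # F
  M = m + 3 * e

  w : G → ℕ
  w = width P

  N : IsNorm w
  N = width-norm P

  good : G → Bool
  good f = F f ∧ (missing-from P X f ≤ᵇ e)

  m≤good+e : m ≤ # good + e
  m≤good+e = (lin 4 m (# good) e (# (λ f → F f ∧ not (missing-from P X f ≤ᵇ e))) 0 v0 (v1 :+ v2) (hyp v0 (v1 :+ v3) (Σ-≤ (([_] ∘ F) ∷ []) (([_] ∘ good) ∷ (λ f → [ F f ∧ not (missing-from P X f ≤ᵇ e) ]) ∷ []) (λ f → bool² (λ a b → [ a ]) (λ a b → [ a ∧ b ] + [ a ∧ not b ]) (F f) (missing-from P X f ≤ᵇ e))) (hyp v3 v2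
   few-poor [])))
   where
   few-poor : # (λ f → F f ∧ not (missing-from P X f ≤ᵇ e)) ≤ e
   few-poor = cancelˡ e 1≤e (≤-trans (≡⇒≤ (sym (Σ-* e λ f → [ F f ∧ not (missing-from P X f ≤ᵇ e) ])))
    (≤-trans (Σ-mono poor) (subst (_≤ e * e) (bad-swap P F X) (few E))))
    where
    poor : ∀ f → e * [ F f ∧ not (missing-from P X f ≤ᵇ e) ] ≤ [ F f ] * missing-from P X f
    poor f with F f | missing-from P X f ≤ᵇ e in eq
    ... | false | _ = ≤-trans (≡⇒≤ (*0 e)) z≤n
    ... | true | true = ≤-trans (≡⇒≤ (*0 e)) z≤n
    ... | true | false = (lin 2 e (missing-from P X f) 0 (v0 :* k1) (k1 :* v1) (hyp (1+ v0) v1 (≰⇒> (λ le → subst T eq (≤⇒≤ᵇ le))) []))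

  -- Both `P + f` and `P + g` lie in `X` up to `e` elements, and `X` has only `m + e` elements more
  -- than `P`.
  good-difference : ∀ f g → T (good f) → T (good g) → w (g ⊖ f) ≤ M
  good-difference f g gf gg = (lin 8 (w (g ⊖ f)) m e (# (λ x → P x ∧ not (X (x ⊹ f)))) (# (λ z → X z ∧ not (P (z ⊖ g)))) (# (λ x → P x ∧ not (X (x ⊹ g)))) n (# X) 0 v0 (v1 :+ k3 :* v2) (hyp v0 (v3 :+ v4) first (hyp v3 v2 (≤ᵇ⇒≤ (missing-from P X f) e (T-∧ʳ {F f} gf)) (hyp v5 v2 (≤ᵇ⇒≤ (missing-from P X g) e (T-∧ʳ {F g}
   gg)) (hyp (v4 :+ v6) (v7 :+ v5) second (hyp v7 (v6 :+ v1 :+ v2) (small E) []))))))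
   where
   first : w (g ⊖ f) ≤ # (λ x → P x ∧ not (X (x ⊹ f))) + # (λ z → X z ∧ not (P (z ⊖ g)))
   first = subst (λ t → w (g ⊖ f) ≤ # (λ x → P x ∧ not (X (x ⊹ f))) + t)
    (trans (Σ-cong λ x → cong (λ y → [ X (x ⊹ f) ∧ not (P y) ]) (group 3 x g f (g0 :- (g1 :- g2)) (g0 :+ g2 :- g1))) (Σ-shift f λ z → [ X z ∧ not (P (z ⊖ g)) ]))
    (Σ-≤ ((λ x → [ P x ∧ not (P (x ⊖ (g ⊖ f))) ]) ∷ []) ((λ x → [ P x ∧ not (X (x ⊹ f)) ]) ∷ (λ x → [ X (x ⊹ f) ∧ not (P (x ⊖ (g ⊖ f))) ]) ∷ [])
     λ x → bool³ (λ a b c → [ a ∧ not c ]) (λ a b c → [ a ∧ not b ] + [ b ∧ not c ]) (P x) (X (x ⊹ f)) (P (x ⊖ (g ⊖ f))))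
   second : # (λ z → X z ∧ not (P (z ⊖ g))) + n ≤ # X + # (λ x → P x ∧ not (X (x ⊹ g)))
   second = subst₂ (λ s t → # (λ z → X z ∧ not (P (z ⊖ g))) + s ≤ # X + t) (Σ-unshift g λ z → [ P z ])
    (trans (Σ-cong λ x → cong (λ y → [ P (x ⊖ g) ∧ not (X y) ]) (group 2 x g g0 (g0 :- g1 :+ g1))) (Σ-unshift g λ x → [ P x ∧ not (X (x ⊹ g)) ]))
    (Σ-≤ ((λ z → [ X z ∧ not (P (z ⊖ g)) ]) ∷ (λ z → [ P (z ⊖ g) ]) ∷ []) (([_] ∘ X) ∷ (λ z → [ P (z ⊖ g) ∧ not (X z) ]) ∷ [])
     λ z → bool² (λ a b → [ a ∧ not b ] + [ b ]) (λ a b → [ a ] + [ b ∧ not a ]) (X z) (P (z ⊖ g)))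

  1≤good : 1 ≤ # good
  1≤good = (lin 3 (# good) m e 0 k1 v0 (hyp v1 (v0 :+ v2) m≤good+e (hyp (1+ v2) v1 e<F [])))

  first-ball : 2 * # good ≤ # (ball w M) + 1 ⊎ p ≤ # (ball w M)
  first-ball with cauchy-davenport (negate good) good (subst (1 ≤_) (sym (#-negate good)) 1≤good) 1≤good
  ... | inj₁ le = inj₁ (lin 4 (# good) (# (ball w M)) (# (negate good)) (# (negate good ⊞ good)) 0 (k2 :* v0) (v1 :+ k1) (hyp (v2 :+ v0) (v3 :+ k1) le (eqn⁻ v2 v0 (#-negate good) (hyp v3 v1 (#-mono inside) []))))
   where
   inside : negate good ⊞ good ⊑ ball w M
   inside z t with ⊞-elim (negate good) good z t
   ... | x , gx , gz = ≤⇒≤ᵇ (subst (λ y → w y ≤ M) (group 2 z x (g0 :- g1 :- :~ g1) g0) (good-difference (⊝ x) (z ⊖ x) gx gz))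
  ... | inj₂ le = inj₂ (≤-trans le (#-mono inside))
   where
   inside : negate good ⊞ good ⊑ ball w M
   inside z t with ⊞-elim (negate good) good z t
   ... | x , gx , gz = ≤⇒≤ᵇ (subst (λ y → w y ≤ M) (group 2 z x (g0 :- g1 :- :~ g1) g0) (good-difference (⊝ x) (z ⊖ x) gx gz))

  ball-multiple : ∀ j → j * (2 * # good) ≤ # (ball w (j * M)) + 2 * j ⊎ p ≤ # (ball w (j * M))
  ball-multiple zero = inj₁ z≤n
  ball-multiple (suc j) with first-ball | ball-multiple j | ball-superadditive N M (j * M)
  ... | _ | _ | inj₂ full = inj₂ full
  ... | inj₂ full | _ | inj₁ _ = inj₂ (≤-trans full (#-mono (ball-mono w (m≤m+n M (j * M)))))
  ... | inj₁ _ | inj₂ full | inj₁ _ = inj₂ (≤-trans full (#-mono (ball-mono w (m≤n+m (j * M) M))))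
  ... | inj₁ a | inj₁ b | inj₁ c = inj₁ (lin 5 j (# good) (# (ball w (M + j * M))) (# (ball w M)) (# (ball w (j * M))) 0 ((1+ v0) :* (k2 :* v1)) (v2 :+ k2 :* (1+ v0)) (hyp (k2 :* v1) (v3 :+ k1) a (hyp (v0 :* (k2 :* v1)) (v4 :+ k2 :* v0) b (hyp (v3 :+ v4) (v2 :+ k1) c []))))

  -- `D` absorbs the rounding of a radius to a multiple of `M` and the `O(e)` lost at each of the
  -- `j` steps.
  module _ (D : ℕ) (fine : ∀ j → j * M ≤ n → 2 * M + e * j * 10 ≤ D) (room : 2 * n + D + 3 ≤ p) (n≥1 : 1 ≤ n) where

   instance
    M≢0 : NonZero M
    M≢0 = ℕ.>-nonZero (lin 2 m e 0 (1+ k0) (v0 :+ k3 :* v1) (hyp k1 v1 1≤e []))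

   lower : ∀ t → t ≤ n → 2 * t ≤ # (ball w t) + D
   lower t t≤n with ball-multiple (t / M)
   ... | inj₂ full = (lin 6 t (# (ball w t)) D p (# (ball w (t / M * M))) n 0 (k2 :* v0) (v1 :+ v2) (hyp v3 v4 full (hyp v4 v1 (#-mono (ball-mono w jM≤t)) (hyp (k2 :* v5 :+ v2 :+ k3) v3 room (hyp* 2 v0 v5 t≤n [])))))
    where
    jM≤t : t / M * M ≤ t
    jM≤t = (lin 4 (t / M) M t (t % M) 0 (v0 :* v1) v2 (eqn⁻ v2 (v3 :+ v0 :* v1) (m≡m%n+[m/n]*n t M) []))
   ... | inj₁ le = (lin 10 t (# (ball w t)) D j (# good) (# (ball w (j * M))) M e (t % M) m 0 (k2 :* v0) (v1 :+ v2) (hyp (v3 :* (k2 :* v4)) (v5 :+ k2 :* v3) le (hyp v5 v1 (#-mono (ball-mono w jM≤t)) (hyp (k2 :* v6 :+ v7 :* v3 :* & 10) v2 (fine j (≤-trans jM≤t t≤n)) (eqn* 2 v0 (v8 :+ v3 :* v6) (m≡m%n+[m/n]*n t M) (hyp*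
    2 (1+ v8) v6 (m%n<n t M) (mul* 2 v3 v9 (v4 :+ v7) m≤good+e (eqn* 2 (v3 :* v6) (v3 :* v9 :+ k3 :* (v3 :* v7)) jM (mul* 2 v3 k1 v7 1≤e [])))))))))
    where
    j = t / M
    jM≤t : j * M ≤ t
    jM≤t = (lin 4 j M t (t % M) 0 (v0 :* v1) v2 (eqn⁻ v2 (v3 :+ v0 :* v1) (m≡m%n+[m/n]*n t M) []))
    jM : j * M ≡ j * m + 3 * (j * e)
    jM = (linEq 3 j m e (v0 :* (v1 :+ k3 :* v2)) (v0 :* v1 :+ k3 :* (v0 :* v2)) 0 [] 0 [])

   count-above : ∀ k a → a ≤ k → # {k} (λ t → a ≤ᵇ toℕ t) + a ≡ k
   count-above zero zero _ = trans (+0 _) (Σ-empty _)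
   count-above (suc k) zero _ = trans (+0 _) (trans (Σ-const (suc k) 1) (*1 (suc k)))
   count-above (suc k) (suc a) (s≤s a≤k) = trans (cong (_+ suc a) (trans (Σ-suc λ t → [ suc a ≤ᵇ toℕ t ]) (Σ-cong λ t → cong [_] (shift a (toℕ t)))))
    (trans (+-suc _ a) (cong suc (count-above k a a≤k)))
    where
    shift : ∀ a b → (suc a ≤ᵇ suc b) ≡ (a ≤ᵇ b)
    shift zero b = refl
    shift (suc a) b = refl

   w≤n : ∀ x → w x ≤ n
   w≤n x = (lin 3 (w x) n (# (cut P x)) 0 v0 v1 (eqn (v2 :+ v0) v1 (cut+width P x) []))

   -- Over the radii below `n`, an element `x` is counted `n - w x` times, which is the overlap of
   -- `P` with its translate; the overlaps add up to `n * n`.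
   total-growth : Σ {n} (λ t → # (ball w (toℕ t))) ≡ n * n
   total-growth = trans (Σ-swap λ t x → [ ball w (toℕ t) x ]) (trans (Σ-cong λ x →
    +-cancelʳ-≡ (w x) _ _ (trans (count-above n (w x) (w≤n x)) (sym (cut+width P x)))) (Σ-cut P))

   triangular : ∀ k → 2 * Σ {k} toℕ + k ≡ k * k
   triangular zero = cong (λ t → 2 * t + 0) (Σ-empty _)
   triangular (suc k) = (linEq 4 (Σ {suc k} toℕ) k (Σ {k} (λ t → suc (toℕ t))) (Σ {k} toℕ) (k2 :* v0 :+ (1+ v1)) ((1+ v1) :* (1+ v1)) 0 (eqn* 2 v0 (k0 :+ v2) (Σ-suc {k} toℕ) (eqn* 2 v2 (v1 :+ v3) (trans (Σ-+ (λ _ → 1) (toℕ {k})) (cong (_+ Σ {k} toℕ) (trans (Σ-const k 1) (*1 k)))) (eqn (k2 :* v3 :+ v1) (v1 :* v1)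
    (triangular k) []))) 0 (eqn⁻* 2 v0 (k0 :+ v2) (Σ-suc {k} toℕ) (eqn⁻* 2 v2 (v1 :+ v3) (trans (Σ-+ (λ _ → 1) (toℕ {k})) (cong (_+ Σ {k} toℕ) (trans (Σ-const k 1) (*1 k)))) (eqn⁻ (k2 :* v3 :+ v1) (v1 :* v1) (triangular k) []))))

   -- The lower bounds nearly exhaust `total-growth`. By superadditivity an excess at `t₀` would
   -- persist at all larger radii, and over the at least `n / 2` radii from `t₀` on it would exceed
   -- what is left.
   upper : ∀ t → 2 * t ≤ n → # (ball w t) ≤ 2 * t + (2 * D + 3)
   upper t₀ 2t₀≤n with ≤-<-connex (# (ball w t₀)) (2 * t₀ + (2 * D + 3))
   ... | inj₁ le = le
   ... | inj₂ gt = (absurd (lin 9 (Σ {n} (λ t → 2 * toℕ t)) (Σ {n} (λ t → [ t₀ ≤ᵇ toℕ t ] * (2 * D + 3))) (Σ {n} (λ t → # (ball w (toℕ t)))) (Σ {n} (λ _ → D)) (Σ {n} toℕ) n D (# {n} (λ t → t₀ ≤ᵇ toℕ t)) t₀ 0 k1 k0 (hyp* 2 (v0 :+ v1) (v2 :+ v3) summed (eqn⁻* 2 v0 (k2 :* v4) (Σ-* {n} 2 toℕ) (eqn⁻* 2 (k2 :* v4 :+ v5) (v5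
    :* v5) (triangular n) (eqn* 2 v2 (v5 :* v5) total-growth (eqn* 2 v3 (v5 :* v6) (Σ-const n D) (eqn⁻* 2 v1 (v7 :* (k2 :* v6 :+ k3)) (Σ-*ʳ (2 * D + 3) (λ (t : Fin n) → [ t₀ ≤ᵇ toℕ t ])) (mul* 2 (k2 :* v6 :+ k3) v5 (v7 :+ v8) (≡⇒≤ (sym (count-above n t₀ t₀≤n))) (mul (k2 :* v6 :+ k3) (k2 :* v8) v5 2t₀≤n (hyp k1 v5 n≥1
    [])))))))))))
    where
    t₀≤n : t₀ ≤ n
    t₀≤n = (lin 2 t₀ n 1 v0 v1 (hyp (k2 :* v0) v1 2t₀≤n []))
    pointwise : ∀ (t : Fin n) → 2 * toℕ t + [ t₀ ≤ᵇ toℕ t ] * (2 * D + 3) ≤ # (ball w (toℕ t)) + D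
    pointwise t with t₀ ≤ᵇ toℕ t in eq
    ... | false = (lin 3 (toℕ t) D (# (ball w (toℕ t))) 0 (k2 :* v0 :+ k0 :* (k2 :* v1 :+ k3)) (v2 :+ v1) (hyp (k2 :* v0) (v2 :+ v1) (lower (toℕ t) (<⇒≤ (Finₚ.toℕ<n t))) []))
    ... | true with ball-superadditive N t₀ (toℕ t ∸ t₀)
    ... | inj₁ le = (lin 7 (toℕ t) D (# (ball w (toℕ t))) (# (ball w t₀)) (# (ball w (toℕ t ∸ t₀))) t₀ (toℕ t ∸ t₀) 0 (k2 :* v0 :+ k1 :* (k2 :* v1 :+ k3)) (v2 :+ v1) (hyp (v3 :+ v4) (v2 :+ k1) (subst (λ s → # (ball w t₀) + # (ball w (toℕ t ∸ t₀)) ≤ # (ball w s) + 1) (+∸ t₀≤t) le) (hyp (1+ (k2 :* v5 :+ (k2 :* v1 :+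
     k3))) v3 gt (hyp (k2 :* v6) (v4 :+ v1) (lower (toℕ t ∸ t₀) (≤-trans (m∸n≤m (toℕ t) t₀) (<⇒≤ (Finₚ.toℕ<n t)))) (eqn⁻* 2 (v5 :+ v6) v0 (+∸ t₀≤t) [])))))
     where
     t₀≤t : t₀ ≤ toℕ t
     t₀≤t = ≤ᵇ⇒≤ t₀ (toℕ t) (T! eq)
    ... | inj₂ full = (lin 5 (toℕ t) D (# (ball w (toℕ t))) p n 0 (k2 :* v0 :+ k1 :* (k2 :* v1 :+ k3)) (v2 :+ v1) (hyp v3 v2 (subst (λ s → p ≤ # (ball w s)) (+∸ t₀≤t) full) (hyp (k2 :* v4 :+ v1 :+ k3) v3 room (hyp* 2 (1+ v0) v4 (Finₚ.toℕ<n t) []))))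
     where
     t₀≤t : t₀ ≤ toℕ t
     t₀≤t = ≤ᵇ⇒≤ t₀ (toℕ t) (T! eq)
    summed : Σ {n} (λ t → 2 * toℕ t) + Σ {n} (λ t → [ t₀ ≤ᵇ toℕ t ] * (2 * D + 3)) ≤ Σ {n} (λ t → # (ball w (toℕ t))) + Σ {n} (λ _ → D)
    summed = Σ-≤ ((λ t → 2 * toℕ t) ∷ (λ t → [ t₀ ≤ᵇ toℕ t ] * (2 * D + 3)) ∷ []) ((λ t → # (ball w (toℕ t))) ∷ (λ _ → D) ∷ []) pointwise

   linear : ∀ R → 2 * R ≤ n → Linear w R (2 * D + 3)
   linear R 2R≤n = record
    { is-norm = N
    ; growth-lower = λ t t≤R → (lin 3 t (# (ball w t)) D 0 (k2 :* v0) (v1 :+ (k2 :* v2 :+ k3)) (hyp (k2 :* v0) (v1 :+ v2) (lower t (≤-trans t≤R R≤n)) []))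
    ; growth-upper = λ t t≤R → upper t (≤-trans (*-monoʳ-≤ 2 t≤R) 2R≤n)
    }
    where
    R≤n : R ≤ n
    R≤n = (lin 2 R n 1 v0 v1 (hyp (k2 :* v0) v1 2R≤n []))

 -- Heights: the norm seen from a far point.

 disjoint⁴ : ∀ {a b c d e} → (T a → T e) → (T b → T e) → (T c → T e) → (T d → T e) →
  (T a → ¬ T b) → (T a → ¬ T c) → (T a → ¬ T d) → (T b → ¬ T c) → (T b → ¬ T d) → (T c → ¬ T d) →
  [ a ] + ([ b ] + ([ c ] + [ d ])) ≤ [ e ]
 disjoint⁴ {true} {true} _ _ _ _ ab _ _ _ _ _ = ⊥-elim (ab tt tt)
 disjoint⁴ {true} {false} {true} _ _ _ _ _ ac _ _ _ _ = ⊥-elim (ac tt tt)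
 disjoint⁴ {true} {false} {false} {true} _ _ _ _ _ _ ad _ _ _ = ⊥-elim (ad tt tt)
 disjoint⁴ {true} {false} {false} {false} a _ _ _ _ _ _ _ _ _ = ⟨⟩-mono a
 disjoint⁴ {false} {true} {true} _ _ _ _ _ _ _ bc _ _ = ⊥-elim (bc tt tt)
 disjoint⁴ {false} {true} {false} {true} _ _ _ _ _ _ _ _ bd _ = ⊥-elim (bd tt tt)
 disjoint⁴ {false} {true} {false} {false} _ b _ _ _ _ _ _ _ _ = ⟨⟩-mono b
 disjoint⁴ {false} {false} {true} {true} _ _ _ _ _ _ _ _ _ cd = ⊥-elim (cd tt tt)
 disjoint⁴ {false} {false} {true} {false} _ _ c _ _ _ _ _ _ _ = ⟨⟩-mono c
 disjoint⁴ {false} {false} {false} _ _ _ d _ _ _ _ _ _ = ⟨⟩-mono d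

 Σ-double : 2 < p → ∀ (f : G → ℕ) → Σ (λ x → f (x ⊹ x)) ≡ Σ f
 Σ-double 2<p f with inverse (residue 2) two≢0
  where
  two≢0 : residue 2 ≢ 𝟘
  two≢0 eq with trans (sym (m<n⇒m%n≡m 2<p)) (trans (sym (toℕ-residue 2)) (trans (cong toℕ eq) (trans (cong toℕ 𝟘-residue) (trans (toℕ-residue 0) (m<n⇒m%n≡m (≤-trans (s≤s z≤n) 2<p))))))
  ... | ()
 ... | u , u2≡1 = Σ-bij (λ x → x ⊹ x) (u •_) (λ y → trans (sym (•-distrib y)) (undo y)) undo f
  where
  •-distrib : ∀ y → u • (y ⊹ y) ≡ u • y ⊹ u • y
  •-distrib y = •-distrib-⊹ u y y
  undo : ∀ y → u • (y ⊹ y) ≡ y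
  undo y = begin
   u • (y ⊹ y) ≡⟨ cong (u •_) (cong₂ _⊹_ (sym y≡) (sym y≡)) ⟩
   u • (n • one ⊹ n • one) ≡⟨ cong (u •_) (•-+ n n one) ⟨
   u • (n + n) • one ≡⟨ cong (λ k → u • k • one) (linEq 1 n (v0 :+ v0) (v0 :* k2) 0 [] 0 []) ⟩
   u • (n * 2) • one ≡⟨ cong (u •_) (•-assoc n 2 one) ⟨
   u • n • 2 • one ≡⟨ •-assoc u n (2 • one) ⟩
   (u * n) • 2 • one ≡⟨ cong (_• 2 • one) (*-comm u n) ⟩
   (n * u) • 2 • one ≡⟨ •-assoc n u (2 • one) ⟨
   n • u • 2 • one ≡⟨ cong (λ t → n • u • t) (residue-• 2) ⟩
   n • u • residue 2 ≡⟨ cong (n •_) u2≡1 ⟩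
   n • one ≡⟨ y≡ ⟩
   y ∎
   where
   open ≡-Reasoning
   one = residue 1
   n = toℕ y
   y≡ : n • one ≡ y
   y≡ = trans (residue-• n) (residue-toℕ y)

 -- The height of x above a far away point u is w (u ⊹ x) - w u; it is ± w x and approximately
 -- additive in x, because shells of the norm consist of two opposite pieces.
 module Heights {w R E} (L : Linear w R E) (3≤E : 3 ≤ E) (Δ : ℕ) (10Δ≤R : Δ * 10 ≤ R) (big : E * 1000 ≤ Δ) (2<p : 2 < p) where

  open Linear L

  w-sub : ∀ x y → w (x ⊖ y) ≤ w x + w y
  w-sub x y = subst (λ t → w (x ⊖ y) ≤ w x + t) (sym-norm y) (triangle x (⊝ y))

  -- Doubling permutes the group, so only as many elements have their double within `6 Δ` as the
  -- ball of that radius contains; the ball of radius `7 Δ` has more.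
  far-point : ∃ λ u → 6 * Δ < w (u ⊹ u) × w u ≤ 7 * Δ
  far-point with Σ-<⇒∃ (λ x → [ ball w (6 * Δ) (x ⊹ x) ]) (λ x → [ ball w (7 * Δ) x ])
   (lin 5 (# (λ x → ball w (6 * Δ) (x ⊹ x))) (# (ball w (7 * Δ))) (# (ball w (6 * Δ))) Δ E 41996 (1+ v0) v1 (eqn* 41997 v0 v2 (Σ-double 2<p (λ x → [ ball w (6 * Δ) x ])) (hyp* 41997 v2 (k2 :* (k6 :* v3) :+ v4) (growth-upper (6 * Δ) (lin 2 Δ R 4 (k6 :* v0) v1 (hyp* 3 (v0 :* & 10) v1 10Δ≤R []))) (hyp* 36004 (k2 :* (k7
    :* v3)) (v1 :+ v4) (growth-lower (7 * Δ) (lin 2 Δ R 9 (k7 :* v0) v1 (hyp* 7 (v0 :* & 10) v1 10Δ≤R []))) (hyp* 92 (v4 :* & 1000) v3 big (hyp* 13999 k3 v4 3≤E []))))))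
  ... | u , lt with ball w (6 * Δ) (u ⊹ u) in near | ball w (7 * Δ) u in ok
  ... | false | true = u , ≰⇒> (λ le → subst T near (≤⇒≤ᵇ le)) , ≤ᵇ⇒≤ (w u) (7 * Δ) (T! ok)
  ... | false | false = ⊥-elim (n≮0 lt)
  ... | true | false = ⊥-elim (n≮0 lt)
  ... | true | true = ⊥-elim (<-irrefl refl lt)

  -- `u` is far from `- u`, so the pieces of a shell near the two points are disjoint.
  record Base (u : G) : Set where
   constructor base
   field
    far : 4 * Δ < w (u ⊹ u)
    near : w u ≤ 8 * Δ
   deep : 2 * Δ < w u
   deep = ≰⇒> λ le → (absurd (lin 3 (w u) Δ (w (u ⊹ u)) 0 k1 k0 (hyp* 2 v0 (k2 :* v1) le (hyp (1+ (k4 :* v1)) v2 far (hyp v2 (v0 :+ v0) (triangle u u) [])))))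

  -- Otherwise balls at `u`, `- u` and `v` and the ball inside the shell would be disjoint parts of
  -- the outer ball. The ball of radius `3 E` at `v` tips the count: it adds about `6 E` elements,
  -- while the five growth estimates lose `5 E`.
  shell : ∀ u → Base u → ∀ v a → a ≤ Δ → w v ≤ w u + a → w u ≤ w v + a →
      w (v ⊖ u) ≤ a + 6 * E ⊎ w (v ⊹ u) ≤ a + 6 * E
  shell u B v a a≤Δ v≤ u≤ with ≤-<-connex (w (v ⊖ u)) (a + 6 * E) | ≤-<-connex (w (v ⊹ u)) (a + 6 * E)
  ... | inj₁ le | _ = inj₁ le
  ... | inj₂ _ | inj₁ le = inj₂ le
  ... | inj₂ v-u | inj₂ v+u = (absurd (lin 11 (# (λ x → ball w a' (x ⊖ u))) (# (λ x → ball w a' (x ⊹ u))) (# (λ x → ball w b (x ⊖ v))) (# (ball w inner)) (# (ball w outer)) (# (ball w a')) (# (ball w b)) a E inner (w u) 0 k1 k0 (hyp (v0 :+ (v1 :+ (v2 :+ v3))) v4 counted (eqn⁻ v0 v5 (Σ-unshift u ([_] ∘ ball w a')) (eqn⁻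
   v1 v5 (Σ-shift u ([_] ∘ ball w a')) (eqn⁻ v2 v6 (Σ-unshift v ([_] ∘ ball w b)) (hyp* 2 (k2 :* (v7 :+ k3 :* v8)) (v5 :+ v8) (growth-lower a' (lin 4 a E R Δ 9999 (v0 :+ k3 :* v1) v2 (hyp* 1003 (v3 :* & 10) v2 10Δ≤R (hyp* 10000 v0 v3 a≤Δ (hyp* 30 (v1 :* & 1000) v3 big []))))) (hyp (k2 :* (k3 :* v8)) (v6 :+ v8)
   (growth-lower b (lin 3 E R Δ 9999 (k3 :* v0) v1 (hyp* 3 (v2 :* & 10) v1 10Δ≤R (hyp* 30 (v0 :* & 1000) v2 big [])))) (hyp (k2 :* v9) (v3 :+ v8) (growth-lower inner (lin 6 inner R a E (w u) Δ 4 v0 v1 (eqn* 5 (v0 :+ (1+ (v2 :+ k3 :* v3))) v4 inner≡ (hyp* 5 v4 (k8 :* v5) (Base.near B) (hyp* 4 (v5 :* & 10) v1 10Δ≤R [])))))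
   (hyp v4 (k2 :* (v10 :+ (v7 :+ k3 :* v8)) :+ v8) (growth-upper outer (lin 5 (w u) a E R Δ 9999 (v0 :+ (v1 :+ k3 :* v2)) v3 (hyp* 10000 v0 (k8 :* v4) (Base.near B) (hyp* 9003 (v4 :* & 10) v3 10Δ≤R (hyp* 10000 v1 v4 a≤Δ (hyp* 30 (v2 :* & 1000) v4 big [])))))) (eqn⁻* 2 (v9 :+ (1+ (v7 :+ k3 :* v8))) v10 inner≡ (hyp k3 v8
   3≤E []))))))))))))
   where
   a' b inner outer : ℕ
   a' = a + 3 * E
   b = 3 * E
   inner = w u ∸ (1 + a')
   outer = w u + a'
   inner≡ : inner + (1 + a') ≡ w u
   inner≡ = m∸n+n≡m (lin 4 a E (w u) Δ 999 (1+ (v0 :+ k3 :* v1)) v2 (hyp* 1997 v0 v3 a≤Δ (hyp* 3 (v1 :* & 1000) v3 big (hyp* 1000 (1+ (k2 :* v3)) v2 (Base.deep B) []))))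
   counted : # (λ x → ball w a' (x ⊖ u)) + (# (λ x → ball w a' (x ⊹ u)) + (# (λ x → ball w b (x ⊖ v)) + # (ball w inner))) ≤ # (ball w outer)
   counted = Σ-≤ ((λ x → [ ball w a' (x ⊖ u) ]) ∷ (λ x → [ ball w a' (x ⊹ u) ]) ∷ (λ x → [ ball w b (x ⊖ v) ]) ∷ ([_] ∘ ball w inner) ∷ [])
    (([_] ∘ ball w outer) ∷ []) λ x →
    let
     A = λ t → ≤ᵇ⇒≤ (w (x ⊖ u)) a' t
     B' = λ t → ≤ᵇ⇒≤ (w (x ⊹ u)) a' t
     C = λ t → ≤ᵇ⇒≤ (w (x ⊖ v)) b t
     D = λ t → ≤ᵇ⇒≤ (w x) inner t
     x-u = subst (λ t → w t ≤ w (x ⊖ u) + w u) (group 2 x u (g0 :- g1 :+ g1) g0) (triangle (x ⊖ u) u)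
     x+u = subst (λ t → w t ≤ w (x ⊹ u) + w u) (group 2 x u (g0 :+ g1 :- g1) g0) (w-sub (x ⊹ u) u)
     x-v = subst (λ t → w t ≤ w (x ⊖ v) + w v) (group 2 x v (g0 :- g1 :+ g1) g0) (triangle (x ⊖ v) v)
     u-x = subst (λ t → w t ≤ w x + w (x ⊖ u)) (group 2 x u (g0 :- (g0 :- g1)) g1) (w-sub x (x ⊖ u))
     u+x = subst (λ t → w t ≤ w (x ⊹ u) + w x) (group 2 x u (g0 :+ g1 :- g0) g1) (w-sub (x ⊹ u) x)
     v-x = subst (λ t → w t ≤ w x + w (x ⊖ v)) (group 2 x v (g0 :- (g0 :- g1)) g1) (w-sub x (x ⊖ v))
     uu = subst (λ t → w t ≤ w (x ⊹ u) + w (x ⊖ u)) (group 2 x u (g0 :+ g1 :- (g0 :- g1)) (g1 :+ g1)) (w-sub (x ⊹ u) (x ⊖ u))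
     vu = subst (λ t → w t ≤ w (x ⊖ u) + w (x ⊖ v)) (group 3 x u v (g0 :- g1 :- (g0 :- g2)) (g2 :- g1)) (w-sub (x ⊖ u) (x ⊖ v))
     v+u' = subst (λ t → w t ≤ w (x ⊹ u) + w (x ⊖ v)) (group 3 x u v (g0 :+ g1 :- (g0 :- g2)) (g2 :+ g1)) (w-sub (x ⊹ u) (x ⊖ v))
    in disjoint⁴
     (λ t → ≤⇒≤ᵇ (lin 5 (w x) (w u) a E (w (x ⊖ u)) 0 v0 (v1 :+ (v2 :+ k3 :* v3)) (hyp v4 (v2 :+ k3 :* v3) (A t) (hyp v0 (v4 :+ v1) x-u []))))
     (λ t → ≤⇒≤ᵇ (lin 5 (w x) (w u) a E (w (x ⊹ u)) 0 v0 (v1 :+ (v2 :+ k3 :* v3)) (hyp v4 (v2 :+ k3 :* v3) (B' t) (hyp v0 (v4 :+ v1) x+u []))))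
     (λ t → ≤⇒≤ᵇ (lin 6 (w x) (w u) a E (w (x ⊖ v)) (w v) 0 v0 (v1 :+ (v2 :+ k3 :* v3)) (hyp v4 (k3 :* v3) (C t) (hyp v0 (v4 :+ v5) x-v (hyp v5 (v1 :+ v2) v≤ [])))))
     (λ t → ≤⇒≤ᵇ (lin 5 (w x) (w u) a E inner 0 v0 (v1 :+ (v2 :+ k3 :* v3)) (hyp v0 v4 (D t) (eqn (v4 :+ (1+ (v2 :+ k3 :* v3))) v1 inner≡ []))))
     (λ t s → (absurd (lin 6 (w (x ⊖ u)) a E (w (x ⊹ u)) (w (u ⊹ u)) Δ 499 k1 k0 (hyp* 500 v0 (v1 :+ k3 :* v2) (A t) (hyp* 500 v3 (v1 :+ k3 :* v2) (B' s) (hyp* 500 v4 (v3 :+ v0) uu (hyp* 500 (1+ (k4 :* v5)) v4 (Base.far B) (hyp* 1000 v1 v5 a≤Δ (hyp* 3 (v2 :* & 1000) v5 big [])))))))))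
     (λ t s → (absurd (lin 5 (w (x ⊖ u)) a E (w (x ⊖ v)) (w (v ⊖ u)) 0 k1 k0 (hyp v0 (v1 :+ k3 :* v2) (A t) (hyp v3 (k3 :* v2) (C s) (hyp v4 (v0 :+ v3) vu (hyp (1+ (v1 :+ k6 :* v2)) v4 v-u [])))))))
     (λ t s → (absurd (lin 6 (w (x ⊖ u)) a E (w x) inner (w u) 0 k1 k0 (hyp v0 (v1 :+ k3 :* v2) (A t) (hyp v3 v4 (D s) (eqn (v4 :+ (1+ (v1 :+ k3 :* v2))) v5 inner≡ (hyp v5 (v3 :+ v0) u-x [])))))))
     (λ t s → (absurd (lin 5 (w (x ⊹ u)) a E (w (x ⊖ v)) (w (v ⊹ u)) 0 k1 k0 (hyp v0 (v1 :+ k3 :* v2) (B' t) (hyp v3 (k3 :* v2) (C s) (hyp v4 (v0 :+ v3) v+u' (hyp (1+ (v1 :+ k6 :* v2)) v4 v+u [])))))))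
     (λ t s → (absurd (lin 6 (w (x ⊹ u)) a E (w x) inner (w u) 0 k1 k0 (hyp v0 (v1 :+ k3 :* v2) (B' t) (hyp v3 v4 (D s) (eqn (v4 :+ (1+ (v1 :+ k3 :* v2))) v5 inner≡ (hyp v5 (v0 :+ v3) u+x [])))))))
     (λ t s → (absurd (lin 7 (w (x ⊖ v)) E (w x) inner a (w u) (w v) 0 k1 k0 (hyp v0 (k3 :* v1) (C t) (hyp v2 v3 (D s) (eqn (v3 :+ (1+ (v4 :+ k3 :* v1))) v5 inner≡ (hyp v6 (v2 :+ v0) v-x (hyp v5 (v6 :+ v4) u≤ []))))))))

  up : ∀ u x → w (u ⊹ x) ≤ w u + w x
  up = triangle

  down : ∀ u x → w u ≤ w (u ⊹ x) + w x
  down u x = subst (λ t → w t ≤ w (u ⊹ x) + w x) (group 2 u x (g0 :+ g1 :- g1) g0) (w-sub (u ⊹ x) x)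

  Up Down : G → G → Set
  Up u x = w u + w x ≤ w (u ⊹ x) + 6 * E
  Down u x = w (u ⊹ x) + w x ≤ w u + 6 * E

  -- `shell` at `v = u + x`: being near `u` means that the height changed by almost `w x`, and being
  -- near `- u` contradicts `Base.far`.
  height-± : ∀ u → Base u → ∀ x → w x ≤ Δ → Up u x ⊎ Down u x
  height-± u B x x≤Δ with ≤-total (w u) (w (u ⊹ x))
  ... | inj₁ le with shell u B (u ⊹ x) (w (u ⊹ x) ∸ w u) (lin 5 (w (u ⊹ x) ∸ w u) Δ (w u) (w (u ⊹ x)) (w x) 0 v0 v1 (eqn (v2 :+ v0) v3 (+∸ le) (hyp v3 (v2 :+ v4) (up u x) (hyp v4 v1 x≤Δ [])))) (≡⇒≤ (sym (+∸ le))) (≤-trans le (m≤m+n _ _))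
  ... | inj₁ s = inj₁ (lin 5 (w u) (w x) (w (u ⊹ x)) E (w (u ⊹ x) ∸ w u) 0 (v0 :+ v1) (v2 :+ k6 :* v3) (hyp v1 (v4 :+ k6 :* v3) (subst (λ t → w t ≤ (w (u ⊹ x) ∸ w u) + 6 * E) (group 2 u x (g0 :+ g1 :- g0) g1) s) (eqn (v0 :+ v4) v2 (+∸ le) [])))
  ... | inj₂ s = (absurd (lin 8 (w (u ⊹ x ⊹ u)) (w (u ⊹ x) ∸ w u) E (w u) (w (u ⊹ x)) (w x) Δ (w (u ⊹ u)) 499 k1 k0 (hyp* 500 v0 (v1 :+ k6 :* v2) s (eqn* 500 (v3 :+ v1) v4 (+∸ le) (hyp* 500 v4 (v3 :+ v5) (up u x) (hyp* 1000 v5 v6 x≤Δ (hyp* 500 v7 (v0 :+ v5) (subst (λ t → w t ≤ w (u ⊹ x ⊹ u) + w x) (group 2 u x (g0 :+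
   g1 :+ g0 :- g1) (g0 :+ g0)) (w-sub (u ⊹ x ⊹ u) x)) (hyp* 500 (1+ (k4 :* v6)) v7 (Base.far B) (hyp* 3 (v2 :* & 1000) v6 big [])))))))))
  height-± u B x x≤Δ | inj₂ le with shell u B (u ⊹ x) (w u ∸ w (u ⊹ x)) (lin 5 (w u ∸ w (u ⊹ x)) Δ (w (u ⊹ x)) (w u) (w x) 0 v0 v1 (eqn (v2 :+ v0) v3 (+∸ le) (hyp v3 (v2 :+ v4) (down u x) (hyp v4 v1 x≤Δ [])))) (≤-trans le (m≤m+n _ _)) (≡⇒≤ (sym (+∸ le)))
  ... | inj₁ s = inj₂ (lin 5 (w (u ⊹ x)) (w x) (w u) E (w u ∸ w (u ⊹ x)) 0 (v0 :+ v1) (v2 :+ k6 :* v3) (hyp v1 (v4 :+ k6 :* v3) (subst (λ t → w t ≤ (w u ∸ w (u ⊹ x)) + 6 * E) (group 2 u x (g0 :+ g1 :- g0) g1) s) (eqn (v0 :+ v4) v2 (+∸ le) [])))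
  ... | inj₂ s = (absurd (lin 8 (w (u ⊹ x ⊹ u)) (w u ∸ w (u ⊹ x)) E (w (u ⊹ x)) (w u) (w x) Δ (w (u ⊹ u)) 499 k1 k0 (hyp* 500 v0 (v1 :+ k6 :* v2) s (eqn* 500 (v3 :+ v1) v4 (+∸ le) (hyp* 500 v4 (v3 :+ v5) (down u x) (hyp* 1000 v5 v6 x≤Δ (hyp* 500 v7 (v0 :+ v5) (subst (λ t → w t ≤ w (u ⊹ x ⊹ u) + w x) (group 2 u x (g0
   :+ g1 :+ g0 :- g1) (g0 :+ g0)) (w-sub (u ⊹ x ⊹ u) x)) (hyp* 500 (1+ (k4 :* v6)) v7 (Base.far B) (hyp* 3 (v2 :* & 1000) v6 big [])))))))))

  above below : G → ℕ → G → Bool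
  above u a x = ball w a x ∧ (suc (w u) ≤ᵇ w (u ⊹ x))
  below u a x = ball w a x ∧ (suc (w (u ⊹ x)) ≤ᵇ w u)

  module Levels (u : G) (B : Base u) where

   r = w u

   mirrored : ∀ (S : G → Bool) → # (λ x → S (⊝ x ⊖ u)) ≡ # S
   mirrored S = trans (Σ-neg λ x → [ S (x ⊖ u) ]) (Σ-unshift u λ x → [ S x ])

   apart : ∀ a x → a ≤ Δ → w (x ⊖ u) ≤ a → w (⊝ x ⊖ u) ≤ a → ⊥
   apart a x a≤Δ l r = (absurd (lin 5 (w (x ⊖ u)) a (w (⊝ x ⊖ u)) Δ (w (u ⊹ u)) 0 k1 k0 (hyp v0 v1 l (hyp v2 v1 r (hyp* 2 v1 v3 a≤Δ (hyp v4 (v0 :+ v2) (subst (_≤ w (x ⊖ u) + w (⊝ x ⊖ u)) (trans (cong w (group 2 x u (g0 :- g1 :+ (:~ g0 :- g1)) (:~ (g1 :+ g1)))) (sym-norm (u ⊹ u))) (triangle (x ⊖ u) (⊝ x ⊖ u))) (hyp (1+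
    (k4 :* v3)) v4 (Base.far B) [])))))))

   unfold : ∀ x → u ⊹ (x ⊖ u) ≡ x
   unfold x = (group 2 u x (g0 :+ (g1 :- g0)) g1)

   unfold⁻ : ∀ x → w (u ⊹ (⊝ x ⊖ u)) ≡ w x
   unfold⁻ x = trans (cong w (group 2 u x (g0 :+ (:~ g1 :- g0)) (:~ g1))) (sym-norm x)

   -- The elements going up occur twice in the annulus between radii `r` and `r + a`, at `u` and
   -- mirrored at `- u`, and the annulus has about `2 a` elements.
   above-bound : ∀ a → a ≤ Δ → # (above u a) ≤ a + E
   above-bound a a≤Δ = (lin 8 (# (above u a)) a E (# (λ x → above u a (x ⊖ u))) (# (λ x → above u a (⊝ x ⊖ u))) (# (ball w r)) (# (ball w (r + a))) r 1 v0 (v1 :+ v2) (hyp (v3 :+ (v4 :+ v5)) v6 counted (eqn⁻ v3 v0 (Σ-unshift u ([_] ∘ above u a)) (eqn⁻ v4 v0 (mirrored (above u a)) (hyp v6 (k2 :* (v7 :+ v1) :+ v2)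
    (growth-upper (r + a) (lin 4 r a R Δ 9 (v0 :+ v1) v2 (hyp* 10 v0 (k8 :* v3) (Base.near B) (hyp* 10 v1 v3 a≤Δ (hyp* 9 (v3 :* & 10) v2 10Δ≤R []))))) (hyp (k2 :* v7) (v5 :+ v2) (growth-lower r (lin 3 r R Δ 4 v0 v1 (hyp* 5 v0 (k8 :* v2) (Base.near B) (hyp* 4 (v2 :* & 10) v1 10Δ≤R [])))) []))))))
    where
    counted : # (λ x → above u a (x ⊖ u)) + (# (λ x → above u a (⊝ x ⊖ u)) + # (ball w r)) ≤ # (ball w (r + a))
    counted = Σ-≤ ((λ x → [ above u a (x ⊖ u) ]) ∷ (λ x → [ above u a (⊝ x ⊖ u) ]) ∷ ([_] ∘ ball w r) ∷ []) ((λ x → [ ball w (r + a) x ]) ∷ []) λ x →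
     let
      A = λ t → ≤ᵇ⇒≤ (w (x ⊖ u)) a (T-∧ˡ t)
      A' = λ (t : T (above u a (x ⊖ u))) → subst (λ y → r < w y) (unfold x) (≤ᵇ⇒≤ (suc r) _ (T-∧ʳ {ball w a (x ⊖ u)} t))
      C = λ t → ≤ᵇ⇒≤ (w (⊝ x ⊖ u)) a (T-∧ˡ t)
      C' = λ (t : T (above u a (⊝ x ⊖ u))) → subst (r <_) (unfold⁻ x) (≤ᵇ⇒≤ (suc r) _ (T-∧ʳ {ball w a (⊝ x ⊖ u)} t))
     in subst (λ t → [ above u a (x ⊖ u) ] + ([ above u a (⊝ x ⊖ u) ] + t) ≤ [ ball w (r + a) x ]) (+0 _) (disjoint⁴ {d = false}
      (λ t → ≤⇒≤ᵇ (≤-trans (subst (λ y → w y ≤ r + w (x ⊖ u)) (unfold x) (up u (x ⊖ u))) (+-monoʳ-≤ r (A t))))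
      (λ t → ≤⇒≤ᵇ (≤-trans (subst (_≤ r + w (⊝ x ⊖ u)) (unfold⁻ x) (up u (⊝ x ⊖ u))) (+-monoʳ-≤ r (C t))))
      (λ t → ≤⇒≤ᵇ (≤-trans (≤ᵇ⇒≤ (w x) r t) (m≤m+n r a))) (λ ())
      (λ t s → apart a x a≤Δ (A t) (C s)) (λ t s → <⇒≱ (A' t) (≤ᵇ⇒≤ (w x) r s)) (λ _ ())
      (λ t s → <⇒≱ (C' t) (≤ᵇ⇒≤ (w x) r s)) (λ _ ()) (λ _ ()))

   below-bound : ∀ a → a ≤ Δ → # (below u a) ≤ a + E
   below-bound a a≤Δ = (lin 10 (# (below u a)) a E (# (λ x → below u a (x ⊖ u))) (# (λ x → below u a (⊝ x ⊖ u))) (# (ball w inner)) (# (ball w outer)) outer inner r 1 v0 (v1 :+ v2) (hyp (v3 :+ (v4 :+ v5)) v6 counted (eqn⁻ v3 v0 (Σ-unshift u ([_] ∘ below u a)) (eqn⁻ v4 v0 (mirrored (below u a)) (hyp v6 (k2 :* v7 :+ v2)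
    (growth-upper outer (lin 4 outer R r Δ 4 v0 v1 (eqn* 5 (v0 :+ k1) v2 outer≡ (hyp* 5 v2 (k8 :* v3) (Base.near B) (hyp* 4 (v3 :* & 10) v1 10Δ≤R []))))) (hyp (k2 :* v8) (v5 :+ v2) (growth-lower inner (lin 5 inner R a r Δ 4 v0 v1 (eqn* 5 (v0 :+ (v2 :+ k1)) v3 inner≡ (hyp* 5 v3 (k8 :* v4) (Base.near B) (hyp* 4 (v4 :* & 10)
    v1 10Δ≤R []))))) (eqn⁻* 2 (v8 :+ (v1 :+ k1)) v9 inner≡ (eqn* 2 (v7 :+ k1) v9 outer≡ []))))))))
    where
    inner outer : ℕ
    inner = r ∸ (a + 1)
    outer = r ∸ 1
    inner≡ : inner + (a + 1) ≡ r
    inner≡ = m∸n+n≡m (lin 3 a r Δ 0 (v0 :+ k1) v1 (hyp (1+ (k2 :* v2)) v1 (Base.deep B) (hyp v0 v2 a≤Δ [])))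
    outer≡ : outer + 1 ≡ r
    outer≡ = m∸n+n≡m (lin 2 r Δ 0 k1 v0 (hyp (1+ (k2 :* v1)) v0 (Base.deep B) []))
    counted : # (λ x → below u a (x ⊖ u)) + (# (λ x → below u a (⊝ x ⊖ u)) + # (ball w inner)) ≤ # (ball w outer)
    counted = Σ-≤ ((λ x → [ below u a (x ⊖ u) ]) ∷ (λ x → [ below u a (⊝ x ⊖ u) ]) ∷ ([_] ∘ ball w inner) ∷ []) (([_] ∘ ball w outer) ∷ []) λ x →
     let
      A = λ t → ≤ᵇ⇒≤ (w (x ⊖ u)) a (T-∧ˡ t)
      A' = λ (t : T (below u a (x ⊖ u))) → subst (λ y → w y < r) (unfold x) (≤ᵇ⇒≤ _ r (T-∧ʳ {ball w a (x ⊖ u)} t))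
      C = λ t → ≤ᵇ⇒≤ (w (⊝ x ⊖ u)) a (T-∧ˡ t)
      C' = λ (t : T (below u a (⊝ x ⊖ u))) → subst (_< r) (unfold⁻ x) (≤ᵇ⇒≤ _ r (T-∧ʳ {ball w a (⊝ x ⊖ u)} t))
      du = subst (λ y → r ≤ w y + w (x ⊖ u)) (unfold x) (down u (x ⊖ u))
      du⁻ = subst (λ y → r ≤ y + w (⊝ x ⊖ u)) (unfold⁻ x) (down u (⊝ x ⊖ u))
     in subst (λ t → [ below u a (x ⊖ u) ] + ([ below u a (⊝ x ⊖ u) ] + t) ≤ [ ball w outer x ]) (+0 _) (disjoint⁴ {d = false}
      (λ t → ≤⇒≤ᵇ (lin 3 (w x) outer r 0 v0 v1 (hyp (1+ v0) v2 (A' t) (eqn⁻ (v1 :+ k1) v2 outer≡ []))))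
      (λ t → ≤⇒≤ᵇ (lin 3 (w x) outer r 0 v0 v1 (hyp (1+ v0) v2 (C' t) (eqn⁻ (v1 :+ k1) v2 outer≡ []))))
      (λ t → ≤⇒≤ᵇ (lin 5 (w x) outer inner r a 0 v0 v1 (hyp v0 v2 (≤ᵇ⇒≤ (w x) inner t) (eqn⁻ (v1 :+ k1) v3 outer≡ (eqn (v2 :+ (v4 :+ k1)) v3 inner≡ []))))) (λ ())
      (λ t s → apart a x a≤Δ (A t) (C s))
      (λ t s → (absurd (lin 5 (w (x ⊖ u)) a r (w x) inner 0 k1 k0 (hyp v0 v1 (A t) (hyp v2 (v3 :+ v0) du (hyp v3 v4 (≤ᵇ⇒≤ (w x) inner s) (eqn (v4 :+ (v1 :+ k1)) v2 inner≡ []))))))) (λ _ ())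
      (λ t s → (absurd (lin 5 (w (⊝ x ⊖ u)) a r (w x) inner 0 k1 k0 (hyp v0 v1 (C t) (hyp v2 (v3 :+ v0) du⁻ (hyp v3 v4 (≤ᵇ⇒≤ (w x) inner s) (eqn (v4 :+ (v1 :+ k1)) v2 inner≡ []))))))) (λ _ ()) (λ _ ()))

   -- Elements that keep the height are short by `height-±`, so they cost only a ball of radius
   -- `6 E`.
   sides : ∀ a → a ≤ Δ → 2 * a ≤ # (above u a) + # (below u a) + E * 14
   sides a a≤Δ = (lin 6 a (# (above u a)) (# (below u a)) E (# (ball w a)) (# (ball w (6 * E))) 0 (k2 :* v0) (v1 :+ v2 :+ v3 :* & 14) (hyp (k2 :* v0) (v4 :+ v3) (growth-lower a (lin 3 a R Δ 9 v0 v1 (hyp* 10 v0 v2 a≤Δ (hyp (v2 :* & 10) v1 10Δ≤R [])))) (hyp v4 (v1 :+ (v2 :+ v5)) (Σ-≤ (([_] ∘ ball w a) ∷ []) (([_] ∘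
    above u a) ∷ ([_] ∘ below u a) ∷ (λ x → [ ball w (6 * E) x ]) ∷ []) level) (hyp v5 (k2 :* (k6 :* v3) :+ v3) (growth-upper (6 * E) (lin 3 E R Δ 4999 (k6 :* v0) v1 (hyp* 30 (v0 :* & 1000) v2 big (hyp* 3 (v2 :* & 10) v1 10Δ≤R [])))) []))))
    where
    level : ∀ x → [ ball w a x ] ≤ [ above u a x ] + ([ below u a x ] + [ ball w (6 * E) x ])
    level x with ball w a x in eq
    ... | false = z≤n
    ... | true with suc r ≤ᵇ w (u ⊹ x) in hi
    ... | true = s≤s z≤n
    ... | false with suc (w (u ⊹ x)) ≤ᵇ r in lo
    ... | true = s≤s z≤n
    ... | false = ≡⇒≤ (sym (T⇒⟨⟩ (≤⇒≤ᵇ small-x)))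
     where
     hi' : w (u ⊹ x) ≤ r
     hi' = ≮⇒≥ λ lt → subst T hi (≤⇒≤ᵇ lt)
     lo' : r ≤ w (u ⊹ x)
     lo' = ≮⇒≥ λ lt → subst T lo (≤⇒≤ᵇ lt)
     small-x : w x ≤ 6 * E
     small-x with height-± u B x (≤-trans (≤ᵇ⇒≤ (w x) a (T! eq)) a≤Δ)
     ... | inj₁ h = (lin 4 (w x) E r (w (u ⊹ x)) 0 v0 (k6 :* v1) (hyp (v2 :+ v0) (v3 :+ k6 :* v1) h (hyp v3 v2 hi' [])))
     ... | inj₂ h = (lin 4 (w x) E (w (u ⊹ x)) r 0 v0 (k6 :* v1) (hyp (v2 :+ v0) (v3 :+ k6 :* v1) h (hyp v3 v2 lo' [])))

   -- At most about half of the ball of radius `b` goes up. So about `b` elements go down, more than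
   -- the radius `b - 18 E` can hold, and one of them has norm close to `b`.
   opposite-down : ∀ b → E * 30 ≤ b → b ≤ Δ → ∃ λ y → Down u y × w y ≤ b × b ≤ w y + E * 18
   opposite-down b 30E≤b b≤Δ with Σ-<⇒∃ (λ x → [ below u (b ∸ E * 18) x ]) ([_] ∘ below u b)
    (lin 6 (# (below u c)) (# (below u b)) c E b (# (above u b)) 2 (1+ v0) v1 (hyp* 3 v0 (v2 :+ v3) (below-bound c (≤-trans (m∸n≤m b (E * 18)) b≤Δ)) (hyp* 3 (k2 :* v4) (v5 :+ v1 :+ v3 :* & 14) (sides b b≤Δ) (hyp* 3 v5 (v4 :+ v3) (above-bound b b≤Δ) (eqn* 3 (v2 :+ v3 :* & 18) v4 c≡ (hyp k3 v3 3≤E []))))))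
    where
    c = b ∸ E * 18
    c≡ : c + E * 18 ≡ b
    c≡ = m∸n+n≡m (lin 2 E b 4 (v0 :* & 18) v1 (hyp* 3 (v0 :* & 30) v1 30E≤b []))
   ... | y , lt with ball w (b ∸ E * 18) y in small-y | ball w b y in y≤b | suc (w (u ⊹ y)) ≤ᵇ r in lo
   ... | _ | _ | false = ⊥-elim (no-gain _ _ lt)
    where
    no-gain : ∀ a b → [ a ∧ false ] < [ b ∧ false ] → ⊥
    no-gain a true ()
    no-gain a false ()
   ... | true | true | true = ⊥-elim (<-irrefl refl lt)
   ... | true | false | true = ⊥-elim (n≮0 lt)
   ... | false | false | true = ⊥-elim (n≮0 lt)
   ... | false | true | true = y , goes-down , wy≤b , (lin 4 b (w y) E (b ∸ E * 18) 0 v0 (v1 :+ v2 :* & 18) (hyp (1+ v3) v1 c<wy (eqn⁻ (v3 :+ v2 :* & 18) v0 c≡ [])))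
    where
    c≡ : (b ∸ E * 18) + E * 18 ≡ b
    c≡ = m∸n+n≡m (lin 2 E b 4 (v0 :* & 18) v1 (hyp* 3 (v0 :* & 30) v1 30E≤b []))
    c<wy : b ∸ E * 18 < w y
    c<wy = ≰⇒> λ le → subst T small-y (≤⇒≤ᵇ le)
    wy≤b : w y ≤ b
    wy≤b = ≤ᵇ⇒≤ (w y) b (T! y≤b)
    goes-down : Down u y
    goes-down with height-± u B y (≤-trans wy≤b b≤Δ)
    ... | inj₂ d = d
    ... | inj₁ h = (absurd (lin 6 r (w y) (w (u ⊹ y)) E (b ∸ E * 18) b 2 k1 k0 (hyp* 2 (v0 :+ v1) (v2 :+ k6 :* v3) h (hyp* 2 (1+ v2) v0 (≤ᵇ⇒≤ (suc (w (u ⊹ y))) r (T! lo)) (hyp (1+ v4) v1 c<wy (eqn⁻ (v4 :+ v3 :* & 18) v5 c≡ (hyp (v3 :* & 30) v5 30E≤b [])))))))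

 -- Near additivity of heights.

 module Additivity {w R E} (L : Linear w R E) (3≤E : 3 ≤ E) (Δ : ℕ) (10Δ≤R : Δ * 10 ≤ R) (big : E * 1000 ≤ Δ) (2<p : 2 < p) where

  open Linear L public
  open Heights L 3≤E Δ 10Δ≤R big 2<p public

  commuted : ∀ u x y → w (u ⊹ y ⊹ x) ≡ w (u ⊹ x ⊹ y)
  commuted u x y = cong w (group 3 u y x (g0 :+ g1 :+ g2) (g0 :+ g2 :+ g1))

  merged : ∀ u x y → w (u ⊹ (x ⊹ y)) ≡ w (u ⊹ x ⊹ y)
  merged u x y = cong w (group 3 u x y (g0 :+ (g1 :+ g2)) (g0 :+ g1 :+ g2))

  module NotBoth (u : G) (base-at : ∀ x → 2 * w x ≤ Δ → Base (u ⊹ x)) where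

   base-u : Base u
   base-u = subst Base (⊹-identityʳ u) (base-at 𝟘 (≤-trans (≡⇒≤ (cong (2 *_) zero-norm)) z≤n))

   open Levels u base-u using (opposite-down)

   close : ∀ x y y' → w (u ⊹ y) ≤ w (u ⊹ y') + (w (x ⊹ y) + w (x ⊹ y'))
   close x y y' = ≤-trans (subst (λ t → w t ≤ w (u ⊹ y') + w (x ⊹ y ⊖ (x ⊹ y'))) (group 4 u y' x y (g0 :+ g1 :+ (g2 :+ g3 :- (g2 :+ g1))) (g0 :+ g3)) (triangle (u ⊹ y') (x ⊹ y ⊖ (x ⊹ y'))))
    (+-monoʳ-≤ (w (u ⊹ y')) (w-sub (x ⊹ y) (x ⊹ y')))

   -- The signs force `x + y` to be almost 0. If `w x` were not small, an element `y'` of about the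
   -- same norm going down from `u` could be compared: in the consistent sign pattern `x + y'` is
   -- almost 0 too, so `y` and `y'` are close although one goes up and the other down.
   not-both-up : ∀ x y → 2 * w x ≤ Δ → 2 * w y ≤ Δ → Up u x → Up u y → Down (u ⊹ x) y → Down (u ⊹ y) x → w x ≤ E * 120
   not-both-up x y x≤ y≤ ux uy dxy dyx with ≤-<-connex (w x) (E * 120)
   ... | inj₁ le = le
   ... | inj₂ gt with opposite-down (w x) (lin 2 E (w x) 3 (v0 :* & 30) v1 (hyp (1+ (v0 :* & 120)) v1 gt [])) (lin 2 (w x) Δ 1 v0 v1 (hyp (k2 :* v0) v1 x≤ []))
   ... | y' , dy' , y'≤x , x≤y' = ⊥-elim (cases (height-± (u ⊹ x) (base-at x x≤) y' y'≤Δ) (height-± (u ⊹ y') (base-at y' (lin 3 (w y') Δ (w x) 0 (k2 :* v0) v1 (hyp* 2 v0 v2 y'≤x (hyp (k2 :* v2) v1 x≤ [])))) x x≤Δ)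
       (height-± u base-u (x ⊹ y) xy≤Δ) (height-± u base-u (x ⊹ y') xy'≤Δ))
    where
    x≤Δ : w x ≤ Δ
    x≤Δ = (lin 2 (w x) Δ 1 v0 v1 (hyp (k2 :* v0) v1 x≤ []))
    y'≤Δ : w y' ≤ Δ
    y'≤Δ = ≤-trans y'≤x x≤Δ
    xy≤Δ : w (x ⊹ y) ≤ Δ
    xy≤Δ = (lin 4 (w (x ⊹ y)) Δ (w x) (w y) 1 v0 v1 (hyp* 2 v0 (v2 :+ v3) (triangle x y) (hyp (k2 :* v2) v1 x≤ (hyp (k2 :* v3) v1 y≤ []))))
    xy'≤Δ : w (x ⊹ y') ≤ Δ
    xy'≤Δ = (lin 4 (w (x ⊹ y')) Δ (w x) (w y') 0 v0 v1 (hyp v0 (v2 :+ v3) (triangle x y') (hyp (k2 :* v2) v1 x≤ (hyp v3 v2 y'≤x []))))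
    xy-small : Up u (x ⊹ y) ⊎ Down u (x ⊹ y) → w (x ⊹ y) ≤ E * 40
    xy-small (inj₁ h) = (lin 10 (w (x ⊹ y)) E (w u) (w (u ⊹ (x ⊹ y))) (w (u ⊹ x ⊹ y)) (w (u ⊹ y ⊹ x)) (w y) (w (u ⊹ x)) (w x) (w (u ⊹ y)) 1 v0 (v1 :* & 40) (hyp* 2 (v2 :+ v0) (v3 :+ k6 :* v1) h (eqn* 2 v3 v4 (merged u x y) (eqn⁻ v5 v4 (commuted u x y) (hyp (v4 :+ v6) (v7 :+ k6 :* v1) dxy (hyp (v5 :+ v8) (v9 :+ k6 :*
     v1) dyx (hyp v7 (v2 :+ v8) (up u x) (hyp v9 (v2 :+ v6) (up u y) []))))))))
    xy-small (inj₂ h) = (lin 10 (w (x ⊹ y)) E (w (u ⊹ (x ⊹ y))) (w u) (w (u ⊹ x ⊹ y)) (w (u ⊹ y ⊹ x)) (w x) (w (u ⊹ x)) (w y) (w (u ⊹ y)) 1 v0 (v1 :* & 40) (hyp* 2 (v2 :+ v0) (v3 :+ k6 :* v1) h (eqn⁻* 2 v2 v4 (merged u x y) (eqn v5 v4 (commuted u x y) (hyp (v3 :+ v6) (v7 :+ k6 :* v1) ux (hyp (v3 :+ v8) (v9 :+ k6 :*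
     v1) uy (hyp v7 (v4 :+ v8) (down (u ⊹ x) y) (hyp v9 (v5 :+ v6) (down (u ⊹ y) x) []))))))))
    xy'-small : Up u (x ⊹ y') ⊎ Down u (x ⊹ y') → w (u ⊹ x ⊹ y') ≤ w u + E * 30 → w u ≤ w (u ⊹ x ⊹ y') + E * 30 → w (x ⊹ y') ≤ E * 36
    xy'-small (inj₁ h) lo hi = (lin 5 (w (x ⊹ y')) E (w u) (w (u ⊹ (x ⊹ y'))) (w (u ⊹ x ⊹ y')) 0 v0 (v1 :* & 36) (hyp (v2 :+ v0) (v3 :+ k6 :* v1) h (eqn v3 v4 (merged u x y') (hyp v4 (v2 :+ v1 :* & 30) lo []))))
    xy'-small (inj₂ h) lo hi = (lin 5 (w (x ⊹ y')) E (w (u ⊹ (x ⊹ y'))) (w u) (w (u ⊹ x ⊹ y')) 0 v0 (v1 :* & 36) (hyp (v2 :+ v0) (v3 :+ k6 :* v1) h (eqn⁻ v2 v4 (merged u x y') (hyp v3 (v4 :+ v1 :* & 30) hi []))))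
    finish : w (u ⊹ x ⊹ y') ≤ w u + E * 30 → w u ≤ w (u ⊹ x ⊹ y') + E * 30 → Up u (x ⊹ y) ⊎ Down u (x ⊹ y) → Up u (x ⊹ y') ⊎ Down u (x ⊹ y') → ⊥
    finish lo hi c d = (absurd (lin 9 (w (u ⊹ y)) (w (u ⊹ y')) (w (x ⊹ y)) (w (x ⊹ y')) E (w u) (w y) (w y') (w x) 0 k1 k0 (hyp v0 (v1 :+ (v2 :+ v3)) (close x y y') (hyp v2 (v4 :* & 40) (xy-small c) (hyp v3 (v4 :* & 36) (xy'-small d lo hi) (hyp (v5 :+ v6) (v0 :+ k6 :* v4) uy (hyp (v1 :+ v7) (v5 :+ k6 :* v4) dy' (hyp
     v8 (v7 :+ v4 :* & 18) x≤y' (hyp (1+ (v4 :* & 120)) v8 gt [])))))))))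
    cases : Up (u ⊹ x) y' ⊎ Down (u ⊹ x) y' → Up (u ⊹ y') x ⊎ Down (u ⊹ y') x → Up u (x ⊹ y) ⊎ Down u (x ⊹ y) → Up u (x ⊹ y') ⊎ Down u (x ⊹ y') → ⊥
    cases (inj₁ a) _ _ _ = (absurd (lin 8 (w (u ⊹ x)) (w y') (w (u ⊹ x ⊹ y')) E (w (u ⊹ y' ⊹ x)) (w (u ⊹ y')) (w x) (w u) 1 k1 k0 (hyp (v0 :+ v1) (v2 :+ k6 :* v3) a (eqn⁻ v4 v2 (commuted u x y') (hyp v4 (v5 :+ v6) (up (u ⊹ y') x) (hyp (v5 :+ v1) (v7 :+ k6 :* v3) dy' (hyp (v7 :+ v6) (v0 :+ k6 :* v3) ux (hyp* 2 v6 (v1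
     :+ v3 :* & 18) x≤y' (hyp* 2 (1+ (v3 :* & 120)) v6 gt [])))))))))
    cases (inj₂ a) (inj₁ b) c d = finish
     (lin 6 (w (u ⊹ x ⊹ y')) (w u) E (w y') (w (u ⊹ x)) (w x) 0 v0 (v1 :+ v2 :* & 30) (hyp (v0 :+ v3) (v4 :+ k6 :* v2) a (hyp v4 (v1 :+ v5) (up u x) (hyp v5 (v3 :+ v2 :* & 18) x≤y' []))))
     (lin 6 (w u) (w (u ⊹ x ⊹ y')) E (w x) (w (u ⊹ x)) (w y') 0 v0 (v1 :+ v2 :* & 30) (hyp (v0 :+ v3) (v4 :+ k6 :* v2) ux (hyp v4 (v1 :+ v5) (down (u ⊹ x) y') (hyp v5 v3 y'≤x [])))) c d
    cases (inj₂ a) (inj₂ b) _ _ = (absurd (lin 8 (w (u ⊹ y' ⊹ x)) (w x) (w (u ⊹ y')) E (w (u ⊹ x ⊹ y')) (w y') (w u) (w (u ⊹ x)) 1 k1 k0 (hyp (v0 :+ v1) (v2 :+ k6 :* v3) b (eqn⁻ v0 v4 (commuted u x y') (hyp (v2 :+ v5) (v6 :+ k6 :* v3) dy' (hyp (v6 :+ v1) (v7 :+ k6 :* v3) ux (hyp v7 (v4 :+ v5) (down (u ⊹ x) y') (hyp*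
     2 (1+ (v3 :* & 120)) v1 gt []))))))))

  module At (u : G) (u-far : 6 * Δ < w (u ⊹ u)) (u-near : w u ≤ 7 * Δ) where

   r : ℕ
   r = w u

   f : G → ℕ
   f x = w (u ⊹ x)

   base-at : ∀ x → w x ≤ Δ → Base (u ⊹ x)
   base-at x x≤Δ = base
    (lin 5 Δ (w (u ⊹ x ⊹ (u ⊹ x))) (w (u ⊹ u)) (w (x ⊹ x)) (w x) 0 (1+ (k4 :* v0)) v1 (hyp (1+ (k6 :* v0)) v2 u-far (hyp v2 (v1 :+ v3) (subst (λ t → w t ≤ w (u ⊹ x ⊹ (u ⊹ x)) + w (x ⊹ x)) (group 2 u x (g0 :+ g1 :+ (g0 :+ g1) :- (g1 :+ g1)) (g0 :+ g0)) (w-sub (u ⊹ x ⊹ (u ⊹ x)) (x ⊹ x))) (hyp v3 (v4 :+ v4) (triangle x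
     x) (hyp* 2 v4 v0 x≤Δ [])))))
    (lin 4 (w (u ⊹ x)) Δ (w u) (w x) 0 v0 (k8 :* v1) (hyp v2 (k7 :* v1) u-near (hyp v0 (v2 :+ v3) (triangle u x) (hyp v3 v1 x≤Δ []))))

   base-u : Base u
   base-u = subst Base (⊹-identityʳ u) (base-at 𝟘 (≤-trans (≡⇒≤ zero-norm) z≤n))

   open NotBoth u (λ x x≤ → base-at x (lin 2 (w x) Δ 1 v0 v1 (hyp (k2 :* v0) v1 x≤ []))) using (not-both-up)

   -- Seen from u + x, the configuration with - x in place of x is one where both go up.
   not-both-down : ∀ x y → 2 * w x ≤ Δ → 2 * w y ≤ Δ → Down u x → Down u y → Up (u ⊹ x) y → Up (u ⊹ y) x → w x ≤ E * 120
   not-both-down x y x≤ y≤ dx dy uxy uyx = subst (_≤ E * 120) (sym-norm x) (NotBoth.not-both-up (u ⊹ x) bases (⊝ x) y (subst (λ t → 2 * t ≤ Δ) (sym (sym-norm x)) x≤) y≤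
    (subst₂ (λ s t → w (u ⊹ x) + s ≤ w t + 6 * E) (sym (sym-norm x)) back dx) uxy (subst (λ t → w (t ⊹ y) + w y ≤ w t + 6 * E) back dy)
    (subst₂ (λ s t → s + t ≤ w (u ⊹ x ⊹ y) + 6 * E) (cong w (group 3 u y x (g0 :+ g1) (g0 :+ g2 :+ g1 :+ :~ g2))) (sym (sym-norm x)) (subst (λ t → w (u ⊹ y) + w x ≤ t + 6 * E) (commuted u x y) uyx)))
    where
    back : u ≡ u ⊹ x ⊹ (⊝ x)
    back = (group 2 u x g0 (g0 :+ g1 :+ :~ g1))
    bases : ∀ z → 2 * w z ≤ Δ → Base (u ⊹ x ⊹ z)
    bases z z≤ = subst Base (group 3 u x z (g0 :+ (g1 :+ g2)) (g0 :+ g1 :+ g2)) (base-at (x ⊹ z) (lin 4 (w (x ⊹ z)) Δ (w x) (w z) 1 v0 v1 (hyp* 2 v0 (v2 :+ v3) (triangle x z) (hyp (k2 :* v2) v1 x≤ (hyp (k2 :* v3) v1 z≤ [])))))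

   K : ℕ
   K = E * 400

   Additive : G → G → Set
   Additive x y = (f (x ⊹ y) + r ≤ f x + f y + K) × (f x + f y ≤ f (x ⊹ y) + r + K)

   -- A step with the same sign from `u` and after the other step contributes the same both times.
   -- The four sign patterns in which neither step keeps its sign occur only for norms `O(E)`, where
   -- all errors fit into `K`.
   additive : ∀ x y → 2 * w x ≤ Δ → 2 * w y ≤ Δ → Additive x y
   additive x y x≤ y≤ = subst (λ t → (t + r ≤ f x + f y + K) × (f x + f y ≤ t + r + K)) (sym (merged u x y))
    (cases (height-± u base-u x x≤Δ) (height-± u base-u y y≤Δ) (height-± (u ⊹ x) (base-at x x≤Δ) y y≤Δ) (height-± (u ⊹ y) (base-at y y≤Δ) x x≤Δ))
    where
    x≤Δ : w x ≤ Δ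
    x≤Δ = (lin 2 (w x) Δ 1 v0 v1 (hyp (k2 :* v0) v1 x≤ []))
    y≤Δ : w y ≤ Δ
    y≤Δ = (lin 2 (w y) Δ 1 v0 v1 (hyp (k2 :* v0) v1 y≤ []))
    Goal = (w (u ⊹ x ⊹ y) + r ≤ f x + f y + K) × (f x + f y ≤ w (u ⊹ x ⊹ y) + r + K)
    swapped = commuted u x y
    small-case : w x + w y ≤ E * 400 → w (u ⊹ x ⊹ y) ≤ r + 6 * E + 6 * E → r ≤ w (u ⊹ x ⊹ y) + E * 12 → w x + w y ≤ E * 380 → Goal
    small-case _ hi lo s = (lin 7 (w (u ⊹ x ⊹ y)) (w u) (w (u ⊹ x)) (w (u ⊹ y)) E (w x) (w y) 0 (v0 :+ v1) (v2 :+ v3 :+ v4 :* & 400) (hyp v0 (v1 :+ k6 :* v4 :+ k6 :* v4) hi (hyp v1 (v2 :+ v5) (down u x) (hyp v1 (v3 :+ v6) (down u y) (hyp (v5 :+ v6) (v4 :* & 380) s []))))) ,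
     (lin 7 (w (u ⊹ x)) (w (u ⊹ y)) (w (u ⊹ x ⊹ y)) (w u) E (w x) (w y) 0 (v0 :+ v1) (v2 :+ v3 :+ v4 :* & 400) (hyp v3 (v2 :+ v4 :* & 12) lo (hyp v0 (v3 :+ v5) (up u x) (hyp v1 (v3 :+ v6) (up u y) (hyp (v5 :+ v6) (v4 :* & 380) s [])))))
    tiny : w x + w y ≤ E * 60 → Goal
    tiny s = (lin 7 (w (u ⊹ x ⊹ y)) (w u) (w (u ⊹ x)) (w (u ⊹ y)) E (w x) (w y) 0 (v0 :+ v1) (v2 :+ v3 :+ v4 :* & 400) (hyp* 2 (v5 :+ v6) (v4 :* & 60) s (hyp v0 (v2 :+ v6) (up (u ⊹ x) y) (hyp v1 (v3 :+ v6) (down u y) [])))) ,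
     (lin 7 (w (u ⊹ x)) (w (u ⊹ y)) (w (u ⊹ x ⊹ y)) (w u) E (w x) (w y) 0 (v0 :+ v1) (v2 :+ v3 :+ v4 :* & 400) (hyp* 2 (v5 :+ v6) (v4 :* & 60) s (hyp v1 (v3 :+ v6) (up u y) (hyp v0 (v2 :+ v6) (down (u ⊹ x) y) []))))
    cases : Up u x ⊎ Down u x → Up u y ⊎ Down u y → Up (u ⊹ x) y ⊎ Down (u ⊹ x) y → Up (u ⊹ y) x ⊎ Down (u ⊹ y) x → Goal
    cases _ (inj₁ hy) (inj₁ hxy) _ =
     (lin 6 (w (u ⊹ x ⊹ y)) (w u) (w (u ⊹ x)) (w (u ⊹ y)) E (w y) 0 (v0 :+ v1) (v2 :+ v3 :+ v4 :* & 400) (hyp v0 (v2 :+ v5) (up (u ⊹ x) y) (hyp (v1 :+ v5) (v3 :+ k6 :* v4) hy []))) ,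
     (lin 6 (w (u ⊹ x)) (w (u ⊹ y)) (w (u ⊹ x ⊹ y)) (w u) E (w y) 0 (v0 :+ v1) (v2 :+ v3 :+ v4 :* & 400) (hyp (v0 :+ v5) (v2 :+ k6 :* v4) hxy (hyp v1 (v3 :+ v5) (up u y) [])))
    cases _ (inj₂ hy) (inj₂ hxy) _ =
     (lin 6 (w (u ⊹ x ⊹ y)) (w u) (w (u ⊹ x)) (w (u ⊹ y)) E (w y) 0 (v0 :+ v1) (v2 :+ v3 :+ v4 :* & 400) (hyp (v0 :+ v5) (v2 :+ k6 :* v4) hxy (hyp v1 (v3 :+ v5) (down u y) []))) ,
     (lin 6 (w (u ⊹ x)) (w (u ⊹ y)) (w (u ⊹ x ⊹ y)) (w u) E (w y) 0 (v0 :+ v1) (v2 :+ v3 :+ v4 :* & 400) (hyp v0 (v2 :+ v5) (down (u ⊹ x) y) (hyp (v1 :+ v5) (v3 :+ k6 :* v4) hy [])))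
    cases (inj₁ hx) _ _ (inj₁ hyx) =
     (lin 7 (w (u ⊹ x ⊹ y)) (w u) (w (u ⊹ x)) (w (u ⊹ y)) E (w (u ⊹ y ⊹ x)) (w x) 0 (v0 :+ v1) (v2 :+ v3 :+ v4 :* & 400) (eqn⁻ v5 v0 swapped (hyp v5 (v3 :+ v6) (up (u ⊹ y) x) (hyp (v1 :+ v6) (v2 :+ k6 :* v4) hx [])))) ,
     (lin 7 (w (u ⊹ x)) (w (u ⊹ y)) (w (u ⊹ x ⊹ y)) (w u) E (w (u ⊹ y ⊹ x)) (w x) 0 (v0 :+ v1) (v2 :+ v3 :+ v4 :* & 400) (eqn v5 v2 swapped (hyp (v1 :+ v6) (v5 :+ k6 :* v4) hyx (hyp v0 (v3 :+ v6) (up u x) []))))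
    cases (inj₂ hx) _ _ (inj₂ hyx) =
     (lin 7 (w (u ⊹ x ⊹ y)) (w u) (w (u ⊹ x)) (w (u ⊹ y)) E (w (u ⊹ y ⊹ x)) (w x) 0 (v0 :+ v1) (v2 :+ v3 :+ v4 :* & 400) (eqn⁻ v5 v0 swapped (hyp (v5 :+ v6) (v3 :+ k6 :* v4) hyx (hyp v1 (v2 :+ v6) (down u x) [])))) ,
     (lin 7 (w (u ⊹ x)) (w (u ⊹ y)) (w (u ⊹ x ⊹ y)) (w u) E (w (u ⊹ y ⊹ x)) (w x) 0 (v0 :+ v1) (v2 :+ v3 :+ v4 :* & 400) (eqn v5 v2 swapped (hyp v1 (v5 :+ v6) (down (u ⊹ y) x) (hyp (v0 :+ v6) (v3 :+ k6 :* v4) hx []))))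
    cases (inj₁ hx) (inj₁ hy) (inj₂ hxy) (inj₂ hyx) = small-case
     (lin 3 (w x) (w y) E 0 (v0 :+ v1) (v2 :* & 400) (hyp v0 (v2 :* & 120) few-x (hyp v1 (v2 :* & 120) few-y [])))
     (lin 8 (w (u ⊹ x ⊹ y)) (w u) E (w y) (w (u ⊹ x)) (w (u ⊹ y ⊹ x)) (w x) (w (u ⊹ y)) 1 v0 (v1 :+ k6 :* v2 :+ k6 :* v2) (hyp (v0 :+ v3) (v4 :+ k6 :* v2) hxy (hyp (v5 :+ v6) (v7 :+ k6 :* v2) hyx (eqn⁻ v5 v0 swapped (hyp v4 (v1 :+ v6) (up u x) (hyp v7 (v1 :+ v3) (up u y) []))))))
     (lin 8 (w u) (w (u ⊹ x ⊹ y)) E (w x) (w (u ⊹ x)) (w y) (w (u ⊹ y)) (w (u ⊹ y ⊹ x)) 1 v0 (v1 :+ v2 :* & 12) (hyp (v0 :+ v3) (v4 :+ k6 :* v2) hx (hyp (v0 :+ v5) (v6 :+ k6 :* v2) hy (eqn v7 v1 swapped (hyp v4 (v1 :+ v5) (down (u ⊹ x) y) (hyp v6 (v7 :+ v3) (down (u ⊹ y) x) []))))))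
     (lin 3 (w x) (w y) E 0 (v0 :+ v1) (v2 :* & 380) (hyp v0 (v2 :* & 120) few-x (hyp v1 (v2 :* & 120) few-y [])))
     where
     few-x = not-both-up x y x≤ y≤ hx hy hxy hyx
     few-y = not-both-up y x y≤ x≤ hy hx hyx hxy
    cases (inj₂ hx) (inj₂ hy) (inj₁ hxy) (inj₁ hyx) = small-case
     (lin 3 (w x) (w y) E 0 (v0 :+ v1) (v2 :* & 400) (hyp v0 (v2 :* & 120) few-x (hyp v1 (v2 :* & 120) few-y [])))
     (lin 8 (w (u ⊹ x ⊹ y)) (w u) E (w (u ⊹ x)) (w x) (w (u ⊹ y)) (w y) (w (u ⊹ y ⊹ x)) 1 v0 (v1 :+ k6 :* v2 :+ k6 :* v2) (hyp (v3 :+ v4) (v1 :+ k6 :* v2) hx (hyp (v5 :+ v6) (v1 :+ k6 :* v2) hy (eqn⁻ v7 v0 swapped (hyp v0 (v3 :+ v6) (up (u ⊹ x) y) (hyp v7 (v5 :+ v4) (up (u ⊹ y) x) []))))))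
     (lin 8 (w u) (w (u ⊹ x ⊹ y)) E (w (u ⊹ x)) (w y) (w (u ⊹ y)) (w x) (w (u ⊹ y ⊹ x)) 1 v0 (v1 :+ v2 :* & 12) (hyp (v3 :+ v4) (v1 :+ k6 :* v2) hxy (hyp (v5 :+ v6) (v7 :+ k6 :* v2) hyx (eqn v7 v1 swapped (hyp v0 (v3 :+ v6) (down u x) (hyp v0 (v5 :+ v4) (down u y) []))))))
     (lin 3 (w x) (w y) E 0 (v0 :+ v1) (v2 :* & 380) (hyp v0 (v2 :* & 120) few-x (hyp v1 (v2 :* & 120) few-y [])))
     where
     few-x = not-both-down x y x≤ y≤ hx hy hxy hyx
     few-y = not-both-down y x y≤ x≤ hy hx hyx hxy
    cases (inj₁ hx) (inj₂ hy) (inj₁ hxy) (inj₂ hyx) = tiny (lin 8 (w x) (w y) E (w u) (w (u ⊹ x)) (w (u ⊹ y)) (w (u ⊹ x ⊹ y)) (w (u ⊹ y ⊹ x)) 1 (v0 :+ v1) (v2 :* & 60) (hyp (v3 :+ v0) (v4 :+ k6 :* v2) hx (hyp (v5 :+ v1) (v3 :+ k6 :* v2) hy (hyp (v4 :+ v1) (v6 :+ k6 :* v2) hxy (hyp (v7 :+ v0) (v5 :+ k6 :* v2) hyx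
     (eqn⁻ v7 v6 swapped []))))))
    cases (inj₂ hx) (inj₁ hy) (inj₂ hxy) (inj₁ hyx) = tiny (lin 8 (w x) (w y) E (w (u ⊹ x)) (w u) (w (u ⊹ y)) (w (u ⊹ x ⊹ y)) (w (u ⊹ y ⊹ x)) 1 (v0 :+ v1) (v2 :* & 60) (hyp (v3 :+ v0) (v4 :+ k6 :* v2) hx (hyp (v4 :+ v1) (v5 :+ k6 :* v2) hy (hyp (v6 :+ v1) (v3 :+ k6 :* v2) hxy (hyp (v5 :+ v0) (v7 :+ k6 :* v2) hyx (eqn
     v7 v6 swapped []))))))

 -- A generator of the balls.

 argmax : ∀ {n} (t : Fin (suc n) → ℕ) → ∃ λ x → ∀ y → t y ≤ t x
 argmax {zero} t = zero , λ { zero → ≤-refl }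
 argmax {suc n} t with argmax (t ∘ suc)
 ... | x , best with ≤-total (t zero) (t (suc x))
 ... | inj₁ le = suc x , λ { zero → le ; (suc y) → best y }
 ... | inj₂ ge = zero , λ { zero → ≤-refl ; (suc y) → ≤-trans (best y) ge }

 argmax-at : ∀ {n} → Fin n → (t : Fin n → ℕ) → ∃ λ x → ∀ y → t y ≤ t x
 argmax-at {suc n} _ t = argmax t

 -- Following the multiples of an element until they leave the ball of radius ρ: an element whose
 -- multiples stay longest generates the whole ball, by a division argument.
 module Multiples {w R E} (L : Linear w R E) (3≤E : 3 ≤ E) (ρ : ℕ) (ρ≤R : ρ * 20 * 10 ≤ R) (fine : E * 30000 ≤ ρ) (2<p : 2 < p)
  (large : E * 1000 ≤ ρ * 20) where

  open Additivity L 3≤E (ρ * 20) ρ≤R large 2<p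

  module From (u : G) (u-far : 6 * (ρ * 20) < w (u ⊹ u)) (u-near : w u ≤ 7 * (ρ * 20)) where

   open At u u-far u-near

   2≤Δ : ∀ {a} → a ≤ 4 * ρ → 2 * a ≤ ρ * 20
   2≤Δ {a} h = (lin 2 a ρ 0 (k2 :* v0) (v1 :* & 20) (hyp* 2 v0 (k4 :* v1) h []))

   ≤Δ : ∀ {a} → a ≤ 4 * ρ → a ≤ ρ * 20
   ≤Δ {a} h = (lin 2 a ρ 0 v0 (v1 :* & 20) (hyp v0 (k4 :* v1) h []))

   f-𝟘 : f 𝟘 ≡ r
   f-𝟘 = cong w (⊹-identityʳ u)

   record Reach (z : G) (J : ℕ) : Set where
    field
     exits : ρ < w (J • z)
     inside : ∀ k → k < J → w (k • z) ≤ ρ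

   open Reach

   -- Some multiple of `z` is the far point `u`, so the ball of radius `ρ` is left eventually.
   exit : ∀ z → z ≢ 𝟘 → ∃ (Reach z)
   exit z z≢0 with generates z z≢0 u
   ... | n , nz with search n
    where
    search : ∀ n → (∀ k → k ≤ n → w (k • z) ≤ ρ) ⊎ ∃ (Reach z)
    search zero = inj₁ λ { zero _ → ≤-trans (≡⇒≤ zero-norm) z≤n }
    search (suc n) with search n
    ... | inj₂ found = inj₂ found
    ... | inj₁ all with ≤-<-connex (w (suc n • z)) ρ
    ... | inj₂ gt = inj₂ (suc n , record { exits = gt ; inside = λ k k≤n → all k (≤-pred k≤n) })
    ... | inj₁ le = inj₁ λ k k≤ → case m≤n⇒m<n∨m≡n k≤ of λ where
         (inj₁ k<) → all k (≤-pred k<)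
         (inj₂ refl) → le
   ... | inj₂ found = found
   ... | inj₁ all = (absurd (lin 2 (w u) ρ 0 k1 k0 (hyp v0 v1 (subst (λ t → w t ≤ ρ) nz (all n ≤-refl)) (hyp (1+ (k2 :* (v1 :* & 20))) v0 (Base.deep base-u) []))))

   reach-unique : ∀ {z J J'} → Reach z J → Reach z J' → J ≤ J'
   reach-unique {z} {J} {J'} a b = ≮⇒≥ λ lt → <⇒≱ (exits b) (inside a J' lt)

   exit-time : G → ℕ
   exit-time z with z ≟ᴳ 𝟘
   -- Below every true exit time, so 0 cannot be the maximiser.
   ... | yes _ = 0
   ... | no z≢0 = proj₁ (exit z z≢0)

   reach-exit-time : ∀ z → z ≢ 𝟘 → Reach z (exit-time z)
   reach-exit-time z z≢0 with z ≟ᴳ 𝟘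
   ... | yes z≡0 = ⊥-elim (z≢0 z≡0)
   ... | no z≢0' = proj₂ (exit z z≢0')

   reach-≥1 : ∀ {z J} → Reach z J → 1 ≤ J
   reach-≥1 {J = zero} a = ⊥-elim (n≮0 (subst (ρ <_) zero-norm (exits a)))
   reach-≥1 {J = suc J} a = s≤s z≤n

   reach-≢𝟘 : ∀ {z J} → Reach z J → z ≢ 𝟘
   reach-≢𝟘 {J = J} a refl = n≮0 (subst (ρ <_) (trans (cong w (•-zero J)) zero-norm) (exits a))
    where
    •-zero : ∀ n → n • 𝟘 ≡ 𝟘
    •-zero zero = refl
    •-zero (suc n) = trans (⊹-identityˡ _) (•-zero n)

   reach-⊝ : ∀ {z J} → Reach z J → Reach (⊝ z) J
   reach-⊝ {z} {J} a = record
    { exits = subst (ρ <_) (same J) (exits a)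
    ; inside = λ k k<J → subst (_≤ ρ) (same k) (inside a k k<J) }
    where
    same : ∀ k → w (k • z) ≡ w (k • (⊝ z))
    same k = trans (sym (sym-norm (k • z))) (cong w (sym (•-⊝ k z)))

   within : ∀ {z J} → Reach z J → ∀ k → k ≤ J → w (k • z) ≤ ρ + w z
   within {z} {J} a zero _ = ≤-trans (≡⇒≤ zero-norm) z≤n
   within {z} {J} a (suc k) k<J = ≤-trans (triangle z (k • z)) (≤-trans (+-monoʳ-≤ (w z) (inside a k k<J)) (≡⇒≤ (+-comm (w z) ρ)))

   module Orbit {z J} (a : Reach z J) (z-small : w z ≤ 3 * ρ) where

    g : ℕ → ℕ
    g k = f (k • z)

    bounded : ∀ k → k ≤ J → w (k • z) ≤ 4 * ρ
    bounded k k≤J = (lin 3 (w (k • z)) ρ (w z) 0 v0 (k4 :* v1) (hyp v0 (v1 :+ v2) (within a k k≤J) (hyp v2 (k3 :* v1) z-small [])))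

    adds : ∀ i j → i + j ≤ J → (g (i + j) + r ≤ g i + g j + K) × (g i + g j ≤ g (i + j) + r + K)
    adds i j le = subst (λ t → (f t + r ≤ g i + g j + K) × (g i + g j ≤ f t + r + K)) (sym (•-+ i j z))
     (additive (i • z) (j • z) (2≤Δ (bounded i (≤-trans (m≤m+n i j) le))) (2≤Δ (bounded j (≤-trans (m≤n+m j i) le))))

    exit-up : r < g J → r + ρ ≤ g J + 6 * E
    exit-up pos with height-± u base-u (J • z) (≤Δ (bounded J ≤-refl))
    ... | inj₁ h = (lin 5 (w u) ρ (w (u ⊹ J • z)) E (w (J • z)) 0 (v0 :+ v1) (v2 :+ k6 :* v3) (hyp (v0 :+ v4) (v2 :+ k6 :* v3) h (hyp (1+ v1) v4 (exits a) [])))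
    ... | inj₂ h = (absurd (lin 5 (w (u ⊹ J • z)) (w (J • z)) (w u) E ρ 9999 k1 k0 (hyp* 5000 (v0 :+ v1) (v2 :+ k6 :* v3) h (hyp* 5000 (1+ v4) v1 (exits a) (hyp* 5000 (1+ v2) v0 pos (hyp (v3 :* & 30000) v4 fine []))))))

    exit-down : g J ≤ r → g J + ρ ≤ r + 6 * E
    exit-down neg with height-± u base-u (J • z) (≤Δ (bounded J ≤-refl))
    ... | inj₂ h = (lin 5 (w (u ⊹ J • z)) ρ (w u) E (w (J • z)) 0 (v0 :+ v1) (v2 :+ k6 :* v3) (hyp (v0 :+ v4) (v2 :+ k6 :* v3) h (hyp (1+ v1) v4 (exits a) [])))
    ... | inj₁ h = (absurd (lin 5 (w u) (w (J • z)) (w (u ⊹ J • z)) E ρ 4999 k1 k0 (hyp* 5000 (v0 :+ v1) (v2 :+ k6 :* v3) h (hyp* 5000 (1+ v4) v1 (exits a) (hyp* 5000 v2 v0 neg (hyp (v3 :* & 30000) v4 fine []))))))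

    -- By near additivity the climb up to the exit splits at `k`. The part of length `J - k` stays
    -- inside the ball and accounts for at most `ρ`, so the other part cannot be far below 0.
    path : r < g J → ∀ k → k ≤ J → r ≤ g k + 2 * K
    path pos zero _ = ≤-trans (≡⇒≤ (sym f-𝟘)) (m≤m+n _ _)
    path pos k@(suc _) k≤J = (lin 7 r (g k) E (g J) (g (J ∸ k)) (w ((J ∸ k) • z)) ρ 0 v0 (v1 :+ k2 :* (v2 :* & 400)) (hyp (v3 :+ v0) (v1 :+ v4 :+ v2 :* & 400) (proj₁ (subst (λ t → (g t + r ≤ g k + g (J ∸ k) + K) × (g k + g (J ∸ k) ≤ g t + r + K)) (+∸ k≤J) (adds k (J ∸ k) (≡⇒≤ (+∸ k≤J))))) (hyp v4 (v0 :+ v5) (up u ((J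
     ∸ k) • z)) (hyp v5 v6 (inside a (J ∸ k) (∸-monoʳ-< {J} {k} {0} (s≤s z≤n) k≤J)) (hyp (v0 :+ v6) (v3 :+ k6 :* v2) (exit-up pos) [])))))

    monotone : r < g J → ∀ i j → i ≤ j → j ≤ J → g i ≤ g j + 3 * K
    monotone pos i j i≤j j≤J = (lin 5 (g i) (g j) E (g (j ∸ i)) r 0 v0 (v1 :+ k3 :* (v2 :* & 400)) (hyp (v0 :+ v3) (v1 :+ v4 :+ v2 :* & 400) (proj₂ (subst (λ t → (g t + r ≤ g i + g (j ∸ i) + K) × (g i + g (j ∸ i) ≤ g t + r + K)) (+∸ i≤j) (adds i (j ∸ i) (≤-trans (≡⇒≤ (+∸ i≤j)) j≤J)))) (hyp v4 (v3 :+ k2 :* (v2 :* &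
     400)) (path pos (j ∸ i) (≤-trans (m∸n≤m j i) j≤J)) [])))

    halving : r < g J → ∀ i j → i ≤ j → j ≤ i + i → j ≤ J → g j + r ≤ 2 * g i + 4 * K
    halving pos i j i≤j j≤2i j≤J = (lin 5 (g j) r (g i) E (g (j ∸ i)) 0 (v0 :+ v1) (k2 :* v2 :+ k4 :* (v3 :* & 400)) (hyp (v0 :+ v1) (v2 :+ v4 :+ v3 :* & 400) (proj₁ (subst (λ t → (g t + r ≤ g i + g (j ∸ i) + K) × (g i + g (j ∸ i) ≤ g t + r + K)) (+∸ i≤j) (adds i (j ∸ i) (≤-trans (≡⇒≤ (+∸ i≤j)) j≤J)))) (hyp v4 (v2 :+
     k3 :* (v3 :* & 400)) (monotone pos (j ∸ i) i (lin 3 (j ∸ i) i j 0 v0 v1 (eqn (v1 :+ v0) v2 (+∸ i≤j) (hyp v2 (v1 :+ v1) j≤2i []))) (≤-trans i≤j j≤J)) [])))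

    -- One or two applications of `halving` carry the height at the exit down to time `k`.
    quarter : r < g J → ∀ k → k ≤ J → J ≤ 4 * k → 4 * r + ρ ≤ 4 * g k + 20 * K
    quarter pos k k≤J J≤4k with ≤-total J (k + k)
    ... | inj₁ J≤2k = (lin 5 r ρ (g k) E (g J) 0 (k4 :* v0 :+ v1) (k4 :* v2 :+ & 20 :* (v3 :* & 400)) (hyp* 2 (v4 :+ v0) (k2 :* v2 :+ k4 :* (v3 :* & 400)) (halving pos k J k≤J J≤2k ≤-refl) (hyp* 2 (v0 :+ v1) (v4 :+ k6 :* v3) (exit-up pos) [])))
    ... | inj₂ 2k≤J = (lin 6 r ρ (g k) E (g (k + k)) (g J) 0 (k4 :* v0 :+ v1) (k4 :* v2 :+ & 20 :* (v3 :* & 400)) (hyp* 2 (v4 :+ v0) (k2 :* v2 :+ k4 :* (v3 :* & 400)) (halving pos k (k + k) (m≤m+n k k) ≤-refl 2k≤J) (hyp (v5 :+ v0) (k2 :* v4 :+ k4 :* (v3 :* & 400)) (halving pos (k + k) J 2k≤J (lin 2 J k 0 v0 (v1 :+ v1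
     :+ (v1 :+ v1)) (hyp v0 (k4 :* v1) J≤4k [])) ≤-refl) (hyp (v0 :+ v1) (v5 :+ k6 :* v3) (exit-up pos) []))))

   opposite-height : ∀ z → w z ≤ 4 * ρ → (r + r ≤ f z + f (⊝ z) + K) × (f z + f (⊝ z) ≤ r + r + K)
   opposite-height z z≤ = subst (λ t → (t + r ≤ f z + f (⊝ z) + K) × (f z + f (⊝ z) ≤ t + r + K)) (trans (cong f (⊹-inverseʳ z)) f-𝟘)
    (additive z (⊝ z) (2≤Δ z≤) (2≤Δ (subst (_≤ 4 * ρ) (sym (sym-norm z)) z≤)))

   flip : ∀ {z J} → Reach z J → w z ≤ 3 * ρ → f (J • z) ≤ r → r < f (J • (⊝ z))
   flip {z} {J} a z≤ neg = subst (λ t → r < f t) (sym (•-⊝ J z)) (lin 5 (w u) (f (⊝ (J • z))) (f (J • z)) E ρ 89999 (1+ v0) v1 (hyp* 90000 (v0 :+ v0) (v2 :+ v1 :+ v3 :* & 400) (proj₁ (opposite-height (J • z) (Orbit.bounded a z≤ J ≤-refl))) (hyp* 90000 (v2 :+ v4) (v0 :+ k6 :* v3) (Orbit.exit-down a z≤ neg) (hyp* 1219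
    (v3 :* & 30000) v4 fine (hyp* 30000 k3 v3 3≤E [])))))

   high⇒positive : ∀ {z J} → Reach z J → w z ≤ 3 * ρ → r + 3 * K < f z → r < f (J • z)
   high⇒positive {z} {J} a z≤ high = ≰⇒> λ neg → (absurd (lin 5 r (f (⊝ z ⊹ 𝟘)) E (f (⊝ z)) (f z) 0 k1 k0 (hyp v0 (v1 :+ k2 :* (v2 :* & 400)) (Orbit.path (reach-⊝ a) (subst (_≤ 3 * ρ) (sym (sym-norm z)) z≤) (flip a z≤ neg) 1 (reach-≥1 a)) (eqn v1 v3 (cong f (⊹-identityʳ (⊝ z))) (hyp (v4 :+ v3) (v0 :+ v0 :+ v2 :* &
    400) (proj₂ (opposite-height z (lin 2 (w z) ρ 0 v0 (k4 :* v1) (hyp v0 (k3 :* v1) z≤ [])))) (hyp (1+ (v0 :+ k3 :* (v2 :* & 400))) v4 high []))))))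

   low⇒negative : ∀ {z J} → Reach z J → w z ≤ 3 * ρ → f z + 2 * K < r → f (J • z) ≤ r
   low⇒negative {z} {J} a z≤ low = ≮⇒≥ λ pos → (absurd (lin 4 r (f (z ⊹ 𝟘)) E (f z) 0 k1 k0 (hyp v0 (v1 :+ k2 :* (v2 :* & 400)) (Orbit.path a z≤ pos 1 (reach-≥1 a)) (eqn v1 v3 (cong f (⊹-identityʳ z)) (hyp (1+ (v3 :+ k2 :* (v2 :* & 400))) v0 low [])))))

   module Generator (x : G) (J : ℕ) (reach-x : Reach x J) (x-small : w x ≤ 3 * ρ) (positive : r < f (J • x))
    (maximal : ∀ z J' → Reach z J' → J' ≤ J) where

    module X = Orbit reach-x x-small

    tiny : ∃ λ z → z ≢ 𝟘 × w z ≤ E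
    tiny with two-elements (ball w E) (lin 2 (# (ball w E)) E 2 k2 v0 (hyp* 2 (k2 :* v1) (v0 :+ v1) (growth-lower E (lin 3 E R ρ 5999999 v0 v1 (hyp* 200 (v0 :* & 30000) v2 fine (hyp (v2 :* & 20 :* & 10) v1 ρ≤R [])))) (hyp* 2 k3 v1 3≤E [])))
    ... | y , y' , y≢y' , small , small' with y ≟ᴳ 𝟘
    ... | no y≢0 = y , y≢0 , ≤ᵇ⇒≤ (w y) E small
    ... | yes refl = y' , (λ eq → y≢y' (sym eq)) , ≤ᵇ⇒≤ (w y') E small'

    w-multiple : ∀ k z → w (k • z) ≤ k * w z
    w-multiple zero z = ≡⇒≤ zero-norm
    w-multiple (suc k) z = ≤-trans (triangle z (k • z)) (+-monoʳ-≤ (w z) (w-multiple k z))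

    -- The norm of a multiple is at most linear in the factor, so a nonzero element of norm at most
    -- `E` takes `ρ / E` steps to leave, and the maximal exit time is no shorter.
    long : 100 ≤ J
    long = from tiny
     where
     from : (∃ λ z → z ≢ 𝟘 × w z ≤ E) → 100 ≤ J
     from (z , z≢0 , z≤E) = ≮⇒≥ λ J<100 → (absurd (lin 5 ρ (w (j • z)) j (w z) E 299 k1 k0 (hyp* 300 (1+ v0) v1 (exits (proj₂ (exit z z≢0))) (hyp* 300 v1 (v2 :* v3) (w-multiple j z) (mul* 300 v2 v3 v4 z≤E (mul* 300 v4 v2 (& 100) (≤-trans (maximal z j (proj₂ (exit z z≢0))) (<⇒≤ J<100)) (hyp (v4 :* & 30000) v0 fine
      [])))))))
      where j = proj₁ (exit z z≢0)

    -- The first 16 multiples stay inside the ball; four doublings show that one step up is not much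
    -- more than `ρ / 16`. A step down contradicts `X.path` unless it is tiny.
    w-x : 8 * w x ≤ ρ
    w-x with height-± u base-u x (≤Δ (lin 2 (w x) ρ 0 v0 (k4 :* v1) (hyp v0 (k3 :* v1) x-small [])))
    ... | inj₁ h = (lin 11 (w x) ρ (w u) (w (u ⊹ x)) E (X.g 1) (X.g 2) (X.g 4) (X.g 8) (X.g 16) (w (16 • x)) 1249 (k8 :* v0) v1 (hyp* 10000 (v2 :+ v0) (v3 :+ k6 :* v4) h (eqn⁻* 10000 v5 v3 (cong f (⊹-identityʳ x)) (hyp* 5000 (k2 :* v5) (v6 :+ v2 :+ v4 :* & 400) d1 (hyp* 2500 (k2 :* v6) (v7 :+ v2 :+ v4 :* & 400) d2
     (hyp* 1250 (k2 :* v7) (v8 :+ v2 :+ v4 :* & 400) d3 (hyp* 625 (k2 :* v8) (v9 :+ v2 :+ v4 :* & 400) d4 (hyp* 625 v9 (v2 :+ v10) (up u (16 • x)) (hyp* 625 v10 v1 (inside reach-x 16 (≤-trans (≤-dec {17} {100}) long)) (hyp* 127 (v4 :* & 30000) v1 fine []))))))))))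
     where
     double : ∀ k → {T (k + k ≤ᵇ 16)} → 2 * X.g k ≤ X.g (k + k) + r + K
     double k {ok} = ≤-trans (≡⇒≤ (cong (X.g k +_) (+0 (X.g k)))) (proj₂ (X.adds k k (≤-trans (≤ᵇ⇒≤ (k + k) 16 ok) (≤-trans (≤-dec {16} {100}) long))))
     d1 = double 1
     d2 = double 2
     d3 = double 4
     d4 = double 8
    ... | inj₂ h = (lin 6 (w x) ρ (w (u ⊹ x)) (w u) E (X.g 1) 1874 (k8 :* v0) v1 (hyp* 15000 (v2 :+ v0) (v3 :+ k6 :* v4) h (eqn* 15000 v5 v2 (cong f (⊹-identityʳ x)) (hyp* 15000 v3 (v5 :+ k2 :* (v4 :* & 400)) (X.path positive 1 (reach-≥1 reach-x)) (hyp* 403 (v4 :* & 30000) v1 fine [])))))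

    -- If both summands climb, `x` climbs too fast. At time `j` the first has climbed `ρ`. If
    -- `j' ≤ 4 j`, the second has climbed `ρ / 4`, and their total exceeds the `ρ + w x ≤ 9/8 ρ`
    -- available to `x` up to time `J`. Otherwise `2 j < J`, and `x` would climb about `2 ρ` by time
    -- `2 j` without leaving the ball.
    no-splitting : ∀ {z z' j j'} → Reach z j → Reach z' j' → w z ≤ 3 * ρ → w z' ≤ 3 * ρ →
            r < f (j • z) → r < f (j' • z') → z ⊹ z' ≡ x → j ≤ j' → ⊥
    no-splitting {z} {z'} {j} {j'} a a' z≤ z'≤ pos pos' split j≤j' with ≤-<-connex j' (4 * j)
    ... | inj₁ j'≤4j = (absurd (lin 8 (Z.g j) (Z'.g j) (X.g j) r E ρ (w (j • x)) (w x) 32255 k1 k0 (hyp* 8 (v0 :+ v1) (v2 :+ v3 :+ v4 :* & 400) total-up (hyp* 8 (v3 :+ v5) (v0 :+ k6 :* v4) (Z.exit-up pos) (hyp* 2 (k4 :* v3 :+ v5) (k4 :* v1 :+ & 20 :* (v4 :* & 400)) (Z'.quarter pos' j j≤j' j'≤4j) (hyp* 8 v2 (v3 :+ v6)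
     (up u (j • x)) (hyp* 8 v6 (v5 :+ v7) (within reach-x j j≤J) (hyp (k8 :* v7) v5 w-x (hyp (v4 :* & 30000) v5 fine (hyp* 10752 k3 v4 3≤E []))))))))))
     where
     module Z = Orbit a z≤
     module Z' = Orbit a' z'≤
     j≤J : j ≤ J
     j≤J = maximal z j a
     total-up : Z.g j + Z'.g j ≤ X.g j + r + K
     total-up = subst (λ t → Z.g j + Z'.g j ≤ f t + r + K) (trans (sym (•-distrib-⊹ j z z')) (cong (j •_) split))
      (proj₂ (additive (j • z) (j • z') (2≤Δ (Z.bounded j ≤-refl)) (2≤Δ (Z'.bounded j j≤j'))))
    ... | inj₂ 4j<j' = (absurd (lin 8 (Z.g j) (Z'.g j) (X.g j) r E ρ (X.g (j + j)) (w ((j + j) • x)) 81563 k1 k0 (hyp* 2 (v0 :+ v1) (v2 :+ v3 :+ v4 :* & 400) total-up (hyp* 2 (v3 :+ v5) (v0 :+ k6 :* v4) (Z.exit-up pos) (hyp* 2 v3 (v1 :+ k2 :* (v4 :* & 400)) (Z'.path pos' j j≤j') (hyp (v2 :+ v2) (v6 :+ v3 :+ v4 :* &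
     400) (proj₂ (X.adds j j (<⇒≤ 2j<J))) (hyp v6 (v3 :+ v7) (up u ((j + j) • x)) (hyp v7 v5 (inside reach-x (j + j) 2j<J) (hyp (v4 :* & 30000) v5 fine (hyp* 27188 k3 v4 3≤E []))))))))))
     where
     module Z = Orbit a z≤
     module Z' = Orbit a' z'≤
     2j<J : j + j < J
     2j<J = (lin 3 j J j' 0 (1+ (v0 :+ v0)) v1 (hyp v2 v1 (maximal z' j' a') (hyp (1+ (k4 :* v0)) v2 4j<j' [])))
     total-up : Z.g j + Z'.g j ≤ X.g j + r + K
     total-up = subst (λ t → Z.g j + Z'.g j ≤ f t + r + K) (trans (sym (•-distrib-⊹ j z z')) (cong (j •_) split))
      (proj₂ (additive (j • z) (j • z') (2≤Δ (Z.bounded j ≤-refl)) (2≤Δ (Z'.bounded j j≤j'))))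

    IsMultiple : G → Set
    IsMultiple y = ∃ λ k → k ≤ J × (y ≡ k • x ⊎ y ≡ ⊝ (k • x))

    -- Division with remainder: `z 0 = y + J x` is clearly positive and `z (J + J) = y - J x`
    -- clearly negative. At a change of sign, `z i` and `- z (i + 1)` are both positive with sum
    -- `x`, which `no-splitting` forbids; so some remainder is 0.
    module Divide (y : G) (y-small : 2 * w y ≤ ρ) where

     z : ℕ → G
     z i = y ⊹ J • x ⊖ i • x

     z-small : ∀ i → i ≤ J + J → w (z i) ≤ 3 * ρ
     z-small i i≤ with ≤-total i J
     ... | inj₁ i≤J = (lin 5 (w (z i)) ρ (w y) (w ((J ∸ i) • x)) (w x) 7 v0 (k3 :* v1) (hyp* 8 v0 (v2 :+ v3) (subst (λ t → w t ≤ w y + w ((J ∸ i) • x)) z≡ (triangle y ((J ∸ i) • x))) (hyp* 8 v3 (v1 :+ v4) (within reach-x (J ∸ i) (m∸n≤m J i)) (hyp (k8 :* v4) v1 w-x (hyp* 4 (k2 :* v2) v1 y-small [])))))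
      where
      z≡ : y ⊹ (J ∸ i) • x ≡ z i
      z≡ = trans (group 3 y ((J ∸ i) • x) (i • x) (g0 :+ g1) (g0 :+ (g2 :+ g1) :- g2)) (cong (λ t → y ⊹ t ⊖ i • x) (trans (sym (•-+ i (J ∸ i) x)) (cong (_• x) (+∸ i≤J))))
     ... | inj₂ J≤i = (lin 5 (w (z i)) ρ (w y) (w ((i ∸ J) • x)) (w x) 7 v0 (k3 :* v1) (hyp* 8 v0 (v2 :+ v3) (subst (λ t → w t ≤ w y + w ((i ∸ J) • x)) z≡ (w-sub y ((i ∸ J) • x))) (hyp* 8 v3 (v1 :+ v4) (within reach-x (i ∸ J) (lin 3 (i ∸ J) J i 0 v0 v1 (eqn (v1 :+ v0) v2 (+∸ J≤i) (hyp v2 (v1 :+ v1) i≤ [])))) (hyp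
      (k8 :* v4) v1 w-x (hyp* 4 (k2 :* v2) v1 y-small [])))))
      where
      z≡ : y ⊖ (i ∸ J) • x ≡ z i
      z≡ = trans (group 3 y ((i ∸ J) • x) (J • x) (g0 :- g1) (g0 :+ g2 :- (g2 :+ g1))) (cong (λ t → y ⊹ J • x ⊖ t) (trans (sym (•-+ J (i ∸ J) x)) (cong (_• x) (+∸ J≤i))))

     module NonZeroRemainders (z≢0 : ∀ i → i ≤ J + J → z i ≢ 𝟘) where

      start-positive : ∀ {j} → Reach (z 0) j → r < f (j • z 0)
      start-positive a = high⇒positive a (z-small 0 z≤n) (lin 9 (w u) E (f (z 0)) (f (y ⊹ J • x ⊖ 0 • x)) (f (y ⊹ J • x)) (f y) (X.g J) (w y) ρ 89999 (1+ (v0 :+ k3 :* (v1 :* & 400))) v2 (eqn⁻* 90000 v2 v3 (cong f (group 3 y (J • x) (0 • x) (g0 :+ g1 :- g2) (g0 :+ g1 :- g2))) (eqn⁻* 90000 v3 v4 (cong f (group 2 y (J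
       • x) (g0 :+ g1 :- gnil) (g0 :+ g1))) (hyp* 90000 (v5 :+ v6) (v4 :+ v0 :+ v1 :* & 400) (proj₂ (additive y (J • x) (2≤Δ (lin 2 (w y) ρ 1 v0 (k4 :* v1) (hyp (k2 :* v0) v1 y-small []))) (2≤Δ (X.bounded J ≤-refl)))) (hyp* 90000 v0 (v5 :+ v7) (down u y) (hyp* 90000 (v0 :+ v8) (v6 :+ k6 :* v1) (X.exit-up positive) (hyp* 45000
       (k2 :* v7) v8 y-small (hyp* 4819 (v1 :* & 30000) v8 fine (hyp* 30000 k3 v1 3≤E [])))))))))

      end-negative : ∀ {j} → Reach (z (J + J)) j → f (j • z (J + J)) ≤ r
      end-negative a = low⇒negative a (z-small (J + J) ≤-refl) (lin 9 (f (z (J + J))) E (w u) (f (y ⊖ J • x)) (f y) (f (⊝ (J • x))) (w y) (X.g J) ρ 89999 (1+ (v0 :+ k2 :* (v1 :* & 400))) v2 (eqn* 90000 v0 v3 (cong f z≡) (hyp* 90000 (v3 :+ v2) (v4 :+ v5 :+ v1 :* & 400) (proj₁ (additive y (⊝ (J • x)) (2≤Δ (lin 2 (w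
       y) ρ 1 v0 (k4 :* v1) (hyp (k2 :* v0) v1 y-small []))) (2≤Δ (subst (_≤ 4 * ρ) (sym (sym-norm (J • x))) (X.bounded J ≤-refl))))) (hyp* 90000 v4 (v2 :+ v6) (up u y) (hyp* 90000 (v7 :+ v5) (v2 :+ v2 :+ v1 :* & 400) (proj₂ (opposite-height (J • x) (X.bounded J ≤-refl))) (hyp* 90000 (v2 :+ v8) (v7 :+ k6 :* v1) (X.exit-up
       positive) (hyp* 45000 (k2 :* v6) v8 y-small (hyp* 4819 (v1 :* & 30000) v8 fine (hyp* 30000 k3 v1 3≤E [])))))))))
       where
       z≡ : z (J + J) ≡ y ⊖ J • x
       z≡ = trans (cong (λ t → y ⊹ J • x ⊖ t) (•-+ J J x)) (group 2 y (J • x) (g0 :+ g1 :- (g1 :+ g1)) (g0 :- g1))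

      descend : ∀ i → i ≤ J + J → (∀ {j} → Reach (z i) j → f (j • z i) ≤ r) → ⊥
      descend zero _ neg = <⇒≱ (start-positive (proj₂ (exit (z 0) (z≢0 0 z≤n)))) (neg (proj₂ (exit (z 0) (z≢0 0 z≤n))))
      descend (suc i) i< neg = descend i (<⇒≤ i<) neg'
       where
       z'≡ : z i ⊹ (⊝ z (suc i)) ≡ x
       z'≡ = (group 4 y (J • x) (i • x) x (g0 :+ g1 :- g2 :+ :~ (g0 :+ g1 :- (g3 :+ g2))) g3)
       small' : w (⊝ z (suc i)) ≤ 3 * ρ
       small' = subst (_≤ 3 * ρ) (sym (sym-norm (z (suc i)))) (z-small (suc i) i<)
       neg' : ∀ {j} → Reach (z i) j → f (j • z i) ≤ r
       neg' {j} a = ≮⇒≥ λ pos → step pos (exit (z (suc i)) (z≢0 (suc i) i<))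
        where
        step : r < f (j • z i) → ∃ (Reach (z (suc i))) → ⊥
        step pos (j' , a') with ≤-total j j'
        ... | inj₁ le = no-splitting a (reach-⊝ a') (z-small i (<⇒≤ i<)) small' pos (flip a' (z-small (suc i) i<) (neg a')) z'≡ le
        ... | inj₂ ge = no-splitting (reach-⊝ a') a small' (z-small i (<⇒≤ i<)) (flip a' (z-small (suc i) i<) (neg a')) pos (trans (⊹-comm _ _) z'≡) ge

      impossible : ⊥
      impossible = descend (J + J) ≤-refl end-negative

     remainder-zero : ∃ λ i → i ≤ J + J × z i ≡ 𝟘
     remainder-zero with anyUpTo? (λ i → z i ≟ᴳ 𝟘) (suc (J + J))
     ... | yes (i , i< , eq) = i , ≤-pred i< , eq
     ... | no none = ⊥-elim (NonZeroRemainders.impossible λ i i≤ eq → none (i , s≤s i≤ , eq))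

     is-multiple : IsMultiple y
     is-multiple = from remainder-zero
      where
      solve-y : ∀ i → z i ≡ 𝟘 → y ≡ i • x ⊖ J • x
      solve-y i eq = trans (group 3 y (J • x) (i • x) g0 (g0 :+ g1 :- g2 :+ (g2 :- g1))) (trans (cong (_⊹ (i • x ⊖ J • x)) eq) (⊹-identityˡ _))
      from : (∃ λ i → i ≤ J + J × z i ≡ 𝟘) → IsMultiple y
      from (i , i≤ , eq) with ≤-total J i
      ... | inj₁ J≤i = i ∸ J , (lin 3 (i ∸ J) J i 0 v0 v1 (eqn (v1 :+ v0) v2 (+∸ J≤i) (hyp v2 (v1 :+ v1) i≤ []))) , inj₁ (trans (solve-y i eq)
       (trans (cong (_⊖ J • x) (trans (cong (_• x) (sym (+∸ J≤i))) (•-+ J (i ∸ J) x))) (group 2 (J • x) ((i ∸ J) • x) (g0 :+ g1 :- g0) g1)))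
      ... | inj₂ i≤J = J ∸ i , m∸n≤m J i , inj₂ (trans (solve-y i eq)
       (trans (cong (λ t → i • x ⊖ t) (trans (cong (_• x) (sym (+∸ i≤J))) (•-+ i (J ∸ i) x))) (group 2 (i • x) ((J ∸ i) • x) (g0 :- (g0 :+ g1)) (:~ g1))))

    short-orbit : ∀ i (S : G → Bool) → (∀ y → T (S y) → ∃ λ k → k < i × (y ≡ k • x ⊎ y ≡ ⊝ (k • x))) → # S ≤ 2 * i
    short-orbit i S all = ≤-trans (Σ-mono λ y → entry y) (≡⇒≤ (trans (Σ-swap λ y k → [ δ y (toℕ k • x) ] + [ δ y (⊝ (toℕ k • x)) ])
     (trans (Σ-cong λ (k : Fin i) → trans (Σ-+ (λ y → [ δ y (toℕ k • x) ]) (λ y → [ δ y (⊝ (toℕ k • x)) ])) (cong₂ _+_ (#-δ (toℕ k • x)) (#-δ (⊝ (toℕ k • x)))))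
      (trans (Σ-const i 2) (*-comm i 2)))))
     where
     entry : ∀ y → [ S y ] ≤ Σ {i} (λ k → [ δ y (toℕ k • x) ] + [ δ y (⊝ (toℕ k • x)) ])
     entry y with S y in Sy
     ... | false = z≤n
     ... | true with all y (T! Sy)
     ... | k , k<i , eq = ≤-trans (hit eq) (term≤Σ (λ k → [ δ y (toℕ k • x) ] + [ δ y (⊝ (toℕ k • x)) ]) (fromℕ< k<i))
      where
      k' = toℕ (fromℕ< k<i)
      k'≡ : k' ≡ k
      k'≡ = Finₚ.toℕ-fromℕ< k<i
      hit : y ≡ k • x ⊎ y ≡ ⊝ (k • x) → 1 ≤ [ δ y (k' • x) ] + [ δ y (⊝ (k' • x)) ]
      hit (inj₁ e) = ≤-trans (≡⇒≤ (sym (T⇒⟨⟩ (subst (T ∘ δ y) (trans e (cong (_• x) (sym k'≡))) (δ-refl y))))) (m≤m+n _ _)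
      hit (inj₂ e) = ≤-trans (≡⇒≤ (sym (T⇒⟨⟩ (subst (T ∘ δ y) (trans e (cong (λ k → ⊝ (k • x)) (sym k'≡))) (δ-refl y))))) (m≤n+m _ _)

    -- If the norm of `i • x` were larger, monotonicity would make every element of the ball of
    -- radius `i + 3 K` plus or minus a multiple below `i`. There are at most `2 i` of these, fewer
    -- than the growth of balls demands.
    orbit-norm : ∀ i → 2 * (i + 3 * K) ≤ ρ → w (i • x) ≤ i + 8 * K
    orbit-norm i small with ≤-<-connex (w (i • x)) (i + 8 * K)
    ... | inj₁ le = le
    ... | inj₂ gt = (absurd (lin 3 (# (ball w (i + 3 * K))) i E 7196 k1 k0 (hyp v0 (k2 :* v1) (short-orbit i (ball w (i + 3 * K)) covered) (hyp (k2 :* (v1 :+ k3 :* (v2 :* & 400))) (v0 :+ v2) (growth-lower (i + 3 * K) (lin 4 i E R ρ 399 (v0 :+ k3 :* (v1 :* & 400)) v2 (hyp* 200 (k2 :* (v0 :+ k3 :* (v1 :* & 400))) v3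
     small (hyp (v3 :* & 20 :* & 10) v2 ρ≤R [])))) (hyp* 2399 k3 v2 3≤E [])))))
     where
     covered : ∀ y → T (ball w (i + 3 * K) y) → ∃ λ k → k < i × (y ≡ k • x ⊎ y ≡ ⊝ (k • x))
     covered y near-y = from (Divide.is-multiple y (≤-trans (*-monoʳ-≤ 2 y≤) small))
      where
      y≤ : w y ≤ i + 3 * K
      y≤ = ≤ᵇ⇒≤ (w y) (i + 3 * K) near-y
      too-far : ∀ k → k ≤ J → i ≤ k → w (k • x) ≤ w y → ⊥
      too-far k k≤J i≤k k≤y with height-± u base-u (i • x) (≤Δ (X.bounded i (≤-trans i≤k k≤J)))
      ... | inj₁ h = (absurd (lin 8 (w u) (w (i • x)) (X.g i) E i (X.g k) (w (k • x)) (w y) 0 k1 k0 (hyp (v0 :+ v1) (v2 :+ k6 :* v3) h (hyp (1+ (v4 :+ k8 :* (v3 :* & 400))) v1 gt (hyp v2 (v5 :+ k3 :* (v3 :* & 400)) (X.monotone positive i k i≤k k≤J) (hyp v5 (v0 :+ v6) (up u (k • x)) (hyp v6 v7 k≤y (hyp v7 (v4 :+ k3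
       :* (v3 :* & 400)) y≤ []))))))))
      ... | inj₂ h = (absurd (lin 5 (X.g i) (w (i • x)) (w u) E i 0 k1 k0 (hyp (v0 :+ v1) (v2 :+ k6 :* v3) h (hyp (1+ (v4 :+ k8 :* (v3 :* & 400))) v1 gt (hyp v2 (v0 :+ k2 :* (v3 :* & 400)) (X.path positive i (≤-trans i≤k k≤J)) [])))))
      from : IsMultiple y → ∃ λ k → k < i × (y ≡ k • x ⊎ y ≡ ⊝ (k • x))
      from (k , k≤J , inj₁ eq) = k , ≰⇒> (λ i≤k → too-far k k≤J i≤k (≡⇒≤ (cong w (sym eq)))) , inj₁ eq
      from (k , k≤J , inj₂ eq) = k , ≰⇒> (λ i≤k → too-far k k≤J i≤k (≡⇒≤ (trans (sym (sym-norm (k • x))) (cong w (sym eq))))) , inj₂ eq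

   Progression : Set
   Progression = ∃ λ x → x ≢ 𝟘 × (∀ i → 2 * (i + 3 * K) ≤ ρ → w (i • x) ≤ i + 8 * K)

   progression : Progression
   progression = from (argmax-at u exit-time)
    where
    one≢𝟘 : residue 1 ≢ 𝟘
    one≢𝟘 eq with trans (sym (m<n⇒m%n≡m 1<p)) (trans (sym (toℕ-residue 1)) (trans (cong toℕ eq) (trans (cong toℕ 𝟘-residue) (trans (toℕ-residue 0) (m<n⇒m%n≡m (≤-trans (s≤s z≤n) 1<p))))))
     where
     1<p : 1 < p
     1<p = <⇒≤ 2<p
    ... | ()
    from : (∃ λ x → ∀ z → exit-time z ≤ exit-time x) → Progression
    from (x , best) = sign (reach-exit-time x x≢0)
     where
     exit-time-𝟘 : exit-time 𝟘 ≡ 0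
     exit-time-𝟘 with 𝟘 ≟ᴳ 𝟘
     ... | yes _ = refl
     ... | no ≢ = ⊥-elim (≢ refl)
     x≢0 : x ≢ 𝟘
     x≢0 eq = <⇒≱ (reach-≥1 (reach-exit-time (residue 1) one≢𝟘)) (≤-trans (best (residue 1)) (≡⇒≤ (trans (cong exit-time eq) exit-time-𝟘)))
     maximal : ∀ z J' → Reach z J' → J' ≤ exit-time x
     maximal z J' a = ≤-trans (reach-unique a (reach-exit-time z (reach-≢𝟘 a))) (best z)
     J = exit-time x
     small-x : Reach x J → w x ≤ 3 * ρ
     small-x a with ≤-<-connex 2 J
     ... | inj₁ 2≤J = ≤-trans (subst (λ t → w t ≤ ρ) (⊹-identityʳ x) (inside a 1 2≤J)) (m≤m+n ρ _)
     ... | inj₂ J<2 = ⊥-elim (quick (two-elements (ball w E) (lin 2 (# (ball w E)) E 2 k2 v0 (hyp* 2 (k2 :* v1) (v0 :+ v1) (growth-lower E (lin 3 E R ρ 5999999 v0 v1 (hyp* 200 (v0 :* & 30000) v2 fine (hyp (v2 :* & 20 :* & 10) v1 ρ≤R [])))) (hyp* 2 k3 v1 3≤E [])))))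
      where
      slow : ∀ z → z ≢ 𝟘 → w z ≤ E → ⊥
      slow z z≢0 z≤E = go (exit z z≢0)
       where
       go : ∃ (Reach z) → ⊥
       go (zero , b) = n≮0 (reach-≥1 b)
       go (suc zero , b) = (absurd (lin 3 ρ (w z) E 29999 k1 k0 (hyp* 30000 (1+ v0) v1 (subst (λ t → ρ < w t) (⊹-identityʳ z) (exits b)) (hyp* 30000 v1 v2 z≤E (hyp (v2 :* & 30000) v0 fine [])))))
       go (suc (suc k) , b) = <⇒≱ J<2 (≤-trans (s≤s (s≤s z≤n)) (maximal z (suc (suc k)) b))
      quick : (∃ λ y → ∃ λ y' → y ≢ y' × T (ball w E y) × T (ball w E y')) → ⊥
      quick (y , y' , y≢y' , s , s') with y ≟ᴳ 𝟘
      ... | no y≢0 = slow y y≢0 (≤ᵇ⇒≤ (w y) E s)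
      ... | yes refl = slow y' (λ eq → y≢y' (sym eq)) (≤ᵇ⇒≤ (w y') E s')
     sign : Reach x J → Progression
     sign a with ≤-<-connex (f (J • x)) r
     ... | inj₂ pos = x , x≢0 , Generator.orbit-norm x J a (small-x a) pos maximal
     -- If the multiples of `x` leave downwards, those of `- x` leave upwards at the same time, so
     -- it is maximal as well.
     ... | inj₁ neg = ⊝ x , reach-≢𝟘 (reach-⊝ a) , Generator.orbit-norm (⊝ x) J (reach-⊝ a) (subst (_≤ 3 * ρ) (sym (sym-norm x)) (small-x a)) (flip a (small-x a) neg) maximal

  generator : ∃ λ x → x ≢ 𝟘 × (∀ i → 2 * (i + 3 * (E * 400)) ≤ ρ → w (i • x) ≤ i + 8 * (E * 400))
  generator = from far-point
   where
   from : (∃ λ u → 6 * (ρ * 20) < w (u ⊹ u) × w u ≤ 7 * (ρ * 20)) → ∃ λ x → x ≢ 𝟘 × (∀ i → 2 * (i + 3 * (E * 400)) ≤ ρ → w (i • x) ≤ i + 8 * (E * 400))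
   from (u , far , near) = From.progression u far near

 -- Windows along a progression: a set of small width is close to an arc.

 p•x≡𝟘 : ∀ x → p • x ≡ 𝟘
 p•x≡𝟘 x = trans (•-residue p x) (trans (residue-cong (trans (cong (_% p) (*-comm p (toℕ x))) (trans (m*n%n≡0 (toℕ x) p) (sym (m<n⇒m%n≡m (ℕ.>-nonZero⁻¹ p)))))) (sym 𝟘-residue))

 •-% : ∀ m x → (m % p) • x ≡ m • x
 •-% m x = trans (•-residue (m % p) x) (trans (residue-cong (trans (%-distribˡ-* (m % p) (toℕ x) p) (trans (cong (λ t → (t * (toℕ x % p)) % p) (m%n%n≡m%n m p)) (sym (%-distribˡ-* m (toℕ x) p))))) (sym (•-residue m x)))

 Σ-orbit : ∀ x → x ≢ 𝟘 → ∀ a (f : G → ℕ) → Σ< p (λ k → f (a ⊹ k • x)) ≡ Σ f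
 Σ-orbit x x≢0 a f = with-inverse (inverse x x≢0)
  where
  with-inverse : (∃ λ u → u • x ≡ residue 1) → Σ< p (λ k → f (a ⊹ k • x)) ≡ Σ f
  with-inverse (u , ux≡1) = trans (sym (Σ<-Fin p (λ k → f (a ⊹ k • x)))) (Σ-bij to from to-from from-to f)
   where
   to from : G → G
   to k = a ⊹ toℕ k • x
   from y = residue (toℕ (y ⊖ a) * u)
   back : ∀ y → (toℕ y * u) • x ≡ y
   back y = trans (sym (•-assoc (toℕ y) u x)) (trans (cong (toℕ y •_) ux≡1) (trans (residue-• (toℕ y)) (residue-toℕ y)))
   to-from : ∀ y → to (from y) ≡ y
   to-from y = trans (cong (λ t → a ⊹ t • x) (toℕ-residue _)) (trans (cong (a ⊹_) (trans (•-% (toℕ (y ⊖ a) * u) x) (back (y ⊖ a)))) (group 2 a y (g0 :+ (g1 :- g0)) g1))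
   from-to : ∀ k → from (to k) ≡ k
   from-to k = begin
    residue (toℕ (a ⊹ toℕ k • x ⊖ a) * u) ≡⟨ cong (λ t → residue (toℕ t * u)) (group 2 a (toℕ k • x) (g0 :+ g1 :- g0) g1) ⟩
    residue (toℕ (toℕ k • x) * u) ≡⟨ cong residue (*-comm _ u) ⟩
    residue (u * toℕ (toℕ k • x)) ≡⟨ •-residue u (toℕ k • x) ⟨
    u • toℕ k • x ≡⟨ trans (•-assoc u (toℕ k) x) (trans (cong (_• x) (*-comm u (toℕ k))) (sym (•-assoc (toℕ k) u x))) ⟩
    toℕ k • u • x ≡⟨ trans (cong (toℕ k •_) ux≡1) (trans (residue-• (toℕ k)) (residue-toℕ k)) ⟩
    k ∎
    where open ≡-Reasoning

 -- `S` read as a sequence of period `p` along the steps of `x`; arcs become intervals of indices.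
 line : (G → Bool) → G → G → ℕ → Bool
 line S x a k = S (a ⊹ k • x)

 Σ<-distance : ∀ j → 3 * Σ< j (λ i → Σ< j λ i' → ∣ i - i' ∣) ≤ j * j * j
 Σ<-distance j = (lin 2 (Σ< j (λ i → Σ< j λ i' → ∣ i - i' ∣)) j 0 (k3 :* v0) (v1 :* v1 :* v1) (eqn (k3 :* v0 :+ v1) (v1 :* v1 :* v1) (exact j) []))
  where
  below : ∀ j → 2 * Σ< j (λ i → ∣ j - i ∣) ≡ j * suc j
  below zero = refl
  below (suc j) = (linEq 6 (Σ< j (λ i → ∣ suc j - i ∣)) (∣ suc j - j ∣) j (Σ< j (λ i → 1 + ∣ j - i ∣)) (Σ< j (λ _ → 1)) (Σ< j (λ i → ∣ j - i ∣)) (k2 :* (v0 :+ v1)) ((1+ v2) :* (1+ (1+ v2))) 0 (eqn* 2 v0 v3 (Σ<-cong j (λ i i<j → step j i (<⇒≤ i<j))) (eqn* 2 v3 (v4 :+ v5) (Σ<-+ j (λ _ → 1) (λ i → ∣ j - i ∣)) (eqn* 2 v4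
   (v2 :* k1) (Σ<-const j 1) (eqn (k2 :* v5) (v2 :* (1+ v2)) (below j) (eqn* 2 v1 k1 (trans (step j j ≤-refl) (cong suc (∣n-n∣≡0 j))) []))))) 0 (eqn⁻* 2 v0 v3 (Σ<-cong j (λ i i<j → step j i (<⇒≤ i<j))) (eqn⁻* 2 v3 (v4 :+ v5) (Σ<-+ j (λ _ → 1) (λ i → ∣ j - i ∣)) (eqn⁻* 2 v4 (v2 :* k1) (Σ<-const j 1) (eqn⁻ (k2 :* v5) (v2 :*
   (1+ v2)) (below j) (eqn⁻* 2 v1 k1 (trans (step j j ≤-refl) (cong suc (∣n-n∣≡0 j))) []))))))
   where
   step : ∀ j i → i ≤ j → ∣ suc j - i ∣ ≡ 1 + ∣ j - i ∣
   step j i i≤j = trans (m≤n⇒∣n-m∣≡n∸m (m≤n⇒m≤1+n i≤j)) (trans (+-∸-assoc 1 i≤j) (cong suc (sym (m≤n⇒∣n-m∣≡n∸m i≤j))))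
  exact : ∀ j → 3 * Σ< j (λ i → Σ< j λ i' → ∣ i - i' ∣) + j ≡ j * j * j
  exact zero = refl
  exact (suc j) = (linEq 6 (Σ< j (λ i → Σ< j (λ i' → ∣ i - i' ∣) + ∣ i - j ∣)) (Σ< j (λ i → ∣ j - i ∣)) (∣ j - j ∣) j (Σ< j (λ i → Σ< j λ i' → ∣ i - i' ∣)) (Σ< j (λ i → ∣ i - j ∣)) (k3 :* (v0 :+ (v1 :+ v2)) :+ (1+ v3)) ((1+ v3) :* (1+ v3) :* (1+ v3)) 0 (eqn* 3 v0 (v4 :+ v5) (Σ<-+ j (λ i → Σ< j λ i' → ∣ i - i' ∣) (λ i →
   ∣ i - j ∣)) (eqn* 3 v5 v1 (Σ<-cong j (λ i _ → ∣-∣-comm i j)) (eqn* 3 (k2 :* v1) (v3 :* (1+ v3)) (below j) (eqn (k3 :* v4 :+ v3) (v3 :* v3 :* v3) (exact j) (eqn* 3 v2 k0 (∣n-n∣≡0 j) []))))) 0 (eqn⁻* 3 v0 (v4 :+ v5) (Σ<-+ j (λ i → Σ< j λ i' → ∣ i - i' ∣) (λ i → ∣ i - j ∣)) (eqn⁻* 3 v5 v1 (Σ<-cong j (λ i _ → ∣-∣-comm i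
   j)) (eqn⁻* 3 (k2 :* v1) (v3 :* (1+ v3)) (below j) (eqn⁻ (k3 :* v4 :+ v3) (v3 :* v3 :* v3) (exact j) [])))))

 record NearArc (S : G → Bool) (x : G) (ε : ℕ) : Set where
  constructor near-arc
  field
   start : G
   len : ℕ
   len≤p : len ≤ p
   close-to : #< len (λ k → not (line S x start k)) + #< (p ∸ len) (λ k → line S x start (len + k)) ≤ ε

 -- The number c k of points of S in the window [k , k + 5 q) changes by at most one when k
 -- increases; windows with q ≤ c k ≤ 4 q are too rare to be crossed four times around the circle.
 module Arcs (S : G → Bool) (x : G) (x≢0 : x ≢ 𝟘) (q C : ℕ) (1≤q : 1 ≤ q) (C≤q : C * 100 ≤ q)
  (steps : ∀ i → i < 5 * q → width S (i • x) ≤ i + C) (9q≤S : 9 * q ≤ # S) (9q≤∁S : 9 * q ≤ # (∁ S)) where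

  j : ℕ
  j = 5 * q

  step-distance : ∀ i i' → i < j → i' < j → width S (i • x ⊖ i' • x) ≤ ∣ i - i' ∣ + C
  step-distance i i' i<j i'<j with ≤-total i i'
  ... | inj₂ i'≤i = subst₂ (λ y d → width S y ≤ d + C) (trans (group 2 ((i ∸ i') • x) (i' • x) g0 (g1 :+ g0 :- g1)) (cong (_⊖ i' • x) (trans (sym (•-+ i' (i ∸ i') x)) (cong (_• x) (+∸ i'≤i)))))
      (sym (m≤n⇒∣n-m∣≡n∸m i'≤i)) (steps (i ∸ i') (≤-<-trans (m∸n≤m i i') i<j))
  ... | inj₁ i≤i' = subst₂ (λ y d → y ≤ d + C) (trans (sym (width-sym S ((i' ∸ i) • x))) (cong (width S) (trans (group 2 ((i' ∸ i) • x) (i • x) (:~ g0) (g1 :- (g1 :+ g0))) (cong (i • x ⊖_) (trans (sym (•-+ i (i' ∸ i) x)) (cong (_• x) (+∸ i≤i')))))))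
      (sym (m≤n⇒∣m-n∣≡n∸m i≤i')) (steps (i' ∸ i) (≤-<-trans (m∸n≤m i' i) i'<j))

  module Around (a : G) where

   s : ℕ → Bool
   s = line S x a

   c D : ℕ → ℕ
   c k = #< j λ i → s (k + i)
   D k = #< j λ i → not (s (k + i))

   c+D : ∀ k → c k + D k ≡ j
   c+D k = #<-not j λ i → s (k + i)

   orbit-shift : ∀ i (f : G → ℕ) → Σ< p (λ k → f (a ⊹ (k + i) • x)) ≡ Σ f
   orbit-shift i f = trans (Σ<-cong p λ k _ → cong f (trans (cong (a ⊹_) (•-+ k i x)) (group 3 a (k • x) (i • x) (g0 :+ (g1 :+ g2)) (g0 :+ g2 :+ g1)))) (Σ-orbit x x≢0 (a ⊹ i • x) f)

   Σc : Σ< p c ≡ j * # S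
   Σc = trans (Σ<-swap p j λ k i → [ s (k + i) ]) (trans (Σ<-cong j λ i _ → orbit-shift i λ y → [ S y ]) (Σ<-const j (# S)))

   ΣD : Σ< p D ≡ j * # (∁ S)
   ΣD = trans (Σ<-swap p j λ k i → [ not (s (k + i)) ]) (trans (Σ<-cong j λ i _ → orbit-shift i λ y → [ not (S y) ]) (Σ<-const j (# (∁ S))))

   -- `c k * D k` counts pairs of a present and an absent position in one window. Over all windows,
   -- the offsets `i` and `i'` contribute the width at `(i - i') • x`, at most `∣ i - i' ∣ + C`, and
   -- the distances sum to at most `j³ / 3`.
   mixing : 3 * Σ< p (λ k → c k * D k) ≤ j * j * j + 3 * C * (j * j)
   mixing = (lin 6 (Σ< p (λ k → c k * D k)) j C (Σ< j (λ i → Σ< j λ i' → Σ< p λ k → [ s (k + i) ] * [ not (s (k + i')) ])) (Σ< j (λ i → Σ< j λ i' → ∣ i - i' ∣ + C)) (Σ< j (λ i → Σ< j λ i' → ∣ i - i' ∣)) 0 (k3 :* v0) (v1 :* v1 :* v1 :+ k3 :* v2 :* (v1 :* v1)) (eqn* 3 v0 v3 expand (hyp* 3 v3 v4 (Σ<-mono j (λ i i<j →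
    Σ<-mono j λ i' i'<j → ≤-trans (≡⇒≤ (pair i i')) (step-distance i i' i<j i'<j))) (eqn* 3 v4 (v5 :+ v1 :* (v1 :* v2)) (trans (Σ<-cong j λ i _ → trans (Σ<-+ j (λ i' → ∣ i - i' ∣) (λ _ → C)) (cong (Σ< j (λ i' → ∣ i - i' ∣) +_) (Σ<-const j C))) (trans (Σ<-+ j (λ i → Σ< j λ i' → ∣ i - i' ∣) (λ _ → j * C)) (cong (Σ< j (λ i →
    Σ< j λ i' → ∣ i - i' ∣) +_) (Σ<-const j (j * C))))) (hyp (k3 :* v5) (v1 :* v1 :* v1) (Σ<-distance j) [])))))
    where
    product : ∀ m n (f g : ℕ → ℕ) → Σ< m f * Σ< n g ≡ Σ< m λ i → Σ< n λ i' → f i * g i'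
    product m n f g = trans (*-comm (Σ< m f) (Σ< n g)) (trans (sym (Σ<-* m (Σ< n g) f)) (Σ<-cong m λ i _ → trans (*-comm (Σ< n g) (f i)) (sym (Σ<-* n (f i) g))))
    expand : Σ< p (λ k → c k * D k) ≡ Σ< j (λ i → Σ< j λ i' → Σ< p λ k → [ s (k + i) ] * [ not (s (k + i')) ])
    expand = trans (Σ<-cong p λ k _ → product j j (λ i → [ s (k + i) ]) (λ i → [ not (s (k + i)) ]))
     (trans (Σ<-swap p j λ k i → Σ< j λ i' → [ s (k + i) ] * [ not (s (k + i')) ]) (Σ<-cong j λ i _ → Σ<-swap p j λ k i' → [ s (k + i) ] * [ not (s (k + i')) ]))
    pair : ∀ i i' → Σ< p (λ k → [ s (k + i) ] * [ not (s (k + i')) ]) ≡ width S (i • x ⊖ i' • x)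
    pair i i' = trans (Σ<-cong p λ k _ → trans (sym (⟨⟩-∧ (s (k + i)) (not (s (k + i'))))) (cong (λ y → [ s (k + i) ∧ not (S y) ])
      (trans (cong (a ⊹_) (•-+ k i' x)) (trans (group 4 a (k • x) (i' • x) (i • x) (g0 :+ (g1 :+ g2)) (g0 :+ (g1 :+ g3) :- (g3 :- g2))) (cong (λ y → a ⊹ y ⊖ (i • x ⊖ i' • x)) (sym (•-+ k i x)))))))
     (orbit-shift i λ y → [ S y ∧ not (S (y ⊖ (i • x ⊖ i' • x))) ])

   next : ∀ k → c (suc k) + [ s k ] ≡ c k + [ s (k + j) ]
   next k = trans (cong (_+ [ s k ]) (Σ<-cong j λ i _ → cong ([_] ∘ s) (sym (+-suc k i)))) (trans (+-comm _ [ s k ])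
    (trans (cong (λ t → [ s t ] + #< j (λ i → s (k + suc i))) (sym (+0 k))) (sym (Σ<-split 1 j λ i → [ s (k + i) ]))))

   mixed : ℕ → Bool
   mixed k = (q ≤ᵇ c k) ∧ (c k ≤ᵇ 4 * q)

   -- The window count clipped to the range from `q` to `4 q` and shifted to start at 0. It moves
   -- only at mixed windows and by at most one, so crossing the range takes `3 q` of them.
   clamp : ℕ → ℕ
   clamp v = (v ∸ q) ⊓ (3 * q)

   travel : ∀ k n → clamp (c k) ≤ clamp (c (n + k)) + #< n (λ i → mixed (i + k)) × clamp (c (n + k)) ≤ clamp (c k) + #< n (λ i → mixed (i + k))
   travel k zero = ≡⇒≤ (sym (+0 _)) , ≡⇒≤ (sym (+0 _))
   travel k (suc n) with travel k n | one (n + k)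
    where
    moves : ∀ v v' → v ≤ v' + 1 → v' ≤ v + 1 → (clamp v ≤ clamp v' + [ (q ≤ᵇ v) ∧ (v ≤ᵇ 4 * q) ]) × (clamp v' ≤ clamp v + [ (q ≤ᵇ v) ∧ (v ≤ᵇ 4 * q) ])
    moves v v' le ge with q ≤ᵇ v in lo | v ≤ᵇ 4 * q in hi
    ... | true | true = ≤-trans (⊓-monoˡ-≤ (3 * q) (∸-monoˡ-≤ q le)) (≤-trans (⊓-monoˡ-≤ (3 * q) (shift v')) (clip (v' ∸ q))) , ≤-trans (⊓-monoˡ-≤ (3 * q) (∸-monoˡ-≤ q ge)) (≤-trans (⊓-monoˡ-≤ (3 * q) (shift v)) (clip (v ∸ q)))
     where
     shift : ∀ t → t + 1 ∸ q ≤ (t ∸ q) + 1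
     shift t = m≤n+o⇒m∸n≤o (t + 1) q (lin 3 t q (t ∸ q) 0 (v0 :+ k1) (v1 :+ (v2 :+ k1)) (hyp v0 (v1 :+ v2) (m≤n+m∸n t q) []))
     clip : ∀ t → (t + 1) ⊓ (3 * q) ≤ t ⊓ (3 * q) + 1
     clip t with ⊓-sel t (3 * q)
     ... | inj₁ eq = ≤-trans (m⊓n≤m (t + 1) _) (+-monoˡ-≤ 1 (≡⇒≤ (sym eq)))
     ... | inj₂ eq = ≤-trans (m⊓n≤n (t + 1) _) (≤-trans (≡⇒≤ (sym eq)) (m≤m+n _ 1))
    ... | false | _ = ≤-trans (≤-trans (m⊓n≤m (v ∸ q) _) (≡⇒≤ (m≤n⇒m∸n≡0 v≤q))) z≤n , ≤-trans (m⊓n≤m (v' ∸ q) _) (≤-trans (≡⇒≤ (m≤n⇒m∸n≡0 (lin 3 v' q v 0 v0 v1 (hyp v0 (v2 :+ k1) ge (hyp (1+ v2) v1 v<q []))))) z≤n)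
     where
     v<q : v < q
     v<q = ≰⇒> λ le → subst T lo (≤⇒≤ᵇ le)
     v≤q : v ≤ q
     v≤q = <⇒≤ v<q
    ... | true | false = ≤-trans (m⊓n≤n (v ∸ q) (3 * q)) (≤-trans (≡⇒≤ (sym (m≥n⇒m⊓n≡n (m+n≤o⇒m≤o∸n (3 * q) (lin 3 q v' v 0 (k3 :* v0 :+ v0) v1 (hyp v2 (v1 :+ k1) le (hyp (1+ (k4 :* v0)) v2 4q<v []))))))) (m≤m+n _ 0)) ,
      ≤-trans (m⊓n≤n (v' ∸ q) (3 * q)) (≤-trans (≡⇒≤ (sym (m≥n⇒m⊓n≡n (m+n≤o⇒m≤o∸n (3 * q) (lin 2 q v 0 (k3 :* v0 :+ v0) v1 (hyp (1+ (k4 :* v0)) v1 4q<v [])))))) (m≤m+n _ 0))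
     where
     4q<v : 4 * q < v
     4q<v = ≰⇒> λ le → subst T hi (≤⇒≤ᵇ le)
    one : ∀ k → (clamp (c k) ≤ clamp (c (suc k)) + [ mixed k ]) × (clamp (c (suc k)) ≤ clamp (c k) + [ mixed k ])
    one k = moves (c k) (c (suc k)) (lin 4 (c k) (c (suc k)) ([ s k ]) ([ s (k + j) ]) 0 v0 (v1 :+ k1) (eqn⁻ (v1 :+ v2) (v0 :+ v3) (next k) (hyp v2 k1 (⟨⟩≤1 (s k)) []))) (lin 4 (c (suc k)) (c k) ([ s k ]) ([ s (k + j) ]) 0 v0 (v1 :+ k1) (eqn (v0 :+ v2) (v1 :+ v3) (next k) (hyp v3 k1 (⟨⟩≤1 (s (k + j))) [])))
   ... | a₁ , a₂ | b₁ , b₂ =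
    (lin 5 (clamp (c k)) (clamp (c (suc n + k))) (#< n (λ i → mixed (i + k))) ([ mixed (n + k) ]) (clamp (c (n + k))) 0 v0 (v1 :+ (v2 :+ v3)) (hyp v0 (v4 :+ v2) a₁ (hyp v4 (v1 :+ v3) b₁ []))) ,
    (lin 5 (clamp (c (suc n + k))) (clamp (c k)) (#< n (λ i → mixed (i + k))) ([ mixed (n + k) ]) (clamp (c (n + k))) 0 v0 (v1 :+ (v2 :+ v3)) (hyp v4 (v1 :+ v2) a₂ (hyp v0 (v4 :+ v3) b₂ [])))

   Low High : ℕ → Set
   Low k = c k ≤ q
   High k = 4 * q ≤ c k

   crossing : ∀ {k l} → k ≤ l → (Low k × High l) ⊎ (High k × Low l) → 3 * q + #< k mixed ≤ #< l mixed
   crossing {k} {l} k≤l h = (lin 4 q (#< k mixed) (#< l mixed) (#< (l ∸ k) (λ i → mixed (i + k))) 0 (k3 :* v0 :+ v1) v2 (eqn⁻ v2 (v1 :+ v3) split (hyp (k3 :* v0) v3 (across h) [])))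
    where
    split : #< l mixed ≡ #< k mixed + #< (l ∸ k) (λ i → mixed (i + k))
    split = trans (cong (λ t → #< t mixed) (sym (+∸ k≤l))) (trans (Σ<-split k (l ∸ k) ([_] ∘ mixed)) (cong (#< k mixed +_) (Σ<-cong (l ∸ k) λ i _ → cong ([_] ∘ mixed) (+-comm k i))))
    low-clamp : ∀ {k} → Low k → clamp (c k) ≡ 0
    low-clamp {k} lo = n≤0⇒n≡0 (≤-trans (m⊓n≤m (c k ∸ q) _) (≡⇒≤ (m≤n⇒m∸n≡0 lo)))
    high-clamp : ∀ {k} → High k → clamp (c k) ≡ 3 * q
    high-clamp {k} hi = m≥n⇒m⊓n≡n (m+n≤o⇒m≤o∸n (3 * q) (lin 2 q (c k) 0 (k3 :* v0 :+ v0) v1 (hyp (k4 :* v0) v1 hi [])))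
    at-l : c (l ∸ k + k) ≡ c l
    at-l = cong c (m∸n+n≡m k≤l)
    across : (Low k × High l) ⊎ (High k × Low l) → 3 * q ≤ #< (l ∸ k) (λ i → mixed (i + k))
    across (inj₁ (lo , hi)) = (lin 5 q (#< (l ∸ k) (λ i → mixed (i + k))) (clamp (c (l ∸ k + k))) (clamp (c k)) (clamp (c l)) 0 (k3 :* v0) v1 (hyp v2 (v3 :+ v1) (proj₂ (travel k (l ∸ k))) (eqn⁻ v2 v4 (cong clamp at-l) (eqn⁻ v4 (k3 :* v0) (high-clamp {l} hi) (eqn v3 k0 (low-clamp {k} lo) [])))))
    across (inj₂ (hi , lo)) = (lin 5 q (#< (l ∸ k) (λ i → mixed (i + k))) (clamp (c k)) (clamp (c (l ∸ k + k))) (clamp (c l)) 0 (k3 :* v0) v1 (hyp v2 (v3 :+ v1) (proj₁ (travel k (l ∸ k))) (eqn v3 v4 (cong clamp at-l) (eqn⁻ v2 (k3 :* v0) (high-clamp {k} hi) (eqn v4 k0 (low-clamp {l} lo) [])))))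

   -- A mixed window has `c * D ≥ 4 q²`, while `mixing` with `j = 5 q` allows little more than
   -- `125/3 q³` in total: too few windows for four crossings.
   few-mixed : #< p mixed < 4 * (3 * q)
   few-mixed = *-cancelˡ-< (12 * (q * q)) _ _ (lin 5 q (#< p mixed) (Σ< p (λ k → 4 * (q * q) * [ mixed k ])) (Σ< p (λ k → c k * D k)) C 3 (1+ (& 12 :* (v0 :* v0) :* v1)) (& 12 :* (v0 :* v0) :* (k4 :* (k3 :* v0))) (hyp* 12 v2 v3 (Σ<-mono p (λ k _ → rich k)) (eqn⁻* 12 v2 (k4 :* (v0 :* v0) :* v1) (Σ<-* p (4 * (q * q))
    ([_] ∘ mixed)) (hyp* 4 (k3 :* v3) (k5 :* v0 :* (k5 :* v0) :* (k5 :* v0) :+ k3 :* v4 :* (k5 :* v0 :* (k5 :* v0))) mixing (mul* 3 (v0 :* v0) (v4 :* & 100) v0 C≤q (hyp* 4 k1 (v0 :* v0 :* v0) (*-mono-≤ (*-mono-≤ 1≤q 1≤q) 1≤q) []))))))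
    where
    rich : ∀ k → 4 * (q * q) * [ mixed k ] ≤ c k * D k
    rich k with q ≤ᵇ c k in lo | c k ≤ᵇ 4 * q in hi
    ... | false | _ = ≤-trans (≡⇒≤ (*0 (4 * (q * q)))) z≤n
    ... | true | false = ≤-trans (≡⇒≤ (*0 (4 * (q * q)))) z≤n
    ... | true | true = bound (≤ᵇ⇒≤ q (c k) (T! lo)) (≤ᵇ⇒≤ (c k) (4 * q) (T! hi)) (c+D k)
     where
     bound : ∀ {v d} → q ≤ v → v ≤ 4 * q → v + d ≡ 5 * q → 4 * (q * q) * 1 ≤ v * d
     bound {v} {d} lo hi eq = (lin 4 q v d e 2 (k4 :* (v0 :* v0) :* k1) (v1 :* v2) (mul* 4 (k3 :* v0) (v0 :+ v3) v1 (≡⇒≤ e≡) (mul* 3 v3 v1 (v0 :+ v3) (≡⇒≤ (sym e≡)) (mul* 3 v1 (k4 :* v0) (v2 :+ v3) (≡⇒≤ (sym d≡)) (mul* 3 v3 v3 (k3 :* v0) e≤ [])))))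
      where
      e = v ∸ q
      e≡ : q + e ≡ v
      e≡ = +∸ lo
      d≡ : d + e ≡ 4 * q
      d≡ = (linEq 4 d e q v (v0 :+ v1) (k4 :* v2) 0 (eqn (v2 :+ v1) v3 e≡ (eqn (v3 :+ v0) (k5 :* v2) eq [])) 0 (eqn⁻ (v2 :+ v1) v3 e≡ (eqn⁻ (v3 :+ v0) (k5 :* v2) eq [])))
      e≤ : e ≤ 3 * q
      e≤ = (lin 3 e q v 0 v0 (k3 :* v1) (eqn (v1 :+ v0) v2 e≡ (hyp v2 (k4 :* v1) hi [])))

   -- Around the circle the counts pass from low to high and back; another high window would need
   -- two more crossings. Between the last low window before the first high one and the next low
   -- one, no window is low; elsewhere none is high.
   module FromLow (low0 : Low 0) where

    low-p : Low p
    low-p = subst (_≤ q) (Σ<-cong j λ i _ → cong ([_] ∘ S) (trans (cong (λ t → a ⊹ t) (sym (⊹-identityˡ (i • x)))) (cong (λ t → a ⊹ t) (trans (cong (_⊹ i • x) (sym (p•x≡𝟘 x))) (sym (•-+ p i x)))))) low0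

    -- Otherwise `D ≥ q` everywhere, and the sum in `mixing` is at least `q * 5 q * 9 q = 45 q³`,
    -- more than it allows.
    some-high : ∃ λ k → k < p × High k
    some-high with anyUpTo? (λ k → 4 * q ℕ.≤? c k) p
    ... | yes found = found
    ... | no none = (absurd (lin 6 (Σ< p (λ k → c k * D k)) q C (Σ< p (λ k → q * c k)) (Σ< p c) (# S) 36 k1 k0 (hyp* 4 (k3 :* v0) (k5 :* v1 :* (k5 :* v1) :* (k5 :* v1) :+ k3 :* v2 :* (k5 :* v1 :* (k5 :* v1))) mixing (hyp* 12 v3 v0 (Σ<-mono p (λ k k<p → low-rich k k<p)) (eqn⁻* 12 v3 (v1 :* v4) (Σ<-* p q c) (mul* 12 v1
     (k5 :* v1 :* v5) v4 (≡⇒≤ (sym Σc)) (mul* 60 (v1 :* v1) (k9 :* v1) v5 9q≤S (mul* 3 (v1 :* v1) (v2 :* & 100) v1 C≤q (hyp* 37 k1 (v1 :* v1 :* v1) (*-mono-≤ (*-mono-≤ 1≤q 1≤q) 1≤q) [])))))))))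
     where
     low-rich : ∀ k → k < p → q * c k ≤ c k * D k
     low-rich k k<p = ≤-trans (≡⇒≤ (*-comm q (c k))) (*-monoʳ-≤ (c k) (lin 3 q (D k) (c k) 0 v0 v1 (eqn⁻ (v2 :+ v1) (k5 :* v0) (c+D k) (hyp (1+ v2) (k4 :* v0) (≰⇒> (λ hi → none (k , k<p , hi))) []))))

    near : NearArc S x (9 * q)
    near = from-high (least (λ k → 4 * q ℕ.≤? c k) (proj₁ some-high) (proj₂ (proj₂ some-high)))
     where
     from-high : (∃ λ F → F ≤ proj₁ some-high × High F × (∀ k → k < F → ¬ High k)) → NearArc S x (9 * q)
     from-high (F , F≤ , high-F , before-F) = ends
      (greatest (λ k → c k ℕ.≤? q) F low0)
      (least (λ k → c (F + k) ℕ.≤? q) (p ∸ F) (subst Low (sym (+∸ F≤p)) low-p))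
      where
      F≤p : F ≤ p
      F≤p = ≤-trans F≤ (<⇒≤ (proj₁ (proj₂ some-high)))
      ends : (∃ λ l → l ≤ F × Low l × (∀ k → l < k → k ≤ F → ¬ Low k)) → (∃ λ t → t ≤ p ∸ F × Low (F + t) × (∀ k → k < t → ¬ Low (F + k))) → NearArc S x (9 * q)
      ends (l , l≤F , low-l , after-l) (t , t≤ , low-r , before-r) = average
       where
       r = F + t
       l<F : l < F
       l<F = ≰⇒> λ le → (absurd (lin 2 (c F) q 2 k1 k0 (hyp v0 v1 (subst Low (≤-antisym l≤F le) low-l) (hyp (k4 :* v1) v0 high-F (hyp* 3 k1 v1 1≤q [])))))
       1≤t : 1 ≤ t
       1≤t = ≰⇒> λ le → (absurd (lin 2 (c F) q 2 k1 k0 (hyp v0 v1 (subst Low (trans (cong (F +_) (n≤0⇒n≡0 le)) (+0 F)) low-r) (hyp (k4 :* v1) v0 high-F (hyp* 3 k1 v1 1≤q [])))))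
       r≤p : r ≤ p
       r≤p = ≤-trans (+-monoʳ-≤ F t≤) (≡⇒≤ (+∸ F≤p))
       len = r ∸ suc l
       l+len : suc l + len ≡ r
       l+len = +∸ (lin 3 l F t 0 (1+ v0) (v1 :+ v2) (hyp (1+ v0) v1 l<F []))
       not-low : ∀ k → k < len → ¬ Low (suc l + k)
       not-low k k<len lo with ≤-<-connex (suc l + k) F
       ... | inj₁ le = after-l (suc l + k) (s≤s (m≤m+n l k)) le lo
       ... | inj₂ gt = before-r (suc l + k ∸ F) (lin 6 (suc l + k ∸ F) t F l k len 0 (1+ v0) v1 (eqn (v2 :+ v0) ((1+ v3) :+ v4) (+∸ (<⇒≤ gt)) (hyp (1+ v4) v5 k<len (eqn ((1+ v3) :+ v5) (v2 :+ v1) l+len [])))) (subst Low (sym (+∸ (<⇒≤ gt))) lo)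
       not-high : ∀ k → r ≤ k → k ≤ p → ¬ High k
       not-high k r≤k k≤p hi = <⇒≱ few-mixed (lin 6 q (#< p mixed) (#< l mixed) (#< F mixed) (#< r mixed) (#< k mixed) 0 (k4 :* (k3 :* v0)) v1 (hyp (k3 :* v0 :+ v2) v3 (crossing l≤F (inj₁ (low-l , high-F))) (hyp (k3 :* v0 :+ v3) v4 (crossing (m≤m+n F t) (inj₂ (high-F , low-r))) (hyp (k3 :* v0 :+ v4) v5 (crossing
        r≤k (inj₁ (low-r , hi))) (hyp (k3 :* v0 :+ v5) v1 (crossing k≤p (inj₂ (hi , low-p))) [])))))
       -- The errors of the arc when each window is represented by its position `i`. Each error is
       -- paid by `c * D / q`, since `c ≥ q` inside and `D ≥ q` outside; over the `5 q` positions
       -- the average is below `9 q`.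
       wrong : ℕ → ℕ
       wrong i = #< len (λ k → not (s (suc l + k + i))) + (#< (p ∸ r) (λ k → s (r + k + i)) + #< (suc l) (λ k → s (k + i)))
       wrong-total : Σ< j wrong ≡ Σ< len (λ k → D (suc l + k)) + (Σ< (p ∸ r) (λ k → c (r + k)) + Σ< (suc l) c)
       wrong-total = trans (Σ<-+ j (λ i → #< len (λ k → not (s (suc l + k + i)))) _) (cong₂ _+_ (Σ<-swap j len λ i k → [ not (s (suc l + k + i)) ])
        (trans (Σ<-+ j (λ i → #< (p ∸ r) (λ k → s (r + k + i))) _) (cong₂ _+_ (Σ<-swap j (p ∸ r) λ i k → [ s (r + k + i) ]) (Σ<-swap j (suc l) λ i k → [ s (k + i) ]))))
       split-p : Σ< p (λ k → c k * D k) ≡ Σ< (suc l) (λ k → c k * D k) + Σ< len (λ k → c (suc l + k) * D (suc l + k)) + Σ< (p ∸ r) (λ k → c (r + k) * D (r + k))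
       split-p = trans (cong (λ n → Σ< n (λ k → c k * D k)) (sym (+∸ r≤p))) (trans (Σ<-split r (p ∸ r) _) (cong (_+ Σ< (p ∸ r) (λ k → c (r + k) * D (r + k)))
        (trans (cong (λ n → Σ< n (λ k → c k * D k)) (sym l+len)) (Σ<-split (suc l) len _))))
       outside-rich : ∀ k → ¬ High k → q * c k ≤ c k * D k
       outside-rich k ¬hi = ≤-trans (≡⇒≤ (*-comm q (c k))) (*-monoʳ-≤ (c k) (lin 3 q (D k) (c k) 0 v0 v1 (eqn⁻ (v2 :+ v1) (k5 :* v0) (c+D k) (hyp (1+ v2) (k4 :* v0) (≰⇒> ¬hi) []))))
       inside-rich : ∀ k → ¬ Low k → q * D k ≤ c k * D k
       inside-rich k ¬lo = *-monoˡ-≤ (D k) (<⇒≤ (≰⇒> ¬lo))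
       total-wrong : 3 * (q * Σ< j wrong) ≤ 5 * q * (5 * q) * (5 * q) + 3 * C * (5 * q * (5 * q))
       total-wrong = (lin 10 q (Σ< j wrong) C (Σ< len (λ k → D (suc l + k))) (Σ< (p ∸ r) (λ k → c (r + k))) (Σ< (suc l) c) (Σ< p (λ k → c k * D k)) (Σ< (suc l) (λ k → c k * D k)) (Σ< len (λ k → c (suc l + k) * D (suc l + k))) (Σ< (p ∸ r) (λ k → c (r + k) * D (r + k))) 0 (k3 :* (v0 :* v1)) (k5 :* v0 :* (k5 :* v0)
        :* (k5 :* v0) :+ k3 :* v2 :* (k5 :* v0 :* (k5 :* v0))) (mul* 3 v0 v1 (v3 :+ (v4 :+ v5)) (≡⇒≤ wrong-total) (hyp (k3 :* v6) (k5 :* v0 :* (k5 :* v0) :* (k5 :* v0) :+ k3 :* v2 :* (k5 :* v0 :* (k5 :* v0))) mixing (eqn⁻* 3 v6 (v7 :+ v8 :+ v9) split-p (hyp* 3 (v0 :* v5) v7 (subst (_≤ Σ< (suc l) (λ k → c k * D k)) (Σ<-* (suc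
        l) q c) (Σ<-mono (suc l) λ k k≤l → outside-rich k (before-F k (≤-<-trans (≤-pred k≤l) l<F)))) (hyp* 3 (v0 :* v3) v8 (subst (_≤ Σ< len (λ k → c (suc l + k) * D (suc l + k))) (Σ<-* len q (λ k → D (suc l + k))) (Σ<-mono len λ k k< → inside-rich (suc l + k) (not-low k k<))) (hyp* 3 (v0 :* v4) v9 (subst (_≤ Σ< (p ∸ r) (λ k
        → c (r + k) * D (r + k))) (Σ<-* (p ∸ r) q (λ k → c (r + k))) (Σ<-mono (p ∸ r) λ k k< → outside-rich (r + k) (not-high (r + k) (m≤m+n r k) (≤-trans (+-monoʳ-≤ r (<⇒≤ k<)) (≡⇒≤ (+∸ r≤p)))))) [])))))))
       average : NearArc S x (9 * q)
       average = pick (Σ<-<⇒∃ j wrong (λ _ → 9 * q) (*-cancelˡ-< (3 * q) _ _ (lin 4 q (Σ< j wrong) (Σ< j (λ _ → 9 * q)) C 179 (1+ (k3 :* v0 :* v1)) (k3 :* v0 :* v2) (hyp* 180 (k3 :* (v0 :* v1)) (k5 :* v0 :* (k5 :* v0) :* (k5 :* v0) :+ k3 :* v3 :* (k5 :* v0 :* (k5 :* v0))) total-wrong (mul* 169 (k3 :* v0) (k5 :* v0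
        :* (k9 :* v0)) v2 (≡⇒≤ (sym (Σ<-const j (9 * q)))) (mul* 135 (v0 :* v0) (v3 :* & 100) v0 C≤q (hyp* 180 k1 (v0 :* v0 :* v0) (*-mono-≤ (*-mono-≤ 1≤q 1≤q) 1≤q) [])))))))
        where
        pick : (∃ λ i → i < j × wrong i < 9 * q) → NearArc S x (9 * q)
        pick (i , _ , small-i) = near-arc (a ⊹ (suc l + i) • x) len (≤-trans (m∸n≤m r (suc l)) r≤p) (<⇒≤ (subst (_< 9 * q) same small-i))
         where
         moved : ∀ k m → m ≡ suc l + k + i → S (a ⊹ m • x) ≡ line S x (a ⊹ (suc l + i) • x) k
         moved k m eq = cong S (trans (cong (λ t → a ⊹ t • x) (trans eq (linEq 3 l k i ((1+ v0) :+ v1 :+ v2) ((1+ v0) :+ v2 :+ v1) 0 [] 0 []))) (trans (cong (a ⊹_) (•-+ (suc l + i) k x)) (sym (⊹-assoc a _ _))))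
         tail : Σ< (p ∸ len) (λ k → [ line S x (a ⊹ (suc l + i) • x) (len + k) ]) ≡ #< (p ∸ r) (λ k → s (r + k + i)) + #< (suc l) (λ k → s (k + i))
         tail = trans (cong (λ n → Σ< n λ k → [ line S x (a ⊹ (suc l + i) • x) (len + k) ]) p-len≡) (trans (Σ<-split (p ∸ r) (suc l) _) (cong₂ _+_
          (Σ<-cong (p ∸ r) λ k _ → cong [_] (sym (moved (len + k) (r + k + i) (linEq 6 F t k i l len (v0 :+ v1 :+ v2 :+ v3) ((1+ v4) :+ (v5 :+ v2) :+ v3) 0 (eqn⁻ ((1+ v4) :+ v5) (v0 :+ v1) l+len []) 0 (eqn ((1+ v4) :+ v5) (v0 :+ v1) l+len [])))))
          (Σ<-cong (suc l) λ k _ → cong [_] (sym (trans (cong S (wrap k)) (moved (len + (p ∸ r + k)) (p + (k + i)) (linEq 8 p k i l len (p ∸ r) F t (v0 :+ (v1 :+ v2)) ((1+ v3) :+ (v4 :+ (v5 :+ v1)) :+ v2) 0 (eqn⁻ ((1+ v3) :+ v4) (v6 :+ v7) l+len (eqn⁻ (v6 :+ v7 :+ v5) v0 (+∸ r≤p) [])) 0 (eqn ((1+ v3) :+ v4) (v6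
           :+ v7) l+len (eqn (v6 :+ v7 :+ v5) v0 (+∸ r≤p) [])))))))))
          where
          wrap : ∀ k → a ⊹ (k + i) • x ≡ a ⊹ (p + (k + i)) • x
          wrap k = cong (a ⊹_) (sym (trans (•-+ p (k + i) x) (trans (cong (_⊹ (k + i) • x) (p•x≡𝟘 x)) (⊹-identityˡ _))))
          p-len≡ : p ∸ len ≡ p ∸ r + suc l
          p-len≡ = (linEq 7 (p ∸ len) (p ∸ r) l F t p len v0 (v1 :+ (1+ v2)) 0 (eqn⁻ (v3 :+ v4 :+ v1) v5 (+∸ r≤p) (eqn⁻ ((1+ v2) :+ v6) (v3 :+ v4) l+len (eqn (v6 :+ v0) v5 (+∸ (≤-trans (m∸n≤m r (suc l)) r≤p)) []))) 0 (eqn (v3 :+ v4 :+ v1) v5 (+∸ r≤p) (eqn ((1+ v2) :+ v6) (v3 :+ v4) l+len (eqn⁻ (v6 :+ v0) v5 (+∸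
           (≤-trans (m∸n≤m r (suc l)) r≤p)) []))))
         same : wrong i ≡ #< len (λ k → not (line S x (a ⊹ (suc l + i) • x) k)) + #< (p ∸ len) (λ k → line S x (a ⊹ (suc l + i) • x) (len + k))
         same = cong₂ _+_ (Σ<-cong len λ k _ → cong (λ b → [ not b ]) (moved k _ refl)) (sym tail)

  arc : NearArc S x (9 * q)
  arc = from-low (anyUpTo? (λ k → Around.c 𝟘 k ℕ.≤? q) p)
   where
   open Around 𝟘
   from-low : Dec (∃ λ k → k < p × c k ≤ q) → NearArc S x (9 * q)
   from-low (yes (k , _ , lo)) = Around.FromLow.near (𝟘 ⊹ k • x) (subst (_≤ q) (Σ<-cong j λ i _ → cong ([_] ∘ S) (trans (cong (𝟘 ⊹_) (•-+ k i x)) (sym (⊹-assoc 𝟘 (k • x) (i • x))))) lo)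
   from-low (no none) = (absurd (lin 6 (Σ< p (λ k → c k * D k)) q C (Σ< p (λ k → q * D k)) (Σ< p D) (# (∁ S)) 36 k1 k0 (hyp* 4 (k3 :* v0) (k5 :* v1 :* (k5 :* v1) :* (k5 :* v1) :+ k3 :* v2 :* (k5 :* v1 :* (k5 :* v1))) mixing (hyp* 12 v3 v0 (Σ<-mono p (λ k k<p → *-monoˡ-≤ (D k) (<⇒≤ (≰⇒> λ le → none (k , k<p , le)))))
    (eqn⁻* 12 v3 (v1 :* v4) (Σ<-* p q D) (mul* 12 v1 (k5 :* v1 :* v5) v4 (≡⇒≤ (sym ΣD)) (mul* 60 (v1 :* v1) (k9 :* v1) v5 9q≤∁S (mul* 3 (v1 :* v1) (v2 :* & 100) v1 C≤q (hyp* 37 k1 (v1 :* v1 :* v1) (*-mono-≤ (*-mono-≤ 1≤q 1≤q) 1≤q) [])))))))))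

 -- The arc structure of an extremal pair.

 shrunk-linear : ∀ {P} h D e e' → Shrunk h e' P → 1 ≤ e' → 1 ≤ h → e' ≤ e → 4 * # P ≤ h * D → h * h * e * 2000 ≤ D → D ≤ # P →
  2 * # P + D + 3 ≤ p → 1 ≤ # P → ∀ R → 2 * R ≤ # P → Linear (width P) R (2 * D + 3)
 shrunk-linear {P} h D e e' S 1≤e' 1≤h e'≤e 4n≤hD e-small D≤n room 1≤n R 2R≤n = Growth.linear (Shrunk.extremal-pair S) 1≤e' e'<m D fine room 1≤n R 2R≤n
  where
  n = # P
  m = # (Shrunk.F S)
  hh = h * h
  hh≥1 : 1 ≤ hh
  hh≥1 = *-mono-≤ 1≤h 1≤h
  e'-small : hh * e' * 2000 ≤ D
  e'-small = ≤-trans (*-monoˡ-≤ 2000 (*-monoʳ-≤ hh e'≤e)) e-small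
  4m≤D : 4 * m ≤ D
  4m≤D = cancelˡ h 1≤h (lin 4 h m D n 0 (v0 :* (k4 :* v1)) (v0 :* v2) (hyp* 4 (v0 :* v1) v3 (Shrunk.thin S) (hyp (k4 :* v3) (v0 :* v2) 4n≤hD [])))
  m≥1 : 1 ≤ m
  m≥1 = ≰⇒> λ m≤0 → (absurd (lin 3 n h m 0 k1 k0 (hyp v0 (v1 :* v1 :* v2 :* & 64) (Shrunk.thick S) (mul* 64 (v1 :* v1) v2 k0 m≤0 (hyp k1 v0 1≤n [])))))
  -- Since `F` is not too small, a radius up to `n` spans only `O(h²)` multiples of `m`, and the
  -- accumulated error is of order `h² e'`.
  few-multiples : ∀ j → j * m ≤ n → j ≤ hh * 64
  few-multiples j jm≤n = *-cancelʳ-≤ j (hh * 64) m {{ℕ.>-nonZero m≥1}} (lin 4 j m hh n 0 (v0 :* v1) (v2 :* & 64 :* v1) (hyp (v0 :* v1) v3 jm≤n (hyp v3 (v2 :* v1 :* & 64) (Shrunk.thick S) [])))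
  e'<m : e' < m
  e'<m = *-cancelˡ-< (hh * 64) _ _ (lin 5 hh e' m n D 399 (1+ (v0 :* & 64 :* v1)) (v0 :* & 64 :* v2) (hyp* 13 v3 (v0 :* v2 :* & 64) (Shrunk.thick S) (hyp* 13 (v0 :* v1 :* & 2000) v4 e'-small (hyp* 13 v4 v3 D≤n (mul* 400 v1 k1 v0 hh≥1 (hyp* 400 k1 v1 1≤e' []))))))
  fine : ∀ j → j * (m + 3 * e') ≤ n → 2 * (m + 3 * e') + e' * j * 10 ≤ D
  fine j jM≤n = (lin 5 m e' j D hh 999 (k2 :* (v0 :+ k3 :* v1) :+ v1 :* v2 :* & 10) v3 (hyp* 500 (k4 :* v0) v3 4m≤D (mul* 10000 v1 v2 (v4 :* & 64) (few-multiples j (lin 4 j m n e' 0 (v0 :* v1) v2 (hyp (v0 :* (v1 :+ k3 :* v3)) v2 jM≤n []))) (hyp* 323 (v4 :* v1 :* & 2000) v3 e'-small (mul* 6000 v1 k1 v4 hh≥1 [])))))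

 module Structure {A B X n e} (E : Extremal A B X e) (#A : # A ≡ n) (#B : # B ≡ n) (X<2n : # X < 2 * n) (1≤e : 1 ≤ e)
  (q D h k : ℕ) (1≤h : 1 ≤ h) (3≤D : 3 ≤ D) (D≤q : D * 1000000 ≤ q) (e≤q : e * 100000 ≤ q) (q≤n : q * 5000 ≤ n) (gap : 2 * n + 10 * q ≤ p)
  (n≤hD : 4 * n ≤ h * D) (small-e : h * h * (5^ k * e) * 2000 ≤ D) (k-large : h * 3 ℕ.^ k ≤ 4 ℕ.^ k) where

  E₀ : ℕ
  E₀ = 2 * D + 3

  1≤n : 1 ≤ n
  1≤n = (lin 3 n q D 14999999999 k1 v0 (hyp (v1 :* & 5000) v0 q≤n (hyp* 5000 (v2 :* & 1000000) v1 D≤q (hyp* 5000000000 k3 v2 3≤D []))))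

  shrink-from : ∀ {F X'} → Extremal A F X' e → # F ≤ n → # F + # X' ≤ p → q ≤ # F → ∃ λ j → Shrunk h (5^ j * e) A × j ≤ k
  shrink-from {F} {X'} E' F≤n room q≤F = shrink h k e {A} {F} {X'} E' 1≤h 1≤e
   (lin 7 h (5^ k) e (# A) D n q 9765624999 (v0 :* v0 :* (v1 :* v2) :* & 1024) v3 (hyp* 5000000000 (v0 :* v0 :* (v1 :* v2) :* & 2000) v4 small-e (eqn⁻ v3 v5 #A (hyp (v6 :* & 5000) v5 q≤n (hyp* 5000 (v4 :* & 1000000) v6 D≤q [])))))
   (subst (# F ≤_) (sym #A) F≤n) room (lin 4 (# A) p n q 1 (1+ (k4 :* v0)) (k3 :* v1) (eqn* 8 v0 v2 #A (hyp* 5 (k2 :* v2 :+ & 10 :* v3) v1 gap (hyp* 2 k1 v2 1≤n []))))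
   (lin 6 (# A) h (# F) n D q 3999999 v0 (v1 :* v1 :* v2 :* & 64) (eqn* 4000000 v0 v3 #A (hyp* 1000000 (k4 :* v3) (v1 :* v4) n≤hD (mul v1 (v4 :* & 1000000) v5 D≤q (mul v1 v5 v2 q≤F (hyp (v1 :* v2) (v1 :* v1 :* v2) hF≤ []))))))
   (lin 5 h (# F) (3 ℕ.^ k) (# A) (4 ℕ.^ k) 0 (v0 :* v1 :* v2) (v3 :* v4) (mul v1 (v0 :* v2) v4 k-large (mul v4 v1 v3 (subst (# F ≤_) (sym #A) F≤n) [])))
   where
   hF≤ : h * # F ≤ h * h * # F
   hF≤ = *-monoˡ-≤ (# F) (≤-trans (≡⇒≤ (sym (*-identityˡ h))) (*-monoˡ-≤ h 1≤h))

  -- Shrink the smallest of the three sets A, B and ∁ X.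
  shrunk-A : ∃ λ j → Shrunk h (5^ j * e) A × j ≤ k
  shrunk-A with ≤-total (n + # X) p
  ... | inj₁ sparse = shrink-from E (≡⇒≤ #B) (subst (λ t → t + # X ≤ p) (sym #B) sparse) (lin 3 q (# B) n 4999 v0 v1 (eqn⁻ v1 v2 #B (hyp (v0 :* & 5000) v2 q≤n [])))
  ... | inj₂ dense = shrink-from (extremal-rotate E) (lin 5 (# (negate (∁ X))) n (# (∁ X)) (# X) p 0 v0 v1 (eqn v0 v2 (#-negate (∁ X)) (eqn (v3 :+ v2) v4 (#-∁ X) (hyp v4 (v1 :+ v3) dense []))))
    (lin 8 (# (negate (∁ X))) (# (negate (∁ B))) p (# (∁ X)) (# (∁ B)) (# X) (# B) n 0 (v0 :+ v1) v2 (eqn v0 v3 (#-negate (∁ X)) (eqn v1 v4 (#-negate (∁ B)) (eqn (v5 :+ v3) v2 (#-∁ X) (eqn (v6 :+ v4) v2 (#-∁ B) (eqn⁻ v6 v7 #B (hyp v2 (v7 :+ v5) dense [])))))))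
    (lin 6 q (# (negate (∁ X))) (# (∁ X)) (# X) p n 9 v0 v1 (eqn⁻ v1 v2 (#-negate (∁ X)) (eqn⁻ (v3 :+ v2) v4 (#-∁ X) (hyp (1+ v3) (k2 :* v5) X<2n (hyp (k2 :* v5 :+ & 10 :* v0) v4 gap [])))))

  5^-mono : ∀ {j k} → j ≤ k → 5^ j ≤ 5^ k
  5^-mono {k = k} z≤n = 5^≥1 k
  5^-mono (s≤s j≤k) = *-monoʳ-≤ 5 (5^-mono j≤k)

  linear-A : ∀ R → 2 * R ≤ # A → Linear (width A) R E₀
  linear-A R 2R≤ = from shrunk-A
   where
   from : (∃ λ j → Shrunk h (5^ j * e) A × j ≤ k) → Linear (width A) R E₀
   from (j , S , j≤k) = shrunk-linear h D (5^ k * e) (5^ j * e) S (*-mono-≤ (5^≥1 j) 1≤e) 1≤h (*-monoˡ-≤ e (5^-mono j≤k))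
    (subst (λ t → 4 * t ≤ h * D) (sym #A) n≤hD) small-e
    (lin 4 D (# A) n q 4999999999 v0 v1 (eqn⁻ v1 v2 #A (hyp (v3 :* & 5000) v2 q≤n (hyp* 5000 (v0 :* & 1000000) v3 D≤q []))))
    (lin 5 (# A) D p n q 499999 (k2 :* v0 :+ v1 :+ k3) v2 (eqn* 1000000 v0 v3 #A (hyp* 500000 (k2 :* v3 :+ & 10 :* v4) v2 gap (hyp (v1 :* & 1000000) v4 D≤q (hyp* 500000 k3 v1 3≤D [])))))
    (subst (1 ≤_) (sym #A) 1≤n) R 2R≤

  ρ : ℕ
  ρ = q * 11

  Step : G → Set
  Step x = x ≢ 𝟘 × (∀ i → 2 * (i + 3 * (E₀ * 400)) ≤ ρ → width A (i • x) ≤ i + 8 * (E₀ * 400))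

  step : ∃ Step
  step = Multiples.generator (linear-A (ρ * 20 * 10) (lin 3 q (# A) n 24 (k2 :* (v0 :* & 11 :* & 20 :* & 10)) v1 (eqn⁻* 22 v1 v2 #A (hyp* 22 (v0 :* & 5000) v2 q≤n [])))) (lin 1 D 0 k3 (k2 :* v0 :+ k3) []) ρ ≤-refl
   (lin 2 D q 99 ((k2 :* v0 :+ k3) :* & 30000) (v1 :* & 11) (hyp* 9 (v0 :* & 1000000) v1 D≤q (hyp* 3000000 k3 v0 3≤D [])))
   (lin 4 p n q D 9999999 (1+ k2) v0 (hyp (k2 :* v1 :+ & 10 :* v2) v0 gap (hyp* 10 (v3 :* & 1000000) v2 D≤q (hyp* 10000000 k3 v3 3≤D []))))
   (lin 2 D q 999 ((k2 :* v0 :+ k3) :* & 1000) (v1 :* & 11 :* & 20) (hyp* 3 (v0 :* & 1000000) v1 D≤q (hyp* 1000000 k3 v0 3≤D [])))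

  module WithStep (x : G) (x≢0 : x ≢ 𝟘) (orbit : ∀ i → 2 * (i + 3 * (E₀ * 400)) ≤ ρ → width A (i • x) ≤ i + 8 * (E₀ * 400)) where

   C : ℕ
   C = 8 * (E₀ * 400) + 8 * e

   C-small : C * 100 ≤ q
   C-small = (lin 3 D e q 124 ((k8 :* ((k2 :* v0 :+ k3) :* & 400) :+ k8 :* v1) :* & 100) v2 (hyp* 120 (v0 :* & 1000000) v2 D≤q (hyp* 40000000 k3 v0 3≤D (hyp (v1 :* & 100000) v2 e≤q []))))

   width-A : ∀ i → i < 5 * q → width A (i • x) ≤ i + 8 * (E₀ * 400)
   width-A i i< = orbit i (lin 3 i D q 1499999 (k2 :* (v0 :+ k3 :* ((k2 :* v1 :+ k3) :* & 400))) (v2 :* & 11) (hyp* 3000000 (1+ v0) (k5 :* v2) i< (hyp* 10799 (v1 :* & 1000000) v2 D≤q (hyp* 3599000000 k3 v1 3≤D []))))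

   -- The small width passes from `A` to `X` through the rotated triple in which `- ∁ X` is a
   -- summand and `- ∁ A` the sumset; `width-B` then passes it on to `B` through the original
   -- triple.
   width-X : ∀ i → i < 5 * q → width X (i • x) ≤ i + 8 * (E₀ * 400) + 4 * e
   width-X i i< = ≤-trans (subst₂ (λ a b → a ≤ b + 4 * e) (trans (width-negate (∁ X) (i • x)) (width-∁ X (i • x))) (trans (width-negate (∁ A) (i • x)) (width-∁ A (i • x)))
    (width-transfer (extremal-rotate (extremal-comm E)) 1≤e
     (lin 7 e (# (negate (∁ X))) (# (∁ X)) (# X) p n q 999999 v0 v1 (eqn⁻ v1 v2 (#-negate (∁ X)) (eqn⁻ (v3 :+ v2) v4 (#-∁ X) (hyp (1+ v3) (k2 :* v5) X<2n (hyp (k2 :* v5 :+ & 10 :* v6) v4 gap (hyp* 10 (v0 :* & 100000) v6 e≤q []))))))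
     (lin 4 e (# B) n q 499999999 v0 v1 (eqn⁻ v1 v2 #B (hyp (v3 :* & 5000) v2 q≤n (hyp* 5000 (v0 :* & 100000) v3 e≤q []))))
     (i • x)
     (lin 13 e (# (cut (∁ (negate (∁ A))) (i • x))) (width (∁ (negate (∁ A))) (i • x)) (# (∁ (negate (∁ A)))) (width A (i • x)) (# (negate (∁ A))) p (# (∁ A)) (# A) i D q n 1498497120099999 v0 v1 (eqn⁻* 3000000 (v1 :+ v2) v3 (cut+width (∁ (negate (∁ A))) (i • x)) (eqn* 3000000 v2 v4 (trans (width-∁ (negate (∁ A)) (i
      • x)) (trans (width-negate (∁ A) (i • x)) (width-∁ A (i • x)))) (eqn⁻* 3000000 (v5 :+ v3) v6 (#-∁ (negate (∁ A))) (eqn* 3000000 v5 v7 (#-negate (∁ A)) (eqn* 3000000 (v8 :+ v7) v6 (#-∁ A) (hyp* 3000000 v4 (v9 :+ k8 :* ((k2 :* v10 :+ k3) :* & 400)) (width-A i i<) (hyp* 3000000 (1+ v9) (k5 :* v11) i< (eqn⁻* 3000000 v8 v12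
      #A (hyp* 3000000 (v11 :* & 5000) v12 q≤n (hyp* 14984971201 (v0 :* & 100000) v11 e≤q (hyp* 28799 (v10 :* & 1000000) v11 D≤q (hyp* 9599000000 k3 v10 3≤D [])))))))))))))))
    (+-monoˡ-≤ (4 * e) (width-A i i<))

   width-B : ∀ i → i < 5 * q → width B (i • x) ≤ i + C
   width-B i i< = (lin 5 (width B (i • x)) i D e (width X (i • x)) 0 v0 (v1 :+ (k8 :* ((k2 :* v2 :+ k3) :* & 400) :+ k8 :* v3)) (hyp v0 (v4 :+ k4 :* v3) (width-transfer E 1≤e e≤B (lin 4 e (# A) n q 499999999 v0 v1 (eqn⁻ v1 v2 #A (hyp (v3 :* & 5000) v2 q≤n (hyp* 5000 (v0 :* & 100000) v3 e≤q [])))) (i • x) (lin 11 e (#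
    (cut (∁ X) (i • x))) (width (∁ X) (i • x)) (# (∁ X)) (width X (i • x)) (# X) p i D q n 748554099999 v0 v1 (eqn⁻* 1500000 (v1 :+ v2) v3 (cut+width (∁ X) (i • x)) (eqn* 1500000 v2 v4 (width-∁ X (i • x)) (eqn⁻* 1500000 (v5 :+ v3) v6 (#-∁ X) (hyp* 1500000 v4 (v7 :+ k8 :* ((k2 :* v8 :+ k3) :* & 400) :+ k4 :* v0) (width-X i
    i<) (hyp* 1500000 (1+ v7) (k5 :* v9) i< (hyp* 1500000 (1+ v5) (k2 :* v10) X<2n (hyp* 1500000 (k2 :* v10 :+ & 10 :* v9) v6 gap (hyp* 7485601 (v0 :* & 100000) v9 e≤q (hyp* 14399 (v8 :* & 1000000) v9 D≤q (hyp* 4799000000 k3 v8 3≤D [])))))))))))) (hyp v4 (v1 :+ k8 :* ((k2 :* v2 :+ k3) :* & 400) :+ k4 :* v3) (width-X i i<)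
    [])))
    where
    e≤B : e ≤ # B
    e≤B = (lin 4 e (# B) n q 499999999 v0 v1 (eqn⁻ v1 v2 #B (hyp (v3 :* & 5000) v2 q≤n (hyp* 5000 (v0 :* & 100000) v3 e≤q []))))

   1≤q : 1 ≤ q
   1≤q = (lin 2 q D 2999999 k1 v0 (hyp (v1 :* & 1000000) v0 D≤q (hyp* 1000000 k3 v1 3≤D [])))

   arc-for : ∀ S → # S ≡ n → (∀ i → i < 5 * q → width S (i • x) ≤ i + C) → NearArc S x (9 * q)
   arc-for S #S widths = Arcs.arc S x x≢0 q C 1≤q C-small widths (lin 3 q (# S) n 4999 (k9 :* v0) v1 (eqn⁻* 9 v1 v2 #S (hyp* 9 (v0 :* & 5000) v2 q≤n [])))
    (lin 5 q (# (∁ S)) (# S) p n 9 (k9 :* v0) v1 (eqn⁻* 9 (v2 :+ v1) v3 (#-∁ S) (eqn* 9 v2 v4 #S (hyp* 9 (k2 :* v4 :+ & 10 :* v0) v3 gap []))))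

   arcs : NearArc A x (9 * q) × NearArc B x (9 * q)
   arcs = arc-for A #A (λ i i< → ≤-trans (width-A i i<) (+-monoʳ-≤ i (m≤m+n _ _))) , arc-for B #B width-B

  near-arcs : ∃ λ x → x ≢ 𝟘 × NearArc A x (9 * q) × NearArc B x (9 * q)
  near-arcs = from step
   where
   from : ∃ Step → ∃ λ x → x ≢ 𝟘 × NearArc A x (9 * q) × NearArc B x (9 * q)
   from (x , x≢0 , orbit) = x , x≢0 , WithStep.arcs x x≢0 orbit

 ⊞-comm : ∀ P Q → P ⊞ Q ⊑ Q ⊞ P
 ⊞-comm P Q z t with ⊞-elim P Q z t
 ... | x , Px , Qz = subst (T ∘ (Q ⊞ P)) (group 2 z x (g0 :- g1 :+ g1) g0) (⊞-intro Q P Qz Px)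

 -- Positions along the progression.

 module Positions (x : G) (x≢0 : x ≢ 𝟘) where

  abstract
   -- The discrete logarithm to the base `x`, with values below `p`.
   pos : G → ℕ
   pos y = toℕ (residue (toℕ y * proj₁ (inverse x x≢0)))

   pos-• : ∀ y → pos y • x ≡ y
   pos-• y = trans (cong (_• x) (toℕ-residue (toℕ y * u))) (trans (•-% (toℕ y * u) x)
    (trans (sym (•-assoc (toℕ y) u x)) (trans (cong (toℕ y •_) (proj₂ (inverse x x≢0))) (trans (residue-• (toℕ y)) (residue-toℕ y)))))
    where
    u : ℕ
    u = proj₁ (inverse x x≢0)

   •-pos : ∀ k → k < p → pos (k • x) ≡ k
   •-pos k k<p = begin
    toℕ (residue (toℕ (k • x) * u)) ≡⟨ cong (toℕ ∘ residue) (*-comm (toℕ (k • x)) u) ⟩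
    toℕ (residue (u * toℕ (k • x))) ≡⟨ cong toℕ (•-residue u (k • x)) ⟨
    toℕ (u • k • x) ≡⟨ cong toℕ (trans (•-assoc u k x) (trans (cong (_• x) (*-comm u k)) (sym (•-assoc k u x)))) ⟩
    toℕ (k • u • x) ≡⟨ cong toℕ (trans (cong (k •_) (proj₂ (inverse x x≢0))) (residue-• k)) ⟩
    toℕ (residue k) ≡⟨ trans (toℕ-residue k) (m<n⇒m%n≡m k<p) ⟩
    k ∎
    where
    open ≡-Reasoning
    u : ℕ
    u = proj₁ (inverse x x≢0)

  pos-from : ∀ a k → k < p → pos (a ⊹ k • x ⊖ a) ≡ k
  pos-from a k k<p = trans (cong pos (group 2 a (k • x) (g0 :+ g1 :- g0) g1)) (•-pos k k<p)

  at-pos : ∀ a y → a ⊹ pos (y ⊖ a) • x ≡ y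
  at-pos a y = trans (cong (a ⊹_) (pos-• (y ⊖ a))) (group 2 a y (g0 :+ (g1 :- g0)) g1)

  window : (G → Bool) → G → ℕ → ℕ → G → Bool
  window S a lo len y = S y ∧ between lo len (pos (y ⊖ a))

  window-elim : ∀ S a lo len y → T (window S a lo len y) → lo ≤ pos (y ⊖ a) × pos (y ⊖ a) < lo + len
  window-elim S a lo len y t = between-elim lo len _ (T-∧ʳ {S y} t)

  window-intro : ∀ S a lo len k → k < len → lo + len ≤ p → T (line S x a (lo + k)) → T (window S a lo len (a ⊹ (lo + k) • x))
  window-intro S a lo len k k<len le t = T-pair t (subst (T ∘ between lo len) (sym (pos-from a (lo + k) (<-≤-trans (+-monoʳ-< lo k<len) le))) (between-inside lo len k k<len))

  Σ-window : ∀ S a lo len (f : G → ℕ) → lo + len ≤ p →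
        Σ (λ y → [ window S a lo len y ] * f y) ≡ Σ< len λ k → [ line S x a (lo + k) ] * f (a ⊹ (lo + k) • x)
  Σ-window S a lo len f le = begin
   Σ (λ y → [ window S a lo len y ] * f y)
    ≡⟨ Σ-orbit x x≢0 a _ ⟨
   Σ< p (λ k → [ window S a lo len (a ⊹ k • x) ] * f (a ⊹ k • x))
    ≡⟨ Σ<-cong p (λ k k<p → trans (cong (λ t → [ line S x a k ∧ between lo len t ] * f (a ⊹ k • x)) (pos-from a k k<p))
       (shuffle (line S x a k) (between lo len k) _)) ⟩
   Σ< p (λ k → [ between lo len k ] * ([ line S x a k ] * f (a ⊹ k • x)))
    ≡⟨ Σ<-between lo len p _ le ⟩
   Σ< len (λ k → [ line S x a (lo + k) ] * f (a ⊹ (lo + k) • x)) ∎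
   where
   open ≡-Reasoning
   shuffle : ∀ b c t → [ b ∧ c ] * t ≡ [ c ] * ([ b ] * t)
   shuffle true c t = cong ([ c ] *_) (sym (+0 t))
   shuffle false c t = sym (*0 [ c ])

  #-window : ∀ S a lo len → lo + len ≤ p → # (window S a lo len) ≡ #< len λ k → line S x a (lo + k)
  #-window S a lo len le = trans (#-as-Σ (window S a lo len)) (trans (Σ-window S a lo len (λ _ → 1) le)
   (Σ<-cong len λ k _ → *1 _))

  #-line : ∀ S a → #< p (line S x a) ≡ # S
  #-line S a = Σ-orbit x x≢0 a λ y → [ S y ]

 -- Maximally dense arcs.

 record HalfCore (S : G → Bool) (x a : G) (len : ℕ) : Set where
  field
   dense : ∀ y → y ≤ len → y * 399 ≤ #< y (line S x a) * 400
   sparse : ∀ w → w + len ≤ p → #< w (line S x (a ⊖ w • x)) * 400 ≤ w * 399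

 -- Both ends have the same description: the right end is the left end of the progression with step
 -- `- x`, read from the last element.
 record Core (S : G → Bool) (x : G) (n ε : ℕ) : Set where
  field
   start : G
   len : ℕ
   1≤len : 1 ≤ len
   len≤p : len ≤ p
   inside : n ≤ #< len (line S x start) + ε
   length : len ≤ n + ε
   left : HalfCore S x start len
   right : HalfCore S (⊝ x) (start ⊹ (len ∸ 1) • x) len

  finish : G
  finish = start ⊹ (len ∸ 1) • x

 module _ (S : G → Bool) (x : G) (x≢0 : x ≢ 𝟘) (n ε : ℕ) (#S : # S ≡ n) (near : NearArc S x ε) (ε<n : ε * 1000 < n) where

  open Positions x x≢0

  count : G → ℕ → ℕ
  count a l = #< l (line S x a)

  -- Up to scaling and a constant, `count - 399/400 * length`, written so that it stays a natural
  -- number. A final or initial piece of lower density could be dropped and an adjacent piece of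
  -- higher density added, so a maximum has the bounds of `HalfCore`.
  score : G → ℕ → ℕ
  score a l = count a l * 400 + (p ∸ l) * 399

  best : ∃ λ a → ∃ λ l → l ≤ p × (∀ a' l' → l' ≤ p → score a' l' ≤ score a l)
  best = overall (argmax-at 𝟘 λ a → score a (toℕ (proj₁ (longest a))))
   where
   longest : ∀ a → ∃ λ (l : Fin (suc p)) → ∀ l' → score a (toℕ l') ≤ score a (toℕ l)
   longest a = argmax λ l → score a (toℕ l)
   overall : (∃ λ a → ∀ a' → score a' (toℕ (proj₁ (longest a'))) ≤ score a (toℕ (proj₁ (longest a)))) → ∃ λ a → ∃ λ l → l ≤ p × (∀ a' l' → l' ≤ p → score a' l' ≤ score a l)
   overall (a , above-all) = a , toℕ (proj₁ (longest a)) , ≤-pred (Finₚ.toℕ<n (proj₁ (longest a))) , λ a' l' l'≤p →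
    ≤-trans (subst (λ t → score a' t ≤ score a' (toℕ (proj₁ (longest a')))) (Finₚ.toℕ-fromℕ< (s≤s l'≤p)) (proj₂ (longest a') (fromℕ< (s≤s l'≤p)))) (above-all a')

  line-shift : ∀ a m k → line S x (a ⊹ m • x) k ≡ line S x a (m + k)
  line-shift a m k = cong S (trans (⊹-assoc a (m • x) (k • x)) (cong (a ⊹_) (sym (•-+ m k x))))

  module AtMax (a : G) (l : ℕ) (l≤p : l ≤ p) (max : ∀ a' l' → l' ≤ p → score a' l' ≤ score a l) where

   c : ℕ
   c = count a l

   split-count : ∀ y → y ≤ l → c ≡ count a y + count (a ⊹ y • x) (l ∸ y)
   split-count y y≤l = trans (cong (count a) (sym (+∸ y≤l))) (trans (Σ<-split y (l ∸ y) ([_] ∘ line S x a))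
    (cong (count a y +_) (Σ<-cong (l ∸ y) λ k _ → cong [_] (sym (line-shift a y k)))))

   -- The given near-arc competes in the maximisation, and its at most `ε` errors bound the deficit
   -- of the maximal arc.
   good-value : n + l * 399 ≤ c * 400 + ε * 400
   good-value = (lin 11 n l c ε cₙ (p ∸ lₙ) (p ∸ l) p lₙ (#< lₙ (λ k → not (line S x (NearArc.start near) k))) (#< (p ∸ lₙ) (λ k → line S x (NearArc.start near) (lₙ + k))) 0 (v0 :+ v1 :* & 399) (v2 :* & 400 :+ v3 :* & 400) (hyp (v4 :* & 400 :+ v5 :* & 399) (v2 :* & 400 :+ v6 :* & 399) (max (NearArc.start near)
    (NearArc.len near) (NearArc.len≤p near)) (eqn* 399 (v1 :+ v6) v7 (+∸ l≤p) (eqn⁻* 399 (v8 :+ v5) v7 (+∸ (NearArc.len≤p near)) (hyp* 399 (v9 :+ v10) v3 (NearArc.close-to near) (eqn⁻* 399 (v4 :+ v9) v8 (#<-not lₙ (line S x (NearArc.start near))) (eqn v0 (v4 :+ v10) whole [])))))))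
    where
    lₙ = NearArc.len near
    cₙ = count (NearArc.start near) lₙ
    whole : n ≡ cₙ + #< (p ∸ lₙ) (λ k → line S x (NearArc.start near) (lₙ + k))
    whole = trans (sym #S) (trans (sym (#-line S (NearArc.start near))) (trans (cong (λ t → #< t (line S x (NearArc.start near))) (sym (+∸ (NearArc.len≤p near))))
     (Σ<-split lₙ (p ∸ lₙ) λ k → [ line S x (NearArc.start near) k ])))

   c≤n : c ≤ n
   c≤n = subst (c ≤_) (trans (#-line S a) #S) (Σ<-≤ ([_] ∘ line S x a) l≤p)

   1≤l : 1 ≤ l
   1≤l = ≰⇒> λ l≤0 → (absurd (lin 4 n l c ε 0 k1 k0 (hyp (v0 :+ v1 :* & 399) (v2 :* & 400 :+ v3 :* & 400) good-value (hyp* 400 v2 v1 (#<≤ l (line S x a)) (hyp v1 k0 l≤0 (hyp (1+ (v3 :* & 1000)) v0 ε<n []))))))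

   left-dense : ∀ y → y ≤ l → y * 399 ≤ count a y * 400
   left-dense y y≤l = (lin 9 y (count a y) (count (a ⊹ y • x) (l ∸ y)) (p ∸ (l ∸ y)) c (p ∸ l) (l ∸ y) p l 0 (v0 :* & 399) (v1 :* & 400) (hyp (v2 :* & 400 :+ v3 :* & 399) (v4 :* & 400 :+ v5 :* & 399) (max (a ⊹ y • x) (l ∸ y) (≤-trans (m∸n≤m l y) l≤p)) (eqn* 400 v4 (v1 :+ v2) (split-count y y≤l) (eqn⁻* 399 (v6 :+ v3)
    v7 (+∸ (≤-trans (m∸n≤m l y) l≤p)) (eqn* 399 (v8 :+ v5) v7 (+∸ l≤p) (eqn* 399 (v0 :+ v6) v8 (+∸ y≤l) []))))))

   left-sparse : ∀ w → w + l ≤ p → count (a ⊖ w • x) w * 400 ≤ w * 399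
   left-sparse w w+l≤p = (lin 8 (count (a ⊖ w • x) w) w (count (a ⊖ w • x) (w + l)) (p ∸ (w + l)) c (p ∸ l) l p 0 (v0 :* & 400) (v1 :* & 399) (hyp (v2 :* & 400 :+ v3 :* & 399) (v4 :* & 400 :+ v5 :* & 399) (max (a ⊖ w • x) (w + l) w+l≤p) (eqn⁻* 400 v2 (v0 :+ v4) longer (eqn⁻* 399 (v1 :+ v6 :+ v3) v7 (+∸ w+l≤p) (eqn*
    399 (v6 :+ v5) v7 (+∸ l≤p) [])))))
    where
    longer : count (a ⊖ w • x) (w + l) ≡ count (a ⊖ w • x) w + c
    longer = trans (Σ<-split w l (λ k → [ line S x (a ⊖ w • x) k ])) (cong (count (a ⊖ w • x) w +_) (Σ<-cong l λ k _ → cong [_] (trans (sym (line-shift (a ⊖ w • x) w k)) (cong (λ y → S (y ⊹ k • x)) (group 2 a (w • x) (g0 :- g1 :+ g1) g0)))))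

   reversed : ∀ b y → #< y (line S (⊝ x) (b ⊹ (y ∸ 1) • x)) ≡ count b y
   reversed b zero = refl
   reversed b (suc y) = Σ<-reverse (suc y) (λ k → [ line S (⊝ x) (b ⊹ y • x) k ]) ([_] ∘ line S x b) λ k k≤y →
    cong ([_] ∘ S) (trans (cong (b ⊹ y • x ⊹_) (•-⊝ k x)) (trans (cong (λ t → b ⊹ t • x ⊖ k • x) (sym (+∸ (≤-pred k≤y)))) (trans (cong (λ t → b ⊹ t ⊖ k • x) (•-+ k (y ∸ k) x)) (group 3 b (k • x) ((y ∸ k) • x) (g0 :+ (g1 :+ g2) :- g1) (g0 :+ g2)))))

   right-dense : ∀ y → y ≤ l → y * 399 ≤ #< y (line S (⊝ x) (a ⊹ (l ∸ 1) • x)) * 400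
   right-dense zero _ = z≤n
   right-dense y@(suc _) y≤l = (lin 11 y (#< y (line S (⊝ x) (a ⊹ (l ∸ 1) • x))) (count a (l ∸ y)) (p ∸ (l ∸ y)) c (p ∸ l) (count (a ⊹ (l ∸ y) • x) (l ∸ (l ∸ y))) (count (a ⊹ (l ∸ y) • x) y) (l ∸ y) p l 0 (v0 :* & 399) (v1 :* & 400) (hyp (v2 :* & 400 :+ v3 :* & 399) (v4 :* & 400 :+ v5 :* & 399) (max a (l ∸ y) (≤-trans
    (m∸n≤m l y) l≤p)) (eqn* 400 v4 (v2 :+ v6) (split-count (l ∸ y) (m∸n≤m l y)) (eqn* 400 v6 v7 (cong (count (a ⊹ (l ∸ y) • x)) (m∸[m∸n]≡n y≤l)) (eqn* 400 v7 v1 (trans (sym (reversed (a ⊹ (l ∸ y) • x) y)) (cong (λ t → #< y (line S (⊝ x) t)) end)) (eqn⁻* 399 (v8 :+ v3) v9 (+∸ (≤-trans (m∸n≤m l y) l≤p)) (eqn* 399 (v10 :+ v5)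
    v9 (+∸ l≤p) (eqn* 399 (v0 :+ v8) v10 (+∸ y≤l) []))))))))
    where
    end : a ⊹ (l ∸ y) • x ⊹ (y ∸ 1) • x ≡ a ⊹ (l ∸ 1) • x
    end = trans (⊹-assoc a _ _) (trans (cong (a ⊹_) (sym (•-+ (l ∸ y) (y ∸ 1) x))) (cong (λ t → a ⊹ t • x) (linEq 5 (l ∸ y) (y ∸ 1) (l ∸ 1) y l (v0 :+ v1) v2 0 (eqn (v3 :+ v0) v4 (+∸ y≤l) (eqn (1+ v1) v3 (+∸ {1} {y} (s≤s z≤n)) (eqn⁻ (1+ v2) v4 (+∸ 1≤l) []))) 0 (eqn⁻ (v3 :+ v0) v4 (+∸ y≤l) (eqn⁻ (1+ v1) v3 (+∸ {1} {y}
     (s≤s z≤n)) (eqn (1+ v2) v4 (+∸ 1≤l) []))))))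

   right-sparse : ∀ w → w + l ≤ p → #< w (line S (⊝ x) (a ⊹ (l ∸ 1) • x ⊖ w • (⊝ x))) * 400 ≤ w * 399
   right-sparse zero _ = z≤n
   right-sparse w@(suc _) w+l≤p = (lin 9 (#< w (line S (⊝ x) (a ⊹ (l ∸ 1) • x ⊖ w • (⊝ x)))) w (count a (l + w)) (p ∸ (l + w)) c (p ∸ l) (count (a ⊹ l • x) w) l p 0 (v0 :* & 400) (v1 :* & 399) (hyp (v2 :* & 400 :+ v3 :* & 399) (v4 :* & 400 :+ v5 :* & 399) (max a (l + w) (subst (_≤ p) (+-comm w l) w+l≤p)) (eqn⁻* 400 v2
    (v4 :+ v6) longer (eqn⁻* 400 v6 v0 (trans (sym (reversed (a ⊹ l • x) w)) (cong (λ t → #< w (line S (⊝ x) t)) end)) (eqn⁻* 399 (v7 :+ v1 :+ v3) v8 (+∸ (subst (_≤ p) (+-comm w l) w+l≤p)) (eqn* 399 (v7 :+ v5) v8 (+∸ l≤p) []))))))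
    where
    longer : count a (l + w) ≡ c + count (a ⊹ l • x) w
    longer = trans (Σ<-split l w ([_] ∘ line S x a)) (cong (c +_) (Σ<-cong w λ k _ → cong [_] (sym (line-shift a l k))))
    end : a ⊹ l • x ⊹ (w ∸ 1) • x ≡ a ⊹ (l ∸ 1) • x ⊖ w • (⊝ x)
    end = trans (⊹-assoc a _ _) (trans (cong (a ⊹_) (trans (sym (•-+ l (w ∸ 1) x)) (trans (cong (_• x) (linEq 4 l (w ∸ 1) (l ∸ 1) w (v0 :+ v1) (v2 :+ v3) 0 (eqn (1+ v1) v3 (+∸ {1} {w} (s≤s z≤n)) (eqn⁻ (1+ v2) v0 (+∸ 1≤l) [])) 0 (eqn⁻ (1+ v1) v3 (+∸ {1} {w} (s≤s z≤n)) (eqn (1+ v2) v0 (+∸ 1≤l) [])))) (•-+ (l ∸ 1) w x))))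
     (trans (group 3 a ((l ∸ 1) • x) (w • x) (g0 :+ (g1 :+ g2)) (g0 :+ g1 :- :~ g2)) (cong (a ⊹ (l ∸ 1) • x ⊖_) (sym (•-⊝ w x)))))

   core-at : Core S x n (ε * 400)
   core-at = record
    { start = a ; len = l ; 1≤len = 1≤l ; len≤p = l≤p
    ; inside = (lin 4 n c ε l 0 v0 (v1 :+ v2 :* & 400) (hyp (v0 :+ v3 :* & 399) (v1 :* & 400 :+ v2 :* & 400) good-value (hyp* 399 v1 v3 (#<≤ l (line S x a)) [])))
    ; length = (lin 4 l n ε c 398 v0 (v1 :+ v2 :* & 400) (hyp (v1 :+ v0 :* & 399) (v3 :* & 400 :+ v2 :* & 400) good-value (hyp* 400 v3 v1 c≤n [])))
    ; left = record { dense = left-dense ; sparse = left-sparse }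
    ; right = record { dense = right-dense ; sparse = right-sparse }
    }

  core : Core S x n (ε * 400)
  core = from best
   where
   from : (∃ λ a → ∃ λ l → l ≤ p × (∀ a' l' → l' ≤ p → score a' l' ≤ score a l)) → Core S x n (ε * 400)
   from (a , l , l≤p , max) = AtMax.core-at a l l≤p max

 -- Sums gained beyond the ends of the arcs.

 bad-∅ : ∀ P Q → bad P Q ∅ ≡ # P * # Q
 bad-∅ P Q = trans (Σ-cong λ x → trans (Σ-cong λ y → trans (cong [_] (case (P x) (Q y))) (⟨⟩-∧ (P x) (Q y))) (Σ-* [ P x ] λ y → [ Q y ])) (Σ-*ʳ (# Q) λ x → [ P x ])
  where
  case : ∀ a b → (a ∧ b) ∧ true ≡ a ∧ b
  case true b = ∧-comm b true
  case false b = refl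

 bad-by-sum : ∀ P Q V → bad P Q V ≡ Σ λ z → # λ x → (P x ∧ Q (z ⊖ x)) ∧ not (V z)
 bad-by-sum P Q V = trans (Σ-cong λ x → trans (sym (Σ-unshift x λ y → [ (P x ∧ Q y) ∧ not (V (x ⊹ y)) ]))
  (Σ-cong λ z → cong (λ t → [ (P x ∧ Q (z ⊖ x)) ∧ not (V t) ]) (group 2 x z (g0 :+ (g1 :- g0)) g1))) (Σ-swap λ x z → [ (P x ∧ Q (z ⊖ x)) ∧ not (V z) ])

 line-sum : ∀ x a b i j → a ⊹ i • x ⊹ (b ⊹ j • x) ≡ a ⊹ b ⊹ (i + j) • x
 line-sum x a b i j = trans (group 4 a (i • x) b (j • x) (g0 :+ g1 :+ (g2 :+ g3)) (g0 :+ g2 :+ (g1 :+ g3))) (cong (a ⊹ b ⊹_) (sym (•-+ i j x)))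

 record Small (A B : G → Bool) (K : ℕ) : Set where
  constructor small-subsets
  field
   A' B' : G → Bool
   A'⊑A : A' ⊑ A
   B'⊑B : B' ⊑ B
   #A' : # A' ≤ K
   #B' : # B' ≤ K

  sums : G → Bool
  sums = A' ⊞ B'

 swap-subsets : ∀ {A B K} → Small A B K → Small B A K
 swap-subsets (small-subsets A' B' a b c d) = small-subsets B' A' b a d c

 open Small public using (sums)

 module Ends (x : G) (x≢0 : x ≢ 𝟘) (s M : ℕ) (1≤s : 1 ≤ s) (M-large : 100000000000 ≤ M) where

  open Positions x x≢0

  N₁ : ℕ
  N₁ = 100000

  -- An end of two sets: indices below g lie outside the cores, which start at index g.
  record End (A : G → Bool) (a : G) (g : ℕ) : Set where
   field
    dense : ∀ y → y ≤ g → y * 399 ≤ #< y (λ k → line A x a (g + k)) * 400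
    sparse : ∀ w → w ≤ g → #< w (λ k → line A x a (g ∸ w + k)) * 400 ≤ w * 399

  captured : (G → Bool) → G → ℕ → ℕ
  captured V c l = #< l (line V x c)

  captured-window : ∀ {V} c l U → l ≤ p → (∀ y → T (U y) → T (V y) × pos (y ⊖ c) < l) → # U ≤ captured V c l
  captured-window {V} c l U l≤p inside = ≤-trans (#-mono λ y t → T-pair (proj₁ (inside y t)) (T-pair tt (≤⇒≤ᵇ (proj₂ (inside y t))))) (≡⇒≤ (#-window V c 0 l l≤p))

  pos-sum : ∀ a b y z → pos (y ⊖ a) + pos (z ⊖ b) < p → pos (y ⊹ z ⊖ (a ⊹ b)) ≡ pos (y ⊖ a) + pos (z ⊖ b)
  pos-sum a b y z lt = trans (cong (λ t → pos (t ⊖ (a ⊹ b))) (trans (cong₂ _⊹_ (sym (at-pos a y)) (sym (at-pos b z))) (line-sum x a b (pos (y ⊖ a)) (pos (z ⊖ b))))) (pos-from (a ⊹ b) _ lt)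

  -- `u'` is where one of the sets, here `A`, has just collected `m / N₁` of the `m` outer elements,
  -- both having fewer before. So almost all of them lie in the `W` indices before the cores, while
  -- the outermost elements, `Bot`, remain available as translations.
  module Side {A B a b g} (eA : End A a g) (eB : End B b g) (room : 4 * g ≤ p) (m u' : ℕ)
   (m≡ : m ≡ #< g (line A x a) + #< g (line B x b)) (m≥1 : 1 ≤ m) (m≤s : m ≤ 4 * (s * s)) (u'<g : u' < g)
   (bot : m ≤ #< (suc u') (line A x a) * N₁) (fewA : #< u' (line A x a) * N₁ < m) (fewB : #< u' (line B x b) * N₁ < m) where

   α β : ℕ → Bool
   α = line A x a
   β = line B x b

   c : G
   c = a ⊹ b

   W : ℕ
   W = g ∸ u'

   g≡ : u' + W ≡ g
   g≡ = +∸ (<⇒≤ u'<g)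

   TA TB : ℕ
   TA = #< W λ k → α (u' + k)
   TB = #< W λ k → β (u' + k)

   split-at : ∀ (f : ℕ → Bool) → #< g f ≡ #< u' f + #< W (λ k → f (u' + k))
   split-at f = trans (cong (λ t → #< t f) (sym g≡)) (Σ<-split u' W λ k → [ f k ])

   m-split : m * N₁ ≤ (TA + TB) * N₁ + 2 * m
   m-split = (lin 7 m TA TB (#< g α) (#< g β) (#< u' α) (#< u' β) 0 (v0 :* & 100000) ((v1 :+ v2) :* & 100000 :+ k2 :* v0) (eqn* 100000 v0 (v3 :+ v4) m≡ (eqn* 100000 v3 (v5 :+ v1) (split-at α) (eqn* 100000 v4 (v6 :+ v2) (split-at β) (hyp (1+ (v5 :* & 100000)) v0 fewA (hyp (1+ (v6 :* & 100000)) v0 fewB []))))))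

   W≤g : W ≤ g
   W≤g = m∸n≤m g u'

   g∸W : g ∸ W ≡ u'
   g∸W = m∸[m∸n]≡n (<⇒≤ u'<g)

   TA≤ : TA * 400 ≤ W * 399
   TA≤ = subst (λ t → #< W (λ k → α (t + k)) * 400 ≤ W * 399) g∸W (End.sparse eA W W≤g)

   TB≤ : TB * 400 ≤ W * 399
   TB≤ = subst (λ t → #< W (λ k → β (t + k)) * 400 ≤ W * 399) g∸W (End.sparse eB W W≤g)

   Bot : G → Bool
   Bot = window A a 0 (suc u')

   #Bot : # Bot ≡ #< (suc u') α
   #Bot = #-window A a 0 (suc u') (lin 3 u' p g 3 (1+ v0) v1 (hyp* 4 (1+ v0) v2 u'<g (hyp (k4 :* v2) v1 room [])))

   Bot≥1 : 1 ≤ # Bot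
   Bot≥1 = ≰⇒> λ le → (absurd (lin 3 m (#< (suc u') α) (# Bot) 0 k1 k0 (hyp v0 (v1 :* & 100000) bot (eqn⁻* 100000 v2 v1 #Bot (hyp* 100000 v2 k0 le (hyp k1 v0 m≥1 []))))))

   K : ℕ
   K = M * s * 1200000

   Goal : Set
   Goal = ∃ λ (R : Small A B K) → m * 1001 ≤ captured (sums R) c (2 * g) * 1000

   in-zone : ∀ i j → i + j < 2 * g → i + j < p
   in-zone i j lt = (lin 4 i j p g 1 (1+ (v0 :+ v1)) v2 (hyp* 2 (1+ (v0 :+ v1)) (k2 :* v3) lt (hyp (k4 :* v3) v2 room [])))

   -- Elements of `Bot` together with `W > 4 m` core indices of `B` already have well over `m` sums,
   -- all at indices below `2 g`; greedy choice retains at least `3 m / 2` of them.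
   wide : 4 * m < W → Goal
   wide 4m<W = finish (greedy 1 (# Bot ⊓ s) (s * 300000) P Bot ∅ (m⊓n≤m (# Bot) s) (≡⇒≤ (trans (sym (bad-∅ P Bot)) (sym (+0 _)))))
    where
    P : G → Bool
    P = window B b g W
    g+W≤p : g + W ≤ p
    g+W≤p = (lin 3 g W p 1 (v0 :+ v1) v2 (hyp* 2 v1 v0 W≤g (hyp (k4 :* v0) v2 room [])))
    #P : W * 399 ≤ # P * 400
    #P = subst (λ t → W * 399 ≤ t * 400) (sym (#-window B b g W g+W≤p)) (End.dense eB W W≤g)
    block : 3 * m ≤ s * 300000 * (# Bot ⊓ s)
    block with ⊓-sel (# Bot) s
    ... | inj₁ eq = subst (λ t → 3 * m ≤ s * 300000 * t) (sym eq) (lin 4 m s (# Bot) (#< (suc u') α) 0 (k3 :* v0) (v1 :* & 300000 :* v2) (hyp* 3 v0 (v3 :* & 100000) bot (eqn⁻* 300000 v2 v3 #Bot (mul* 300000 v2 k1 v1 1≤s []))))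
    ... | inj₂ eq = subst (λ t → 3 * m ≤ s * 300000 * t) (sym eq) (lin 2 m s 0 (k3 :* v0) (v1 :* & 300000 :* v1) (hyp* 3 v0 (k4 :* (v1 :* v1)) m≤s []))
    half : 3 * m ≤ # P ⊓ (s * 300000 * (# Bot ⊓ s))
    half = ⊓-glb (lin 3 m (# P) W 531 (k3 :* v0) v1 (hyp (v2 :* & 399) (v1 :* & 400) #P (hyp* 399 (1+ (k4 :* v0)) v2 4m<W []))) block
    finish : (∃ λ P' → ∃ λ Q' → P' ⊑ P × Q' ⊑ Bot × # P' ≤ s * 300000 × # Q' ≤ # Bot ⊓ s × # P ⊓ (s * 300000 * (# Bot ⊓ s)) ≤ 2 * 1 * # (fresh P' Q' ∅)) → Goal
    finish (P' , Q' , P'⊑ , Q'⊑ , #P' , #Q' , gain) =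
     small-subsets Q' P' (λ y t → T-∧ˡ (Q'⊑ y t)) (λ y t → T-∧ˡ (P'⊑ y t))
      (lin 3 (# Q') M s 99999999999 v0 (v1 :* v2 :* & 1200000) (hyp* 100000000000 v0 v2 (≤-trans #Q' (m⊓n≤n (# Bot) s)) (mul v2 (& 100000000000) v1 M-large [])))
      (lin 3 (# P') M s 999999 v0 (v1 :* v2 :* & 1200000) (hyp* 1000000 v0 (v2 :* & 300000) #P' (mul* 3 v2 (& 100000000000) v1 M-large []))) ,
     (lin 3 m (captured (Q' ⊞ P') c (2 * g)) (# (fresh P' Q' ∅)) 2 (v0 :* & 1001) (v1 :* & 1000) (hyp* 1001 (k3 :* v0) (k2 :* k1 :* v2) (≤-trans half gain) (hyp* 2002 v2 v1 (captured-window c (2 * g) (fresh P' Q' ∅) (lin 2 g p 1 (k2 :* v0) v1 (hyp (k4 :* v0) v1 room [])) inside) [])))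
     where
     inside : ∀ y → T (fresh P' Q' ∅ y) → T ((Q' ⊞ P') y) × pos (y ⊖ c) < 2 * g
     inside y t = ⊞-comm P' Q' y (T-∧ˡ t) , place (⊞-elim Q' P' y (⊞-comm P' Q' y (T-∧ˡ t)))
      where
      place : (∃ λ z → T (Q' z) × T (P' (y ⊖ z))) → pos (y ⊖ c) < 2 * g
      place (z , Q'z , P'z) = subst (_< 2 * g) (trans (sym (pos-sum a b z (y ⊖ z) (in-zone (pos (z ⊖ a)) (pos (y ⊖ z ⊖ b)) lt))) (cong (λ t → pos (t ⊖ c)) (group 2 z y (g0 :+ (g1 :- g0)) g1))) lt
       where
       lt : pos (z ⊖ a) + pos (y ⊖ z ⊖ b) < 2 * g
       lt = (lin 5 (pos (z ⊖ a)) (pos (y ⊖ z ⊖ b)) g u' W 0 (1+ (v0 :+ v1)) (k2 :* v2) (hyp (1+ v0) (1+ v3) (proj₂ (window-elim A a 0 (suc u') z (Q'⊑ z Q'z))) (hyp (1+ v1) (v2 :+ v4) (proj₂ (window-elim B b g W (y ⊖ z) (P'⊑ (y ⊖ z) P'z))) (eqn (v3 :+ v4) v2 g≡ []))))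

   -- `V` declares the sums beyond the zone as covered, so that only sums inside it count. Either
   -- saturation finds enough of them, or almost all pairs of an outer element of `A` with an
   -- element of `B` near the end of its core are accounted for, and `tally` counts their sums.
   narrow : W ≤ 4 * m → Goal
   narrow W≤4m = finish (saturate M (# Q ⊓ s) (4 * s) P Q V (m⊓n≤m (# Q) s) block (M * 300000))
    where
    P Q V : G → Bool
    P = window A a 0 g
    Q = window B b u' (W + W)
    V y = not (between 0 (2 * g) (pos (y ⊖ c)))
    g≤p : g ≤ p
    g≤p = (lin 2 g p 3 v0 v1 (hyp (k4 :* v0) v1 room []))
    u'WW : u' + (W + W) ≤ p
    u'WW = (lin 4 u' W p g 1 (v0 :+ (v1 :+ v1)) v2 (eqn* 4 (v0 :+ v1) v3 g≡ (hyp (k4 :* v3) v2 room [])))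
    #P : # P ≡ #< g α
    #P = #-window A a 0 g g≤p
    #Q : # Q ≡ TB + #< W (λ k → β (g + k))
    #Q = trans (#-window B b u' (W + W) u'WW) (trans (Σ<-split W W λ k → [ β (u' + k) ]) (cong (TB +_) (Σ<-cong W λ k _ → cong ([_] ∘ β) (trans (sym (+-assoc u' W k)) (cong (_+ k) g≡)))))
    Q≥ : W * 399 ≤ # Q * 400
    Q≥ = (lin 4 W (# Q) TB (#< W (λ k → β (g + k))) 0 (v0 :* & 399) (v1 :* & 400) (eqn⁻* 400 v1 (v2 :+ v3) #Q (hyp (v0 :* & 399) (v3 :* & 400) (End.dense eB W W≤g) [])))
    Q≤ : # Q ≤ 8 * m
    Q≤ = (lin 5 (# Q) m TB (#< W (λ k → β (g + k))) W 0 v0 (k8 :* v1) (eqn v0 (v2 :+ v3) #Q (hyp v3 v4 (#<≤ W (λ k → β (g + k))) (hyp v2 v4 (#<≤ W (λ k → β (u' + k))) (hyp* 2 v4 (k4 :* v1) W≤4m [])))))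
    W≥ : m * 49 ≤ W * 100
    W≥ = (lin 4 m W TA TB 99997 (v0 :* & 49) (v1 :* & 100) (hyp* 49 (v0 :* & 100000) ((v2 :+ v3) :* & 100000 :+ k2 :* v0) m-split (hyp* 12250 (v2 :* & 400) (v1 :* & 399) TA≤ (hyp* 12250 (v3 :* & 400) (v1 :* & 399) TB≤ []))))
    P≤m : # P ≤ m
    P≤m = (lin 4 (# P) m (#< g α) (#< g β) 0 v0 v1 (eqn v0 v2 #P (eqn⁻ v1 (v2 :+ v3) m≡ [])))
    Bot⊑P : ∀ y → T (Bot y) → T (P y)
    Bot⊑P y t = T-pair (T-∧ˡ t) (T-pair tt (≤⇒≤ᵇ (≤-trans (proj₂ (window-elim A a 0 (suc u') y t)) u'<g)))
    block : # P ≤ 4 * s * (# Q ⊓ s)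
    block with ⊓-sel (# Q) s
    ... | inj₁ eq = subst (λ t → # P ≤ 4 * s * t) (sym eq) (lin 5 (# P) s (# Q) m W 19550 v0 (k4 :* v1 :* v2) (hyp* 19551 v0 v3 P≤m (hyp* 399 (v3 :* & 49) (v4 :* & 100) W≥ (hyp* 100 (v4 :* & 399) (v2 :* & 400) Q≥ (mul* 40000 v2 k1 v1 1≤s [])))))
    ... | inj₂ eq = subst (λ t → # P ≤ 4 * s * t) (sym eq) (lin 3 (# P) s m 0 v0 (k4 :* v1 :* v1) (hyp v0 v2 P≤m (hyp v2 (k4 :* (v1 :* v1)) m≤s [])))
    finish : (∃ λ P' → ∃ λ Q' → P' ⊑ P × Q' ⊑ Q × # P' ≤ M * 300000 * (4 * s) × # Q' ≤ M * 300000 * (# Q ⊓ s) ×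
     (M * 300000 * # P ≤ 2 * M * # (fresh P' Q' V) ⊎ M * bad P Q (V ∪ P' ⊞ Q') ≤ # P * # Q)) → Goal
    finish (P' , Q' , P'⊑ , Q'⊑ , #P' , #Q' , outcome) =
     small-subsets P' Q' (λ y t → T-∧ˡ (P'⊑ y t)) (λ y t → T-∧ˡ (Q'⊑ y t))
      (lin 3 (# P') M s 0 v0 (v1 :* v2 :* & 1200000) (hyp v0 (v1 :* & 300000 :* (k4 :* v2)) #P' []))
      (lin 4 (# Q') M s (# Q ⊓ s) 0 v0 (v1 :* v2 :* & 1200000) (hyp v0 (v1 :* & 300000 :* v3) #Q' (mul (v1 :* & 300000) v3 v2 (m⊓n≤n (# Q) s) []))) ,
     enough outcome
     where
     V' : G → Bool
     V' = P' ⊞ Q'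
     κ : ℕ
     κ = captured V' c (2 * g)
     2g≤p : 2 * g ≤ p
     2g≤p = (lin 2 g p 1 (k2 :* v0) v1 (hyp (k4 :* v0) v1 room []))
     fresh-inside : ∀ y → T (fresh P' Q' V y) → T (V' y) × pos (y ⊖ c) < 2 * g
     fresh-inside y t = T-∧ˡ t , zone (between 0 (2 * g) (pos (y ⊖ c))) refl (T-∧ʳ {V' y} t)
      where
      zone : ∀ q → between 0 (2 * g) (pos (y ⊖ c)) ≡ q → T (not (not q)) → pos (y ⊖ c) < 2 * g
      zone true eq _ = proj₂ (between-elim 0 (2 * g) _ (T! eq))
     enough : M * 300000 * # P ≤ 2 * M * # (fresh P' Q' V) ⊎ M * bad P Q (V ∪ V') ≤ # P * # Q → m * 1001 ≤ κ * 1000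
     enough (inj₁ many) = (lin 6 m κ (# P) (# (fresh P' Q' V)) (# Bot) (#< (suc u') α) 2 (v0 :* & 1001) (v1 :* & 1000) (hyp* 1001 (v2 :* & 300000) (k2 :* v3) (cancelˡ M (≤-trans (s≤s z≤n) M-large) (lin 3 M (# P) (# (fresh P' Q' V)) 0 (v0 :* (v1 :* & 300000)) (v0 :* (k2 :* v2)) (hyp (v0 :* & 300000 :* v1) (k2 :* v0
      :* v2) many []))) (hyp* 2002 v3 v1 (captured-window c (2 * g) (fresh P' Q' V) 2g≤p fresh-inside) (hyp* 300300000 v4 v2 (#-mono Bot⊑P) (eqn⁻* 300300000 v4 v5 #Bot (hyp* 3003 v0 (v5 :* & 100000) bot []))))))
     -- `E` is the last index up to which the outer part of `A` has density at most 1/400, with an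
     -- allowance of `W / 40000` that makes later sums popular.
     enough (inj₂ few) = tally (light-element Bot D Bot≥1) (greatest (λ E → (#< E (λ k → α (u' + k)) * 40000) ℕ.≤? (E * 100 + W)) W z≤n)
      where
      Bad = bad P Q (V ∪ V')
      D : G → ℕ
      D y = # λ z → Q z ∧ not ((V ∪ V') (y ⊹ z))
      Bad≤ : M * Bad ≤ m * (8 * m)
      Bad≤ = ≤-trans few (*-mono-≤ P≤m Q≤)
      tally : (∃ λ t → T (Bot t) × # Bot * D t ≤ Σ λ y → [ Bot y ] * D y) →
          (∃ λ E → E ≤ W × #< E (λ k → α (u' + k)) * 40000 ≤ E * 100 + W × (∀ k → E < k → k ≤ W → ¬ (#< k (λ k → α (u' + k)) * 40000 ≤ k * 100 + W))) →
          m * 1001 ≤ κ * 1000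
      -- Translation by one `t` in `Bot` captures `B` up to core index `E` with few losses. Beyond,
      -- sums have many representations by outer elements of `A` and core elements of `B`, so few
      -- are missed. The outer part of `A` has density about 1/400 up to `E` and at most 399/400
      -- after it, so the captured sums exceed the outer elements by about `W / 400`, where `W` is
      -- at least 49/100 of `m`.
      tally (t , Bot-t , light) (E , E≤W , low-E , high) =
       (lin 14 m κ κ₁ κ₂ TB (#< E (λ k → β (g + k))) (D t) E (L ∸ κ₂) L W (#< E (λ k → α (u' + k))) TA (#< L (λ k → α (u' + E + k))) 34078849 (v0 :* & 1001) (v1 :* & 1000) (eqn⁻* 34078850000 v1 (v2 :+ v3) κ-split (hyp* 34068000000 (v4 :+ v5) (v2 :+ v6) low-part (hyp* 85170000 (v7 :* & 399) (v5 :* & 400) (End.dense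
        eB E (≤-trans E≤W W≤g)) (hyp* 340680 (v6 :* & 100000) v0 D-small (hyp* 681577 (v8 :* & 50000) v0 U-small (hyp* 34078850000 v9 (v3 :+ v8) (m≤n+m∸n L κ₂) (eqn⁻* 96020000 (v7 :+ v9) v10 L≡ (hyp* 851700 (v11 :* & 40000) (v7 :* & 100 :+ v10) low-E (eqn* 34068000000 v12 (v11 :+ v13) TA-split (hyp* 85170000 (v13 :* & 400) (v9
        :* & 399) TA-rest (hyp* 340680 (v0 :* & 100000) ((v12 :+ v4) :* & 100000 :+ k2 :* v0) m-split (hyp* 951683 (v0 :* & 49) (v10 :* & 100) W≥ [])))))))))))))
       where
       L lo κ₁ κ₂ : ℕ
       L = W ∸ E
       lo = u' + g + E
       κ₁ = captured V' c lo
       κ₂ = #< L λ k → line V' x c (lo + k)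
       L≡ : E + L ≡ W
       L≡ = +∸ E≤W
       lo+L : lo + L ≡ 2 * g
       lo+L = (linEq 5 u' g E L W (v0 :+ v1 :+ v2 :+ v3) (k2 :* v1) 0 (eqn (v2 :+ v3) v4 L≡ (eqn (v0 :+ v4) v1 g≡ [])) 0 (eqn⁻ (v2 :+ v3) v4 L≡ (eqn⁻ (v0 :+ v4) v1 g≡ [])))
       κ-split : κ ≡ κ₁ + κ₂
       κ-split = trans (cong (λ t → #< t (line V' x c)) (sym lo+L)) (Σ<-split lo L λ k → [ line V' x c k ])
       TA-split : TA ≡ #< E (λ k → α (u' + k)) + #< L (λ k → α (u' + E + k))
       TA-split = trans (cong (λ t → #< t λ k → α (u' + k)) (sym L≡)) (trans (Σ<-split E L λ k → [ α (u' + k) ]) (cong (#< E (λ k → α (u' + k)) +_) (Σ<-cong L λ k _ → cong ([_] ∘ α) (sym (+-assoc u' E k)))))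
       TA-rest : #< L (λ k → α (u' + E + k)) * 400 ≤ L * 399
       TA-rest = subst (λ t → #< L (λ k → α (t + k)) * 400 ≤ L * 399) (linEq 6 (g ∸ L) u' E L g W v0 (v1 :+ v2) 0 (eqn (v0 :+ v3) v4 (m∸n+n≡m L≤g) (eqn⁻ (v2 :+ v3) v5 L≡ (eqn⁻ (v1 :+ v5) v4 g≡ []))) 0 (eqn⁻ (v0 :+ v3) v4 (m∸n+n≡m L≤g) (eqn (v2 :+ v3) v5 L≡ (eqn (v1 :+ v5) v4 g≡ [])))) (End.sparse eA L L≤g)
        where
        L≤g : L ≤ g
        L≤g = ≤-trans (m∸n≤m W E) W≤g
       D-small : D t * 100000 ≤ m
       D-small = cancelˡ (m * M) (*-mono-≤ m≥1 (≤-trans (s≤s z≤n) M-large)) (lin 5 m M (D t) (# Bot) Bad 4 (v0 :* v1 :* (v2 :* & 100000)) (v0 :* v1 :* v0) (mul* 5 (v1 :* v2 :* & 100000) v0 (v3 :* & 100000) bot' (mul* 5 (v1 :* & 10000000000) (v3 :* v2) v4 (≤-trans light Bot≤Bad) (hyp* 50000000000 (v1 :* v4) (v0 :*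
        (k8 :* v0)) Bad≤ (mul* 4 (v0 :* v0) (& 100000000000) v1 M-large [])))))
        where
        bot' : m ≤ # Bot * 100000
        bot' = subst (λ t → m ≤ t * 100000) (sym #Bot) bot
        Bot≤Bad : Σ (λ y → [ Bot y ] * D y) ≤ Bad
        Bot≤Bad = Σ-mono λ y → ≤-trans (≡⇒≤ (sym (Σ-* [ Bot y ] λ z → [ Q z ∧ not ((V ∪ V') (y ⊹ z)) ])))
         (Σ-mono λ z → ≤-trans (*-monoˡ-≤ _ (⟨⟩-mono (Bot⊑P y))) (bool³ (λ a b c → [ a ] * [ b ∧ c ]) (λ a b c → [ (a ∧ b) ∧ c ]) (P y) (Q z) (not ((V ∪ V') (y ⊹ z)))))
       low-part : TB + #< E (λ k → β (g + k)) ≤ κ₁ + D t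
       low-part = (lin 7 TB (#< E (λ k → β (g + k))) κ₁ (D t) (# (window B b u' (W + E))) (# (λ z → U (z ⊹ t))) (# U) 0 (v0 :+ v1) (v2 :+ v3) (eqn⁻ v4 (v0 :+ v1) #-low (hyp v4 (v5 :+ v3) (Σ-≤ ((λ z → [ window B b u' (W + E) z ]) ∷ []) ((λ z → [ U (z ⊹ t) ]) ∷ (λ z → [ Q z ∧ not ((V ∪ V') (t ⊹ z)) ]) ∷ []) entry)
        (eqn v5 v6 (Σ-shift t ([_] ∘ U)) (hyp v6 v2 (captured-window {V'} c lo U (≤-trans (m≤m+n lo L) (subst (_≤ p) (sym lo+L) 2g≤p)) (λ y h → T-∧ˡ {V' y} h , ≤ᵇ⇒≤ (suc (pos (y ⊖ c))) lo (T-∧ʳ {V' y} h))) [])))))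
        where
        U : G → Bool
        U y = V' y ∧ (suc (pos (y ⊖ c)) ≤ᵇ lo)
        #-low : # (window B b u' (W + E)) ≡ TB + #< E (λ k → β (g + k))
        #-low = trans (#-window B b u' (W + E) (lin 4 u' W E p 0 (v0 :+ (v1 :+ v2)) v3 (hyp v2 v1 E≤W (hyp (v0 :+ (v1 :+ v1)) v3 u'WW [])))) (trans (Σ<-split W E λ k → [ β (u' + k) ]) (cong (TB +_) (Σ<-cong E λ k _ → cong ([_] ∘ β) (trans (sym (+-assoc u' W k)) (cong (_+ k) g≡)))))
        entry : ∀ z → [ window B b u' (W + E) z ] ≤ [ U (z ⊹ t) ] + [ Q z ∧ not ((V ∪ V') (t ⊹ z)) ]
        entry z with window B b u' (W + E) z in wz
        ... | false = z≤n
        ... | true = by-hit (V' (t ⊹ z)) refl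
         where
         bz = window-elim B b u' (W + E) z (T! wz)
         lt-lo : pos (t ⊖ a) + pos (z ⊖ b) < lo
         lt-lo = (lin 6 (pos (t ⊖ a)) (pos (z ⊖ b)) u' g E W 0 (1+ (v0 :+ v1)) (v2 :+ v3 :+ v4) (hyp (1+ v0) (1+ v2) (proj₂ (window-elim A a 0 (suc u') t Bot-t)) (hyp (1+ v1) (v2 :+ (v5 :+ v4)) (proj₂ bz) (eqn (v2 :+ v5) v3 g≡ []))))
         lt : pos (t ⊖ a) + pos (z ⊖ b) < 2 * g
         lt = ≤-trans lt-lo (≤-trans (m≤m+n lo L) (≡⇒≤ lo+L))
         pos< : ∀ {r} → pos (t ⊖ a) + pos (z ⊖ b) < r → T (suc (pos (t ⊹ z ⊖ c)) ≤ᵇ r)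
         pos< {r} h = ≤⇒≤ᵇ (subst (_< r) (sym (pos-sum a b t z (in-zone (pos (t ⊖ a)) (pos (z ⊖ b)) lt))) h)
         Qz : T (Q z)
         Qz = T-pair {B z} (T-∧ˡ {B z} (T! wz)) (T-pair {u' ≤ᵇ pos (z ⊖ b)} (≤⇒≤ᵇ (proj₁ bz)) (≤⇒≤ᵇ (≤-trans (proj₂ bz) (+-monoʳ-≤ u' (+-monoʳ-≤ W E≤W)))))
         by-hit : ∀ q → V' (t ⊹ z) ≡ q → 1 ≤ [ U (z ⊹ t) ] + [ Q z ∧ not ((V ∪ V') (t ⊹ z)) ]
         by-hit true hit = ≤-trans (≡⇒≤ (sym (T⇒⟨⟩ (subst (T ∘ U) (⊹-comm t z) (T-pair (T! hit) (pos< lt-lo)))))) (m≤m+n _ _)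
         by-hit false hit = ≤-trans (≡⇒≤ (sym (T⇒⟨⟩ (T-pair Qz (T-not λ h → case T-∨-elim {V (t ⊹ z)} h of λ where
           (inj₁ hV) → T-not⁻ hV (T-pair tt (pos< lt))
           (inj₂ hV') → subst T hit hV'))))) (m≤n+m _ _)
       U-small : (L ∸ κ₂) * 50000 ≤ m
       U-small = cancelˡ (m * M) (*-mono-≤ m≥1 (≤-trans (s≤s z≤n) M-large)) (lin 5 m M (L ∸ κ₂) W Bad 48 (v0 :* v1 :* (v2 :* & 50000)) (v0 :* v1 :* v0) (mul* 50000 (v1 :* v2) (v0 :* & 49) (v3 :* & 100) W≥ (mul* 5000000 v1 (v2 :* v3) (v4 :* & 40000) rows-bad (hyp* 200000000000 (v1 :* v4) (v0 :* (k8 :* v0)) Bad≤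
        (mul* 16 (v0 :* v0) (& 100000000000) v1 M-large [])))))
        where
        badAt : G → ℕ
        badAt z = # λ y → (P y ∧ Q (z ⊖ y)) ∧ not ((V ∪ V') z)
        uncaught : #< L (λ k → not (line V' x c (lo + k))) ≡ L ∸ κ₂
        uncaught = sym (trans (cong (_∸ κ₂) (sym (#<-not L λ k → line V' x c (lo + k)))) (m+n∸m≡n κ₂ _))
        -- Each sum missed beyond `E` accounts for at least `W / 40000` bad pairs.
        rows-bad : (L ∸ κ₂) * W ≤ Bad * 40000
        rows-bad = begin
         (L ∸ κ₂) * W ≡⟨ cong (_* W) (sym uncaught) ⟩
         #< L (λ k → not (line V' x c (lo + k))) * W ≡⟨ trans (*-comm _ W) (sym (Σ<-* L W λ k → [ not (line V' x c (lo + k)) ])) ⟩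
         Σ< L (λ k → W * [ not (line V' x c (lo + k)) ]) ≤⟨ Σ<-mono L row ⟩
         Σ< L (λ k → badAt (c ⊹ (lo + k) • x) * 40000) ≡⟨ Σ<-*ʳ L 40000 (λ k → badAt (c ⊹ (lo + k) • x)) ⟩
         Σ< L (λ k → badAt (c ⊹ (lo + k) • x)) * 40000 ≤⟨ *-monoˡ-≤ 40000 (Σ<-sub lo L p (λ k → badAt (c ⊹ k • x)) (subst (_≤ p) (sym lo+L) 2g≤p)) ⟩
         Σ< p (λ k → badAt (c ⊹ k • x)) * 40000 ≡⟨ cong (_* 40000) (trans (Σ-orbit x x≢0 c badAt) (sym (bad-by-sum P Q (V ∪ V')))) ⟩
         Bad * 40000 ∎
         where
         open ≤-Reasoning
         row : ∀ k → k < L → W * [ not (line V' x c (lo + k)) ] ≤ badAt (c ⊹ (lo + k) • x) * 40000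
         row k k<L = by-hit (line V' x c (lo + k)) refl
          where
          e = E + k
          σ = c ⊹ (lo + k) • x
          e<W : e < W
          e<W = (lin 4 E k W L 0 (1+ (v0 :+ v1)) v2 (hyp (1+ v1) v3 k<L (eqn (v0 :+ v3) v2 L≡ [])))
          lo+k< : lo + k < 2 * g
          lo+k< = ≤-trans (+-monoʳ-< lo k<L) (≡⇒≤ lo+L)
          no-capture : V' σ ≡ false → T (not ((V ∪ V') σ))
          no-capture hit = T-not λ h → case T-∨-elim {V σ} h of λ where
           (inj₁ hV) → T-not⁻ hV (T-pair tt (≤⇒≤ᵇ (subst (_< 2 * g) (sym (pos-from c (lo + k) (<-≤-trans lo+k< 2g≤p))) lo+k<)))
           (inj₂ hV') → subst T hit hV'
          -- Index `u' + i` of `A` is paired with core index `e - i` of `B`. When `σ` is missed,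
          -- each outer element gives a bad pair unless it meets a hole of `B`.
          pairs : V' σ ≡ false → #< (suc e) (λ i → α (u' + i)) ≤ badAt σ + #< (suc e) (λ i → not (β (g + i)))
          pairs hit = (lin 6 (#< (suc e) (λ i → α (u' + i))) (badAt σ) (#< (suc e) (λ i → not (β (g + i)))) (Σ< (suc e) (λ i → [ α (u' + i) ] * [ Q (σ ⊖ (a ⊹ (u' + i) • x)) ])) (Σ< (suc e) (λ i → [ not (β (g + (e ∸ i))) ])) (Σ< g (λ i → [ α i ] * [ Q (σ ⊖ (a ⊹ i • x)) ])) 0 v0 (v1 :+ v2) (hyp v0 (v3 :+ v4)
           (≤-trans (Σ<-mono (suc e) entry) (≡⇒≤ (Σ<-+ (suc e) (λ i → [ α (u' + i) ] * [ Q (σ ⊖ (a ⊹ (u' + i) • x)) ]) (λ i → [ not (β (g + (e ∸ i))) ])))) (eqn v4 v2 (Σ<-reverse (suc e) (λ i → [ not (β (g + (e ∸ i))) ]) (λ i → [ not (β (g + i)) ]) (λ _ _ → refl)) (hyp v3 v5 (Σ<-sub u' (suc e) g (λ i → [ α i ] * [ Q (σ ⊖ (a ⊹ i •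
           x)) ]) (lin 4 u' e g W 0 (v0 :+ (1+ v1)) v2 (hyp (1+ v1) v3 e<W (eqn (v0 :+ v3) v2 g≡ [])))) (eqn v5 v1 (trans (sym (Σ-window A a 0 g (λ y → [ Q (σ ⊖ y) ]) g≤p)) (Σ-cong λ y → trans (sym (⟨⟩-∧ (P y) (Q (σ ⊖ y)))) (sym (cong [_] (drop (P y ∧ Q (σ ⊖ y)) (no-capture hit)))))) [])))))
           where
           drop : ∀ b {d} → T d → b ∧ d ≡ b
           drop true {true} _ = refl
           drop false _ = refl
           entry : ∀ i → i < suc e → [ α (u' + i) ] ≤ [ α (u' + i) ] * [ Q (σ ⊖ (a ⊹ (u' + i) • x)) ] + [ not (β (g + (e ∸ i))) ]
           entry i i≤e with β (g + (e ∸ i)) in bi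
           ... | false = ≤-trans (⟨⟩≤1 (α (u' + i))) (m≤n+m 1 _)
           ... | true = ≤-trans (≡⇒≤ (sym (trans (cong ([ α (u' + i) ] *_) (T⇒⟨⟩ Q-holds)) (*1 _)))) (m≤m+n _ 0)
            where
            k' = W + (e ∸ i)
            g+ : u' + k' ≡ g + (e ∸ i)
            g+ = trans (sym (+-assoc u' W (e ∸ i))) (cong (_+ (e ∸ i)) g≡)
            point : b ⊹ (u' + k') • x ≡ σ ⊖ (a ⊹ (u' + i) • x)
            point = trans (group 4 b ((u' + k') • x) a ((u' + i) • x) (g0 :+ g1) (g2 :+ g0 :+ (g3 :+ g1) :- (g2 :+ g3))) (cong (λ t → a ⊹ b ⊹ t ⊖ (a ⊹ (u' + i) • x)) (trans (sym (•-+ (u' + i) (u' + k') x)) (cong (_• x) (linEq 7 u' i k' g E k (e ∸ i) (v0 :+ v1 :+ (v0 :+ v2)) (v0 :+ v3 :+ v4 :+ v5) 0 (eqn (v0 :+ v2) (v3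
             :+ v6) g+ (eqn (v1 :+ v6) (v4 :+ v5) (+∸ (≤-pred i≤e)) [])) 0 (eqn⁻ (v0 :+ v2) (v3 :+ v6) g+ (eqn⁻ (v1 :+ v6) (v4 :+ v5) (+∸ (≤-pred i≤e)) []))))))
            Q-holds : T (Q (σ ⊖ (a ⊹ (u' + i) • x)))
            Q-holds = subst (T ∘ Q) point (window-intro B b u' (W + W) k' (+-monoʳ-< W (≤-<-trans (m∸n≤m e i) e<W)) u'WW (subst (T ∘ β) (sym g+) (T! bi)))
          popular : V' σ ≡ false → suc e * 100 + W < #< (suc e) (λ i → α (u' + i)) * 40000 → W ≤ badAt σ * 40000
          popular hit gt = (lin 6 W (badAt σ) e (#< (suc e) (λ i → α (u' + i))) (#< (suc e) (λ i → not (β (g + i)))) (#< (suc e) (λ i → β (g + i))) 0 v0 (v1 :* & 40000) (hyp (1+ ((1+ v2) :* & 100 :+ v0)) (v3 :* & 40000) gt (hyp* 40000 v3 (v1 :+ v4) (pairs hit) (eqn* 40000 (v5 :+ v4) (1+ v2) (#<-not (suc e) (λ i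
           → β (g + i))) (hyp* 100 ((1+ v2) :* & 399) (v5 :* & 400) (End.dense eB (suc e) (≤-trans e<W W≤g)) [])))))
          by-hit : ∀ q → V' σ ≡ q → W * [ not q ] ≤ badAt σ * 40000
          by-hit true _ = ≤-trans (≡⇒≤ (*0 W)) z≤n
          by-hit false hit = ≤-trans (≡⇒≤ (*1 W)) (popular hit (≰⇒> (high (suc e) (s≤s (m≤m+n E k)) e<W)))

   result : Goal
   result with ≤-<-connex W (4 * m)
   ... | inj₁ le = narrow le
   ... | inj₂ gt = wide gt

  -- The factor 1001/1000 is the surplus that later pays for elements far from both cores. The set
  -- that first collects its share at the outer end takes the role of `A` in `Side`.
  end-captured : ∀ {A B a b g} → End A a g → End B b g → 4 * g ≤ p → (m : ℕ) → m ≡ #< g (line A x a) + #< g (line B x b) → m ≤ 4 * (s * s) →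
   ∃ λ (R : Small A B (M * s * 1200000)) → m * 1001 ≤ captured (sums R) (a ⊹ b) (2 * g) * 1000
  end-captured {A} {B} {a} {b} {g} eA eB room zero m≡ m≤ = small-subsets ∅ ∅ (λ _ ()) (λ _ ()) (≤-trans (≡⇒≤ #∅) z≤n) (≤-trans (≡⇒≤ #∅) z≤n) , z≤n
  end-captured {A} {B} {a} {b} {g} eA eB room m@(suc _) m≡ m≤ = from (least (λ u → (m ℕ.≤? #< u (line A x a) * N₁) ⊎-dec (m ℕ.≤? #< u (line B x b) * N₁)) g start)
   where
   start : m ≤ #< g (line A x a) * N₁ ⊎ m ≤ #< g (line B x b) * N₁
   start with ≤-total (#< g (line A x a)) (#< g (line B x b))
   ... | inj₁ le = inj₂ (lin 3 m (#< g (line B x b)) (#< g (line A x a)) 0 v0 (v1 :* & 100000) (eqn v0 (v2 :+ v1) m≡ (hyp v2 v1 le [])))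
   ... | inj₂ ge = inj₁ (lin 3 m (#< g (line A x a)) (#< g (line B x b)) 0 v0 (v1 :* & 100000) (eqn v0 (v1 :+ v2) m≡ (hyp v2 v1 ge [])))
   from : (∃ λ u → u ≤ g × (m ≤ #< u (line A x a) * N₁ ⊎ m ≤ #< u (line B x b) * N₁) × (∀ k → k < u → ¬ (m ≤ #< k (line A x a) * N₁ ⊎ m ≤ #< k (line B x b) * N₁))) →
       ∃ λ (R : Small A B (M * s * 1200000)) → m * 1001 ≤ captured (sums R) (a ⊹ b) (2 * g) * 1000
   from (zero , _ , inj₁ () , _)
   from (zero , _ , inj₂ () , _)
   from (suc u' , u≤g , inj₁ bot , before) = Side.result eA eB room m u' m≡ (s≤s z≤n) m≤ u≤g bot (≰⇒> (before u' ≤-refl ∘ inj₁)) (≰⇒> (before u' ≤-refl ∘ inj₂))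
   from (suc u' , u≤g , inj₂ bot , before) = swapped (Side.result eB eA room m u' (trans m≡ (+-comm (#< g (line A x a)) _)) (s≤s z≤n) m≤ u≤g bot (≰⇒> (before u' ≤-refl ∘ inj₂)) (≰⇒> (before u' ≤-refl ∘ inj₁)))
    where
    swapped : (∃ λ (R : Small B A (M * s * 1200000)) → m * 1001 ≤ captured (sums R) (b ⊹ a) (2 * g) * 1000) → ∃ λ (R : Small A B (M * s * 1200000)) → m * 1001 ≤ captured (sums R) (a ⊹ b) (2 * g) * 1000
    swapped (R , le) = swap-subsets R , ≤-trans le (*-monoˡ-≤ 1000 (Σ<-mono (2 * g) λ k _ → ⟨⟩-mono λ t → subst (T ∘ sums (swap-subsets R)) (cong (_⊹ k • x) (⊹-comm b a)) (⊞-comm (Small.A' R) (Small.B' R) _ t)))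

 enlarge : ∀ {A B K K'} → Small A B K → K ≤ K' → Small A B K'
 enlarge (small-subsets A' B' a b #a #b) le = small-subsets A' B' a b (≤-trans #a le) (≤-trans #b le)

 unite : ∀ {A B K L} → Small A B K → Small A B L → Small A B (K + L)
 unite (small-subsets A' B' a b #a #b) (small-subsets A″ B″ c d #c #d) = small-subsets (A' ∪ A″) (B' ∪ B″) (∪-⊑ {A'} a c) (∪-⊑ {B'} b d)
  (≤-trans (#-∪ A' A″) (+-mono-≤ #a #c)) (≤-trans (#-∪ B' B″) (+-mono-≤ #b #d))

 unite-ˡ : ∀ {A B K L} (R : Small A B K) (R' : Small A B L) → sums R ⊑ sums (unite R R')
 unite-ˡ R R' = ⊞-mono (λ _ → T-∨ˡ) (λ _ → T-∨ˡ)

 unite-ʳ : ∀ {A B K L} (R : Small A B K) (R' : Small A B L) → sums R' ⊑ sums (unite R R')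
 unite-ʳ R R' = ⊞-mono (λ y → T-∨ʳ {Small.A' R y}) (λ y → T-∨ʳ {Small.B' R y})

 -- Sums inside the arcs.

 absent : (V : G → Bool) (x c : G) → ℕ → Bool
 absent V x c k = not (line V x c k)

 #<-reflect : ∀ S x c m y → y ≤ suc m → #< y (line S (⊝ x) (c ⊹ m • x)) ≡ #< y λ k → line S x c (suc m ∸ y + k)
 #<-reflect S x c m y le = trans (Σ<-cong y λ k k<y → cong ([_] ∘ S) (trans (cong (c ⊹ m • x ⊹_) (•-⊝ k x)) (trans (cong (λ t → c ⊹ t • x ⊖ k • x) (sym (+∸ (≤-pred (≤-trans k<y le)))))
  (trans (cong (λ t → c ⊹ t ⊖ k • x) (•-+ k (m ∸ k) x)) (group 3 c (k • x) ((m ∸ k) • x) (g0 :+ (g1 :+ g2) :- g1) (g0 :+ g2))))))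
  (Σ<-countdown y m ([_] ∘ line S x c) le)

 -- Carries the covering of integers over to the group: as `l ≤ p`, indices below `l` determine
 -- elements uniquely, and adding indices is adding elements along the progression.
 module Fill {A B : G → Bool} (x : G) (x≢0 : x ≢ 𝟘) (a b : G) (l : ℕ) (l≤p : l ≤ p) {α β : ℕ → Bool}
  (α⊆ : ∀ i → i < l → T (α i) → T (line A x a i)) (β⊆ : ∀ i → i < l → T (β i) → T (line B x b i)) where

  open Positions x x≢0

  part : (S : G → Bool) (s : G) (sel : ℕ → Bool) → G → Bool
  part S s sel y = S y ∧ window (λ z → sel (pos (z ⊖ s))) s 0 l y

  #-part : ∀ S s sel {K} → (∀ n → #< n sel ≤ K) → # (part S s sel) ≤ K
  #-part S s sel small = begin
   # (part S s sel) ≤⟨ #-mono (λ y t → T-∧ʳ {S y} t) ⟩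
   # (window (λ z → sel (pos (z ⊖ s))) s 0 l) ≡⟨ #-window (λ z → sel (pos (z ⊖ s))) s 0 l l≤p ⟩
   #< l (λ k → sel (pos (s ⊹ k • x ⊖ s))) ≡⟨ Σ<-cong l (λ k k<l → cong ([_] ∘ sel) (pos-from s k (<-≤-trans k<l l≤p))) ⟩
   #< l sel ≤⟨ small l ⟩
   _ ∎
   where open ≤-Reasoning

  in-part : ∀ S s sel i → i < l → T (line S x s i) → T (sel i) → T (part S s sel (s ⊹ i • x))
  in-part S s sel i i<l Si seli = T-pair Si (T-pair (subst (T ∘ sel) (sym at-i) seli) (subst (T ∘ between 0 l) (sym at-i) (between-inside 0 l i i<l)))
   where
   at-i : pos (s ⊹ i • x ⊖ s) ≡ i
   at-i = pos-from s i (<-≤-trans i<l l≤p)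

  fill : ∀ {K} → Selection α β K K → Small A B K
  fill S = small-subsets (part A a (selA S)) (part B b (selB S)) (λ y t → T-∧ˡ t) (λ y t → T-∧ˡ t) (#-part A a (selA S) (#selA S)) (#-part B b (selB S) (#selB S))

  fill-absent : ∀ {K} (S : Selection α β K K) z → (∀ i j → i + j ≡ z → T (selA S i) → T (selB S j) → i < l × j < l) →
   T (absent (sums (fill S)) x (a ⊹ b) z) → T (missed S z)
  fill-absent S z inside t = T-not λ h → from (sumOf-elim (selA S) (selB S) z h)
   where
   from : (∃ λ i → ∃ λ j → i + j ≡ z × T (selA S i) × T (selB S j)) → ⊥
   from (i , j , eq , Ai , Bj) = T-not⁻ t (subst (T ∘ sums (fill S)) (trans (line-sum x a b i j) (cong (λ t → a ⊹ b ⊹ t • x) eq))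
    (⊞-intro (part A a (selA S)) (part B b (selB S)) (in-part A a (selA S) i i<l (α⊆ i i<l (selA⊆ S i Ai)) Ai) (in-part B b (selB S) j j<l (β⊆ j j<l (selB⊆ S j Bj)) Bj)))
    where
    i<l = proj₁ (inside i j eq Ai Bj)
    j<l = proj₂ (inside i j eq Ai Bj)

 Dense : (S : G → Bool) (x a : G) (len : ℕ) → Set
 Dense S x a len = ∀ y → y ≤ len → y * 399 ≤ #< y (line S x a) * 400

 few-holes : ∀ S x a {len} → Dense S x a len → ∀ y → y ≤ len → #< y (absent S x a) * 400 ≤ y
 few-holes S x a dense y y≤ = (lin 3 (#< y (absent S x a)) y (#< y (line S x a)) 0 (v0 :* & 400) v1 (hyp (v1 :* & 399) (v2 :* & 400) (dense y y≤) (eqn* 400 (v2 :+ v0) v1 (#<-not y (line S x a)) [])))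

 Halved : (A B : G → Bool) (x a b : G) (l K : ℕ) → Set
 Halved A B x a b l K = ∃ λ (R : Small A B K) → #< l (absent (sums R) x (a ⊹ b)) * 100 ≤ (#< l (absent A x a) + #< l (absent B x b)) * 16

 -- `Prefix` read along the arc: the lower half of the sums loses 16/100 of the holes. The upper
 -- half comes from the same statement for step `- x`.
 half : ∀ {A B} x → x ≢ 𝟘 → ∀ a b l → l ≤ p → Dense A x a l → Dense B x b l → ∀ j → l ≤ 2 ℕ.^ j * 2 ℕ.^ j →
  Halved A B x a b l (2 ℕ.^ j * 8)
 half {A} {B} x x≢0 a b l l≤p denseA denseB j l≤Q = finish (Prefix.cover (extended A a) (extended B b) (extended-dense A a denseA) (extended-dense B b denseB) j)
  where
  Q = 2 ℕ.^ j * 2 ℕ.^ j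
  -- Completing the sets beyond l spares the covering lemma a bound on the range.
  extended : (G → Bool) → G → ℕ → Bool
  extended S s i = line S x s i ∨ not (suc i ≤ᵇ l)
  inside : ∀ S s i → i < l → T (extended S s i) → T (line S x s i)
  inside S s i i<l t = from (T-∨-elim {line S x s i} t)
   where
   from : T (line S x s i) ⊎ T (not (suc i ≤ᵇ l)) → T (line S x s i)
   from (inj₁ h) = h
   from (inj₂ h) = ⊥-elim (T-not⁻ h (≤⇒≤ᵇ i<l))
  extended-holes : ∀ S s y → #< y (not ∘ extended S s) ≤ #< l (absent S x s)
  extended-holes S s y = ≤-trans (Σ<-≤ (λ i → [ not (extended S s i) ]) (m≤m+n y l)) (≤-trans
   (Σ<-mono (y + l) λ i _ → bool² (λ u v → [ not (u ∨ not v) ]) (λ u v → [ v ] * [ not u ]) (line S x s i) (suc i ≤ᵇ l))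
   (≡⇒≤ (Σ<-between 0 l (y + l) ([_] ∘ absent S x s) (m≤n+m l y))))
  extended-dense : ∀ S s → Dense S x s l → ∀ y → #< y (not ∘ extended S s) * 400 ≤ y
  extended-dense S s dense y = by (≤-total y l)
   where
   by : y ≤ l ⊎ l ≤ y → #< y (not ∘ extended S s) * 400 ≤ y
   by (inj₁ y≤l) = ≤-trans (*-monoˡ-≤ 400 (Σ<-mono y λ i _ → bool² (λ u v → [ not (u ∨ v) ]) (λ u v → [ not u ]) (line S x s i) (not (suc i ≤ᵇ l)))) (few-holes S x s dense y y≤l)
   by (inj₂ l≤y) = ≤-trans (*-monoˡ-≤ 400 (extended-holes S s y)) (≤-trans (few-holes S x s dense l ≤-refl) l≤y)
  open Fill {A} {B} x x≢0 a b l l≤p {extended A a} {extended B b} (inside A a) (inside B b)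
  open Prefix (extended A a) (extended B b) (extended-dense A a denseA) (extended-dense B b denseB) using (holes; Good)
  finish : Good (2 ℕ.^ j) Q →
   Halved A B x a b l (2 ℕ.^ j * 8)
  finish (S , le) = fill S , (begin
   #< l (absent (sums (fill S)) x (a ⊹ b)) * 100 ≤⟨ *-monoˡ-≤ 100 (Σ<-mono l λ z z<l → ⟨⟩-mono (fill-absent S z λ i k eq _ _ → ≤-<-trans (subst (i ≤_) eq (m≤m+n i k)) z<l , ≤-<-trans (subst (k ≤_) eq (m≤n+m k i)) z<l)) ⟩
   #< l (missed S) * 100 ≤⟨ *-monoˡ-≤ 100 (Σ<-≤ ([_] ∘ missed S) l≤Q) ⟩
   #< Q (missed S) * 100 ≤⟨ *-cancelʳ-≤ (#< Q (missed S) * 100) (holes Q * 16) Q {{m*n≢0 (2 ℕ.^ j) (2 ℕ.^ j) {{m^n≢0 2 j}} {{m^n≢0 2 j}}}} (lin 3 (#< Q (missed S)) Q (holes Q) 0 (v0 :* & 100 :* v1) (v2 :* & 16 :* v1) (hyp (v0 :* v1 :* & 100 :+ v2 :* v2 :* & 400) (v2 :* v1 :* & 16) le [])) ⟩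
   holes Q * 16 ≤⟨ *-monoˡ-≤ 16 (+-mono-≤ (extended-holes A a Q) (extended-holes B b Q)) ⟩
   (#< l (absent A x a) + #< l (absent B x b)) * 16 ∎)
   where open ≤-Reasoning

 -- No multiscale argument is needed here: a target between `l` and `l + d` has `r * r`
 -- representations whose first summand is among the last `r * r` indices, so blocks of these and
 -- residue classes of all of `B` at a single scale suffice.
 middle : ∀ {A B} x → x ≢ 𝟘 → ∀ a b l d → l ≤ p → Dense A x a l → Dense B x b l → 4 * d ≤ l → 100 ≤ l → ∀ r → r * r * 4 ≤ 3 * l → l ≤ 2 * (r * r) →
  ∃ λ (R : Small A B (r * 4)) → #< d (λ k → absent (sums R) x (a ⊹ b) (l + k)) * 100 ≤ #< l (absent A x a) + #< l (absent B x b)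
 middle {A} {B} x x≢0 a b l d l≤p denseA denseB d-small l-large r r-small r-large = finish two-rounds
  where
  q x₀ H : ℕ
  q = r * r
  x₀ = l ∸ q
  H = #< l (absent A x a) + #< l (absent B x b)
  1≤q : 1 ≤ q
  1≤q = ≰⇒> λ le → (absurd (lin 2 r l 99 k1 k0 (hyp* 2 (v0 :* v0) k0 le (hyp v1 (k2 :* (v0 :* v0)) r-large (hyp (& 100) v1 l-large [])))))
  q≢0 : NonZero q
  q≢0 = ℕ.>-nonZero 1≤q
  instance
   r≢0 : NonZero r
   r≢0 = m*n≢0⇒m≢0 r {{q≢0}}
  x₀+q : x₀ + q ≡ l
  x₀+q = trans (+-comm x₀ q) (+∸ (lin 2 r l 3 (v0 :* v0) v1 (hyp (v0 :* v0 :* k4) (k3 :* v1) r-small [])))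
  within : (G → Bool) → G → ℕ → Bool
  within S s i = line S x s i ∧ (suc i ≤ᵇ l)
  α β : ℕ → Bool
  α = within A a
  β = within B b
  same-holes : ∀ S s i → i < l → [ not (within S s i) ] ≤ [ absent S x s i ]
  same-holes S s i i<l = ⟨⟩-mono λ t → T-not λ h → T-not⁻ t (T-pair h (≤⇒≤ᵇ i<l))
  open Round r x₀ l (r * 2) H α β (lin 2 l r 0 v0 (v1 :* k2 :* v1) (hyp v0 (k2 :* (v1 :* v1)) r-large []))
   (+-mono-≤ (≤-trans (Σ<-mono q λ i i<q → same-holes A a (x₀ + i) (<-≤-trans (+-monoʳ-< x₀ i<q) (≡⇒≤ x₀+q))) (Σ<-sub x₀ q l ([_] ∘ absent A x a) (≡⇒≤ x₀+q)))
    (Σ<-mono l (same-holes B b))) l d (≡⇒≤ x₀+q)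
   (lin 4 l d x₀ r 3 (v0 :+ v1) (v2 :+ v0) (eqn⁻* 4 (v2 :+ v3 :* v3) v0 x₀+q (hyp (v3 :* v3 :* k4) (k3 :* v0) r-small (hyp (k4 :* v1) v0 d-small [])))) using (two-rounds)
  open Fill {A} {B} x x≢0 a b l l≤p {α} {β} (λ i _ t → T-∧ˡ t) (λ i _ t → T-∧ˡ t)
  finish : (∃ λ (S : Selection α β (r + r) (r * 2 + r * 2)) → #< d (λ i → missed S (l + i)) * q * q ≤ d * (H * H)) →
   ∃ λ (R : Small A B (r * 4)) → #< d (λ k → absent (sums R) x (a ⊹ b) (l + k)) * 100 ≤ H
  finish (S₀ , le) = shape (weaken (lin 1 r 0 (v0 :+ v0) (v0 :* k4) []) (lin 1 r 0 (v0 :* k2 :+ v0 :* k2) (v0 :* k4) []) S₀)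
   where
   shape : (∃ λ (S : Selection α β (r * 4) (r * 4)) → ∀ z → missed S z ≡ missed S₀ z) → ∃ λ (R : Small A B (r * 4)) → #< d (λ k → absent (sums R) x (a ⊹ b) (l + k)) * 100 ≤ H
   shape (S , same) = fill S , *-cancelʳ-≤ (M * 100) H (q * q) {{m*n≢0 q q {{q≢0}} {{q≢0}}}} (lin 5 M q H F d 3 (v0 :* & 100 :* (v1 :* v1)) (v2 :* (v1 :* v1)) (mul* 400 (v1 :* v1) v0 v3 M≤ (hyp* 400 (v3 :* v1 :* v1) (v4 :* (v2 :* v2)) le (mul* 200 (v2 :* v2) (k2 :* v4) v1 d≤ (mul (v2 :* v1) (v2 :* & 200) (k2 :* v1) H≤
    [])))))
    where
    M F : ℕ
    M = #< d λ k → absent (sums (fill S)) x (a ⊹ b) (l + k)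
    F = #< d λ i → missed S₀ (l + i)
    M≤ : M ≤ F
    M≤ = Σ<-mono d λ k _ → ⟨⟩-mono λ t → subst T (same (l + k)) (fill-absent S (l + k) (λ i j _ Si Sj → ≤ᵇ⇒≤ (suc i) l (T-∧ʳ {line A x a i} (selA⊆ S i Si)) , ≤ᵇ⇒≤ (suc j) l (T-∧ʳ {line B x b j} (selB⊆ S j Sj))) t)
    d≤ : 2 * d ≤ q
    d≤ = (lin 3 d r l 1 (k2 :* v0) (v1 :* v1) (hyp (k4 :* v0) v2 d-small (hyp v2 (k2 :* (v1 :* v1)) r-large [])))
    H≤ : H * 200 ≤ 2 * q
    H≤ = (lin 5 H r (#< l (absent A x a)) (#< l (absent B x b)) l 1 (v0 :* & 200) (k2 :* (v1 :* v1)) (eqn* 400 v0 (v2 :+ v3) refl (hyp (v2 :* & 400) v4 (few-holes A x a denseA l ≤-refl) (hyp (v3 :* & 400) v4 (few-holes B x b denseB l ≤-refl) (hyp* 2 v4 (k2 :* (v1 :* v1)) r-large [])))))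

 -- `r * r` is about 3/4 of `l`: in `middle` it must exceed half of the arc and leave `d ≤ l / 4`
 -- indices.
 scale : ∀ l → ∃ λ r → r * r * 4 ≤ 3 * l × 3 * l < (r + 1) * (r + 1) * 4
 scale l = from (greatest (λ r → r * r * 4 ℕ.≤? 3 * l) l z≤n)
  where
  from : (∃ λ r → r ≤ l × r * r * 4 ≤ 3 * l × (∀ k → r < k → k ≤ l → ¬ (k * k * 4 ≤ 3 * l))) → ∃ λ r → r * r * 4 ≤ 3 * l × 3 * l < (r + 1) * (r + 1) * 4
  from (r , r≤l , le , max) = r , le , by (r + 1 ℕ.≤? l)
   where
   by : Dec (r + 1 ≤ l) → 3 * l < (r + 1) * (r + 1) * 4
   by (yes r<l) = ≰⇒> (max (r + 1) (≡⇒≤ (+-comm 1 r)) r<l)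
   by (no r≮l) = (lin 2 l r 0 (1+ (k3 :* v0)) ((v1 :+ k1) :* (v1 :+ k1) :* k4) (eqn⁻* 3 v1 v0 (≤-antisym r≤l (≤-pred (subst (l <_) (+-comm r 1) (≰⇒> r≮l)))) []))

 -- The sums of the two arcs are `L` from the left end, `L' - L` in the middle and `L` from the
 -- right end. The losses are 16, 1 and 16 per hundred holes, together below 34.
 module Middle {A B : G → Bool} (x : G) (x≢0 : x ≢ 𝟘) (a b : G) (L L' : ℕ) (L≤L' : L ≤ L') (L'≤p : L' ≤ p) (close : 4 * L' ≤ 5 * L) (L-large : 1000 ≤ L)
  (denseA : Dense A x a L) (denseB : Dense B x b L') (denseA⁻ : Dense A (⊝ x) (a ⊹ (L ∸ 1) • x) L) (denseB⁻ : Dense B (⊝ x) (b ⊹ (L' ∸ 1) • x) L')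
  (j : ℕ) (L≤Q : L ≤ 2 ℕ.^ j * 2 ℕ.^ j) where

  c : G
  c = a ⊹ b

  hA hB h : ℕ
  hA = #< L (absent A x a)
  hB = #< L' (absent B x b)
  h = hA + hB

  Result : Set
  Result = ∃ λ (R : Small A B (2 ℕ.^ j * 20)) → #< (L + L' ∸ 1) (absent (sums R) x c) * 100 ≤ h * 34

  ends : ∀ {m} → 1 ≤ m → suc (m ∸ 1) ≡ m
  ends = +∸

  1≤L : 1 ≤ L
  1≤L = ≤-trans (s≤s z≤n) L-large
  1≤L' : 1 ≤ L'
  1≤L' = ≤-trans 1≤L L≤L'

  reversed-holes : ∀ S s len → 1 ≤ len → L ≤ len → #< L (absent S (⊝ x) (s ⊹ (len ∸ 1) • x)) ≤ #< len (absent S x s)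
  reversed-holes S s len 1≤len L≤len = ≤-trans (≡⇒≤ (#<-reflect (∁ S) x s (len ∸ 1) L (subst (L ≤_) (sym (ends 1≤len)) L≤len)))
   (Σ<-sub (suc (len ∸ 1) ∸ L) L len ([_] ∘ absent S x s) (≡⇒≤ (trans (+-comm _ L) (trans (+∸ (subst (L ≤_) (sym (ends 1≤len)) L≤len)) (ends 1≤len)))))

  L≤p : L ≤ p
  L≤p = ≤-trans L≤L' L'≤p

  shorter : ∀ S y s → Dense S y s L' → Dense S y s L
  shorter S y s dense k k≤ = dense k (≤-trans k≤ L≤L')

  upper-absent : ∀ V → #< L (λ k → absent V x c (L' ∸ 1 + k)) ≡ #< L (absent V (⊝ x) (a ⊹ (L ∸ 1) • x ⊹ (b ⊹ (L' ∸ 1) • x)))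
  upper-absent V = sym (trans (cong (λ t → #< L (absent V (⊝ x) t)) (line-sum x a b (L ∸ 1) (L' ∸ 1)))
   (trans (#<-reflect (∁ V) x c (L ∸ 1 + (L' ∸ 1)) L (lin 3 L (L ∸ 1) (L' ∸ 1) 0 v0 (1+ (v1 :+ v2)) (eqn⁻ (1+ v1) v0 (ends 1≤L) [])))
    (cong (λ t → #< L λ k → absent V x c (t + k)) (linEq 2 (suc (L ∸ 1 + (L' ∸ 1)) ∸ L) (L' ∸ 1) v0 v1 0 (eqn v0 v1 (trans (cong (_∸ L) (cong (_+ (L' ∸ 1)) (ends 1≤L))) (m+n∸m≡n L (L' ∸ 1))) []) 0 (eqn⁻ v0 v1 (trans (cong (_∸ L) (cong (_+ (L' ∸ 1)) (ends 1≤L))) (m+n∸m≡n L (L' ∸ 1))) [])))))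

  assemble : Halved A B x a b L (2 ℕ.^ j * 8) →
   (∃ λ r → r * r * 4 ≤ 3 * L × 3 * L < (r + 1) * (r + 1) * 4) →
   Halved A B (⊝ x) (a ⊹ (L ∸ 1) • x) (b ⊹ (L' ∸ 1) • x) L (2 ℕ.^ j * 8) → Result
  assemble (R₁ , le₁) (r , r-small , r-next) (R₃ , le₃) = finish (middle {A} {B} x x≢0 a b L (L' ∸ L) L≤p denseA (shorter B x b denseB) (lin 3 (L' ∸ L) L L' 0 (k4 :* v0) v1 (eqn* 4 (v1 :+ v0) v2 (+∸ L≤L') (hyp (k4 :* v2) (k5 :* v1) close []))) (≤-trans ≤-dec L-large) r r-small r-large)
   where
   30≤r : 10 ≤ r
   30≤r = ≰⇒> λ le → (absurd (lin 2 r L 2600 k1 k0 (hyp* 44 v0 k9 le (mul* 4 v0 v0 k9 le (hyp (1+ (k3 :* v1)) ((v0 :+ k1) :* (v0 :+ k1) :* k4) r-next (hyp* 3 (& 1000) v1 L-large []))))))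
   r-large : L ≤ 2 * (r * r)
   r-large = (lin 2 L r 299 v0 (k2 :* (v1 :* v1)) (hyp* 100 (1+ (k3 :* v0)) ((v1 :+ k1) :* (v1 :+ k1) :* k4) r-next (mul* 83 v1 (& 10) v1 30≤r (hyp* 30 (& 10) v1 30≤r []))))
   r≤ : r ≤ 2 ℕ.^ j
   r≤ = ≮⇒≥ λ lt → (absurd (lin 3 r (2 ℕ.^ j) L 999 k1 k0 (mul* 4 v0 v1 v0 (<⇒≤ lt) (mul* 4 v1 v1 v0 (<⇒≤ lt) (hyp (v0 :* v0 :* k4) (k3 :* v2) r-small (hyp* 4 v2 (v1 :* v1) L≤Q (hyp (& 1000) v2 L-large [])))))))
   finish : (∃ λ (R : Small A B (r * 4)) → #< (L' ∸ L) (λ k → absent (sums R) x c (L + k)) * 100 ≤ #< L (absent A x a) + #< L (absent B x b)) → Result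
   finish (R₂ , le₂) = enlarge (unite (unite R₁ R₂) R₃) (lin 2 (2 ℕ.^ j) r 0 (v0 :* k8 :+ v1 :* k4 :+ v0 :* k8) (v0 :* & 20) (hyp* 4 v1 v0 r≤ [])) ,
    (lin 13 (#< (L + L' ∸ 1) (absent V x c)) hA hB (#< L (absent V x c)) (#< (L' ∸ L) (λ k → absent V x c (L + k))) (#< L (λ k → absent V x c (L' ∸ 1 + k))) (#< L (absent (sums R₁) x c)) (#< L (absent B x b)) (#< (L' ∸ L) (λ k → absent (sums R₂) x c (L + k))) (#< L (absent V (⊝ x) c⁻)) (#< L (absent (sums R₃) (⊝ x)
     c⁻)) (#< L (absent A (⊝ x) (a ⊹ (L ∸ 1) • x))) (#< L (absent B (⊝ x) (b ⊹ (L' ∸ 1) • x))) 0 (v0 :* & 100) ((v1 :+ v2) :* & 34) (hyp* 100 v0 (v3 :+ v4 :+ v5) pieces (hyp* 100 v3 v6 (Σ<-mono L (λ k _ → fewer x (λ y t → unite-ˡ (unite R₁ R₂) R₃ y (unite-ˡ R₁ R₂ y t)) c k)) (hyp (v6 :* & 100) ((v1 :+ v7) :* & 16) le₁ (hyp*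
     100 v4 v8 (Σ<-mono (L' ∸ L) (λ k _ → fewer x (λ y t → unite-ˡ (unite R₁ R₂) R₃ y (unite-ʳ R₁ R₂ y t)) c (L + k))) (hyp (v8 :* & 100) (v1 :+ v7) le₂ (eqn* 100 v5 v9 (upper-absent V) (hyp* 100 v9 v10 (Σ<-mono L (λ k _ → fewer (⊝ x) (unite-ʳ (unite R₁ R₂) R₃) c⁻ k)) (hyp (v10 :* & 100) ((v11 :+ v12) :* & 16) le₃ (hyp* 16
     v11 v1 (reversed-holes A a L 1≤L ≤-refl) (hyp* 16 v12 v2 (reversed-holes B b L' 1≤L' L≤L') (hyp* 17 v7 v2 (Σ<-≤ ([_] ∘ absent B x b) L≤L') []))))))))))))
    where
    V : G → Bool
    V = sums (unite (unite R₁ R₂) R₃)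
    c⁻ : G
    c⁻ = a ⊹ (L ∸ 1) • x ⊹ (b ⊹ (L' ∸ 1) • x)
    fewer : ∀ y {U} → U ⊑ V → ∀ d k → [ absent V y d k ] ≤ [ absent U y d k ]
    fewer y U⊑ d k = ⟨⟩-mono λ t → T-not λ h → T-not⁻ t (U⊑ (d ⊹ k • y) h)
    f : ℕ → ℕ
    f k = [ absent V x c k ]
    pieces : Σ< (L + L' ∸ 1) f ≤ Σ< L f + Σ< (L' ∸ L) (λ k → f (L + k)) + Σ< L (λ k → f (L' ∸ 1 + k))
    pieces = ≤-trans (≡⇒≤ (trans (cong (λ t → Σ< t f) (trans (+-∸-assoc L 1≤L') (+-comm L _))) (Σ<-split (L' ∸ 1) L f)))
     (+-monoˡ-≤ _ (≤-trans (Σ<-≤ f (≤-trans (m∸n≤m L' 1) (≡⇒≤ (sym (+∸ L≤L'))))) (≡⇒≤ (Σ<-split L (L' ∸ L) f))))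

  covered : Result
  covered = assemble (half x x≢0 a b L L≤p denseA (shorter B x b denseB) j L≤Q) (scale L)
   (half (⊝ x) (λ eq → x≢0 (trans (group 1 x g0 (:~ :~ g0)) (trans (cong ⊝_ eq) (group 0 (:~ gnil) gnil)))) _ _ L L≤p denseA⁻ (shorter B (⊝ x) (b ⊹ (L' ∸ 1) • x) denseB⁻) j L≤Q)

 ⊝≢𝟘 : ∀ {x} → x ≢ 𝟘 → ⊝ x ≢ 𝟘
 ⊝≢𝟘 {x} x≢0 eq = x≢0 (trans (group 1 x g0 (:~ :~ g0)) (trans (cong ⊝_ eq) (group 0 (:~ gnil) gnil)))

 line-wrap : ∀ S x c w k → w ≤ p → line S x (c ⊖ w • x) k ≡ line S x c (p ∸ w + k)
 line-wrap S x c w k w≤p = cong S (trans (cong (λ t → t ⊹ k • x) (trans (group 2 c (w • x) (g0 :- g1) (g0 :+ gnil :- g1)) (cong (λ t → c ⊹ t ⊖ w • x) (trans (sym (p•x≡𝟘 x)) (trans (cong (_• x) (sym (m∸n+n≡m w≤p))) (•-+ (p ∸ w) w x))))))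
  (trans (group 4 c ((p ∸ w) • x) (w • x) (k • x) (g0 :+ (g1 :+ g2) :- g2 :+ g3) (g0 :+ (g1 :+ g3))) (cong (c ⊹_) (sym (•-+ (p ∸ w) k x)))))

 line-from : ∀ S x c w k → line S x (c ⊖ w • x) (w + k) ≡ line S x c k
 line-from S x c w k = cong S (trans (cong (c ⊖ w • x ⊹_) (•-+ w k x)) (group 3 c (w • x) (k • x) (g0 :- g1 :+ (g1 :+ g2)) (g0 :+ g2)))

 #<-beyond : ∀ S x c m w → #< w (line S (⊝ x) (c ⊹ m • x ⊖ w • (⊝ x))) ≡ #< w λ k → line S x c (suc m + k)
 #<-beyond S x c m w = trans (cong (λ t → #< w (line S (⊝ x) t)) (trans (cong (c ⊹ m • x ⊖_) (•-⊝ w x)) (trans (group 3 c (m • x) (w • x) (g0 :+ g1 :- :~ g2) (g0 :+ (g1 :+ g2))) (cong (c ⊹_) (sym (•-+ m w x))))))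
  (trans (#<-reflect S x c (m + w) w (m≤n⇒m≤1+n (m≤n+m w m))) (cong (λ t → #< w λ k → line S x c (t + k)) (m+n∸n≡m (suc m) w)))

 -- Elements far from the arcs.

 module Far {A B : G → Bool} (x : G) (x≢0 : x ≢ 𝟘) (a b : G) (L L' g s μ : ℕ) (few-holes : #< L (absent A x a) * 2 ≤ g) (g≤L : g ≤ L)
  (1≤L : 1 ≤ L) (1≤L' : 1 ≤ L') (room : L + L' + 4 * g ≤ p) (μ-large : 2 * L ≤ μ * g) (1≤s : 1 ≤ s) where

  open Positions x x≢0

  N : ℕ
  N = L + L' ∸ 1

  N≡ : 1 + N ≡ L + L'
  N≡ = +∸ (≤-trans 1≤L (m≤m+n L L'))

  c : G
  c = a ⊹ b

  P Q V : G → Bool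
  P = window A a 0 L
  Q = window B b (L' + g) (p ∸ (L' + 2 * g))
  V y = between 0 N (pos (y ⊖ c))

  Q≤p : L' + g + (p ∸ (L' + 2 * g)) + g ≡ p
  Q≤p = (linEq 4 L' g (p ∸ (L' + 2 * g)) p (v0 :+ v1 :+ v2 :+ v1) v3 0 (eqn (v0 :+ k2 :* v1 :+ v2) v3 (+∸ {L' + 2 * g} {p} (lin 4 L' g p L 0 (v0 :+ k2 :* v1) v2 (hyp (v3 :+ v0 :+ k4 :* v1) v2 room []))) []) 0 (eqn⁻ (v0 :+ k2 :* v1 :+ v2) v3 (+∸ {L' + 2 * g} {p} (lin 4 L' g p L 0 (v0 :+ k2 :* v1) v2 (hyp (v3 :+ v0 :+ k4
   :* v1) v2 room []))) []))

  L≤p : L ≤ p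
  L≤p = (lin 4 L p L' g 0 v0 v1 (hyp (v0 :+ v2 :+ k4 :* v3) v1 room []))

  -- At least `g` consecutive indices of the arc of `A` are moved by `y` out of the arc of sums. `u`
  -- is the first index moved to `N`, or 0 by truncated subtraction when `y` itself lies beyond. At
  -- most half of these `g` indices are holes.
  row : ∀ y → T (Q y) → g ≤ 2 * # λ z → P z ∧ not (V (z ⊹ y))
  row y Qy = (lin 7 g (# (λ z → P z ∧ not (V (z ⊹ y)))) (#< g (λ t → line A x a (u + t))) (#< g (λ t → absent A x a (u + t))) (#< L (absent A x a)) (Σ< g (λ t → [ line A x a (u + t) ] * F (a ⊹ (u + t) • x))) (Σ< L (λ k → [ line A x a k ] * F (a ⊹ k • x))) 0 v0 (k2 :* v1) (eqn⁻* 2 (v2 :+ v3) v0 (#<-not g (λ t → line A x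
   a (u + t))) (hyp* 2 v3 v4 (Σ<-sub u g L ([_] ∘ absent A x a) u+g≤L) (hyp (v4 :* k2) v0 few-holes (hyp* 2 v2 v5 (Σ<-mono g entry) (hyp* 2 v5 v6 (Σ<-sub u g L (λ k → [ line A x a k ] * F (a ⊹ k • x)) u+g≤L) (eqn* 2 v6 v1 (trans (sym (Σ-window A a 0 L F L≤p)) (Σ-cong λ z → sym (⟨⟩-∧ (P z) (not (V (z ⊹ y)))))) [])))))))
   where
   F : G → ℕ
   F z = [ not (V (z ⊹ y)) ]
   i u : ℕ
   i = pos (y ⊖ b)
   u = N ∸ i
   i-lo : L' + g ≤ i
   i-lo = proj₁ (window-elim B b (L' + g) _ y Qy)
   i-hi : i + g < p
   i-hi = (lin 5 i g p L' (p ∸ (L' + 2 * g)) 0 (1+ (v0 :+ v1)) v2 (hyp (1+ v0) (v3 :+ v1 :+ v4) (proj₂ (window-elim B b (L' + g) _ y Qy)) (eqn (v3 :+ v1 :+ v4 :+ v1) v2 Q≤p [])))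
   at-sum : ∀ k → k + i < p → pos (a ⊹ k • x ⊹ y ⊖ c) ≡ k + i
   at-sum k lt = trans (cong (λ t → pos (t ⊖ c)) (trans (cong (a ⊹ k • x ⊹_) (sym (at-pos b y))) (line-sum x a b k i))) (pos-from c (k + i) lt)
   bounds : u + g ≤ L × N ≤ u + i × u + i + g ≤ p
   bounds = from (≤-total i N)
    where
    from : i ≤ N ⊎ N ≤ i → u + g ≤ L × N ≤ u + i × u + i + g ≤ p
    from (inj₁ i≤N) = (lin 6 u g L i N L' 0 (v0 :+ v1) v2 (eqn (v3 :+ v0) v4 (+∸ i≤N) (eqn (1+ v4) (v2 :+ v5) N≡ (hyp (v5 :+ v1) v3 i-lo [])))) , ≡⇒≤ (sym (trans (+-comm u i) (+∸ i≤N))) ,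
     (lin 7 u i g p N L L' 0 (v0 :+ v1 :+ v2) v3 (eqn (v1 :+ v0) v4 (+∸ i≤N) (eqn (1+ v4) (v5 :+ v6) N≡ (hyp (v5 :+ v6 :+ k4 :* v2) v3 room []))))
    from (inj₂ N≤i) = subst (λ t → t + g ≤ L × N ≤ t + i × t + i + g ≤ p) (sym (m≤n⇒m∸n≡0 N≤i)) (g≤L , N≤i , <⇒≤ i-hi)
   u+g≤L : u + g ≤ L
   u+g≤L = proj₁ bounds
   entry : ∀ t → t < g → [ line A x a (u + t) ] ≤ [ line A x a (u + t) ] * F (a ⊹ (u + t) • x)
   entry t t<g = ≡⇒≤ (sym (trans (cong ([ line A x a (u + t) ] *_) (T⇒⟨⟩ (T-not λ v → <⇒≱ (subst (_< N) (at-sum (u + t) lt) (proj₂ (between-elim 0 N _ v))) beyond))) (*1 _)))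
    where
    lt : u + t + i < p
    lt = (lin 5 u t i p g 0 (1+ (v0 :+ v1 :+ v2)) v3 (hyp (v0 :+ v2 :+ v4) v3 (proj₂ (proj₂ bounds)) (hyp (1+ v1) v4 t<g [])))
    beyond : N ≤ u + t + i
    beyond = (lin 4 N u t i 0 v0 (v1 :+ v2 :+ v3) (hyp v0 (v1 :+ v3) (proj₁ (proj₂ bounds)) []))

  dense : # P * # Q ≤ μ * bad P Q V
  dense = (lin 6 (# P) (# Q) μ (bad P Q V) L g 1 (v0 :* v1) (v2 :* v3) (mul* 2 v1 v0 v4 (≤-trans (≡⇒≤ (#-window A a 0 L L≤p)) (#<≤ L (line A x a))) (mul v1 (k2 :* v4) (v2 :* v5) μ-large (mul v2 (v1 :* v5) (k2 :* v3) rows []))))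
   where
   R : G → ℕ
   R y = # λ z → P z ∧ not (V (z ⊹ y))
   rows : # Q * g ≤ 2 * bad P Q V
   rows = begin
    # Q * g ≡⟨ Σ-*ʳ g ([_] ∘ Q) ⟨
    Σ (λ y → [ Q y ] * g) ≤⟨ Σ-mono (λ y → by y (Q y) refl) ⟩
    Σ (λ y → 2 * ([ Q y ] * R y)) ≡⟨ trans (Σ-* 2 (λ y → [ Q y ] * R y)) (cong (2 *_) (sym (bad-swap P Q V))) ⟩
    2 * bad P Q V ∎
    where
    open ≤-Reasoning
    by : ∀ y q → Q y ≡ q → [ q ] * g ≤ 2 * ([ q ] * R y)
    by y false _ = z≤n
    by y true eq = (lin 2 g (R y) 0 (k1 :* v0) (k2 :* (k1 :* v1)) (hyp v0 (k2 :* v1) (row y (T! eq)) []))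

  -- At least the proportion `1 / μ` of the pairs leaves the arc of sums, so greedy choice obtains
  -- `need` outside sums from `O(μ s)` elements.
  gain : ∀ need → need ≤ # Q * 3000 → need ≤ s * s * 3000 → need * μ * 4 ≤ L → 1 ≤ μ →
   ∃ λ (R : Small A B (μ * s * 6000)) → need ≤ #< (p ∸ N) λ k → line (sums R) x c (N + k)
  gain need need≤Q need≤s need≤L 1≤μ = finish (greedy μ (# Q ⊓ s) (μ * s * 6000) P Q V (m⊓n≤m (# Q) s) dense)
   where
   #P : L ≤ 2 * # P
   #P = (lin 5 L (# P) (#< L (line A x a)) (#< L (absent A x a)) g 0 v0 (k2 :* v1) (eqn⁻* 2 v1 v2 (#-window A a 0 L L≤p) (eqn⁻* 2 (v2 :+ v3) v0 (#<-not L (line A x a)) (hyp (v3 :* k2) v4 few-holes (hyp v4 v0 g≤L [])))))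
   block : need * μ * 2 ≤ μ * s * 6000 * (# Q ⊓ s)
   block = by (⊓-sel (# Q) s)
    where
    by : # Q ⊓ s ≡ # Q ⊎ # Q ⊓ s ≡ s → need * μ * 2 ≤ μ * s * 6000 * (# Q ⊓ s)
    by (inj₁ eq) = subst (λ t → need * μ * 2 ≤ μ * s * 6000 * t) (sym eq) (lin 4 need μ s (# Q) 0 (v0 :* v1 :* k2) (v1 :* v2 :* & 6000 :* v3) (mul* 2 v1 v0 (v3 :* & 3000) need≤Q (mul* 6000 (v3 :* v1) k1 v2 1≤s [])))
    by (inj₂ eq) = subst (λ t → need * μ * 2 ≤ μ * s * 6000 * t) (sym eq) (lin 3 need μ s 0 (v0 :* v1 :* k2) (v1 :* v2 :* & 6000 :* v2) (mul* 2 v1 v0 (v2 :* v2 :* & 3000) need≤s []))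
   finish : (∃ λ P' → ∃ λ Q' → P' ⊑ P × Q' ⊑ Q × # P' ≤ μ * s * 6000 × # Q' ≤ # Q ⊓ s × # P ⊓ (μ * s * 6000 * (# Q ⊓ s)) ≤ 2 * μ * # (fresh P' Q' V)) →
    ∃ λ (R : Small A B (μ * s * 6000)) → need ≤ #< (p ∸ N) λ k → line (sums R) x c (N + k)
   finish (P' , Q' , P'⊑ , Q'⊑ , #P' , #Q' , le) = small-subsets P' Q' (λ y t → T-∧ˡ (P'⊑ y t)) (λ y t → T-∧ˡ (Q'⊑ y t)) #P'
     (lin 3 (# Q') μ s 0 v0 (v1 :* v2 :* & 6000) (hyp v0 v2 (≤-trans #Q' (m⊓n≤n (# Q) s)) (mul v2 k1 v1 1≤μ []))) ,
    (begin
     need ≤⟨ *-cancelʳ-≤ need _ (μ * 2) {{ℕ.>-nonZero (*-mono-≤ 1≤μ (s≤s (z≤n {1})))}} enough ⟩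
     # (fresh P' Q' V) ≤⟨ Σ-mono (λ y → bool² (λ u v → [ u ∧ not v ]) (λ u v → [ not v ] * [ u ]) ((P' ⊞ Q') y) (V y)) ⟩
     Σ (λ y → [ not (V y) ] * [ (P' ⊞ Q') y ]) ≡⟨ Σ-orbit x x≢0 c _ ⟨
     Σ< p (λ k → [ not (V (c ⊹ k • x)) ] * [ line (P' ⊞ Q') x c k ]) ≤⟨ Σ<-mono p (λ k k<p → *-monoˡ-≤ [ line (P' ⊞ Q') x c k ] (late k k<p)) ⟩
     Σ< p (λ k → [ between N (p ∸ N) k ] * [ line (P' ⊞ Q') x c k ]) ≡⟨ Σ<-between N (p ∸ N) p _ (≡⇒≤ (+∸ N≤p)) ⟩
     #< (p ∸ N) (λ k → line (P' ⊞ Q') x c (N + k)) ∎)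
    where
    open ≤-Reasoning
    N≤p : N ≤ p
    N≤p = (lin 5 N p L L' g 0 v0 v1 (eqn (1+ v0) (v2 :+ v3) N≡ (hyp (v2 :+ v3 :+ k4 :* v4) v1 room [])))
    enough : need * (μ * 2) ≤ # (fresh P' Q' V) * (μ * 2)
    enough = (lin 3 need μ (# (fresh P' Q' V)) 0 (v0 :* (v1 :* k2)) (v2 :* (v1 :* k2)) (hyp (v0 :* v1 :* k2) (k2 :* v1 :* v2) (≤-trans (⊓-glb (lin 4 need μ (# P) L 1 (v0 :* v1 :* k2) v2 (hyp (v0 :* v1 :* k4) v3 need≤L (hyp v3 (k2 :* v2) #P []))) block) le) []))
    late : ∀ k → k < p → [ not (V (c ⊹ k • x)) ] ≤ [ between N (p ∸ N) k ]
    late k k<p = ⟨⟩-mono λ t → T-pair (≤⇒≤ᵇ (≮⇒≥ λ k<N → T-not⁻ t (subst (T ∘ between 0 N) (sym (pos-from c k k<p)) (between-inside 0 N k k<N)))) (≤⇒≤ᵇ (subst (k <_) (sym (+∸ N≤p)) k<p))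

 -- Balance of holes against outside elements.

 Σ<-around : ∀ L g (f : ℕ → ℕ) → L + 2 * g ≤ p →
  Σ< p f ≡ Σ< L f + Σ< g (λ k → f (L + k)) + Σ< (p ∸ (L + 2 * g)) (λ k → f (L + g + k)) + Σ< g (λ k → f (p ∸ g + k))
 Σ<-around L g f le = begin
  Σ< p f ≡⟨ cong (λ t → Σ< t f) (sym (m∸n+n≡m g≤p)) ⟩
  Σ< (p ∸ g + g) f ≡⟨ Σ<-split (p ∸ g) g f ⟩
  Σ< (p ∸ g) f + Σ< g (λ k → f (p ∸ g + k)) ≡⟨ cong (λ t → Σ< t f + Σ< g (λ k → f (p ∸ g + k))) parts ⟩
  Σ< (L + g + (p ∸ (L + 2 * g))) f + Σ< g (λ k → f (p ∸ g + k)) ≡⟨ cong (_+ Σ< g (λ k → f (p ∸ g + k))) (trans (Σ<-split (L + g) _ f) (cong (_+ Σ< (p ∸ (L + 2 * g)) (λ k → f (L + g + k))) (Σ<-split L g f))) ⟩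
  Σ< L f + Σ< g (λ k → f (L + k)) + Σ< (p ∸ (L + 2 * g)) (λ k → f (L + g + k)) + Σ< g (λ k → f (p ∸ g + k)) ∎
  where
  open ≡-Reasoning
  g≤p : g ≤ p
  g≤p = (lin 3 g p L 1 v0 v1 (hyp (v2 :+ k2 :* v0) v1 le []))
  parts : p ∸ g ≡ L + g + (p ∸ (L + 2 * g))
  parts = (linEq 5 (p ∸ g) L g (p ∸ (L + 2 * g)) p v0 (v1 :+ v2 :+ v3) 0 (eqn (v0 :+ v2) v4 (m∸n+n≡m g≤p) (eqn⁻ (v1 :+ k2 :* v2 :+ v3) v4 (+∸ le) [])) 0 (eqn⁻ (v0 :+ v2) v4 (m∸n+n≡m g≤p) (eqn (v1 :+ k2 :* v2 :+ v3) v4 (+∸ le) [])))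

 module Combine {A B : G → Bool} (x : G) (x≢0 : x ≢ 𝟘) (s M μ : ℕ) (1≤s : 1 ≤ s) (M-large : 100000000000 ≤ M) (a b : G) (L L' g ε n : ℕ)
  (1≤L : 1 ≤ L) (L≤L' : L ≤ L') (coreA : HalfCore A x a L) (coreB : HalfCore B x b L') (coreA⁻ : HalfCore A (⊝ x) (a ⊹ (L ∸ 1) • x) L) (coreB⁻ : HalfCore B (⊝ x) (b ⊹ (L' ∸ 1) • x) L')
  (#A : # A ≡ n) (#B : # B ≡ n) (insideA : n ≤ #< L (line A x a) + ε) (insideB : n ≤ #< L' (line B x b) + ε) (L≤ : L ≤ n + ε) (L'≤ : L' ≤ n + ε)
  (room : L + L' + 4 * g ≤ p) (ε-small : ε * 100000 ≤ g) (g≤L : g ≤ L) (μ-large : 2 * L' ≤ μ * g) (ε-tiny : ε * μ * 100 ≤ L) (1≤μ : 1 ≤ μ)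
  (ε≤s : ε ≤ s * s) (close : 4 * L' ≤ 5 * L) (L-large : 1000 ≤ L) (j : ℕ) (L≤Q : L ≤ 2 ℕ.^ j * 2 ℕ.^ j) where

  y : G
  y = ⊝ x

  y≢0 : y ≢ 𝟘
  y≢0 = ⊝≢𝟘 x≢0

  c a⁻ b⁻ : G
  c = a ⊹ b
  a⁻ = a ⊹ (L ∸ 1) • x
  b⁻ = b ⊹ (L' ∸ 1) • x

  1≤L' : 1 ≤ L'
  1≤L' = ≤-trans 1≤L L≤L'

  N : ℕ
  N = L + L' ∸ 1

  N≡ : 1 + N ≡ L + L'
  N≡ = +∸ (≤-trans 1≤L (m≤m+n L L'))

  K : ℕ
  K = 2 ℕ.^ j * 20 + (M * s * 2400000 + μ * s * 6000)

  Result : Set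
  Result = ∃ λ (R : Small A B K) → 2 * n ≤ # (sums R) + 1

  end-of : ∀ {S} z → ∀ e len → len + g ≤ p → HalfCore S z e len → (∀ k → k ≤ g → k ≤ len) → ∀ (z≢0 : z ≢ 𝟘) → Ends.End z z≢0 s M 1≤s M-large S (e ⊖ g • z) g
  end-of {S} z e len fits core short z≢0 = record
   { dense = λ k k≤g → subst (λ t → k * 399 ≤ t * 400) (Σ<-cong k λ i _ → cong [_] (sym (line-from S z e g i))) (HalfCore.dense core k (short k k≤g))
   ; sparse = λ w w≤g → subst (λ t → t * 400 ≤ w * 399) (Σ<-cong w λ i _ → cong [_] (begin
     line S z (e ⊖ w • z) i ≡⟨ line-from S z (e ⊖ w • z) (g ∸ w) i ⟨
     line S z (e ⊖ w • z ⊖ (g ∸ w) • z) (g ∸ w + i) ≡⟨ cong (λ t → line S z t (g ∸ w + i)) (trans (group 3 e (w • z) ((g ∸ w) • z) (g0 :- g1 :- g2) (g0 :- (g1 :+ g2))) (cong (e ⊖_) (trans (sym (•-+ w (g ∸ w) z)) (cong (_• z) (+∸ w≤g))))) ⟩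
     line S z (e ⊖ g • z) (g ∸ w + i) ∎)) (HalfCore.sparse core w (≤-trans (+-monoˡ-≤ len w≤g) (subst (_≤ p) (+-comm len g) fits)))
   }
   where open ≡-Reasoning

  lA rA fA hA lB rB fB hB : ℕ
  lA = #< g (line A x (a ⊖ g • x))
  rA = #< g (line A y (a⁻ ⊖ g • y))
  fA = #< (p ∸ (L + 2 * g)) λ k → line A x a (L + g + k)
  hA = #< L (absent A x a)
  lB = #< g (line B x (b ⊖ g • x))
  rB = #< g (line B y (b⁻ ⊖ g • y))
  fB = #< (p ∸ (L' + 2 * g)) λ k → line B x b (L' + g + k)
  hB = #< L' (absent B x b)

  -- The circle consists of the arc, a zone of length `g` on either side and the far rest. This
  -- expresses `2 n` through lengths, holes and outside elements, the terms in which sums are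
  -- counted.
  census : ∀ S e len → 1 ≤ len → len + 2 * g ≤ p → # S + #< len (absent S x e) ≡ len + #< g (line S x (e ⊖ g • x)) + #< g (line S y (e ⊹ (len ∸ 1) • x ⊖ g • y)) + #< (p ∸ (len + 2 * g)) (λ k → line S x e (len + g + k))
  census S e len 1≤len le = (linEq 9 (# S) (#< len (absent S x e)) len (#< g (line S x (e ⊖ g • x))) (#< g (line S y (e ⊹ (len ∸ 1) • x ⊖ g • y))) (#< (p ∸ (len + 2 * g)) (λ k → line S x e (len + g + k))) (#< len (line S x e)) (#< g (λ k → line S x e (len + k))) (#< g (λ k → line S x e (p ∸ g + k))) (v0 :+ v1) (v2 :+
   v3 :+ v4 :+ v5) 0 (eqn v0 (v6 :+ v7 :+ v5 :+ v8) (trans (sym (Positions.#-line x x≢0 S e)) (Σ<-around len g ([_] ∘ line S x e) le)) (eqn (v6 :+ v1) v2 (#<-not len (line S x e)) (eqn⁻ v3 v8 (Σ<-cong g (λ k _ → cong [_] (line-wrap S x e g k (≤-trans (m≤m+n g _) (≤-trans (m≤n+m (g + 1 * g) len) le))))) (eqn⁻ v4 v7 (trans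
   (#<-beyond S x e (len ∸ 1) g) (cong (λ t → #< g λ k → line S x e (t + k)) (+∸ 1≤len))) [])))) 0 (eqn⁻ v0 (v6 :+ v7 :+ v5 :+ v8) (trans (sym (Positions.#-line x x≢0 S e)) (Σ<-around len g ([_] ∘ line S x e) le)) (eqn⁻ (v6 :+ v1) v2 (#<-not len (line S x e)) (eqn v3 v8 (Σ<-cong g (λ k _ → cong [_] (line-wrap S x e g k
   (≤-trans (m≤m+n g _) (≤-trans (m≤n+m (g + 1 * g) len) le))))) (eqn v4 v7 (trans (#<-beyond S x e (len ∸ 1) g) (cong (λ t → #< g λ k → line S x e (t + k)) (+∸ 1≤len))) [])))))

  fitA : L + 2 * g ≤ p
  fitA = (lin 4 L g p L' 0 (v0 :+ k2 :* v1) v2 (hyp (v0 :+ v3 :+ k4 :* v1) v2 room []))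
  fitB : L' + 2 * g ≤ p
  fitB = (lin 4 L' g p L 0 (v0 :+ k2 :* v1) v2 (hyp (v3 :+ v0 :+ k4 :* v1) v2 room []))

  censusA : n + hA ≡ L + lA + rA + fA
  censusA = subst (λ t → t + hA ≡ L + lA + rA + fA) #A (census A a L 1≤L fitA)
  censusB : n + hB ≡ L' + lB + rB + fB
  censusB = subst (λ t → t + hB ≡ L' + lB + rB + fB) #B (census B b L' 1≤L' fitB)

  outsideA : lA + rA + fA ≤ ε × hA ≤ 2 * ε
  outsideA = (lin 8 lA rA fA ε n hA L (#< L (line A x a)) 0 (v0 :+ v1 :+ v2) v3 (eqn⁻ (v4 :+ v5) (v6 :+ v0 :+ v1 :+ v2) censusA (hyp v4 (v7 :+ v3) insideA (eqn (v7 :+ v5) v6 (#<-not L (line A x a)) [])))) ,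
   (lin 5 hA ε L n (#< L (line A x a)) 0 v0 (k2 :* v1) (hyp v2 (v3 :+ v1) L≤ (hyp v3 (v4 :+ v1) insideA (eqn (v4 :+ v0) v2 (#<-not L (line A x a)) []))))
  outsideB : lB + rB + fB ≤ ε × hB ≤ 2 * ε
  outsideB = (lin 8 lB rB fB ε n hB L' (#< L' (line B x b)) 0 (v0 :+ v1 :+ v2) v3 (eqn⁻ (v4 :+ v5) (v6 :+ v0 :+ v1 :+ v2) censusB (hyp v4 (v7 :+ v3) insideB (eqn (v7 :+ v5) v6 (#<-not L' (line B x b)) [])))) ,
   (lin 5 hB ε L' n (#< L' (line B x b)) 0 v0 (k2 :* v1) (hyp v2 (v3 :+ v1) L'≤ (hyp v3 (v4 :+ v1) insideB (eqn (v4 :+ v0) v2 (#<-not L' (line B x b)) []))))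

  captured-mono : ∀ {V W : G → Bool} z e lo len → V ⊑ W → #< len (λ k → line V z e (lo + k)) ≤ #< len (λ k → line W z e (lo + k))
  captured-mono z e lo len V⊑W = Σ<-mono len λ k _ → ⟨⟩-mono (V⊑W (e ⊹ (lo + k) • z))

  N≤p : N ≤ p
  N≤p = (lin 5 N p L L' g 0 v0 v1 (eqn (1+ v0) (v2 :+ v3) N≡ (hyp (v2 :+ v3 :+ k4 :* v4) v1 room [])))

  core-count : ∀ {K₀} (R : Small A B K₀) → #< N (absent (sums R) x c) * 100 ≤ (hA + hB) * 34 → ∀ V → sums R ⊑ V → N * 100 ≤ #< N (line V x c) * 100 + (hA + hB) * 34
  core-count R le V R⊑V = (lin 6 N (#< N (line V x c)) hA hB (#< N (absent (sums R) x c)) (#< N (line (sums R) x c)) 0 (v0 :* & 100) (v1 :* & 100 :+ (v2 :+ v3) :* & 34) (hyp (v4 :* & 100) ((v2 :+ v3) :* & 34) le (eqn⁻* 100 (v5 :+ v4) v0 (#<-not N (line (sums R) x c)) (hyp* 100 v5 v1 (captured-mono x c 0 N R⊑V) []))))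

  Middles : Set
  Middles = ∃ λ (R : Small A B (2 ℕ.^ j * 20)) → #< N (absent (sums R) x c) * 100 ≤ (hA + hB) * 34

  -- The far elements number at most 1/1000 of those at the ends, and the surplus of `end-captured`
  -- covers them. The arc of sums and the two end zones are disjoint, so the counts add up.
  by-ends : (lA + rA + (lB + rB)) ≥ (fA + fB) * 1000 → Middles →
   (∃ λ (R : Small A B (M * s * 1200000)) → (lA + lB) * 1001 ≤ #< (2 * g) (line (sums R) x (a ⊖ g • x ⊹ (b ⊖ g • x))) * 1000) →
   (∃ λ (R : Small A B (M * s * 1200000)) → (rA + rB) * 1001 ≤ #< (2 * g) (line (sums R) y (a⁻ ⊖ g • y ⊹ (b⁻ ⊖ g • y))) * 1000) → Result
  by-ends near (R₀ , le₀) (R₁ , le₁) (R₂ , le₂) = enlarge R (lin 4 (2 ℕ.^ j) M s μ 0 (v0 :* & 20 :+ v1 :* v2 :* & 1200000 :+ v1 :* v2 :* & 1200000) (v0 :* & 20 :+ (v1 :* v2 :* & 2400000 :+ v3 :* v2 :* & 6000)) []) ,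
   (lin 21 n (# V) (#< N (line V x c)) (#< (2 * g) (λ k → line V x c (N + k))) (#< (p ∸ (N + 2 * (2 * g))) (λ k → line V x c (N + 2 * g + k))) (#< (2 * g) (λ k → line V x c (p ∸ 2 * g + k))) N hA hB L L' lA rA fA lB rB fB (#< (2 * g) (line (sums R₁) x (a ⊖ g • x ⊹ (b ⊖ g • x)))) (#< (2 * g) (line V x (a ⊖ g • x ⊹ (b ⊖
    g • x)))) (#< (2 * g) (line (sums R₂) y (a⁻ ⊖ g • y ⊹ (b⁻ ⊖ g • y)))) (#< (2 * g) (line V y (a⁻ ⊖ g • y ⊹ (b⁻ ⊖ g • y)))) 999 (k2 :* v0) (v1 :+ k1) (eqn⁻* 1000 v1 (v2 :+ v3 :+ v4 :+ v5) (trans (sym (Positions.#-line x x≢0 V c)) (Σ<-around N (2 * g) ([_] ∘ line V x c) fit)) (hyp* 10 (v6 :* & 100) (v2 :* & 100 :+ (v7 :+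
    v8) :* & 34) (core-count R₀ le₀ V (λ z t → unite-ˡ (unite R₀ R₁) R₂ z (unite-ˡ R₀ R₁ z t))) (eqn⁻* 1000 (1+ v6) (v9 :+ v10) N≡ (eqn* 1000 (v0 :+ v7) (v9 :+ v11 :+ v12 :+ v13) censusA (eqn* 1000 (v0 :+ v8) (v10 :+ v14 :+ v15 :+ v16) censusB (hyp ((v11 :+ v14) :* & 1001) (v17 :* & 1000) le₁ (hyp* 1000 v17 v18
    (captured-mono x _ 0 (2 * g) (λ z t → unite-ˡ (unite R₀ R₁) R₂ z (unite-ʳ R₀ R₁ z t))) (eqn* 1000 v18 v5 left-zone (hyp ((v12 :+ v15) :* & 1001) (v19 :* & 1000) le₂ (hyp* 1000 v19 v20 (captured-mono y _ 0 (2 * g) (unite-ʳ (unite R₀ R₁) R₂)) (eqn* 1000 v20 v3 right-zone (hyp ((v13 :+ v16) :* & 1000) (v11 :+ v12 :+ (v14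
    :+ v15)) near [])))))))))))))
   where
   R : Small A B (2 ℕ.^ j * 20 + M * s * 1200000 + M * s * 1200000)
   R = unite (unite R₀ R₁) R₂
   V : G → Bool
   V = sums R
   fit : N + 2 * (2 * g) ≤ p
   fit = (lin 5 N g p L L' 0 (v0 :+ k2 :* (k2 :* v1)) v2 (eqn (1+ v0) (v3 :+ v4) N≡ (hyp (v3 :+ v4 :+ k4 :* v1) v2 room [])))
   twice : ∀ z u v → u ⊖ g • z ⊹ (v ⊖ g • z) ≡ u ⊹ v ⊖ (2 * g) • z
   twice z u v = trans (group 3 u (g • z) v (g0 :- g1 :+ (g2 :- g1)) (g0 :+ g2 :- (g1 :+ g1))) (cong (u ⊹ v ⊖_) (trans (sym (•-+ g g z)) (cong (λ t → (g + t) • z) (sym (+0 g)))))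
   left-zone : #< (2 * g) (line V x (a ⊖ g • x ⊹ (b ⊖ g • x))) ≡ #< (2 * g) (λ k → line V x c (p ∸ 2 * g + k))
   left-zone = trans (cong (λ t → #< (2 * g) (line V x t)) (twice x a b)) (Σ<-cong (2 * g) λ k _ → cong [_] (line-wrap V x c (2 * g) k (≤-trans (m≤n+m (2 * g) L) fitA)))
   right-zone : #< (2 * g) (line V y (a⁻ ⊖ g • y ⊹ (b⁻ ⊖ g • y))) ≡ #< (2 * g) (λ k → line V x c (N + k))
   right-zone = trans (cong (λ t → #< (2 * g) (line V y t)) (trans (twice y a⁻ b⁻) (cong (_⊖ (2 * g) • y) (line-sum x a b (L ∸ 1) (L' ∸ 1)))))
    (trans (#<-beyond V x c (L ∸ 1 + (L' ∸ 1)) (2 * g)) (cong (λ t → #< (2 * g) λ k → line V x c (t + k)) (linEq 5 (L ∸ 1) (L' ∸ 1) N L L' (1+ (v0 :+ v1)) v2 0 (eqn⁻ (1+ v2) (v3 :+ v4) N≡ (eqn (1+ v0) v3 (+∸ 1≤L) (eqn (1+ v1) v4 (+∸ 1≤L') []))) 0 (eqn (1+ v2) (v3 :+ v4) N≡ (eqn⁻ (1+ v0) v3 (+∸ 1≤L) (eqn⁻ (1+ v1) v4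
     (+∸ 1≤L') []))))))

  -- Far elements are now a fixed proportion of the outside ones, so `Far` can be asked for one new
  -- sum per outside element: `need` is at most 2002 times the larger far part, within the factor
  -- 3000 of `gain`.
  by-far : (lA + rA + (lB + rB)) < (fA + fB) * 1000 → Middles → Result
  by-far far (R₀ , le₀) = by (≤-total fB fA)
   where
   need : ℕ
   need = lA + rA + fA + (lB + rB + fB)
   need≤ : need ≤ 2 * ε
   need≤ = (lin 7 lA rA fA lB rB fB ε 0 (v0 :+ v1 :+ v2 :+ (v3 :+ v4 :+ v5)) (k2 :* v6) (hyp (v0 :+ v1 :+ v2) v6 (proj₁ outsideA) (hyp (v3 :+ v4 :+ v5) v6 (proj₁ outsideB) [])))
   need-s : need ≤ s * s * 3000
   need-s = (lin 3 need s ε 0 v0 (v1 :* v1 :* & 3000) (hyp v0 (k2 :* v2) need≤ (hyp* 2 v2 (v1 :* v1) ε≤s [])))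
   need-L : need * μ * 4 ≤ L
   need-L = (lin 4 need μ L ε 24 (v0 :* v1 :* k4) v2 (mul* 100 v1 v0 (k2 :* v3) need≤ (hyp* 2 (v3 :* v1 :* & 100) v2 ε-tiny [])))
   μL : 2 * L ≤ μ * g
   μL = ≤-trans (*-monoʳ-≤ 2 L≤L') μ-large
   extend : (∃ λ (R : Small A B (μ * s * 6000)) → need ≤ #< (p ∸ N) λ k → line (sums R) x c (N + k)) → Result
   extend (R₁ , le₁) = enlarge R (lin 4 (2 ℕ.^ j) μ s M 0 (v0 :* & 20 :+ v1 :* v2 :* & 6000) (v0 :* & 20 :+ (v3 :* v2 :* & 2400000 :+ v1 :* v2 :* & 6000)) []) ,
    (lin 16 n (# V) (#< N (line V x c)) (#< (p ∸ N) (λ k → line V x c (N + k))) N hA hB L L' lA rA fA lB rB fB (#< (p ∸ N) (λ k → line (sums R₁) x c (N + k))) 99 (k2 :* v0) (v1 :+ k1) (eqn⁻* 100 v1 (v2 :+ v3) (trans (sym (Positions.#-line x x≢0 V c)) (trans (cong (λ t → #< t (line V x c)) (sym (+∸ N≤p))) (Σ<-split N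
     (p ∸ N) λ k → [ line V x c k ]))) (hyp (v4 :* & 100) (v2 :* & 100 :+ (v5 :+ v6) :* & 34) (core-count R₀ le₀ V (unite-ˡ R₀ R₁)) (eqn⁻* 100 (1+ v4) (v7 :+ v8) N≡ (eqn* 100 (v0 :+ v5) (v7 :+ v9 :+ v10 :+ v11) censusA (eqn* 100 (v0 :+ v6) (v8 :+ v12 :+ v13 :+ v14) censusB (hyp* 100 (v9 :+ v10 :+ v11 :+ (v12 :+ v13 :+ v14))
     v15 le₁ (hyp* 100 v15 v3 (captured-mono x c N (p ∸ N) (unite-ʳ R₀ R₁)) []))))))))
    where
    R : Small A B (2 ℕ.^ j * 20 + μ * s * 6000)
    R = unite R₀ R₁
    V : G → Bool
    V = sums R
   by : fB ≤ fA ⊎ fA ≤ fB → Result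
   by (inj₂ le) = extend (gain need (lin 8 need (# Q) lA rA lB rB fA fB 0 v0 (v1 :* & 3000) (hyp (1+ (v2 :+ v3 :+ (v4 :+ v5))) ((v6 :+ v7) :* & 1000) far (hyp* 1001 v6 v7 le (eqn⁻* 2002 v1 v7 #-far (eqn v0 (v2 :+ v3 :+ v6 :+ (v4 :+ v5 :+ v7)) refl []))))) need-s need-L 1≤μ)
    where
    open Far {A} {B} x x≢0 a b L L' g s μ (lin 3 hA g ε 24999 (v0 :* k2) v1 (hyp* 50000 v0 (k2 :* v2) (proj₂ outsideA) (hyp (v2 :* & 100000) v1 ε-small []))) g≤L 1≤L 1≤L' room μL 1≤s using (gain; Q; Q≤p)
    #-far : # Q ≡ fB
    #-far = Positions.#-window x x≢0 B b (L' + g) _ (≤-trans (m≤m+n _ g) (≡⇒≤ Q≤p))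
   by (inj₁ le) = swapped (gain need (lin 8 need (# Q) lA rA lB rB fA fB 0 v0 (v1 :* & 3000) (hyp (1+ (v2 :+ v3 :+ (v4 :+ v5))) ((v6 :+ v7) :* & 1000) far (hyp* 1001 v7 v6 le (eqn⁻* 2002 v1 v6 #-far (eqn v0 (v2 :+ v3 :+ v6 :+ (v4 :+ v5 :+ v7)) refl []))))) need-s (≤-trans need-L L≤L') 1≤μ)
    where
    open Far {B} {A} x x≢0 b a L' L g s μ (lin 3 hB g ε 24999 (v0 :* k2) v1 (hyp* 50000 v0 (k2 :* v2) (proj₂ outsideB) (hyp (v2 :* & 100000) v1 ε-small []))) (≤-trans g≤L L≤L') 1≤L' 1≤L (subst (λ t → t + 4 * g ≤ p) (+-comm L L') room) μ-large 1≤s using (gain; Q; Q≤p)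
    #-far : # Q ≡ fA
    #-far = Positions.#-window x x≢0 A a (L + g) _ (≤-trans (m≤m+n _ g) (≡⇒≤ Q≤p))
    swapped : (∃ λ (R : Small B A (μ * s * 6000)) → need ≤ #< (p ∸ (L' + L ∸ 1)) λ k → line (sums R) x (b ⊹ a) (L' + L ∸ 1 + k)) → Result
    swapped (R , le) = extend (swap-subsets R , ≤-trans (subst₂ (λ m d → need ≤ #< (p ∸ m) λ k → line (sums R) x d (m + k)) (cong (_∸ 1) (+-comm L' L)) (⊹-comm b a) le)
     (captured-mono x c N (p ∸ N) (⊞-comm (Small.A' R) (Small.B' R))))

  4g≤p : 4 * g ≤ p
  4g≤p = (lin 4 g p L L' 0 (k4 :* v0) v1 (hyp (v2 :+ v3 :+ k4 :* v0) v1 room []))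

  covered : Result
  covered = by (≤-<-connex ((fA + fB) * 1000) (lA + rA + (lB + rB)))
   where
   middles : Middles
   middles = Middle.covered x x≢0 a b L L' L≤L' (≤-trans (m≤m+n L' _) fitB) close L-large (HalfCore.dense coreA) (HalfCore.dense coreB) (HalfCore.dense coreA⁻) (HalfCore.dense coreB⁻) j L≤Q
   shortA : ∀ k → k ≤ g → k ≤ L
   shortA k k≤g = ≤-trans k≤g g≤L
   shortB : ∀ k → k ≤ g → k ≤ L'
   shortB k k≤g = ≤-trans (shortA k k≤g) L≤L'
   fits : ∀ {len} → len + 2 * g ≤ p → len + g ≤ p
   fits {len} = ≤-trans (+-monoʳ-≤ len (m≤m+n g _))
   by : (fA + fB) * 1000 ≤ lA + rA + (lB + rB) ⊎ lA + rA + (lB + rB) < (fA + fB) * 1000 → Result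
   by (inj₂ far) = by-far far middles
   by (inj₁ near) = by-ends near middles
    (Ends.end-captured x x≢0 s M 1≤s M-large (end-of x a L (fits fitA) coreA shortA x≢0) (end-of x b L' (fits fitB) coreB shortB x≢0) 4g≤p (lA + lB) refl
     (lin 8 lA lB s rA fA ε rB fB 0 (v0 :+ v1) (k4 :* (v2 :* v2)) (hyp (v0 :+ v3 :+ v4) v5 (proj₁ outsideA) (hyp (v1 :+ v6 :+ v7) v5 (proj₁ outsideB) (hyp* 2 v5 (v2 :* v2) ε≤s [])))))
    (Ends.end-captured y y≢0 s M 1≤s M-large (end-of y a⁻ L (fits fitA) coreA⁻ shortA y≢0) (end-of y b⁻ L' (fits fitB) coreB⁻ shortB y≢0) 4g≤p (rA + rB) refl
     (lin 8 rA rB s lA fA ε lB fB 0 (v0 :+ v1) (k4 :* (v2 :* v2)) (hyp (v3 :+ v0 :+ v4) v5 (proj₁ outsideA) (hyp (v6 :+ v1 :+ v7) v5 (proj₁ outsideB) (hyp* 2 v5 (v2 :* v2) ε≤s [])))))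

 -- Choice of the scales and small subsets with `2 n - 1` sums.

 module Main (N : ℕ) (1≤N : 1 ≤ N) (Sc : Scales N) (n s : ℕ) (1≤n : 1 ≤ n) (room : 2 * n * N + n ≤ p * N) (s²≤n : s * s ≤ n) (n<s² : n < (s + 1) * (s + 1)) where

  open Scales Sc

  1≤s : 1 ≤ s
  1≤s = ≰⇒> λ le → (absurd (lin 2 n s 0 k1 k0 (hyp (1+ v0) ((v1 :+ k1) :* (v1 :+ k1)) n<s² (hyp* 2 v1 k0 le (mul v1 v1 k0 le (hyp k1 v0 1≤n []))))))

  s≤n : s ≤ n
  s≤n = (lin 2 s n 0 v0 v1 (hyp (v0 :* v0) v1 s²≤n (mul v0 k1 v0 1≤s [])))

  n≤4s² : n ≤ 4 * (s * s)
  n≤4s² = (lin 2 n s 0 v0 (k4 :* (v1 :* v1)) (hyp (1+ v0) ((v1 :+ k1) :* (v1 :+ k1)) n<s² (mul* 2 v1 k1 v1 1≤s [])))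

  1≤W : 1 ≤ W
  1≤W = (lin 2 W N 4 k1 v0 (eqn⁻ v0 (v1 :* k5) W≡ (hyp* 5 k1 v1 1≤N [])))

  1≤τ : 1 ≤ τ
  1≤τ = (lin 2 τ W 999999999 k1 v0 (eqn⁻ v0 (v1 :* & 1000000000) τ≡ (hyp* 1000000000 k1 v1 1≤W [])))

  1≤h : 1 ≤ h
  1≤h = (lin 2 h τ 15999999 k1 v0 (eqn⁻ v0 (v1 :* & 16000000) h≡ (hyp* 16000000 k1 v1 1≤τ [])))

  1≤Z : 1 ≤ Z
  1≤Z = (lin 3 Z h (5 ℕ.^ k) 1999 k1 v0 (eqn⁻ v0 (v1 :* v1 :* v2 :* & 2000) Z≡ (hyp* 2000 k1 (v1 :* v1 :* v2) (*-mono-≤ (*-mono-≤ 1≤h 1≤h) (5^≥1 k)) [])))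

  1≤Y : 1 ≤ Y
  1≤Y = (lin 3 Y τ Z 7999999 k1 v0 (eqn⁻ v0 (v1 :* v2 :* & 8000000) Y≡ (hyp* 8000000 k1 (v1 :* v2) (*-mono-≤ 1≤τ 1≤Z) [])))

  1≤YY : 1 ≤ Y * Y
  1≤YY = *-mono-≤ 1≤Y 1≤Y

  Result : (A B : G → Bool) → Set
  Result A B = ∃ λ (R : Small A B (C * s)) → 2 * n ≤ # (sums R) + 1

  -- Successive integer parts: `q` of `n / τ`, `D` of `q / 1000000`, `e` of `D / Z`. The bound
  -- `n₀ < n` keeps all three positive despite rounding.
  module Large (n₀<n : n₀ < n) (q D e : ℕ) (q-lo : q * τ ≤ n) (q-hi : n < q * τ + τ) (D-lo : D * 1000000 ≤ q) (D-hi : q < D * 1000000 + 1000000) (e-lo : e * Z ≤ D) (e-hi : D < e * Z + Z) where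

   q-large : (Z + 3) * 1000000 ≤ q
   q-large = ≮⇒≥ λ lt → (absurd (lin 5 n₀ n τ Z q 1 k1 k0 (hyp (1+ v0) v1 n₀<n (eqn⁻ v0 (v2 :* (v3 :+ k3) :* & 1000000) n₀≡ (hyp (1+ v1) (v4 :* v2 :+ v2) q-hi (mul v2 (1+ v4) ((v3 :+ k3) :* & 1000000) lt []))))))

   D-large : Z + 3 ≤ D
   D-large = ≮⇒≥ λ lt → (absurd (lin 3 D Z q 0 k1 k0 (hyp* 1000000 (1+ v0) (v1 :+ k3) lt (hyp (1+ v2) (v0 :* & 1000000 :+ & 1000000) D-hi (hyp ((v1 :+ k3) :* & 1000000) v2 q-large [])))))

   1≤e : 1 ≤ e
   1≤e = ≰⇒> λ le → (absurd (lin 3 Z e D 3 k1 k0 (mul v0 v1 k0 le (hyp (1+ v2) (v1 :* v0 :+ v0) e-hi (hyp (v0 :+ k3) v2 D-large [])))))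

   1≤D : 1 ≤ D
   1≤D = (lin 2 D Z 2 k1 v0 (hyp (v1 :+ k3) v0 D-large []))

   1≤q : 1 ≤ q
   1≤q = (lin 2 q D 999999 k1 v0 (hyp* 1000000 k1 v1 1≤D (hyp (v1 :* & 1000000) v0 D-lo [])))

   n≤qτ : n ≤ 2 * q * τ
   n≤qτ = (lin 3 n q τ 0 v0 (k2 :* v1 :* v2) (hyp (1+ v0) (v1 :* v2 :+ v2) q-hi (mul v2 k1 v1 1≤q [])))

   -- All scales are constant fractions of `n`. The constant for the smallest of them fixes the
   -- proportion of missing pairs that the greedy stage must reach.
   n≤Ye : n ≤ Y * e
   n≤Ye = (lin 7 n Y e q τ D Z 1 v0 (v1 :* v2) (hyp* 2 v0 (k2 :* v3 :* v4) n≤qτ (mul* 4 v4 (1+ v3) (v5 :* & 1000000 :+ & 1000000) D-hi (mul* 4000000 v4 (1+ v5) (v2 :* v6 :+ v6) e-hi (mul* 4000000 (v4 :* v6) k1 v2 1≤e (mul v2 (v4 :* v6 :* & 8000000) v1 (≡⇒≤ (sym Y≡)) []))))))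

   qW : q * W * 1000000000 ≤ n
   qW = (lin 4 q W n τ 0 (v0 :* v1 :* & 1000000000) v2 (hyp (v0 :* v3) v2 q-lo (mul v0 (v1 :* & 1000000000) v3 (≡⇒≤ (sym τ≡)) [])))

   q≤n : q * 5000000000 ≤ n
   q≤n = (lin 4 q n W N 0 (v0 :* & 5000000000) v1 (hyp (v0 :* v2 :* & 1000000000) v1 qW (mul* 1000000000 v0 (v3 :* k5) v2 (≡⇒≤ (sym W≡)) (mul* 5000000000 v0 k1 v3 1≤N []))))

   gap : 2 * n + q * 5000000000 ≤ p
   gap = *-cancelʳ-≤ _ p N {{ℕ.>-nonZero 1≤N}} (lin 5 n q N p W 0 ((k2 :* v0 :+ v1 :* & 5000000000) :* v2) (v3 :* v2) (hyp (k2 :* v0 :* v2 :+ v0) (v3 :* v2) room (hyp (v1 :* v4 :* & 1000000000) v0 qW (mul* 1000000000 v1 (v2 :* k5) v4 (≡⇒≤ (sym W≡)) []))))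

   join-cores : ∀ {A B x} → x ≢ 𝟘 → # A ≡ n → # B ≡ n → (CA : Core A x n (9 * q * 400)) (CB : Core B x n (9 * q * 400)) → Core.len CA ≤ Core.len CB → Result A B
   join-cores {A} {B} {x} x≢0 #A #B CA CB L≤L' = by (power-of-two (3 * s))
    where
    L L' : ℕ
    L = Core.len CA
    L' = Core.len CB
    L-lo : n ≤ L + q * 3600
    L-lo = (lin 4 n L q (#< L (line A x (Core.start CA))) 0 v0 (v1 :+ v2 :* & 3600) (hyp v0 (v3 :+ k9 :* v2 :* & 400) (Core.inside CA) (hyp v3 v1 (#<≤ L (line A x (Core.start CA))) [])))
    L'-hi : L' ≤ n + q * 3600
    L'-hi = (lin 3 L' n q 0 v0 (v1 :+ v2 :* & 3600) (hyp v0 (v1 :+ k9 :* v2 :* & 400) (Core.length CB) []))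
    by : (∃ λ j → 3 * s ≤ 2 ℕ.^ j × 2 ℕ.^ j ≤ 2 * (3 * s) + 1) → Result A B
    -- The power of two is at least `3 s`, so its square exceeds the arc length. The zones have
    -- width `q * 1000000000`, at most `n / W` yet far above the arc error `9 * q * 400`, and `μ` is
    -- `W * 8`.
    by (j , lo , hi) = shape (Combine.covered x x≢0 s M (W * 8) 1≤s (≡⇒≤ (sym M≡)) (Core.start CA) (Core.start CB) L L' (q * 1000000000) (9 * q * 400) n (Core.1≤len CA) L≤L'
     (Core.left CA) (Core.left CB) (Core.right CA) (Core.right CB) #A #B (Core.inside CA) (Core.inside CB) (Core.length CA) (Core.length CB)
     (lin 5 L L' q p n 0 (v0 :+ v1 :+ k4 :* (v2 :* & 1000000000)) v3 (hyp v0 v1 L≤L' (hyp* 2 v1 (v4 :+ v2 :* & 3600) L'-hi (hyp (k2 :* v4 :+ v2 :* & 5000000000) v3 gap []))))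
     (lin 1 q 0 (k9 :* v0 :* & 400 :* & 100000) (v0 :* & 1000000000) []) (lin 3 q L n 12499990 (v0 :* & 1000000000) v1 (hyp* 2500000 v2 (v1 :+ v0 :* & 3600) L-lo (hyp* 2500000 (v0 :* & 5000000000) v2 q≤n [])))
     (lin 5 L' W q n τ 6249999 (k2 :* v0) (v1 :* k8 :* (v2 :* & 1000000000)) (hyp* 12500000 v0 (v3 :+ v2 :* & 3600) L'-hi (hyp* 9 (v2 :* & 5000000000) v3 q≤n (hyp* 12500009 v3 (k2 :* v2 :* v4) n≤qτ (mul* 25000018 v2 v4 (v1 :* & 1000000000) (≡⇒≤ τ≡) [])))))
     (lin 4 q W L n 2499990 (k9 :* v0 :* & 400 :* (v1 :* k8) :* & 100) v2 (hyp* 7200 v3 (v2 :+ v0 :* & 3600) L-lo (hyp* 7200 (v0 :* v1 :* & 1000000000) v3 qW (mul* 25920000 v0 k1 v1 1≤W []))))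
     (lin 1 W 0 k1 (v0 :* k8) (hyp k1 v0 1≤W [])) (lin 3 q s n 12499999 (k9 :* v0 :* & 400) (v1 :* v1) (hyp* 9 (v0 :* & 5000000000) v2 q≤n (hyp* 9 v2 (k4 :* (v1 :* v1)) n≤4s² [])))
     (lin 4 L' L n q 12499990 (k4 :* v0) (k5 :* v1) (hyp* 50000036 v2 (v1 :+ v3 :* & 3600) L-lo (hyp* 49999964 v0 (v2 :+ v3 :* & 3600) L'-hi (hyp* 72 (v3 :* & 5000000000) v2 q≤n [])))) (lin 3 L n q 24999981 (& 1000) v0 (hyp* 5 v1 (v0 :+ v2 :* & 3600) L-lo (hyp* 5 (v2 :* & 5000000000) v1 q≤n (hyp* 24999982000 k1 v2 1≤q []))))
     j (lin 6 L (2 ℕ.^ j) L' n q s 112499999 v0 (v1 :* v1) (hyp* 112500000 v0 v2 L≤L' (hyp* 112500000 v2 (v3 :+ v4 :* & 3600) L'-hi (hyp* 81 (v4 :* & 5000000000) v3 q≤n (hyp* 112500081 v3 (k4 :* (v5 :* v5)) n≤4s² (hyp* 50000036 (k3 :* v5 :* (k3 :* v5)) (v1 :* v1) (*-mono-≤ lo lo) [])))))))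
     where
     shape : (∃ λ (R : Small A B (2 ℕ.^ j * 20 + (M * s * 2400000 + W * 8 * s * 6000))) → 2 * n ≤ # (sums R) + 1) → Result A B
     shape (R , le) = enlarge R (lin 7 (2 ℕ.^ j) M s W C Y n₀ 0 (v0 :* & 20 :+ (v1 :* v2 :* & 2400000 :+ v3 :* k8 :* v2 :* & 6000)) (v4 :* v2) (hyp* 20 v0 (k2 :* (k3 :* v2) :+ k1) hi (mul v2 (v1 :* & 2400000 :+ v3 :* & 48000 :+ v5 :* v5 :* & 12 :+ v6 :+ & 140) v4 (≡⇒≤ (sym C≡)) (hyp* 20 k1 v2 1≤s [])))) , le

   from-arcs : ∀ {A B} → # A ≡ n → # B ≡ n → (∃ λ x → x ≢ 𝟘 × NearArc A x (9 * q) × NearArc B x (9 * q)) → Result A B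
   from-arcs {A} {B} #A #B (x , x≢0 , nearA , nearB) = by (≤-total (Core.len CA) (Core.len CB))
    where
    tiny : 9 * q * 1000 < n
    tiny = (lin 2 q n 4999999999 (1+ (k9 :* v0 :* & 1000)) v1 (hyp* 9001 (v0 :* & 5000000000) v1 q≤n (hyp* 5000000000 k1 v0 1≤q [])))
    CA : Core A x n (9 * q * 400)
    CA = core A x x≢0 n (9 * q) #A nearA tiny
    CB : Core B x n (9 * q * 400)
    CB = core B x x≢0 n (9 * q) #B nearB tiny
    by : Core.len CA ≤ Core.len CB ⊎ Core.len CB ≤ Core.len CA → Result A B
    by (inj₁ le) = join-cores x≢0 #A #B CA CB le
    by (inj₂ le) = swapped (join-cores x≢0 #B #A CB CA le)
     where
     swapped : Result B A → Result A B
     swapped (R , le) = swap-subsets R , ≤-trans le (+-monoˡ-≤ 1 (#-mono (⊞-comm (Small.A' R) (Small.B' R))))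

   -- With proportion `1 / Y²`, the `4 Y²` rounds produce `2 n` sums unless at most `n² / Y² ≤ e²`
   -- pairs are missing, which is the extremal case with error `e`.
   many-or-extremal : ∀ {A B} → # A ≡ n → # B ≡ n → Result A B
   many-or-extremal {A} {B} #A #B = by (saturate (Y * Y) s (s + 2) A B ∅ (subst (s ≤_) (sym #B) s≤n) (subst (_≤ (s + 2) * s) (sym #A) (lin 2 n s 0 v0 ((v1 :+ k2) :* v1) (hyp (1+ v0) ((v1 :+ k1) :* (v1 :+ k1)) n<s² []))) (4 * (Y * Y)))
    where
    by : (∃ λ P' → ∃ λ Q' → P' ⊑ A × Q' ⊑ B × # P' ≤ 4 * (Y * Y) * (s + 2) × # Q' ≤ 4 * (Y * Y) * s × (4 * (Y * Y) * # A ≤ 2 * (Y * Y) * # (fresh P' Q' ∅) ⊎ Y * Y * bad A B (∅ ∪ P' ⊞ Q') ≤ # A * # B)) → Result A B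
    by (P' , Q' , P'⊑ , Q'⊑ , #P' , #Q' , outcome) = outcome-of outcome
     where
     X : G → Bool
     X = P' ⊞ Q'
     done : 2 * n ≤ # X → Result A B
     done le = small-subsets P' Q' P'⊑ Q'⊑ (lin 7 (# P') C s Y M W n₀ 0 v0 (v1 :* v2) (hyp v0 (k4 :* (v3 :* v3) :* (v2 :+ k2)) #P' (mul v2 (v4 :* & 2400000 :+ v5 :* & 48000 :+ v3 :* v3 :* & 12 :+ v6 :+ & 140) v1 (≡⇒≤ (sym C≡)) (mul* 8 (v3 :* v3) k1 v2 1≤s []))))
      (lin 7 (# Q') C s Y M W n₀ 2 v0 (v1 :* v2) (hyp* 3 v0 (k4 :* (v3 :* v3) :* v2) #Q' (mul v2 (v4 :* & 2400000 :+ v5 :* & 48000 :+ v3 :* v3 :* & 12 :+ v6 :+ & 140) v1 (≡⇒≤ (sym C≡)) []))) , ≤-trans le (m≤m+n _ 1)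
     structured : Y * Y * bad A B X ≤ # A * # B → # X < 2 * n → Result A B
     structured few X<2n = from-arcs #A #B (Structure.near-arcs (extremal {A} {B} {X} {e} (lin 5 (# X) (# A) (# B) e n 0 v0 (v1 :+ v2 :+ v3) (hyp (1+ v0) (k2 :* v4) X<2n (eqn⁻ v1 v4 #A (eqn⁻ v2 v4 #B [])))) bad≤) #A #B X<2n 1≤e q D h k 1≤h
      (lin 2 D Z 0 k3 v0 (hyp (v1 :+ k3) v0 D-large [])) D-lo (lin 4 e q Z D 9 (v0 :* & 100000) v1 (hyp* 1000000 (v0 :* v2) v3 e-lo (mul* 1000000 v0 k1 v2 1≤Z (hyp (v3 :* & 1000000) v1 D-lo [])))) (lin 2 q n 999999 (v0 :* & 5000) v1 (hyp (v0 :* & 5000000000) v1 q≤n []))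
      (lin 3 n q p 0 (k2 :* v0 :+ & 10 :* v1) v2 (hyp (k2 :* v0 :+ v1 :* & 5000000000) v2 gap []))
      (lin 5 n h D q τ 1999999 (k4 :* v0) (v1 :* v2) (hyp* 8000000 v0 (k2 :* v3 :* v4) n≤qτ (mul* 16000000 v4 (1+ v3) (v2 :* & 1000000 :+ & 1000000) D-hi (mul* 15999984000000 v4 k1 v2 1≤D (mul* 1999999 v2 (v4 :* & 16000000) v1 (≡⇒≤ (sym h≡)) [])))))
      (lin 5 h (5 ℕ.^ k) e D Z 0 (v0 :* v0 :* (v1 :* v2) :* & 2000) v3 (mul v2 (v0 :* v0 :* v1 :* & 2000) v4 (≡⇒≤ (sym Z≡)) (hyp (v2 :* v4) v3 e-lo []))) k-large)
      where
      bad≤ : bad A B X ≤ e * e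
      bad≤ = cancelˡ (Y * Y) 1≤YY (lin 5 Y (bad A B X) e (# A) (# B) 0 (v0 :* v0 :* v1) (v0 :* v0 :* (v2 :* v2)) (hyp (v0 :* v0 :* v1) (v3 :* v4) few (hyp (v3 :* v4) (v0 :* v2 :* (v0 :* v2)) (*-mono-≤ (subst (_≤ Y * e) (sym #A) n≤Ye) (subst (_≤ Y * e) (sym #B) n≤Ye)) [])))
     outcome-of : 4 * (Y * Y) * # A ≤ 2 * (Y * Y) * # (fresh P' Q' ∅) ⊎ Y * Y * bad A B (∅ ∪ P' ⊞ Q') ≤ # A * # B → Result A B
     outcome-of (inj₁ many) = done (≤-trans (cancelˡ (Y * Y) 1≤YY (lin 4 Y n (# (fresh P' Q' ∅)) (# A) 1 (v0 :* v0 :* (k2 :* v1)) (v0 :* v0 :* v2) (hyp (k4 :* (v0 :* v0) :* v3) (k2 :* (v0 :* v0) :* v2) many (mul* 4 (v0 :* v0) v1 v3 (≡⇒≤ (sym #A)) [])))) (#-mono λ y t → T-∧ˡ t))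
     outcome-of (inj₂ few) = enough (≤-<-connex (2 * n) (# X))
      where
      enough : 2 * n ≤ # X ⊎ # X < 2 * n → Result A B
      enough (inj₁ le) = done le
      enough (inj₂ lt) = structured few lt

  -- For `n ≤ n₀` the sets themselves respect the size bound, since `C ≥ n₀`, and Cauchy-Davenport
  -- gives the sums.
  covering : ∀ {A B} → # A ≡ n → # B ≡ n → Result A B
  covering {A} {B} #A #B = by (≤-<-connex n n₀)
   where
   room' : 2 * n ≤ p
   room' = *-cancelʳ-≤ (2 * n) p N {{ℕ.>-nonZero 1≤N}} (lin 3 n N p 0 (k2 :* v0 :* v1) (v2 :* v1) (hyp (k2 :* v0 :* v1 :+ v0) (v2 :* v1) room []))
   by : n ≤ n₀ ⊎ n₀ < n → Result A B
   by (inj₁ n≤n₀) = small-subsets A B (λ _ t → t) (λ _ t → t) (size #A) (size #B) , sum-size (cauchy-davenport A B (subst (1 ≤_) (sym #A) 1≤n) (subst (1 ≤_) (sym #B) 1≤n))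
    where
    size : ∀ {S} → # S ≡ n → # S ≤ C * s
    size {S} eq = (lin 8 (# S) C s n n₀ M W Y 0 v0 (v1 :* v2) (eqn v0 v3 eq (hyp v3 v4 n≤n₀ (mul v4 k1 v2 1≤s (mul v2 (v5 :* & 2400000 :+ v6 :* & 48000 :+ v7 :* v7 :* & 12 :+ v4 :+ & 140) v1 (≡⇒≤ (sym C≡)) [])))))
    sum-size : # A + # B ≤ # (A ⊞ B) + 1 ⊎ p ≤ # (A ⊞ B) → 2 * n ≤ # (A ⊞ B) + 1
    sum-size (inj₁ le) = (lin 4 n (# (A ⊞ B)) (# A) (# B) 0 (k2 :* v0) (v1 :+ k1) (hyp (v2 :+ v3) (v1 :+ k1) le (eqn⁻ v2 v0 #A (eqn⁻ v3 v0 #B []))))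
    sum-size (inj₂ le) = (lin 3 n (# (A ⊞ B)) p 0 (k2 :* v0) (v1 :+ k1) (hyp v2 v1 le (hyp (k2 :* v0) v2 room' [])))
   by (inj₂ n₀<n) = from-q (quotient n τ 1≤τ)
    where
    from-q : (∃ λ q → q * τ ≤ n × n < q * τ + τ) → Result A B
    from-q (q , q-lo , q-hi) = from-D (quotient q 1000000 (s≤s z≤n))
     where
     from-D : (∃ λ D → D * 1000000 ≤ q × q < D * 1000000 + 1000000) → Result A B
     from-D (D , D-lo , D-hi) = from-e (quotient D Z 1≤Z)
      where
      from-e : (∃ λ e → e * Z ≤ D × D < e * Z + Z) → Result A B
      from-e (e , e-lo , e-hi) = Large.many-or-extremal n₀<n q D e q-lo q-hi D-lo D-hi e-lo e-hi #A #B

 -- Further sums from the size of `A + B`.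

 new : (S X : G → Bool) → G → ℕ
 new S X a = # λ b → S b ∧ not (X (a ⊹ b))

 new-gain : ∀ S X X' a → X ⊑ X' → (∀ b → T (S b) → T (X' (a ⊹ b))) → # X + new S X a ≤ # X'
 new-gain S X X' a X⊑ covers = (lin 4 (# X) (new S X a) (# X') (Σ f) 0 (v0 :+ v1) v2 (eqn⁻ v3 v1 (trans (sym (Σ-shift a f)) (Σ-cong λ b → cong₂ (λ u v → [ S u ∧ not (X v) ]) (group 2 b a (g0 :+ g1 :- g1) g0) (⊹-comm b a))) (hyp (v0 :+ v3) v2 (Σ-≤ (([_] ∘ X) ∷ f ∷ []) (([_] ∘ X') ∷ []) (λ z → case (X z) (S (z ⊖ a)) (X'
  z) (X⊑ z) λ t → subst (T ∘ X') (group 2 a z (g0 :+ (g1 :- g0)) g1) (covers (z ⊖ a) t))) [])))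
  where
  f : G → ℕ
  f z = [ S (z ⊖ a) ∧ not (X z) ]
  case : ∀ u v w → (T u → T w) → (T v → T w) → [ u ] + [ v ∧ not u ] ≤ [ w ]
  case true v true _ _ rewrite ∧-zeroʳ v = ≤-refl
  case true _ false u→ _ = ⊥-elim (u→ tt)
  case false true true _ _ = ≤-refl
  case false true false _ v→ = ⊥-elim (v→ tt)
  case false false w _ _ = z≤n

 #⊞≤ : ∀ A B → # (A ⊞ B) ≤ # A * # B
 #⊞≤ A B = ≤-trans (Σ-mono entry) (≡⇒≤ (trans (sym (bad-by-sum A B ∅)) (bad-∅ A B)))
  where
  entry : ∀ z → [ (A ⊞ B) z ] ≤ # λ x → (A x ∧ B (z ⊖ x)) ∧ true
  entry z = by ((A ⊞ B) z) refl
   where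
   found : (∃ λ x → T (A x) × T (B (z ⊖ x))) → 1 ≤ # λ x → (A x ∧ B (z ⊖ x)) ∧ true
   found (x , Ax , Bx) = ≤-trans (≡⇒≤ (sym (T⇒⟨⟩ (T-pair (T-pair Ax Bx) tt)))) (term≤Σ (λ x → [ (A x ∧ B (z ⊖ x)) ∧ true ]) x)
   by : ∀ q → (A ⊞ B) z ≡ q → [ q ] ≤ # λ x → (A x ∧ B (z ⊖ x)) ∧ true
   by false _ = z≤n
   by true eq = found (⊞-elim A B z (T! eq))

 -- If a + b is fixed, (a , b' , a') ↦ (a + b' , a' + b' , a' + b) is injective, and the alternating
 -- sum of the image is a + b.
 module FewNew (A B X : G → Bool) (n : ℕ) (#A : # A ≡ n) (#B : # B ≡ n)
  (poorA : ∀ a → T (A a) → 4 * new B X a ≤ n) (poorB : ∀ b → T (B b) → 4 * new A X b ≤ n) where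

  triples : G → ℕ
  triples z = Σ λ x → Σ λ w → [ (X x ∧ X w) ∧ X (x ⊹ w ⊖ z) ]

  present : ∀ S e → # S ≡ n → # (λ t → S t ∧ X (t ⊹ e)) + new S X e ≡ n
  present S e #S = trans (Σ-≡ ((λ t → [ S t ∧ X (t ⊹ e) ]) ∷ (λ t → [ S t ∧ not (X (e ⊹ t)) ]) ∷ []) (([_] ∘ S) ∷ [])
   λ t → trans (cong (λ y → [ S t ∧ X (t ⊹ e) ] + [ S t ∧ not (X y) ]) (⊹-comm e t)) (case (S t) (X (t ⊹ e)))) #S
   where
   case : ∀ u v → [ u ∧ v ] + [ u ∧ not v ] ≡ [ u ]
   case true v = ⟨⟩-not v
   case false v = refl

  few-bad : 4 * bad A B X ≤ n * n
  few-bad = begin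
   4 * bad A B X ≡⟨ Σ-* 4 _ ⟨
   Σ (λ x → 4 * # λ y → (A x ∧ B y) ∧ not (X (x ⊹ y))) ≤⟨ Σ-mono (λ x → row x (A x) refl) ⟩
   Σ (λ x → [ A x ] * n) ≡⟨ trans (Σ-*ʳ n ([_] ∘ A)) (cong (_* n) #A) ⟩
   n * n ∎
   where
   open ≤-Reasoning
   row : ∀ x q → A x ≡ q → 4 * # (λ y → (q ∧ B y) ∧ not (X (x ⊹ y))) ≤ [ q ] * n
   row x false _ = ≡⇒≤ (trans (cong (4 *_) (Σ-zero p)) refl)
   row x true eq = ≤-trans (poorA x (T! eq)) (m≤m+n n 0)

  -- At least `3 n / 4` choices remain for each of `b'` and `a'`, hence `9/16 n²` pairs; at most
  -- `n² / 4` of them have `a' + b'` outside `X`.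
  at-sum : ∀ a b → T (A a) → T (B b) → 5 * (n * n) ≤ 16 * triples (a ⊹ b)
  at-sum a b Aa Bb = (lin 5 n (triples (a ⊹ b)) (# P) (# Q) (bad A B X) 0 (k5 :* (v0 :* v0)) (& 16 :* v1) (hyp* 16 (v2 :* v3) (v1 :+ v4) products (hyp* 4 (k4 :* v4) (v0 :* v0) few-bad (hyp (k3 :* v0 :* (k3 :* v0)) (k4 :* v2 :* (k4 :* v3)) (*-mono-≤ (lin 3 n (# P) (new B X a) 0 (k3 :* v0) (k4 :* v1) (eqn⁻* 4 (v1 :+ v2)
   v0 (present B a #B) (hyp (k4 :* v2) v0 (poorA a Aa) []))) (lin 3 n (# Q) (new A X b) 0 (k3 :* v0) (k4 :* v1) (eqn⁻* 4 (v1 :+ v2) v0 (present A b #A) (hyp (k4 :* v2) v0 (poorB b Bb) [])))) []))))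
   where
   P Q : G → Bool
   P b' = B b' ∧ X (b' ⊹ a)
   Q a' = A a' ∧ X (a' ⊹ b)
   shifted : triples (a ⊹ b) ≡ Σ λ b' → Σ λ a' → [ (X (b' ⊹ a) ∧ X (a' ⊹ b)) ∧ X (a' ⊹ b') ]
   shifted = trans (sym (Σ-shift a λ x → Σ λ w → [ (X x ∧ X w) ∧ X (x ⊹ w ⊖ (a ⊹ b)) ])) (Σ-cong λ b' →
    trans (sym (Σ-shift b λ w → [ (X (b' ⊹ a) ∧ X w) ∧ X (b' ⊹ a ⊹ w ⊖ (a ⊹ b)) ]))
     (Σ-cong λ a' → cong (λ t → [ (X (b' ⊹ a) ∧ X (a' ⊹ b)) ∧ X t ]) (group 4 b' a a' b (g0 :+ g1 :+ (g2 :+ g3) :- (g1 :+ g3)) (g2 :+ g0))))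
   products : # P * # Q ≤ triples (a ⊹ b) + bad A B X
   products = begin
    # P * # Q ≡⟨ Σ-*ʳ (# Q) ([_] ∘ P) ⟨
    Σ (λ b' → [ P b' ] * # Q) ≡⟨ Σ-cong (λ b' → Σ-* [ P b' ] λ a' → [ Q a' ]) ⟨
    Σ (λ b' → Σ λ a' → [ P b' ] * [ Q a' ])
     ≤⟨ Σ-mono (λ b' → ≤-trans (Σ-mono λ a' → case (A a') (B b') (X (b' ⊹ a)) (X (a' ⊹ b)) (X (a' ⊹ b'))) (≡⇒≤ (Σ-+ (λ a' → [ (X (b' ⊹ a) ∧ X (a' ⊹ b)) ∧ X (a' ⊹ b') ]) _))) ⟩
    Σ (λ b' → Σ (λ a' → [ (X (b' ⊹ a) ∧ X (a' ⊹ b)) ∧ X (a' ⊹ b') ]) + # λ a' → (A a' ∧ B b') ∧ not (X (a' ⊹ b')))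
     ≡⟨ trans (Σ-+ (λ b' → Σ λ a' → [ (X (b' ⊹ a) ∧ X (a' ⊹ b)) ∧ X (a' ⊹ b') ]) _) (cong₂ _+_ (sym shifted) (Σ-swap λ b' a' → [ (A a' ∧ B b') ∧ not (X (a' ⊹ b')) ])) ⟩
    triples (a ⊹ b) + bad A B X ∎
    where
    open ≤-Reasoning
    case : ∀ α β u v w → [ β ∧ u ] * [ α ∧ v ] ≤ [ (u ∧ v) ∧ w ] + [ (α ∧ β) ∧ not w ]
    case false β u v w = ≤-trans (≡⇒≤ (*0 [ β ∧ u ])) z≤n
    case true β u v w = bool⁴ (λ β u v w → [ β ∧ u ] * [ v ]) (λ β u v w → [ (u ∧ v) ∧ w ] + [ β ∧ not w ]) β u v w

  #sums : # (A ⊞ B) * (5 * (n * n)) ≤ 16 * (# X * # X * # X)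
  #sums = begin
   # (A ⊞ B) * (5 * (n * n)) ≡⟨ Σ-*ʳ (5 * (n * n)) (λ z → [ (A ⊞ B) z ]) ⟨
   Σ (λ z → [ (A ⊞ B) z ] * (5 * (n * n))) ≤⟨ Σ-mono (λ z → entry z ((A ⊞ B) z) refl) ⟩
   Σ (λ z → 16 * triples z) ≡⟨ Σ-* 16 triples ⟩
   16 * Σ triples ≡⟨ cong (16 *_) all-triples ⟩
   16 * (# X * # X * # X) ∎
   where
   open ≤-Reasoning
   entry : ∀ z q → (A ⊞ B) z ≡ q → [ q ] * (5 * (n * n)) ≤ 16 * triples z
   entry z false _ = z≤n
   entry z true eq = from (⊞-elim A B z (T! eq))
    where
    from : (∃ λ x → T (A x) × T (B (z ⊖ x))) → 1 * (5 * (n * n)) ≤ 16 * triples z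
    from (x , Ax , Bx) = ≤-trans (≡⇒≤ (+0 _)) (subst (λ t → 5 * (n * n) ≤ 16 * triples t) (group 2 x z (g0 :+ (g1 :- g0)) g1) (at-sum x (z ⊖ x) Ax Bx))
   all-triples : Σ triples ≡ # X * # X * # X
   all-triples = trans (Σ-swap λ z x → Σ λ w → [ (X x ∧ X w) ∧ X (x ⊹ w ⊖ z) ]) (trans (Σ-cong inner) (trans (Σ-*ʳ (# X) (λ x → [ X x ] * # X)) (cong (_* # X) (Σ-*ʳ (# X) ([_] ∘ X)))))
    where
    inner : ∀ x → Σ (λ z → Σ λ w → [ (X x ∧ X w) ∧ X (x ⊹ w ⊖ z) ]) ≡ [ X x ] * # X * # X
    inner x = trans (Σ-swap λ z w → [ (X x ∧ X w) ∧ X (x ⊹ w ⊖ z) ]) (trans (Σ-cong λ w → trans (trans (Σ-cong λ z → ⟨⟩-∧ (X x ∧ X w) (X (x ⊹ w ⊖ z))) (Σ-* [ X x ∧ X w ] λ z → [ X (x ⊹ w ⊖ z) ]))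
     (trans (cong ([ X x ∧ X w ] *_) (Σ-reflect (x ⊹ w) λ z → [ X z ])) (cong (_* # X) (⟨⟩-∧ (X x) (X w))))) (trans (Σ-*ʳ (# X) (λ w → [ X x ] * [ X w ])) (cong (_* # X) (Σ-* [ X x ] λ w → [ X w ]))))

 single : G → G → Bool
 single a w = δ w a

 single⊑ : ∀ {S} a → T (S a) → single a ⊑ S
 single⊑ {S} a Sa w t = subst (T ∘ S) (sym (δ-sound t)) Sa

 module Lines (A B : G → Bool) (n s : ℕ) (#A : # A ≡ n) (#B : # B ≡ n) (1≤n : 1 ≤ n) (n<s² : n < (s + 1) * (s + 1)) where

  cross : ∀ {ℓ} → Small A B ℓ → G → Bool
  cross L = Small.A' L ⊞ B ∪ A ⊞ Small.B' L

  -- With `# (A ⊞ B) = κ n` this reads `# X ≥ κ^{1/3} n / 2`.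
  Enough : (G → Bool) → Set
  Enough X = # (A ⊞ B) * (n * n) ≤ 8 * (# X * # X * # X)

  Search : Set
  Search = ∃ λ (L : Small A B (2 * s + 2)) → Enough (cross L)

  Rich : (S U X : G → Bool) → Set
  Rich S U X = (∃ λ a → T (S a) × n < 4 * new U X a) ⊎ (∀ a → T (S a) → 4 * new U X a ≤ n)

  rich? : ∀ (S U X : G → Bool) → Rich S U X
  rich? S U X = by (Finₚ.any? λ a → T? (S a ∧ (suc n ≤ᵇ 4 * new U X a)))
   where
   by : Dec (∃ λ a → T (S a ∧ (suc n ≤ᵇ 4 * new U X a))) → Rich S U X
   by (yes (a , t)) = inj₁ (a , T-∧ˡ t , ≤ᵇ⇒≤ (suc n) _ (T-∧ʳ {S a} t))
   by (no none) = inj₂ λ a Sa → ≮⇒≥ λ lt → none (a , T-pair Sa (≤⇒≤ᵇ lt))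

  -- Each element brought `n / 4` sums, so `2 s + 2` of them give `(s + 1) n / 2`. Its cube is
  -- enough because `A + B` has at most `n²` elements and `n < (s + 1)²`.
  short : ∀ {ℓ} (L : Small A B ℓ) → ℓ * n ≤ 4 * # (cross L) → ¬ Enough (cross L) → ℓ < 2 * s + 2
  short {ℓ} L big not-enough = ≰⇒> λ le → (absurd (lin 4 x (# (A ⊞ B)) n s 0 k1 k0 (hyp (1+ (k8 :* (v0 :* v0 :* v0))) (v1 :* (v2 :* v2)) (≰⇒> not-enough) (mul (v2 :* v2) v1 (v2 :* v2) (subst₂ (λ u v → # (A ⊞ B) ≤ u * v) #A #B (#⊞≤ A B)) (hyp ((v3 :+ k1) :* v2 :* ((v3 :+ k1) :* v2) :* ((v3 :+ k1) :* v2)) (k2 :* v0 :*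
   (k2 :* v0) :* (k2 :* v0)) (*-mono-≤ (*-mono-≤ (wide le) (wide le)) (wide le)) (mul (v2 :* v2 :* v2 :* (v3 :+ k1)) v2 ((v3 :+ k1) :* (v3 :+ k1)) (<⇒≤ n<s²) []))))))
   where
   x = # (cross L)
   wide : 2 * s + 2 ≤ ℓ → (s + 1) * n ≤ 2 * x
   wide le = *-cancelˡ-≤ 2 (lin 4 s n x ℓ 0 (k2 :* ((v0 :+ k1) :* v1)) (k2 :* (k2 :* v2)) (mul v1 (k2 :* v0 :+ k2) v3 le (hyp (v3 :* v1) (k4 :* v2) big [])))

  -- `f` counts the additions still allowed; `short` excludes failure when it runs out. If no
  -- element brings `n / 4` new sums, `FewNew` gives the bound with 16/5 in place of 8.
  search : ∀ f ℓ → ℓ + f ≡ 2 * s + 2 → (L : Small A B ℓ) → ℓ * n ≤ 4 * # (cross L) → Search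
  search f ℓ eq L big = by (# (A ⊞ B) * (n * n) ℕ.≤? 8 * (# (cross L) * # (cross L) * # (cross L)))
   where
   open Small L
   X : G → Bool
   X = cross L
   by : Dec (Enough X) → Search
   by (yes enough) = enlarge L (subst (ℓ ≤_) eq (m≤m+n ℓ f)) , enough
   by (no not-enough) = more f eq (rich? A B X) (rich? B A X)
    where
    step : ∀ f S a (L' : Small A B (suc ℓ)) → ℓ + suc f ≡ 2 * s + 2 → n < 4 * new S X a → X ⊑ cross L' → (∀ b → T (S b) → T (cross L' (a ⊹ b))) → Search
    step f S a L' eq rich X⊑ covers = search f (suc ℓ) (trans (sym (+-suc ℓ f)) eq) L' (lin 5 ℓ n (# (cross L')) (# X) (new S X a) 0 ((1+ v0) :* v1) (k4 :* v2) (hyp (v0 :* v1) (k4 :* v3) big (hyp (1+ v1) (k4 :* v4) rich (hyp* 4 (v3 :+ v4) v2 (new-gain S X (cross L') a X⊑ covers) []))))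
    more : ∀ f → ℓ + f ≡ 2 * s + 2 → Rich A B X → Rich B A X → Search
    more zero eq _ _ = ⊥-elim (<⇒≢ (short L big not-enough) (trans (sym (+0 ℓ)) eq))
    more (suc f) eq (inj₁ (a , Aa , rich)) _ = step f B a L' eq rich X⊑ covers
     where
     L' : Small A B (suc ℓ)
     L' = small-subsets (A' ∪ single a) B' (∪-⊑ {A'} A'⊑A (single⊑ a Aa)) B'⊑B (lin 4 (# (A' ∪ single a)) ℓ (# A') (# (single a)) 0 v0 (1+ v1) (hyp v0 (v2 :+ v3) (#-∪ A' (single a)) (eqn v3 k1 (#-δ a) (hyp v2 v1 #A' [])))) (m≤n⇒m≤1+n #B')
     X⊑ : X ⊑ cross L'
     X⊑ = ∪-⊑ {A' ⊞ B} (λ z t → T-∨ˡ (⊞-mono {A'} {A' ∪ single a} {B} {B} (λ _ → T-∨ˡ) (λ _ t → t) z t)) (λ z → T-∨ʳ {((A' ∪ single a) ⊞ B) z})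
     covers : ∀ b → T (B b) → T (cross L' (a ⊹ b))
     covers b Bb = T-∨ˡ (⊞-intro (A' ∪ single a) B (T-∨ʳ {A' a} (δ-refl a)) Bb)
    more (suc f) eq (inj₂ poor) (inj₁ (b , Bb , rich)) = step f A b L' eq rich X⊑ covers
     where
     L' : Small A B (suc ℓ)
     L' = small-subsets A' (B' ∪ single b) A'⊑A (∪-⊑ {B'} B'⊑B (single⊑ b Bb)) (m≤n⇒m≤1+n #A') (lin 4 (# (B' ∪ single b)) ℓ (# B') (# (single b)) 0 v0 (1+ v1) (hyp v0 (v2 :+ v3) (#-∪ B' (single b)) (eqn v3 k1 (#-δ b) (hyp v2 v1 #B' []))))
     X⊑ : X ⊑ cross L'
     X⊑ = ∪-⊑ {A' ⊞ B} (λ z → T-∨ˡ) (λ z t → T-∨ʳ {(A' ⊞ B) z} (⊞-mono {A} {A} {B'} {B' ∪ single b} (λ _ t → t) (λ _ → T-∨ˡ) z t))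
     covers : ∀ a → T (A a) → T (cross L' (b ⊹ a))
     covers a Aa = T-∨ʳ {(A' ⊞ B) (b ⊹ a)} (subst (T ∘ (A ⊞ (B' ∪ single b))) (⊹-comm a b) (⊞-intro A (B' ∪ single b) Aa (T-∨ʳ {B' b} (δ-refl b))))
    more (suc f) eq (inj₂ poorA) (inj₂ poorB) = ⊥-elim (not-enough (*-cancelˡ-≤ 5 (lin 3 (# (A ⊞ B)) n (# X) 0 (k5 :* (v0 :* (v1 :* v1))) (k5 :* (k8 :* (v2 :* v2 :* v2))) (hyp (v0 :* (k5 :* (v1 :* v1))) (& 16 :* (v2 :* v2 :* v2)) (FewNew.#sums A B X n #A #B poorA poorB) []))))

  lines : Search
  lines = search (2 * s + 2) 0 refl (small-subsets ∅ ∅ (λ _ ()) (λ _ ()) (≡⇒≤ #∅) (≡⇒≤ #∅)) z≤n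

  -- Every new sum is assigned to one of its summands in B; the k most useful elements of B are kept.
  Useful : (S U V : G → Bool) → ℕ → Set
  Useful S U V k = ∃ λ S₁ → S₁ ⊑ S × # S₁ ≡ k × k * # (fresh S U V) ≤ # S * # (fresh S₁ U V)

  mostUseful : ∀ (S U V : G → Bool) k j → # S ≡ k + j → Useful S U V k
  mostUseful S U V k j #S = finish (heavy-subset j k S D #S)
   where
   owner-of : ∀ z q → (S ⊞ U) z ≡ q → ∃ λ x → T q → T (S x) × T (U (z ⊖ x))
   owner-of z true eq = from (⊞-elim S U z (T! eq))
    where
    from : (∃ λ x → T (S x) × T (U (z ⊖ x))) → ∃ λ x → ⊤ → T (S x) × T (U (z ⊖ x))
    from (x , both) = x , λ _ → both
   owner-of z false _ = 𝟘 , λ ()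
   owner : G → G
   owner z = proj₁ (owner-of z ((S ⊞ U) z) refl)
   owned : ∀ z → T ((S ⊞ U) z) → T (S (owner z)) × T (U (z ⊖ owner z))
   owned z = proj₂ (owner-of z ((S ⊞ U) z) refl)
   D : G → ℕ
   D x = # λ z → δ x (owner z) ∧ fresh S U V z
   total-D : ∀ S' → Σ (λ x → [ S' x ] * D x) ≡ Σ λ z → [ S' (owner z) ] * [ fresh S U V z ]
   total-D S' = trans (Σ-cong λ x → sym (Σ-* [ S' x ] λ z → [ δ x (owner z) ∧ fresh S U V z ])) (trans (Σ-swap λ x z → [ S' x ] * [ δ x (owner z) ∧ fresh S U V z ])
    (Σ-cong λ z → trans (Σ-cong λ x → shuffle (S' x) (δ x (owner z)) (fresh S U V z)) (Σ-δ (λ x → [ S' x ] * [ fresh S U V z ]) (owner z))))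
    where
    shuffle : ∀ a b c → [ a ] * [ b ∧ c ] ≡ [ b ] * ([ a ] * [ c ])
    shuffle a true c = sym (+0 _)
    shuffle a false c = *0 [ a ]
   finish : (∃ λ S' → S' ⊑ S × # S' ≡ k × k * Σ (λ x → [ S x ] * D x) ≤ # S * Σ (λ x → [ S' x ] * D x)) → Useful S U V k
   finish (S' , S'⊑ , #S' , le) = S' , S'⊑ , #S' , (begin
    k * # (fresh S U V) ≤⟨ *-monoʳ-≤ k (Σ-mono λ z → whole z (fresh S U V z) (owned z ∘ T-∧ˡ)) ⟩
    k * Σ (λ z → [ S (owner z) ] * [ fresh S U V z ]) ≡⟨ cong (k *_) (total-D S) ⟨
    k * Σ (λ x → [ S x ] * D x) ≤⟨ le ⟩
    # S * Σ (λ x → [ S' x ] * D x) ≡⟨ cong (# S *_) (total-D S') ⟩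
    # S * Σ (λ z → [ S' (owner z) ] * [ fresh S U V z ]) ≤⟨ *-monoʳ-≤ (# S) (Σ-mono λ z → part z) ⟩
    # S * # (fresh S' U V) ∎)
    where
    open ≤-Reasoning
    whole : ∀ z q → (T q → T (S (owner z)) × T (U (z ⊖ owner z))) → [ q ] ≤ [ S (owner z) ] * [ q ]
    whole z false _ = z≤n
    whole z true f = ≡⇒≤ (sym (trans (*1 _) (T⇒⟨⟩ (proj₁ (f tt)))))
    part : ∀ z → [ S' (owner z) ] * [ fresh S U V z ] ≤ [ fresh S' U V z ]
    part z = ≤-trans (≡⇒≤ (sym (⟨⟩-∧ (S' (owner z)) (fresh S U V z)))) (⟨⟩-mono λ t → T-pair
     (subst (T ∘ (S' ⊞ U)) (group 2 (owner z) z (g0 :+ (g1 :- g0)) g1) (⊞-intro S' U (T-∧ˡ t) (proj₂ (owned z (T-∧ˡ (T-∧ʳ {S' (owner z)} t)))))) (T-∧ʳ {(S ⊞ U) z} (T-∧ʳ {S' (owner z)} t)))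

  -- Keeping `k` of `n` elements keeps the share `k / n` of the gain over `X₀`. The result is at
  -- least the mean of `# X₀ ≥ 2 n - 1` and `x` with weights `1 - k / n` and `k / n`, so the same
  -- subsets satisfy both bounds.
  module Extend {K : ℕ} (R₀ : Small A B K) (base : 2 * n ≤ # (sums R₀) + 1) (k d : ℕ) (k+d : k + d ≡ n) where

   Final : Set
   Final = ∃ λ (R : Small A B (K + (2 * s + 2) + k)) → 2 * n ≤ # (sums R) + 1 × (∃ λ x → # (A ⊞ B) * (n * n) ≤ 8 * (x * x * x) × (∀ u → x ≡ 2 * n + u → n * (2 * n) + k * u ≤ n * (# (sums R) + 1)))

   extend : Search → Final
   -- Sums in `A₁ + B` are excluded before elements of `A` are chosen, so that the two gains do not
   -- overlap.
   extend (L , enough) = pick (mostUseful B A₁ X₀ k d (trans #B (sym k+d))) (mostUseful A B₁ (X₀ ∪ A₁ ⊞ B) k d (trans #A (sym k+d)))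
    where
    A₁ B₁ X₀ : G → Bool
    A₁ = Small.A' L
    B₁ = Small.B' L
    R₁ : Small A B (K + (2 * s + 2))
    R₁ = unite R₀ L
    X₀ = sums R₁
    pick : Useful B A₁ X₀ k → Useful A B₁ (X₀ ∪ A₁ ⊞ B) k → Final
    pick (B₂ , B₂⊑ , #B₂ , leB) (A₂ , A₂⊑ , #A₂ , leA) = R , (lin 6 n (# V) (# (sums R₀)) (# X₀) (# (fresh B₂ A₁ X₀)) (# (fresh A₂ B₁ W)) 0 (k2 :* v0) (v1 :+ k1) (hyp (k2 :* v0) (v2 :+ k1) base (hyp v2 v3 (#-mono (unite-ˡ R₀ L)) (hyp (v3 :+ v4 :+ v5) v1 gained [])))) , # (cross L) , enough ,
     λ u x≡ → (lin 12 n k u (# V) d (# (sums R₀)) (# X₀) (# (fresh B₂ A₁ X₀)) (# (fresh A₂ B₁ W)) (# (fresh B A₁ X₀)) (# (fresh A B₁ W)) (# (cross L)) 0 (v0 :* (k2 :* v0) :+ v1 :* v2) (v0 :* (v3 :+ k1)) (mul v4 (k2 :* v0) (v5 :+ k1) base (mul v4 v5 v6 (#-mono (unite-ˡ R₀ L)) (mul v0 (v6 :+ v7 :+ v8) v3 gained (mul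
      v6 (v1 :+ v4) v0 (≡⇒≤ k+d) (mul* 2 v0 v0 (v1 :+ v4) (≡⇒≤ (sym k+d)) (eqn (v1 :+ v4) v0 k+d (hyp (v1 :* v9) (v0 :* v7) (subst (λ t → k * # (fresh B A₁ X₀) ≤ t * # (fresh B₂ A₁ X₀)) #B leB) (hyp (v1 :* v10) (v0 :* v8) (subst (λ t → k * # (fresh A B₁ W) ≤ t * # (fresh A₂ B₁ W)) #A leA) (mul v1 v11 (v6 :+ v9 :+ v10) pieces
      (mul v1 (k2 :* v0 :+ v2) v11 (≡⇒≤ (sym x≡)) [])))))))))))
     where
     W : G → Bool
     W = X₀ ∪ A₁ ⊞ B
     R : Small A B (K + (2 * s + 2) + k)
     R₂ : Small A B k
     R₂ = small-subsets A₂ B₂ A₂⊑ B₂⊑ (≡⇒≤ #A₂) (≡⇒≤ #B₂)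
     R = unite R₁ R₂
     V : G → Bool
     V = sums R
     pieces : # (cross L) ≤ # X₀ + # (fresh B A₁ X₀) + # (fresh A B₁ W)
     pieces = (lin 4 (# (cross L)) (# X₀) (# (fresh B A₁ X₀)) (# (fresh A B₁ W)) 0 v0 (v1 :+ v2 :+ v3) (hyp v0 (v1 :+ (v2 :+ v3)) (Σ-≤ (([_] ∘ cross L) ∷ []) (([_] ∘ X₀) ∷ ([_] ∘ fresh B A₁ X₀) ∷ ([_] ∘ fresh A B₁ W) ∷ []) (λ z → case (X₀ z) ((A₁ ⊞ B) z) ((B ⊞ A₁) z) ((A ⊞ B₁) z) (⊞-comm A₁ B z))) []))
      where
      case : ∀ x l l' r → (T l → T l') → [ l ∨ r ] ≤ [ x ] + ([ l' ∧ not x ] + [ r ∧ not (x ∨ l) ])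
      case true l l' r _ = ≤-trans (⟨⟩≤1 (l ∨ r)) (m≤m+n 1 _)
      case false true true r _ = s≤s z≤n
      case false true false r f = ⊥-elim (f tt)
      case false false l' r _ = ≤-trans (≡⇒≤ (cong [_] (∧-comm true r))) (m≤n+m _ _)
     gained : # X₀ + # (fresh B₂ A₁ X₀) + # (fresh A₂ B₁ W) ≤ # V
     gained = (lin 4 (# X₀) (# (fresh B₂ A₁ X₀)) (# (fresh A₂ B₁ W)) (# V) 0 (v0 :+ v1 :+ v2) v3 (hyp (v0 :+ (v1 :+ v2)) v3 (Σ-≤ (([_] ∘ X₀) ∷ ([_] ∘ fresh B₂ A₁ X₀) ∷ ([_] ∘ fresh A₂ B₁ W) ∷ []) (([_] ∘ V) ∷ []) (λ z → case (X₀ z) ((A₁ ⊞ B) z) ((B₂ ⊞ A₁) z) ((A₂ ⊞ B₁) z) (V z) (unite-ˡ R₁ R₂ z) (inB z) (inA z)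
      (outside z))) []))
      where
      outside : ∀ z → T ((B₂ ⊞ A₁) z) → T ((A₁ ⊞ B) z)
      outside z t = ⊞-comm B A₁ z (⊞-mono {B₂} {B} {A₁} {A₁} B₂⊑ (λ _ t → t) z t)
      inB : ∀ z → T ((B₂ ⊞ A₁) z) → T (V z)
      inB z t = ⊞-mono {A₁} {Small.A' R} {B₂} {Small.B' R} (λ y h → T-∨ˡ (T-∨ʳ {Small.A' R₀ y} h)) (λ y → T-∨ʳ {Small.B' R₁ y}) z (⊞-comm B₂ A₁ z t)
      inA : ∀ z → T ((A₂ ⊞ B₁) z) → T (V z)
      inA z t = ⊞-mono {A₂} {Small.A' R} {B₁} {Small.B' R} (λ y → T-∨ʳ {Small.A' R₁ y}) (λ y h → T-∨ˡ (T-∨ʳ {Small.B' R₀ y} h)) z t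
      case : ∀ x l b a v → (T x → T v) → (T b → T v) → (T a → T v) → (T b → T l) → [ x ] + ([ b ∧ not x ] + [ a ∧ not (x ∨ l) ]) ≤ [ v ]
      case true l b a v x→ _ _ _ rewrite ∧-zeroʳ b | ∧-zeroʳ a = ⟨⟩-mono x→
      case false true b a v _ b→ _ _ rewrite ∧-zeroʳ a | ∧-comm b true = ≤-trans (≡⇒≤ (+0 _)) (⟨⟩-mono b→)
      case false false true a v _ _ _ b→l = ⊥-elim (b→l tt)
      case false false false a v _ _ a→ _ rewrite ∧-comm a true = ⟨⟩-mono a→

   final : Final
   final = extend lines

 -- Translation to `Subset` and `_⊕_`.

 open import Data.Vec using (lookup; tabulate; []; _∷_)
 open import Data.Vec.Properties using (lookup∘tabulate; []=⇒lookup; lookup⇒[]=)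
 open import Data.Fin.Subset using (Subset; _∈_; _⊆_) renaming (∣_∣ to size)
 open import Data.Fin.Subset.Properties using (_∈?_)
 open import Defs using (_⊕_; AddsTo)

 #-lookup : ∀ {m} (S : Subset m) → # (lookup S) ≡ size S
 #-lookup [] = Σ-empty _
 #-lookup (true ∷ S) = trans (Σ-suc _) (cong suc (#-lookup S))
 #-lookup (false ∷ S) = trans (Σ-suc _) (#-lookup S)

 #-tabulate : ∀ (S : G → Bool) → size (tabulate S) ≡ # S
 #-tabulate S = trans (sym (#-lookup (tabulate S))) (Σ-cong λ x → cong [_] (lookup∘tabulate S x))

 ∈⇒T : ∀ {x} {S : Subset p} → x ∈ S → T (lookup S x)
 ∈⇒T x∈S = subst T (sym ([]=⇒lookup x∈S)) tt

 T⇒∈ : ∀ x (S : Subset p) → T (lookup S x) → x ∈ S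
 T⇒∈ x S t = lookup⇒[]= x S (true! t)
  where
  true! : ∀ {b} → T b → b ≡ true
  true! {true} _ = refl

 adds⇒ : ∀ x y z → AddsTo x y z → x ⊹ y ≡ z
 adds⇒ x y z sum = trans (⊹-residue x y) (Finₚ.toℕ-injective (trans (toℕ-residue (toℕ x + toℕ y)) (by sum)))
  where
  by : AddsTo x y z → (toℕ x + toℕ y) % p ≡ toℕ z
  by (inj₁ eq) = trans (cong (_% p) eq) (m<n⇒m%n≡m (toℕ<p z))
  by (inj₂ eq) = trans (cong (_% p) eq) (trans ([m+n]%n≡m%n (toℕ z) p) (m<n⇒m%n≡m (toℕ<p z)))

 ⇒adds : ∀ x y → AddsTo x y (x ⊹ y)
 ⇒adds x y = by (m / p) refl
  where
  m = toℕ x + toℕ y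
  z = toℕ (x ⊹ y)
  z≡ : z ≡ m % p
  z≡ = trans (cong toℕ (⊹-residue x y)) (toℕ-residue m)
  by : ∀ q → m / p ≡ q → AddsTo x y (x ⊹ y)
  by q eq = from q (trans (m≡m%n+[m/n]*n m p) (cong₂ (λ u v → u + v * p) (sym z≡) eq))
   where
   from : ∀ q → m ≡ z + q * p → AddsTo x y (x ⊹ y)
   from zero eq = inj₁ (trans eq (+0 z))
   from (suc zero) eq = inj₂ (trans eq (cong (z +_) (+0 p)))
   from (suc (suc q)) eq = (absurd (lin 5 (toℕ x) (toℕ y) z q p 1 k1 k0 (eqn⁻ (v0 :+ v1) (v2 :+ (1+ (1+ v3)) :* v4) eq (hyp (1+ v0) v4 (toℕ<p x) (hyp (1+ v1) v4 (toℕ<p y) [])))))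

 ⊕-⊞ : ∀ X Y → size (X ⊕ Y) ≡ # (lookup X ⊞ lookup Y)
 ⊕-⊞ X Y = trans (#-tabulate _) (≤-antisym (#-mono λ z → into z (sum? z)) (#-mono λ z → onto z (sum? z)))
  where
  Sum : G → Set
  Sum z = ∃ λ x → ∃ λ y → x ∈ X × y ∈ Y × AddsTo x y z
  sum? : ∀ z → Dec (Sum z)
  sum? z = Finₚ.any? λ x → Finₚ.any? λ y → (x ∈? X) ×-dec (y ∈? Y) ×-dec ((toℕ x + toℕ y ℕ.≟ toℕ z) ⊎-dec (toℕ x + toℕ y ℕ.≟ toℕ z + p))
  into : ∀ z (d : Dec (Sum z)) → T (does d) → T ((lookup X ⊞ lookup Y) z)
  into z (yes (x , y , x∈ , y∈ , sum)) _ = subst (T ∘ (lookup X ⊞ lookup Y)) (adds⇒ x y z sum) (⊞-intro (lookup X) (lookup Y) (∈⇒T x∈) (∈⇒T y∈))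
  onto : ∀ z (d : Dec (Sum z)) → T ((lookup X ⊞ lookup Y) z) → T (does d)
  onto z (yes _) _ = tt
  onto z (no none) t = from (⊞-elim (lookup X) (lookup Y) z t)
   where
   from : (∃ λ x → T (lookup X x) × T (lookup Y (z ⊖ x))) → ⊥
   from (x , Xx , Yx) = none (x , z ⊖ x , T⇒∈ x X Xx , T⇒∈ (z ⊖ x) Y Yx , subst (AddsTo x (z ⊖ x)) (group 2 x z (g0 :+ (g1 :- g0)) g1) (⇒adds x (z ⊖ x)))

 Selected : ∀ {N} → Scales N → (A B : Subset p) (n s k : ℕ) → Set
 Selected Sc A B n s k = ∃ λ As → ∃ λ Bs → As ⊆ A × Bs ⊆ B × size As ≤ Scales.C Sc * s + (2 * s + 2) + k × size Bs ≤ Scales.C Sc * s + (2 * s + 2) + k ×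
  2 * n ≤ size (As ⊕ Bs) + 1 × (∃ λ x → size (A ⊕ B) * (n * n) ≤ 8 * (x * x * x) × (∀ u → x ≡ 2 * n + u → n * (2 * n) + k * u ≤ n * (size (As ⊕ Bs) + 1)))

 small-selection : ∀ {N} → 1 ≤ N → (Sc : Scales N) → ∀ A B n s → 1 ≤ n → 2 * n * N + n ≤ p * N → s * s ≤ n → n < (s + 1) * (s + 1) → size A ≡ n → size B ≡ n → ∀ k → k ≤ n → Selected Sc A B n s k
 small-selection {N} 1≤N Sc A B n s 1≤n room lo hi #A #B k k≤n = first (Main.covering N 1≤N Sc n s 1≤n room lo hi #A' #B')
  where
  #A' : # (lookup A) ≡ n
  #A' = trans (#-lookup A) #A
  #B' : # (lookup B) ≡ n
  #B' = trans (#-lookup B) #B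
  sub : ∀ {S} S₀ → S ⊑ lookup S₀ → tabulate S ⊆ S₀
  sub {S} S₀ S⊑ {x} x∈ = T⇒∈ x S₀ (S⊑ x (subst T (lookup∘tabulate S x) (∈⇒T x∈)))
  first : (∃ λ (R : Small (lookup A) (lookup B) (Scales.C Sc * s)) → 2 * n ≤ # (sums R) + 1) → Selected Sc A B n s k
  first (R₀ , base) = second (Lines.Extend.final (lookup A) (lookup B) n s #A' #B' 1≤n hi R₀ base k (n ∸ k) (+∸ k≤n))
   where
   second : Lines.Extend.Final (lookup A) (lookup B) n s #A' #B' 1≤n hi R₀ base k (n ∸ k) (+∸ k≤n) → Selected Sc A B n s k
   second (R , base' , x , many , gain) = tabulate A' , tabulate B' , sub A A'⊑A , sub B B'⊑B , subst (_≤ _) (sym (#-tabulate A')) #A'₁ , subst (_≤ _) (sym (#-tabulate B')) #B'₁ ,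
    subst (λ t → 2 * n ≤ t + 1) (sym total-sums) base' , x , subst (λ t → t * (n * n) ≤ 8 * (x * x * x)) (sym (⊕-⊞ A B)) many , λ u eq → subst (λ t → n * (2 * n) + k * u ≤ n * (t + 1)) (sym total-sums) (gain u eq)
    where
    open Small R hiding (sums) renaming (#A' to #A'₁; #B' to #B'₁)
    total-sums : size (tabulate A' ⊕ tabulate B') ≡ # (sums R)
    total-sums = trans (⊕-⊞ (tabulate A') (tabulate B')) (≤-antisym (#-mono (⊞-mono (tab A') (tab B'))) (#-mono (⊞-mono (bat A') (bat B'))))
     where
     tab : ∀ S → lookup (tabulate S) ⊑ S
     tab S x = subst T (lookup∘tabulate S x)
     bat : ∀ S → S ⊑ lookup (tabulate S)
     bat S x = subst T (sym (lookup∘tabulate S x))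

-- Estimates with rationals in place of square and cube roots.

module Rationals where

 open import Data.Empty using (⊥-elim)
 open import Data.Integer as ℤ using (+_)
 import Data.Integer.Properties as ℤₚ
 open import Data.List using (List; []; _∷_)
 open import Data.Nat as ℕ using (ℕ; zero; suc; z≤n; s≤s)
 import Data.Nat.Coprimality as Coprimality
 import Data.Nat.Properties as ℕₚ
 open import Data.Product using (∃; _×_; _,_)
 open import Data.Rational
 open import Data.Rational.Properties
 open import Data.Rational.Solver using (module +-*-Solver)
 import Data.Rational.Unnormalised as ℚᵘ
 import Data.Rational.Unnormalised.Properties as ℚᵘₚ
 open import Data.Sum using (_⊎_; inj₁; inj₂)
 open import Relation.Binary.PropositionalEquality
 open import Relation.Nullary using (¬_)
 open import Defs
 open Counting using (Expr; eval; v0; v1; v2; v3; v4; least)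
 module C = Counting
 open +-*-Solver using (solve; con; _:+_; _:*_; _:-_; _:=_)

 int : ℕ → ℚ
 int m = mkℚ (+ m) 0 (Coprimality.sym (Coprimality.1-coprimeTo m))

 ⟦⟧-int : ∀ m → ⟦ m ⟧ ≡ int m
 ⟦⟧-int m = normalize-coprime (Coprimality.sym (Coprimality.1-coprimeTo m))

 ⟦⟧-+ : ∀ m n → ⟦ m ℕ.+ n ⟧ ≡ ⟦ m ⟧ + ⟦ n ⟧
 ⟦⟧-+ m n = trans (cong (_/ 1) (sym (cong₂ ℤ._+_ (ℤₚ.*-identityʳ (+ m)) (ℤₚ.*-identityʳ (+ n))))) (sym (cong₂ _+_ (⟦⟧-int m) (⟦⟧-int n)))

 ⟦⟧-* : ∀ m n → ⟦ m ℕ.* n ⟧ ≡ ⟦ m ⟧ * ⟦ n ⟧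
 ⟦⟧-* m n = trans (cong (_/ 1) (ℤₚ.pos-* m n)) (sym (cong₂ _*_ (⟦⟧-int m) (⟦⟧-int n)))

 ⟦⟧-mono : ∀ {m n} → m ℕ.≤ n → ⟦ m ⟧ ≤ ⟦ n ⟧
 ⟦⟧-mono {m} {n} le = subst₂ _≤_ (sym (⟦⟧-int m)) (sym (⟦⟧-int n)) (*≤* (ℤₚ.*-monoʳ-≤-nonNeg (+ 1) (ℤ.+≤+ le)))

 ⟦⟧-cancel : ∀ {m n} → ⟦ m ⟧ ≤ ⟦ n ⟧ → m ℕ.≤ n
 ⟦⟧-cancel {m} {n} le = ℤₚ.drop‿+≤+ (ℤₚ.*-cancelʳ-≤-pos (+ m) (+ n) (+ 1) (drop-*≤* (subst₂ _≤_ (⟦⟧-int m) (⟦⟧-int n) le)))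

 -- The expressions of the arithmetic certificates are reused to move inequalities between ℕ and ℚ.
 evalℚ : List ℕ → Expr → ℚ
 evalℚ ρ (C.$ i) = ⟦ ρ C.‼ i ⟧
 evalℚ ρ (C.& c) = ⟦ c ⟧
 evalℚ ρ (a C.:+ b) = evalℚ ρ a + evalℚ ρ b
 evalℚ ρ (a C.:* b) = evalℚ ρ a * evalℚ ρ b

 ⟦⟧-eval : ∀ ρ e → ⟦ eval ρ e ⟧ ≡ evalℚ ρ e
 ⟦⟧-eval ρ (C.$ i) = refl
 ⟦⟧-eval ρ (C.& c) = refl
 ⟦⟧-eval ρ (a C.:+ b) = trans (⟦⟧-+ (eval ρ a) (eval ρ b)) (cong₂ _+_ (⟦⟧-eval ρ a) (⟦⟧-eval ρ b))
 ⟦⟧-eval ρ (a C.:* b) = trans (⟦⟧-* (eval ρ a) (eval ρ b)) (cong₂ _*_ (⟦⟧-eval ρ a) (⟦⟧-eval ρ b))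

 lift : ∀ ρ l r → eval ρ l ℕ.≤ eval ρ r → evalℚ ρ l ≤ evalℚ ρ r
 lift ρ l r le = subst₂ _≤_ (⟦⟧-eval ρ l) (⟦⟧-eval ρ r) (⟦⟧-mono le)

 lower : ∀ ρ l r → evalℚ ρ l ≤ evalℚ ρ r → eval ρ l ℕ.≤ eval ρ r
 lower ρ l r le = ⟦⟧-cancel (subst₂ _≤_ (sym (⟦⟧-eval ρ l)) (sym (⟦⟧-eval ρ r)) le)

 0≤⟦_⟧ : ∀ m → 0ℚ ≤ ⟦ m ⟧
 0≤⟦ m ⟧ = ⟦⟧-mono {0} {m} z≤n

 0<⟦⟧ : ∀ {m} → 1 ℕ.≤ m → 0ℚ < ⟦ m ⟧
 0<⟦⟧ {m} 1≤m = ≰⇒> λ le → ℕₚ.<⇒≱ 1≤m (⟦⟧-cancel {m} {0} le)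

 0≤* : ∀ {x y} → 0ℚ ≤ x → 0ℚ ≤ y → 0ℚ ≤ x * y
 0≤* {x} {y} 0≤x 0≤y = nonNegative⁻¹ (x * y) {{nonNeg*nonNeg⇒nonNeg x {{nonNegative 0≤x}} y {{nonNegative 0≤y}}}}

 0≤+ : ∀ {x y} → 0ℚ ≤ x → 0ℚ ≤ y → 0ℚ ≤ x + y
 0≤+ 0≤x 0≤y = +-mono-≤ 0≤x 0≤y

 gap : ∀ {x y} → x ≤ y → 0ℚ ≤ y - x
 gap {x} {y} le = subst (_≤ y - x) (+-inverseʳ x) (+-monoˡ-≤ (- x) le)

 ≤-by : ∀ {x y e} → 0ℚ ≤ e → y ≡ x + e → x ≤ y
 ≤-by {x} {y} {e} 0≤e eq = subst (x ≤_) (sym eq) (subst (_≤ x + e) (+-identityʳ x) (+-monoʳ-≤ x 0≤e))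

 square-mono : ∀ {x y} → 0ℚ ≤ x → x ≤ y → x * x ≤ y * y
 square-mono {x} {y} 0≤x le = ≤-by (0≤* (gap le) (0≤+ 0≤x (≤-trans 0≤x le))) (solve 2 (λ x y → y :* y := x :* x :+ (y :- x) :* (x :+ y)) refl x y)

 square-cancel : ∀ {x y} → 0ℚ ≤ y → x * x ≤ y * y → x ≤ y
 square-cancel {x} {y} 0≤y le = ≮⇒≥ λ y<x → <-irrefl refl (≤-<-trans le (≤-<-trans (*-monoˡ-≤-nonNeg y {{nonNegative 0≤y}} (<⇒≤ y<x)) (*-monoˡ-<-pos x {{positive (≤-<-trans 0≤y y<x)}} y<x)))

 cube-cancel : ∀ {x y} → 0ℚ ≤ y → x * x * x < y * y * y → x < y
 cube-cancel {x} {y} 0≤y lt = ≰⇒> λ y≤x → <-irrefl refl (<-≤-trans lt (≤-by (0≤* (gap y≤x) (0≤+ (0≤+ (0≤* (≤-trans 0≤y y≤x) (≤-trans 0≤y y≤x)) (0≤* (≤-trans 0≤y y≤x) 0≤y)) (0≤* 0≤y 0≤y)))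
   (solve 2 (λ x y → x :* x :* x := y :* y :* y :+ (x :- y) :* (x :* x :+ x :* y :+ y :* y)) refl x y)))

 -- x ≤ α √m and y ≤ β √m add up to x + y ≤ (α + β) √m.
 add-squares : ∀ {x y α β m} → 0ℚ ≤ x → 0ℚ ≤ y → 0ℚ ≤ α → 0ℚ ≤ β → 0ℚ ≤ m → x * x ≤ α * α * m → y * y ≤ β * β * m → (x + y) * (x + y) ≤ (α + β) * (α + β) * m
 add-squares {x} {y} {α} {β} {m} 0≤x 0≤y 0≤α 0≤β 0≤m hx hy = ≤-by (0≤+ (0≤+ (gap hx) (gap hy)) (0≤+ (gap cross) (gap cross)))
   (solve 5 (λ x y α β m → (α :+ β) :* (α :+ β) :* m := (x :+ y) :* (x :+ y) :+ ((α :* α :* m :- x :* x) :+ (β :* β :* m :- y :* y) :+ ((α :* β :* m :- x :* y) :+ (α :* β :* m :- x :* y)))) refl x y α β m)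
   where
   cross : x * y ≤ α * β * m
   cross = square-cancel (0≤* (0≤* 0≤α 0≤β) 0≤m) (≤-by (0≤+ (0≤* (gap hx) (0≤* (0≤* 0≤β 0≤β) 0≤m)) (0≤* (0≤* 0≤x 0≤x) (gap hy)))
     (solve 5 (λ x y α β m → α :* β :* m :* (α :* β :* m) := x :* y :* (x :* y) :+ ((α :* α :* m :- x :* x) :* (β :* β :* m) :+ x :* x :* (β :* β :* m :- y :* y))) refl x y α β m))

 -- For `r ≤ 0` the first `2 n - 1` sums suffice. For `r ≥ 0`, comparing sixth powers gives
 -- `a √n < x`; since `a - r > 2 √n`, this leaves `r √n ≤ u = x - 2 n`, and with `k ≥ c √n` the gain
 -- `k u / n` is at least `c r`.
 sum-bound : ∀ {n M S x k κ c} → 1 ℕ.≤ n → 0ℚ ≤ c → ⟦ M ⟧ ≡ κ * ⟦ n ⟧ → M ℕ.* (n ℕ.* n) ℕ.≤ 8 ℕ.* (x ℕ.* x ℕ.* x) → 2 ℕ.* n ℕ.≤ S ℕ.+ 1 →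
   (∀ u → x ≡ 2 ℕ.* n ℕ.+ u → n ℕ.* (2 ℕ.* n) ℕ.+ k ℕ.* u ℕ.≤ n ℕ.* (S ℕ.+ 1)) → c * c * ⟦ n ⟧ ≤ ⟦ k ⟧ * ⟦ k ⟧ → SumBound n κ c S
 sum-bound {n} {M} {S} {x} {k} {κ} {c} 1≤n 0≤c M≡ many base gain c≤k r (_ , a , 0<a-r , 4n< , a-small) = by (≤-total r 0ℚ)
   where
   ν = ⟦ n ⟧
   ξ = ⟦ x ⟧
   0<ν : 0ℚ < ν
   0<ν = 0<⟦⟧ 1≤n
   0≤ν : 0ℚ ≤ ν
   0≤ν = <⇒≤ 0<ν
   by : r ≤ 0ℚ ⊎ 0ℚ ≤ r → ⟦ 2 ℕ.* n ⟧ - ⟦ 1 ⟧ + c * r ≤ ⟦ S ⟧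
   by (inj₁ r≤0) = ≤-by (0≤+ (gap (lift (2 ℕ.* n ∷ S ∷ []) v0 (v1 C.:+ C.& 1) base)) (0≤* 0≤c (gap r≤0)))
     (solve 5 (λ N S o c r → S := N :- o :+ c :* r :+ ((S :+ o :- N) :+ c :* (con 0ℚ :- r))) refl ⟦ 2 ℕ.* n ⟧ ⟦ S ⟧ ⟦ 1 ⟧ c r)
   by (inj₂ 0≤r) = *-cancelˡ-≤-pos ν {{positive 0<ν}} (≤-by (0≤+ (gap (lift (n ∷ 2 ℕ.* n ∷ k ∷ u ∷ S ∷ []) (v0 C.:* v1 C.:+ v2 C.:* v3) (v0 C.:* (v4 C.:+ C.& 1)) (gain u x≡))) (gap ncr≤ku))
       (solve 8 (λ n N o c r S k u → n :* S := n :* (N :- o :+ c :* r) :+ ((n :* (S :+ o) :- (n :* N :+ k :* u)) :+ (k :* u :- n :* c :* r))) refl ν ⟦ 2 ℕ.* n ⟧ ⟦ 1 ⟧ c r ⟦ S ⟧ ⟦ k ⟧ ⟦ u ⟧))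
     where
     0≤α : 0ℚ ≤ a - r
     0≤α = <⇒≤ 0<a-r
     0≤a : 0ℚ ≤ a
     0≤a = ≤-by (0≤+ 0≤α 0≤r) (solve 2 (λ a r → a := con 0ℚ :+ (a :- r :+ r)) refl a r)
     t = ⟦ 2 ⟧ * a
     n³ = ν * ν * ν
     below : t * t * t * t * t * t < κ * κ * ν * ν * ν
     below = pick a-small
       where
       pick : a < 0ℚ ⊎ t * t * t * t * t * t < κ * κ * ν * ν * ν → t * t * t * t * t * t < κ * κ * ν * ν * ν
       pick (inj₁ a<0) = ⊥-elim (<-irrefl refl (≤-<-trans 0≤a a<0))
       pick (inj₂ lt) = lt
     0<n³ : 0ℚ < n³
     0<n³ = positive⁻¹ n³ {{pos*pos⇒pos (ν * ν) {{pos*pos⇒pos ν {{positive 0<ν}} ν {{positive 0<ν}}}} ν {{positive 0<ν}}}}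
     many² : ⟦ M ⟧ * (ν * ν) * (⟦ M ⟧ * (ν * ν)) ≤ ⟦ 8 ⟧ * (ξ * ξ * ξ) * (⟦ 8 ⟧ * (ξ * ξ * ξ))
     many² = square-mono (0≤* 0≤⟦ M ⟧ (0≤* 0≤ν 0≤ν)) (lift (M ∷ n ∷ x ∷ []) (v0 C.:* (v1 C.:* v1)) (C.& 8 C.:* (v2 C.:* v2 C.:* v2)) many)
     P = t * t * ν
     Q = ⟦ 2 ⟧ * ξ * (⟦ 2 ⟧ * ξ)
     P<Q : P < Q
     P<Q = cube-cancel (0≤* (0≤* 0≤⟦ 2 ⟧ 0≤⟦ x ⟧) (0≤* 0≤⟦ 2 ⟧ 0≤⟦ x ⟧)) (subst₂ _<_ (solve 2 (λ t n → t :* t :* t :* t :* t :* t :* (n :* n :* n) := t :* t :* n :* (t :* t :* n) :* (t :* t :* n)) refl t ν)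
       (solve 1 (λ x → con ⟦ 8 ⟧ :* (x :* x :* x) :* (con ⟦ 8 ⟧ :* (x :* x :* x)) := con ⟦ 2 ⟧ :* x :* (con ⟦ 2 ⟧ :* x) :* (con ⟦ 2 ⟧ :* x :* (con ⟦ 2 ⟧ :* x)) :* (con ⟦ 2 ⟧ :* x :* (con ⟦ 2 ⟧ :* x))) refl ξ)
       (<-≤-trans (*-monoˡ-<-pos n³ {{positive 0<n³}} below) (subst (_≤ ⟦ 8 ⟧ * (ξ * ξ * ξ) * (⟦ 8 ⟧ * (ξ * ξ * ξ)))
         (trans (cong (λ m → m * (ν * ν) * (m * (ν * ν))) M≡) (solve 2 (λ κ n → κ :* n :* (n :* n) :* (κ :* n :* (n :* n)) := κ :* κ :* n :* n :* n :* (n :* n :* n)) refl κ ν)) many²)))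
     a²n<x² : a * a * ν < ξ * ξ
     a²n<x² = *-cancelˡ-<-nonNeg ⟦ 4 ⟧ {{nonNegative 0≤⟦ 4 ⟧}} (subst₂ _<_ (solve 2 (λ a n → con ⟦ 2 ⟧ :* a :* (con ⟦ 2 ⟧ :* a) :* n := con ⟦ 4 ⟧ :* (a :* a :* n)) refl a ν) (solve 1 (λ x → con ⟦ 2 ⟧ :* x :* (con ⟦ 2 ⟧ :* x) := con ⟦ 4 ⟧ :* (x :* x)) refl ξ) P<Q)
     2n≤x : 2 ℕ.* n ℕ.≤ x
     2n≤x = lower (n ∷ x ∷ []) (C.& 2 C.:* v0) v1 (square-cancel 0≤⟦ x ⟧ (≤-by (0≤+ (0≤+ (0≤* (gap (<⇒≤ 4n<)) 0≤ν) (0≤* (0≤* 0≤r (0≤+ 0≤a 0≤α)) 0≤ν)) (gap (<⇒≤ a²n<x²)))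
       (solve 4 (λ n a r x → x :* x := con ⟦ 2 ⟧ :* n :* (con ⟦ 2 ⟧ :* n) :+ (((a :- r) :* (a :- r) :- con ⟦ 4 ⟧ :* n) :* n :+ r :* (a :+ (a :- r)) :* n :+ (x :* x :- a :* a :* n))) refl ν a r ξ)))
     u = x ℕ.∸ 2 ℕ.* n
     x≡ : x ≡ 2 ℕ.* n ℕ.+ u
     x≡ = sym (ℕₚ.m+[n∸m]≡n 2n≤x)
     ξ≡ : ξ ≡ ⟦ 2 ⟧ * ν + ⟦ u ⟧
     ξ≡ = trans (cong ⟦_⟧ x≡) (⟦⟧-eval (n ∷ u ∷ []) (C.& 2 C.:* v0 C.:+ v1))
     -- By contradiction, to avoid roots: `u < r √n` and `2 n ≤ (a - r) √n` would add up to
     -- `x ≤ a √n`.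
     r²n≤u² : r * r * ν ≤ ⟦ u ⟧ * ⟦ u ⟧
     r²n≤u² = ≮⇒≥ λ lt → <-irrefl refl (<-≤-trans a²n<x² (subst₂ _≤_ (trans (cong (λ y → y * y) (+-comm ⟦ u ⟧ (⟦ 2 ⟧ * ν))) (cong (λ y → y * y) (sym ξ≡))) (solve 3 (λ a r n → (r :+ (a :- r)) :* (r :+ (a :- r)) :* n := a :* a :* n) refl a r ν)
       (add-squares 0≤⟦ u ⟧ (0≤* 0≤⟦ 2 ⟧ 0≤ν) 0≤r 0≤α 0≤ν (<⇒≤ lt) (≤-by (0≤* (gap (<⇒≤ 4n<)) 0≤ν) (solve 3 (λ n a r → (a :- r) :* (a :- r) :* n := con ⟦ 2 ⟧ :* n :* (con ⟦ 2 ⟧ :* n) :+ ((a :- r) :* (a :- r) :- con ⟦ 4 ⟧ :* n) :* n) refl ν a r)))))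
     ncr≤ku : ν * c * r ≤ ⟦ k ⟧ * ⟦ u ⟧
     ncr≤ku = square-cancel (0≤* 0≤⟦ k ⟧ 0≤⟦ u ⟧) (≤-by (0≤+ (0≤* (gap c≤k) (0≤* 0≤⟦ u ⟧ 0≤⟦ u ⟧)) (0≤* (0≤* (0≤* 0≤c 0≤c) 0≤ν) (gap r²n≤u²)))
       (solve 5 (λ n c r k u → k :* u :* (k :* u) := n :* c :* r :* (n :* c :* r) :+ ((k :* k :- c :* c :* n) :* (u :* u) :+ c :* c :* n :* (u :* u :- r :* r :* n))) refl ν c r ⟦ k ⟧ ⟦ u ⟧))

 size-bound : ∀ {t K s v n c} → t ℕ.≤ K ℕ.* s ℕ.+ v → s ℕ.* s ℕ.≤ n → 0ℚ ≤ c → ⟦ v ⟧ * ⟦ v ⟧ ≤ c * c * ⟦ n ⟧ → ⟦ t ⟧ ≤[ ⟦ K ⟧ + c ]√ n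
 size-bound {t} {K} {s} {v} {n} t≤ s²≤n 0≤c v² = inj₂ (≤-trans (square-mono 0≤⟦ t ⟧ (lift (t ∷ K ∷ s ∷ v ∷ []) v0 (v1 C.:* v2 C.:+ v3) t≤))
   (add-squares (0≤* 0≤⟦ K ⟧ 0≤⟦ s ⟧) 0≤⟦ v ⟧ 0≤⟦ K ⟧ 0≤c 0≤⟦ n ⟧ (≤-by (0≤* (0≤* 0≤⟦ K ⟧ 0≤⟦ K ⟧) (gap (lift (s ∷ n ∷ []) (v0 C.:* v0) v1 s²≤n)))
     (solve 3 (λ K s n → K :* K :* n := K :* s :* (K :* s) :+ K :* K :* (n :- s :* s)) refl ⟦ K ⟧ ⟦ s ⟧ ⟦ n ⟧)) v²))

 -- `suc v` is the least integer not below `c √n`; it is at most `n` because `c ≤ √n`.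
 root-multiple : ∀ n c → 1 ℕ.≤ n → 0ℚ < c → c * c ≤ ⟦ n ⟧ → ∃ λ v → suc v ℕ.≤ n × c * c * ⟦ n ⟧ ≤ ⟦ suc v ⟧ * ⟦ suc v ⟧ × ⟦ v ⟧ * ⟦ v ⟧ ≤ c * c * ⟦ n ⟧
 root-multiple n c 1≤n 0<c c²≤n = from (least (λ k → c * c * ⟦ n ⟧ ≤? ⟦ k ⟧ * ⟦ k ⟧) n (*-monoʳ-≤-nonNeg ⟦ n ⟧ {{nonNegative 0≤⟦ n ⟧}} c²≤n))
   where
   from : (∃ λ k → k ℕ.≤ n × c * c * ⟦ n ⟧ ≤ ⟦ k ⟧ * ⟦ k ⟧ × (∀ j → j ℕ.< k → ¬ (c * c * ⟦ n ⟧ ≤ ⟦ j ⟧ * ⟦ j ⟧))) → ∃ λ v → suc v ℕ.≤ n × c * c * ⟦ n ⟧ ≤ ⟦ suc v ⟧ * ⟦ suc v ⟧ × ⟦ v ⟧ * ⟦ v ⟧ ≤ c * c * ⟦ n ⟧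
   from (zero , _ , le , _) = ⊥-elim (<-irrefl refl (<-≤-trans (positive⁻¹ (c * c * ⟦ n ⟧) {{pos*pos⇒pos (c * c) {{pos*pos⇒pos c {{positive 0<c}} c {{positive 0<c}}}} ⟦ n ⟧ {{positive (0<⟦⟧ 1≤n)}}}}) le))
   from (suc v , v<n , le , before) = v , v<n , le , <⇒≤ (≰⇒> (before v ℕₚ.≤-refl))

 -- A positive `β` times its denominator is its numerator. The denominator thus serves as the
 -- integer `N` with `β ≥ 1 / N` on which all constants depend.
 denominator-large : ∀ β → 0ℚ < β → 1ℚ ≤ β * ⟦ ↧ₙ β ⟧
 denominator-large (mkℚ (+ zero) d _) (*<* (ℤ.+<+ ()))
 denominator-large (mkℚ (ℤ.-[1+ _ ]) d _) (*<* ())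
 denominator-large β@(mkℚ (+ suc b) d _) _ = subst (λ t → 1ℚ ≤ β * t) (sym (⟦⟧-int (suc d))) (toℚᵘ-cancel-≤ (ℚᵘₚ.≤-respʳ-≃ (ℚᵘₚ.≃-sym (toℚᵘ-homo-* β (int (suc d)))) (ℚᵘ.*≤* (ℤ.+≤+ le))))
   where
   le : suc (d ℕ.* 1) ℕ.+ 0 ℕ.≤ (suc d ℕ.+ b ℕ.* suc d) ℕ.* 1
   le = subst₂ ℕ._≤_ (sym (trans (ℕₚ.+-identityʳ _) (cong suc (ℕₚ.*-identityʳ d)))) (sym (ℕₚ.*-identityʳ _)) (ℕₚ.m≤m+n (suc d) _)

 room : ∀ {β n p} → 0ℚ < β → n ℕ.≤ p → ⟦ n ⟧ ≤ (1ℚ - β) * ½ * ⟦ p ⟧ → 2 ℕ.* n ℕ.* ↧ₙ β ℕ.+ n ℕ.≤ p ℕ.* ↧ₙ β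
 room {β} {n} {p} 0<β n≤p small = lower (n ∷ ↧ₙ β ∷ p ∷ []) (C.& 2 C.:* v0 C.:* v1 C.:+ v0) (v2 C.:* v1)
   (≤-by (0≤+ (0≤+ (0≤* (0≤* 0≤⟦ 2 ⟧ 0≤⟦ ↧ₙ β ⟧) (gap small)) (0≤* (gap (denominator-large β 0<β)) 0≤⟦ p ⟧)) (gap (⟦⟧-mono n≤p)))
     (solve 4 (λ n N p β → p :* N := con ⟦ 2 ⟧ :* n :* N :+ n :+ (con ⟦ 2 ⟧ :* N :* ((con 1ℚ :- β) :* con ½ :* p :- n) :+ (β :* N :- con 1ℚ) :* p :+ (p :- n))) refl ⟦ n ⟧ ⟦ ↧ₙ β ⟧ ⟦ p ⟧ β))

-- The theorem from the selected subsets.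

open import Data.Empty using (⊥-elim)
open import Data.Nat as ℕ using (ℕ; suc)
import Data.Nat.Properties as ℕₚ
open import Data.Nat.Primality using (Prime)
open import Data.Fin.Subset.Properties using (∣p∣≤n)
open import Data.Product using (_,_)
open import Data.Rational using (↧ₙ_)
open import Data.Rational.Properties using (<⇒≤)
open import Relation.Binary.PropositionalEquality using (subst)
open import Defs
open import Data.Nat using (ℕ; _≥_)
open import Data.Nat.Primality using (Prime)
open import Data.Rational using (ℚ; _+_; _-_; _*_; _≤_; _<_; 0ℚ; 1ℚ; ½)
open import Data.Fin.Subset using (Subset; _⊆_; ∣_∣)
open import Data.Product using (Σ; _×_; ∃; ∃-syntax)
open import Relation.Binary.PropositionalEquality using (_≡_)

theorem2p7 : (β : ℚ) → 0ℚ < β → β < 1ℚ →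
  ∃[ c′ ] (0ℚ < c′ ×
    ((p : ℕ) → Prime p → (A B : Subset p) (n : ℕ) →
      n ≥ 1 → ∣ A ∣ ≡ n → ∣ B ∣ ≡ n →
      ⟦ n ⟧ ≤ (1ℚ - β) * ½ * ⟦ p ⟧ →
      (κ : ℚ) → ⟦ ∣ A ⊕ B ∣ ⟧ ≡ κ * ⟦ n ⟧ →
      (c : ℚ) → 0ℚ < c → c * c ≤ ⟦ n ⟧ →
      ∃[ As ] ∃[ Bs ] (As ⊆ A × Bs ⊆ B
        × ⟦ ∣ As ∣ ⟧ ≤[ c′ + c ]√ n
        × ⟦ ∣ Bs ∣ ⟧ ≤[ c′ + c ]√ n
        × SumBound n κ c ∣ As ⊕ Bs ∣)))
theorem2p7 β 0<β _ = ⟦ K ⟧ , Rationals.0<⟦⟧ (ℕₚ.≤-trans (ℕ.s≤s ℕ.z≤n) (ℕₚ.m≤n+m 5 C)) , λ p p-prime A B n 1≤n #A #B small κ κ≡ c 0<c c²≤n →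
  from p p-prime A B n 1≤n #A #B small κ κ≡ c 0<c (Counting.root n) (Rationals.root-multiple n c 1≤n 0<c c²≤n)
  where
  N : ℕ
  N = ↧ₙ β
  Sc : Counting.Scales N
  Sc = Counting.scales N
  C K : ℕ
  C = Counting.Scales.C Sc
  K = C ℕ.+ 5
  from : (p : ℕ) → Prime p → (A B : Subset p) (n : ℕ) → n ≥ 1 → ∣ A ∣ ≡ n → ∣ B ∣ ≡ n → ⟦ n ⟧ ≤ (1ℚ - β) * ½ * ⟦ p ⟧ → (κ : ℚ) → ⟦ ∣ A ⊕ B ∣ ⟧ ≡ κ * ⟦ n ⟧ → (c : ℚ) → 0ℚ < c →
    (∃ λ s → s ℕ.* s ℕ.≤ n × n ℕ.< (s ℕ.+ 1) ℕ.* (s ℕ.+ 1)) → (∃ λ v → suc v ℕ.≤ n × c * c * ⟦ n ⟧ ≤ ⟦ suc v ⟧ * ⟦ suc v ⟧ × ⟦ v ⟧ * ⟦ v ⟧ ≤ c * c * ⟦ n ⟧) →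
    ∃[ As ] ∃[ Bs ] (As ⊆ A × Bs ⊆ B × ⟦ ∣ As ∣ ⟧ ≤[ ⟦ K ⟧ + c ]√ n × ⟦ ∣ Bs ∣ ⟧ ≤[ ⟦ K ⟧ + c ]√ n × SumBound n κ c ∣ As ⊕ Bs ∣)
  from p p-prime A B n 1≤n #A #B small κ κ≡ c 0<c (s , lo , hi) (v , v<n , c≤k , v≤c) = finish
    (Residues.small-selection p p-prime (ℕ.s≤s ℕ.z≤n) Sc A B n s 1≤n (Rationals.room {β} 0<β (subst (ℕ._≤ p) #A (∣p∣≤n A)) small) lo hi #A #B (suc v) v<n)
    where
    1≤s : 1 ℕ.≤ s
    1≤s = positive-root s hi
      where
      positive-root : ∀ s → n ℕ.< (s ℕ.+ 1) ℕ.* (s ℕ.+ 1) → 1 ℕ.≤ s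
      positive-root 0 lt = ⊥-elim (ℕₚ.<⇒≱ lt 1≤n)
      positive-root (suc _) _ = ℕ.s≤s ℕ.z≤n
    small-enough : ∀ {t} → t ℕ.≤ C ℕ.* s ℕ.+ (2 ℕ.* s ℕ.+ 2) ℕ.+ suc v → t ℕ.≤ K ℕ.* s ℕ.+ v
    small-enough le = ℕₚ.≤-trans le (Counting.sizes C s v 1≤s)
    finish : Residues.Selected p p-prime Sc A B n s (suc v) → ∃[ As ] ∃[ Bs ] (As ⊆ A × Bs ⊆ B × ⟦ ∣ As ∣ ⟧ ≤[ ⟦ K ⟧ + c ]√ n × ⟦ ∣ Bs ∣ ⟧ ≤[ ⟦ K ⟧ + c ]√ n × SumBound n κ c ∣ As ⊕ Bs ∣)
    finish (As , Bs , As⊆ , Bs⊆ , #As , #Bs , base , x , many , gain) = As , Bs , As⊆ , Bs⊆ , Rationals.size-bound {∣ As ∣} {K} {s} {v} (small-enough #As) lo (<⇒≤ 0<c) v≤c , Rationals.size-bound {∣ Bs ∣} {K} {s} {v} (small-enough #Bs) lo (<⇒≤ 0<c) v≤c ,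
      Rationals.sum-bound {n} {∣ A ⊕ B ∣} {∣ As ⊕ Bs ∣} {x} {suc v} {κ} {c} 1≤n (<⇒≤ 0<c) κ≡ many base gain c≤k
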